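{- Let $C=C_f$ be an irreducible hypersurface over $\mathbb{Q}$ given by the projective equation $f(x_1,\dots,x_m)=0$, where $f\in\mathbb{Z}[x_1,\dots,x_m]$ is irreducible and homogeneous of degree $d$, and suppose that $C$ has a non-singular rational point. Then $G(C_f)=1$ and \[ D(C_f)^{\mathrm{inf}} \supset d^2+\mathrm{Frob}(d-1,d), \] so that $\mathcal E(C_f)\subset\{1,\dots,2d^2-3d+1\}$.
   Context: For a number field $L$, a point of $C$ with coordinates in $L$ is a new point over $L$ if it is non-singular and not defined over any proper subfield of $L$. $\mathcal F(C)$ is the set of number fields over which $C$ has a new point; $D(C)=\{[L:\mathbb{Q}]:L\in\mathcal F(C)\}$; $D(C)^{\mathrm{inf}}$ is the set of $n$ such that infinitely many $L\in\mathcal F(C)$ have $[L:\mathbb{Q}]=n$; $G(C)=\gcd_{n\in D(C)}n$; $\mathcal E(C)=\{n\ge1: G(C)\mid n,\ n\notin D(C)^{\mathrm{inf}}\}$. For positive integers $a_1,\dots,a_k$, $\mathrm{Frob}(a_1,\dots,a_k)=\{a_1n_1+\cdots+a_kn_k: n_i\in\mathbb{Z}_{\ge0}\}$, and $d^2+S=\{d^2+s:s\in S\}$. -}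

module Defs where

open import Level using (Level; 0ℓ) renaming (suc to lsuc)
open import Data.Bool.Base using (if_then_else_)
open import Data.Nat.Base as ℕ using (ℕ; pred)
import Data.Nat.Properties as ℕₚ
open import Data.Nat.Divisibility using (_∣_)
open import Data.Integer.Base as ℤ using (ℤ; 0ℤ; 1ℤ)
open import Data.Rational.Base as ℚ using (ℚ)
import Data.Rational.Properties as ℚₚ
open import Data.Fin.Base using (Fin; zero)
open import Data.List.Base as List using (List; []; _∷_; _++_)
open import Data.Vec.Base as Vec using (Vec; lookup; updateAt)
import Data.Vec.Properties as Vecₚ
open import Data.Vec.Functional using (Vector)
open import Data.Product.Base using (∃; _×_; _,_)
open import Data.Product using (∃!)
open import Function.Base using (id)
open import Algebra.Bundles using (CommutativeRing)
open import Algebra.Bundles.Raw using (RawRing; RawSemiring)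
open import Algebra.Apartness.Bundles using (HeytingField; HeytingCommutativeRing)
open import Algebra.Morphism.Structures using (IsRingHomomorphism; IsRingIsomorphism)
import Algebra.Definitions.RawSemiring as RawSemiringDefs
open import Relation.Nullary using (¬_; does)
open import Relation.Unary using (Pred; _∈_; _∉_; Universal)
open import Relation.Binary.PropositionalEquality using (_≡_; _≢_; _≗_; refl; sym; trans; cong)

------------------------------------------------------------------------
-- The polynomial ring ℤ[x₁,…,xₘ]

-- A polynomial is a formal sum of terms a·x^α.  The list may be redundant
-- (repeated exponents, zero coefficients), so polynomials are compared
-- with _≈ₚ_, never with _≡_.
Poly : ℕ → Set
Poly m = List (ℤ × Vec ℕ m)

coeff : ∀ {m} → Poly m → Vec ℕ m → ℤ
coeff []            β = 0ℤ
coeff ((a , α) ∷ f) β =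
  if does (Vecₚ.≡-dec ℕₚ._≟_ α β) then a ℤ.+ coeff f β else coeff f β

infix 4 _≈ₚ_
_≈ₚ_ : ∀ {m} → Poly m → Poly m → Set
f ≈ₚ g = ∀ α → coeff f α ≡ coeff g α

_*ₚ_ : ∀ {m} → Poly m → Poly m → Poly m
_*ₚ_ = List.cartesianProductWith
  λ (a , α) (b , β) → a ℤ.* b , Vec.zipWith ℕ._+_ α β

polyRawSemiring : ℕ → RawSemiring 0ℓ 0ℓ
polyRawSemiring m = record
  { Carrier = Poly m
  ; _≈_     = _≈ₚ_
  ; _+_     = _++_
  ; _*_     = _*ₚ_
  ; 0#      = []
  ; 1#      = (1ℤ , Vec.replicate m 0) ∷ []
  }

-- Irreducibility in ℤ[x₁,…,xₘ] itself, so f is in particular primitive;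
-- 0 and the units are excluded.
Irreducible : ∀ {m} → Poly m → Set
Irreducible {m} = RawSemiringDefs.Irreducible (polyRawSemiring m)

Homogeneous : ∀ {m} → ℕ → Poly m → Set
Homogeneous d f = ∀ α → coeff f α ≢ 0ℤ → Vec.sum α ≡ d

-- When αᵢ = 0 the truncated exponent is harmless: the coefficient is 0.
∂ : ∀ {m} → Fin m → Poly m → Poly m
∂ i = List.map λ (a , α) → a ℤ.* ℤ.+ lookup α i , updateAt α i pred

------------------------------------------------------------------------
-- Number fields

-- [L : ℚ] is recorded together with a ℚ-basis witnessing it.  The library's
-- HeytingField has x # y exactly when x - y is invertible, and it forces
-- 0 ≉ 1.  In the presence of the basis, # is decidable and coincides with ≉.
record NumberField : Set₁ where
  field
    heytingField : HeytingField 0ℓ 0ℓ 0ℓ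

  open HeytingField heytingField public
    using (Carrier; _≈_; _#_; _+_; _*_; -_; 0#; 1#; heytingCommutativeRing)
  open HeytingCommutativeRing heytingCommutativeRing public
    using (commutativeRing)
  open CommutativeRing commutativeRing public
    using (rawRing)
  open RawRing rawRing public
    using (rawSemiring)
  open RawSemiringDefs rawSemiring public
    using (sum; product; _^_)

  field
    ι                    : ℚ → Carrier
    ι-isRingHomomorphism : IsRingHomomorphism ℚ.+-*-rawRing rawRing ι
    degree               : ℕ
    basis                : Vector Carrier degree
    isBasis              : ∀ x → ∃! _≗_ λ (c : Vector ℚ degree) →
                            x ≈ sum (λ i → ι (c i) * basis i)

  eval : ∀ {m} → Poly m → Vector Carrier m → Carrier
  eval f x = List.foldr
    (λ (a , α) s → ι (a ℚ./ 1) * product (λ i → x i ^ lookup α i) + s) 0# f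

infix 4 _≅_
_≅_ : NumberField → NumberField → Set
L ≅ M = ∃ (IsRingIsomorphism (NumberField.rawRing L) (NumberField.rawRing M))

rationals : NumberField
rationals = record
  { heytingField         = ℚₚ.heytingField
  ; ι                    = id
  ; ι-isRingHomomorphism = id-isRingHomomorphism
  ; degree               = 1
  ; basis                = λ _ → ℚ.1ℚ
  ; isBasis              = λ x → (λ _ → x) , sym (x*1+0≡x x) ,
                            λ { {c} x≡ zero → trans x≡ (x*1+0≡x (c zero)) }
  }
  where
  open import Algebra.Morphism.Construct.Identity using (isRingHomomorphism)

  id-isRingHomomorphism : IsRingHomomorphism ℚ.+-*-rawRing ℚ.+-*-rawRing id
  id-isRingHomomorphism = isRingHomomorphism ℚ.+-*-rawRing refl

  x*1+0≡x : ∀ x → x ℚ.* ℚ.1ℚ ℚ.+ ℚ.0ℚ ≡ x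
  x*1+0≡x x = trans (ℚₚ.+-identityʳ (x ℚ.* ℚ.1ℚ)) (ℚₚ.*-identityʳ x)

module _ (L : NumberField) where
  open NumberField L

  record IsSubfield (K : Pred Carrier 0ℓ) : Set where
    field
      resp      : ∀ {x y} → x ≈ y → x ∈ K → y ∈ K
      0∈        : 0# ∈ K
      1∈        : 1# ∈ K
      +-closed  : ∀ {x y} → x ∈ K → y ∈ K → x + y ∈ K
      *-closed  : ∀ {x y} → x ∈ K → y ∈ K → x * y ∈ K
      -‿closed  : ∀ {x} → x ∈ K → - x ∈ K
      ⁻¹-closed : ∀ {x y} → x ∈ K → x * y ≈ 1# → y ∈ K

  IsProperSubfield : Pred Carrier 0ℓ → Set
  IsProperSubfield K = IsSubfield K × ¬ Universal K

------------------------------------------------------------------------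
-- Points of the projective hypersurface C_f = {f = 0} ⊂ ℙᵐ⁻¹

-- A representative of a point of ℙᵐ⁻¹(L); every notion below is invariant
-- under rescaling when f is homogeneous.
record Point (L : NumberField) (m : ℕ) : Set where
  open NumberField L
  field
    coord   : Vector Carrier m
    nonzero : ∃ λ i → coord i # 0#

module _ {L : NumberField} {m : ℕ} where
  open NumberField L
  open Point

  OnHypersurface : Poly m → Point L m → Set
  OnHypersurface f P = eval f (coord P) ≈ 0#

  NonSingular : Poly m → Point L m → Set
  NonSingular f P = ∃ λ i → eval (∂ i f) (coord P) # 0#

  DefinedOver : Pred Carrier 0ℓ → Point L m → Set
  DefinedOver K P = ∃ λ t → t # 0# × (∀ i → t * coord P i ∈ K)

  record IsNewPoint (f : Poly m) (P : Point L m) : Set₁ where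
    field
      onHypersurface : OnHypersurface f P
      nonSingular    : NonSingular f P
      new            : ∀ K → IsProperSubfield L K → ¬ DefinedOver K P

------------------------------------------------------------------------
-- The invariants of C_f

module _ {m : ℕ} (f : Poly m) where

  HasNonSingularRationalPoint : Set
  HasNonSingularRationalPoint =
    ∃ λ (P : Point rationals m) → OnHypersurface f P × NonSingular f P

  𝓕 : Pred NumberField (lsuc 0ℓ)
  𝓕 L = ∃ λ (P : Point L m) → IsNewPoint f P

  D : Pred ℕ (lsuc 0ℓ)
  D n = ∃ λ L → L ∈ 𝓕 × NumberField.degree L ≡ n

  -- Number fields are counted up to isomorphism.  Counting subfields of a
  -- fixed algebraic closure instead gives the same notion of "infinitely
  -- many", as a number field has only finitely many embeddings into it.
  Dinf : Pred ℕ (lsuc 0ℓ)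
  Dinf n = ∃ λ (L : ℕ → NumberField) →
    (∀ i → L i ∈ 𝓕 × NumberField.degree (L i) ≡ n) ×
    (∀ i j → L i ≅ L j → i ≡ j)

IsGCD : ∀ {ℓ} → Pred ℕ ℓ → ℕ → Set ℓ
IsGCD S g = (∀ {n} → n ∈ S → g ∣ n) × (∀ {k} → (∀ {n} → n ∈ S → k ∣ n) → k ∣ g)

module _ {m : ℕ} (f : Poly m) where

  -- The relation G(C_f) = g: D(C_f) is not given as a decidable set, so its gcd is
  -- specified by its universal property, which determines g uniquely.
  G≡ : ℕ → Set₁
  G≡ = IsGCD (D f)

  𝓔 : Pred ℕ (lsuc 0ℓ)
  𝓔 n = 1 ℕ.≤ n × (∃ λ g → G≡ g × g ∣ n) × n ∉ Dinf f

------------------------------------------------------------------------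
-- Numerical semigroups

-- The usual convention is that all aᵢ are positive; the definition itself
-- does not impose it.
Frob : ∀ {k} → Vec ℕ k → Pred ℕ 0ℓ
Frob {k} a n = ∃ λ (c : Vec ℕ k) → n ≡ Vec.sum (Vec.zipWith ℕ._*_ a c)

infixr 6 _+ˢ_
_+ˢ_ : ∀ {ℓ} → ℕ → Pred ℕ ℓ → Pred ℕ ℓ
(k +ˢ S) n = ∃ λ s → s ∈ S × n ≡ k ℕ.+ s

{-# OPTIONS --safe #-}

-- Let P be a non-singular rational point and V a vector with c = f(V) ≠ 0 and D_V f(P) ≠ 0.
-- Write n = d(a + k) - a with k ≥ 2.  Correcting P + l²sξ along V gives a curve y₁(s) with
-- f(y₁) divisible by sᵃ⁺², and the curve x(s) = Qω y₁ + sᵃ(Q(T + s) + sᵏ)V then satisfies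
-- f(x(s)) = sᵃF(T, s) with F of degree n in s and leading coefficient c.  For a root θ of F at
-- an integer T = p, the point x(θ) is new over ℚ(θ), which has degree n if F(p, ·) is irreducible.
--
-- For indeterminate ξ, irreducibility of f makes F irreducible.  For suitable integral ξ and
-- large primes T = p this survives: F has a power series root ŷ(T) with ŷ(0) = 0, hence a root
-- in pℤ_p at T = p, and a factor of F(p, ·) vanishing there has coefficients bounded by a fixed
-- power of p, so that, by an argument of Sprindžuk, it comes from a relation on ŷ of low degree.
--
-- The fields are pairwise non-isomorphic because Q runs through products of the primes p chosen
-- before: the earlier field with T = p has an embedding into ℚ_p, whereas a later F has no root
-- in ℚ_p, being congruent to c sⁿ modulo p and exactly divisible by pᵈ at s ∈ pℤ_p.
module Submission where

open import Level using (0ℓ)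
open import Data.Nat.Base as ℕ using (ℕ; zero; suc; z≤n; s≤s)
import Data.Nat.Properties as ℕP
open import Data.Integer.Base as ℤ using (ℤ; +_; -[1+_]; _⊖_)
import Data.Integer.Properties as ℤP
import Data.Sign.Base as Sign
open import Data.Maybe.Base using (Maybe; just; nothing)
open import Data.List.Base as List using (List; []; _∷_)
open import Data.Product.Base using (∃; _×_; _,_; proj₁; proj₂)
open import Data.Sum.Base using (_⊎_; inj₁; inj₂)
open import Data.Empty using (⊥; ⊥-elim)
open import Relation.Nullary using (¬_; Dec; yes; no)
open import Relation.Binary.Definitions using (Tri; tri<; tri≈; tri>)
open import Relation.Binary.PropositionalEquality as ≡ using (_≡_; _≢_)
open import Algebra.Bundles using () renaming (CommutativeRing to CR)
open import Algebra.Bundles.Raw using (RawRing; RawSemiring)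
open import Algebra.Morphism.Structures using (IsRingMonomorphism; IsRingIsomorphism)
import Algebra.Morphism.RingMonomorphism as RingMono
import Algebra.Solver.Ring as RingSolver
open import Algebra.Solver.Ring.AlmostCommutativeRing using (fromCommutativeRing; _-Raw-AlmostCommutative⟶_)
import Algebra.Properties.Ring as RingProps
import Algebra.Properties.Semiring.Mult as SemiringMult
import Algebra.Properties.Semiring.Exp as SemiringExp
import Relation.Binary.Reasoning.Setoid as SetoidReasoning
open import Data.List.Relation.Unary.All as All using (All; []; _∷_)
import Data.List.Relation.Unary.All.Properties as AllP
open import Data.Nat.Induction using (<-rec)
open import Data.Vec.Base as Vec using (Vec; []; _∷_; lookup)
import Data.Vec.Properties as VecP
open import Data.Fin.Base as Fin using (Fin; zero; suc)
import Data.Integer.Divisibility.Signed as ℤ∣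
import Data.Nat.Divisibility as ℕ∣
import Data.Nat.Primality as ℕPrime
import Data.Nat.Primality.Factorisation as Factorisation
import Data.Nat.ListAction as ℕList
open import Function.Base using (_∘_)
import Algebra.Definitions.RawSemiring as RawSemiringDefs
import Algebra.Properties.CommutativeMonoid.Sum as MonoidSum
open import Defs
import Algebra.Definitions.RawMagma as RawMagmaDefs
open import Data.Rational.Base as ℚ using (ℚ)
import Data.Rational.Properties as ℚP
open import Data.Rational.Unnormalised.Base as ℚᵘ using (mkℚᵘ)
import Data.Rational.Unnormalised.Properties as ℚᵘP
import Data.Fin.Properties as FinP
import Data.Nat.DivMod as ℕDivMod
import Data.Nat.Coprimality as Coprimality
import Data.Nat.GCD as ℕGCD
open import Algebra.Apartness.Bundles using (HeytingField)
import Data.Nat.Solver as ℕSolver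

-- Hilbert's irreducibility theorem would provide good values of T but no hold on the resulting
-- fields. A large prime T = p supplies a root of F(p, ·) in ℤ_p, and this one place does double
-- duty: it gives irreducibility and it separates the field from all later ones. For the second use,
-- the multiplier ω (`choose`: Q if a = 0, and 1 otherwise) is set so that, at a prime dividing Q
-- exactly once, the value of F has the same valuation d in both cases. The direction ξ starts as a
-- vector of indeterminates because (x, T, s) ↦ (x(s), υ, s) is then a birational change of
-- variables that carries the prime f to sᵃF. Linear independence of monomials on the branch is
-- recorded by integral dual functionals with a common denominator Δ: one condition Δ ≠ 0 survives
-- the choice of ξ, and the functionals bound heights independently of p. Prime factorisations up to
-- double negation suffice, as irreducibility is used only in negative form.

Ring : Set₁
Ring = CR 0ℓ 0ℓ

-- Opening the library record itself would copy several hundred derived definitions at each use.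
module CRing (R : Ring) where
  infix 8 -_
  infixl 7 _*_
  infixl 6 _+_ _-_
  infix 4 _≈_

  Carrier : Set
  Carrier = CR.Carrier R
  _≈_ : Carrier → Carrier → Set
  _≈_ = CR._≈_ R
  _+_ _*_ _-_ : Carrier → Carrier → Carrier
  _+_ = CR._+_ R
  _*_ = CR._*_ R
  _-_ = CR._-_ R
  -_ : Carrier → Carrier
  -_ = CR.-_ R
  0# 1# : Carrier
  0# = CR.0# R
  1# = CR.1# R

  refl : ∀ {x} → x ≈ x
  refl = CR.refl R
  sym : ∀ {x y} → x ≈ y → y ≈ x
  sym = CR.sym R
  trans : ∀ {x y z} → x ≈ y → y ≈ z → x ≈ z
  trans = CR.trans R
  reflexive : ∀ {x y} → x ≡ y → x ≈ y
  reflexive = CR.reflexive R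
  +-cong : ∀ {x y u v} → x ≈ y → u ≈ v → x + u ≈ y + v
  +-cong = CR.+-cong R
  *-cong : ∀ {x y u v} → x ≈ y → u ≈ v → x * u ≈ y * v
  *-cong = CR.*-cong R
  +-congˡ : ∀ {x y z} → y ≈ z → x + y ≈ x + z
  +-congˡ = CR.+-congˡ R
  +-congʳ : ∀ {x y z} → y ≈ z → y + x ≈ z + x
  +-congʳ = CR.+-congʳ R
  *-congˡ : ∀ {x y z} → y ≈ z → x * y ≈ x * z
  *-congˡ = CR.*-congˡ R
  *-congʳ : ∀ {x y z} → y ≈ z → y * x ≈ z * x
  *-congʳ = CR.*-congʳ R
  -‿cong : ∀ {x y} → x ≈ y → - x ≈ - y
  -‿cong = CR.-‿cong R
  +-assoc : ∀ x y z → (x + y) + z ≈ x + (y + z)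
  +-assoc = CR.+-assoc R
  *-assoc : ∀ x y z → (x * y) * z ≈ x * (y * z)
  *-assoc = CR.*-assoc R
  +-comm : ∀ x y → x + y ≈ y + x
  +-comm = CR.+-comm R
  *-comm : ∀ x y → x * y ≈ y * x
  *-comm = CR.*-comm R
  +-identityˡ : ∀ x → 0# + x ≈ x
  +-identityˡ = CR.+-identityˡ R
  +-identityʳ : ∀ x → x + 0# ≈ x
  +-identityʳ = CR.+-identityʳ R
  *-identityˡ : ∀ x → 1# * x ≈ x
  *-identityˡ = CR.*-identityˡ R
  *-identityʳ : ∀ x → x * 1# ≈ x
  *-identityʳ = CR.*-identityʳ R
  zeroˡ : ∀ x → 0# * x ≈ 0#
  zeroˡ = CR.zeroˡ R
  zeroʳ : ∀ x → x * 0# ≈ 0#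
  zeroʳ = CR.zeroʳ R
  distribˡ : ∀ x y z → x * (y + z) ≈ x * y + x * z
  distribˡ = CR.distribˡ R
  distribʳ : ∀ x y z → (y + z) * x ≈ y * x + z * x
  distribʳ = CR.distribʳ R
  -‿inverseˡ : ∀ x → - x + x ≈ 0#
  -‿inverseˡ = CR.-‿inverseˡ R
  -‿inverseʳ : ∀ x → x + - x ≈ 0#
  -‿inverseʳ = CR.-‿inverseʳ R

  isEquivalence = CR.isEquivalence R
  isCommutativeRing = CR.isCommutativeRing R
  setoid = CR.setoid R
  rawRing = CR.rawRing R
  semiring = CR.semiring R
  ring = CR.ring R
  +-group = CR.+-group R
  +-commutativeMonoid = CR.+-commutativeMonoid R

∣_∣ : Ring → Set
∣ R ∣ = CRing.Carrier R

ℤR : Ring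
ℤR = ℤP.+-*-commutativeRing

-- Ring homomorphisms and the canonical map from ℤ

record Hom (R S : Ring) : Set where
  private
    module R = CRing R
    module S = CRing S
  field
    fn : ∣ R ∣ → ∣ S ∣
    cong : ∀ {a b} → a R.≈ b → fn a S.≈ fn b
    +-homo : ∀ a b → fn (a R.+ b) S.≈ fn a S.+ fn b
    *-homo : ∀ a b → fn (a R.* b) S.≈ fn a S.* fn b
    1-homo : fn R.1# S.≈ S.1#

  0-homo : fn R.0# S.≈ S.0#
  0-homo = RingProps.x+x≈x⇒x≈0 S.ring (fn R.0#)
    (S.trans (S.sym (+-homo _ _)) (cong (R.+-identityʳ R.0#)))

  -‿homo : ∀ a → fn (R.- a) S.≈ S.- fn a
  -‿homo a = RingProps.+-inverseˡ-unique S.ring (fn (R.- a)) (fn a)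
    (S.trans (S.sym (+-homo _ _)) (S.trans (cong (R.-‿inverseˡ a)) 0-homo))

open Hom using (fn; +-homo; *-homo; 1-homo; 0-homo; -‿homo) public

infixr 9 _∘ₕ_
_∘ₕ_ : ∀ {R S T} → Hom S T → Hom R S → Hom R T
_∘ₕ_ {R} {S} {T} g f = record
  { fn = λ a → fn g (fn f a)
  ; cong = λ p → Hom.cong g (Hom.cong f p)
  ; +-homo = λ a b → T.trans (Hom.cong g (+-homo f a b)) (+-homo g _ _)
  ; *-homo = λ a b → T.trans (Hom.cong g (*-homo f a b)) (*-homo g _ _)
  ; 1-homo = T.trans (Hom.cong g (1-homo f)) (1-homo g)
  }
  where module T = CRing T

idₕ : ∀ {R} → Hom R R
idₕ {R} = record
  { fn = λ a → a ; cong = λ p → p ; +-homo = λ _ _ → refl ; *-homo = λ _ _ → refl ; 1-homo = refl }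
  where open CRing R

idℤ : Hom ℤR ℤR
idℤ = idₕ

module _ (R : Ring) where
  open CRing R
  open RingProps ring
  open SemiringMult semiring using (×-homo-+; ×1-homo-*; ×-homo-1) renaming (_×_ to _·_)
  open SetoidReasoning setoid

  fromℤ : ℤ → ∣ R ∣
  fromℤ (+ n) = n · 1#
  fromℤ -[1+ n ] = - (suc n · 1#)

  private
    ⊖-homo : ∀ m n → fromℤ (m ⊖ n) ≈ m · 1# - n · 1#
    ⊖-homo zero zero = sym (-‿inverseʳ 0#)
    ⊖-homo zero (suc n) = sym (+-identityˡ _)
    ⊖-homo (suc m) zero = sym (trans (+-congˡ -0#≈0#) (+-identityʳ _))
    ⊖-homo (suc m) (suc n) = begin
      fromℤ (suc m ⊖ suc n) ≡⟨ ≡.cong fromℤ (ℤP.[1+m]⊖[1+n]≡m⊖n m n) ⟩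
      fromℤ (m ⊖ n) ≈⟨ ⊖-homo m n ⟩
      a - b ≈⟨ +-congʳ (trans (+-congʳ (-‿inverseʳ 1#)) (+-identityˡ a)) ⟨
      ((1# - 1#) + a) - b ≈⟨ +-congʳ (trans (+-assoc _ _ _) (+-congˡ (+-comm _ _))) ⟩
      (1# + (a - 1#)) - b ≈⟨ trans (+-congʳ (sym (+-assoc _ _ _))) (+-assoc _ _ _) ⟩
      (1# + a) + (- 1# - b) ≈⟨ +-congˡ (-‿+-comm 1# b) ⟩
      (1# + a) - (1# + b) ∎
      where a = m · 1# ; b = n · 1#

    +-hom : ∀ i j → fromℤ (i ℤ.+ j) ≈ fromℤ i + fromℤ j
    +-hom (+ m) (+ n) = ×-homo-+ 1# m n
    +-hom (+ m) -[1+ n ] = ⊖-homo m (suc n)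
    +-hom -[1+ m ] (+ n) = trans (⊖-homo n (suc m)) (+-comm _ _)
    +-hom -[1+ m ] -[1+ n ] = begin
      - (suc (suc (m ℕ.+ n)) · 1#) ≡⟨ ≡.cong (λ k → - (k · 1#)) (≡.cong suc (ℕP.+-suc m n)) ⟨
      - ((suc m ℕ.+ suc n) · 1#) ≈⟨ -‿cong (×-homo-+ 1# (suc m) (suc n)) ⟩
      - (suc m · 1# + suc n · 1#) ≈⟨ -‿+-comm _ _ ⟨
      - (suc m · 1#) - suc n · 1# ∎

    neg◃ : ∀ n → fromℤ (Sign.- ℤ.◃ n) ≈ - (n · 1#)
    neg◃ zero = sym -0#≈0#
    neg◃ (suc n) = refl

    pos◃ : ∀ n → fromℤ (Sign.+ ℤ.◃ n) ≈ n · 1#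
    pos◃ zero = refl
    pos◃ (suc n) = refl

    *-hom : ∀ i j → fromℤ (i ℤ.* j) ≈ fromℤ i * fromℤ j
    *-hom (+ m) (+ n) = trans (pos◃ (m ℕ.* n)) (×1-homo-* m n)
    *-hom (+ m) -[1+ n ] = trans (neg◃ (m ℕ.* suc n))
      (trans (-‿cong (×1-homo-* m (suc n))) (-‿distribʳ-* _ _))
    *-hom -[1+ m ] (+ n) = trans (neg◃ (suc m ℕ.* n))
      (trans (-‿cong (×1-homo-* (suc m) n)) (-‿distribˡ-* _ _))
    *-hom -[1+ m ] -[1+ n ] = begin
      (suc m ℕ.* suc n) · 1# ≈⟨ ×1-homo-* (suc m) (suc n) ⟩
      suc m · 1# * suc n · 1# ≈⟨ -‿involutive _ ⟨
      - - (suc m · 1# * suc n · 1#) ≈⟨ -‿cong (-‿distribʳ-* _ _) ⟩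
      - (suc m · 1# * - (suc n · 1#)) ≈⟨ -‿distribˡ-* _ _ ⟩
      - (suc m · 1#) * - (suc n · 1#) ∎

  opaque
    ι : Hom ℤR R
    ι = record
      { fn = fromℤ ; cong = λ { ≡.refl → refl } ; +-homo = +-hom ; *-homo = *-hom ; 1-homo = ×-homo-1 1# }

  module Solver where
    private
      morphism : CRing.rawRing ℤR -Raw-AlmostCommutative⟶ fromCommutativeRing R
      morphism = record
        { ⟦_⟧ = fn ι ; +-homo = +-homo ι ; *-homo = *-homo ι
        ; -‿homo = -‿homo ι ; 0-homo = 0-homo ι ; 1-homo = 1-homo ι }

      dec : ∀ i j → Maybe (fn ι i ≈ fn ι j)
      dec i j with i ℤP.≟ j
      ... | yes ≡.refl = just refl
      ... | no _ = nothing
    open RingSolver (CRing.rawRing ℤR) (fromCommutativeRing R) morphism dec public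

-- Power series and polynomials in one variable over a ring

module _ (R : Ring) where
  open CRing R
  open SetoidReasoning setoid

  private
    Seq : Set
    Seq = ℕ → Carrier

    -- The Cauchy product through ab = a₀b + t·(tail a)·b. This recursion yields the ring laws by
    -- induction, without reindexing double sums.
    mul : Seq → Seq → Seq
    mul a b zero = a 0 * b 0
    mul a b (suc n) = a 0 * b (suc n) + mul (λ i → a (suc i)) b n

    one : Seq
    one zero = 1#
    one (suc n) = 0#

    mul-cong : ∀ {a a′ b b′ : Seq} → (∀ i → a i ≈ a′ i) → (∀ i → b i ≈ b′ i) →
               ∀ n → mul a b n ≈ mul a′ b′ n
    mul-cong p q zero = *-cong (p 0) (q 0)
    mul-cong p q (suc n) = +-cong (*-cong (p 0) (q (suc n))) (mul-cong (λ i → p (suc i)) q n)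

    -- The recursion of `mul` read from the other end; comparing the two gives commutativity.
    mul-right : ∀ (a b : Seq) n → mul a b (suc n) ≈ mul a (λ i → b (suc i)) n + a (suc n) * b 0
    mul-right a b zero = refl
    mul-right a b (suc n) = trans (+-congˡ (mul-right (λ i → a (suc i)) b n)) (sym (+-assoc _ _ _))

    mul-comm : ∀ (a b : Seq) n → mul a b n ≈ mul b a n
    mul-comm a b zero = *-comm _ _
    mul-comm a b (suc n) = begin
      a 0 * b (suc n) + mul (λ i → a (suc i)) b n ≈⟨ +-cong (*-comm _ _) (mul-comm (λ i → a (suc i)) b n) ⟩
      b (suc n) * a 0 + mul b (λ i → a (suc i)) n ≈⟨ +-comm _ _ ⟩
      mul b (λ i → a (suc i)) n + b (suc n) * a 0 ≈⟨ mul-right b a n ⟨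
      mul b a (suc n) ∎

    mul-distribʳ : ∀ (a b c : Seq) n → mul (λ i → a i + b i) c n ≈ mul a c n + mul b c n
    mul-distribʳ a b c zero = distribʳ _ _ _
    mul-distribʳ a b c (suc n) = begin
      (a 0 + b 0) * c (suc n) + _ ≈⟨ +-cong (distribʳ _ _ _) (mul-distribʳ (λ i → a (suc i)) (λ i → b (suc i)) c n) ⟩
      (p + q) + (r + s) ≈⟨ Solver.solve R 4 (λ p q r s → (p :+ q) :+ (r :+ s) := (p :+ r) :+ (q :+ s)) refl p q r s ⟩
      (p + r) + (q + s) ∎
      where
      open Solver R using (_:+_; _:=_)
      p = a 0 * c (suc n)
      q = b 0 * c (suc n)
      r = mul (λ i → a (suc i)) c n
      s = mul (λ i → b (suc i)) c n

    mul-scale : ∀ r (a b : Seq) n → mul (λ i → r * a i) b n ≈ r * mul a b n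
    mul-scale r a b zero = *-assoc _ _ _
    mul-scale r a b (suc n) = trans (+-cong (*-assoc _ _ _) (mul-scale r _ b n)) (sym (distribˡ _ _ _))

    mul-assoc : ∀ (a b c : Seq) n → mul (mul a b) c n ≈ mul a (mul b c) n
    mul-assoc a b c zero = *-assoc _ _ _
    mul-assoc a b c (suc n) = begin
      (a 0 * b 0) * c (suc n) + mul (λ i → a 0 * b (suc i) + mul a′ b i) c n
        ≈⟨ +-cong (*-assoc _ _ _) (mul-distribʳ _ _ c n) ⟩
      a 0 * (b 0 * c (suc n)) + (mul (λ i → a 0 * b (suc i)) c n + mul (mul a′ b) c n)
        ≈⟨ +-congˡ (+-cong (mul-scale _ _ c n) (mul-assoc a′ b c n)) ⟩
      a 0 * (b 0 * c (suc n)) + (a 0 * mul (λ i → b (suc i)) c n + mul a′ (mul b c) n)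
        ≈⟨ +-assoc _ _ _ ⟨
      (a 0 * (b 0 * c (suc n)) + a 0 * mul (λ i → b (suc i)) c n) + mul a′ (mul b c) n
        ≈⟨ +-congʳ (distribˡ _ _ _) ⟨
      a 0 * mul b c (suc n) + mul a′ (mul b c) n ∎
      where
      a′ : Seq
      a′ i = a (suc i)

    mul-zeroˡ : ∀ (b : Seq) n → mul (λ _ → 0#) b n ≈ 0#
    mul-zeroˡ b zero = zeroˡ _
    mul-zeroˡ b (suc n) = trans (+-cong (zeroˡ _) (mul-zeroˡ b n)) (+-identityʳ 0#)

    mul-identityˡ : ∀ (b : Seq) n → mul one b n ≈ b n
    mul-identityˡ b zero = *-identityˡ _
    mul-identityˡ b (suc n) = trans (+-cong (*-identityˡ _) (mul-zeroˡ b n)) (+-identityʳ _)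

  private
    series : Ring
    series = record
      { Carrier = Seq
      ; _≈_ = λ a b → ∀ n → a n ≈ b n
      ; _+_ = λ a b n → a n + b n
      ; _*_ = mul
      ; -_ = λ a n → - a n
      ; 0# = λ _ → 0#
      ; 1# = one
      ; isCommutativeRing = record
        { isRing = record
          { +-isAbelianGroup = record
            { isGroup = record
              { isMonoid = record
                { isSemigroup = record
                  { isMagma = record
                    { isEquivalence = record
                      { refl = λ _ → refl ; sym = λ p n → sym (p n) ; trans = λ p q n → trans (p n) (q n) }
                    ; ∙-cong = λ p q n → +-cong (p n) (q n) }
                  ; assoc = λ a b c n → +-assoc _ _ _ }
                ; identity = (λ a n → +-identityˡ _) , (λ a n → +-identityʳ _) }
              ; inverse = (λ a n → -‿inverseˡ _) , (λ a n → -‿inverseʳ _)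
              ; ⁻¹-cong = λ p n → -‿cong (p n) }
            ; comm = λ a b n → +-comm _ _ }
          ; *-cong = mul-cong
          ; *-assoc = mul-assoc
          ; *-identity = mul-identityˡ , (λ b n → trans (mul-comm b one n) (mul-identityˡ b n))
          ; distrib = (λ c a b n → trans (mul-comm c _ n) (trans (mul-distribʳ a b c n)
                          (+-cong (mul-comm a c n) (mul-comm b c n))))
                    , (λ c a b n → mul-distribʳ a b c n) }
        ; *-comm = mul-comm } }

  opaque
    Series : Ring
    Series = series

    coefₛ : ∣ Series ∣ → ℕ → Carrier
    coefₛ a n = a n

    mkₛ : (ℕ → Carrier) → ∣ Series ∣
    mkₛ a = a

  private module S = CRing Series

  tailₛ : ∣ Series ∣ → ∣ Series ∣
  tailₛ a = mkₛ (λ n → coefₛ a (suc n))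

  opaque
    unfolding Series
    extₛ : ∀ {a b} → (∀ n → coefₛ a n ≈ coefₛ b n) → a S.≈ b
    extₛ p = p

    coefₛ-cong : ∀ {a b} → a S.≈ b → ∀ n → coefₛ a n ≈ coefₛ b n
    coefₛ-cong p = p

    coefₛ-mk : ∀ a n → coefₛ (mkₛ a) n ≈ a n
    coefₛ-mk a n = refl

    coefₛ-+ : ∀ a b n → coefₛ (a S.+ b) n ≈ coefₛ a n + coefₛ b n
    coefₛ-+ a b n = refl

    coefₛ-neg : ∀ a n → coefₛ (S.- a) n ≈ - coefₛ a n
    coefₛ-neg a n = refl

    coefₛ-0 : ∀ n → coefₛ S.0# n ≈ 0#
    coefₛ-0 n = refl

    coefₛ-1 : ∀ n → coefₛ S.1# (suc n) ≈ 0#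
    coefₛ-1 n = refl

    coefₛ-1-0 : coefₛ S.1# 0 ≈ 1#
    coefₛ-1-0 = refl

    coefₛ-*-0 : ∀ a b → coefₛ (a S.* b) 0 ≈ coefₛ a 0 * coefₛ b 0
    coefₛ-*-0 a b = refl

    coefₛ-*-suc : ∀ a b n → coefₛ (a S.* b) (suc n) ≈ coefₛ a 0 * coefₛ b (suc n) + coefₛ (tailₛ a S.* b) n
    coefₛ-*-suc a b n = refl

  coefᴸ : List Carrier → ℕ → Carrier
  coefᴸ [] n = 0#
  coefᴸ (r ∷ p) zero = r
  coefᴸ (r ∷ p) (suc n) = coefᴸ p n

  infixl 6 _+ᴸ_
  infixl 7 _*ᴸ_
  _+ᴸ_ _*ᴸ_ : List Carrier → List Carrier → List Carrier
  [] +ᴸ q = q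
  (r ∷ p) +ᴸ [] = r ∷ p
  (r ∷ p) +ᴸ (s ∷ q) = r + s ∷ p +ᴸ q
  [] *ᴸ q = []
  (r ∷ p) *ᴸ q = List.map (r *_) q +ᴸ (0# ∷ p *ᴸ q)

  coefᴸ-+ : ∀ p q n → coefᴸ (p +ᴸ q) n ≈ coefᴸ p n + coefᴸ q n
  coefᴸ-+ [] q n = sym (+-identityˡ _)
  coefᴸ-+ (r ∷ p) [] n = sym (+-identityʳ _)
  coefᴸ-+ (r ∷ p) (s ∷ q) zero = refl
  coefᴸ-+ (r ∷ p) (s ∷ q) (suc n) = coefᴸ-+ p q n

  coefᴸ-scale : ∀ r q n → coefᴸ (List.map (r *_) q) n ≈ r * coefᴸ q n
  coefᴸ-scale r [] n = sym (zeroʳ r)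
  coefᴸ-scale r (s ∷ q) zero = refl
  coefᴸ-scale r (s ∷ q) (suc n) = coefᴸ-scale r q n

  coefᴸ-* : ∀ p q n → coefᴸ (p *ᴸ q) n ≈ mul (coefᴸ p) (coefᴸ q) n
  coefᴸ-* [] q n = sym (mul-zeroˡ (coefᴸ q) n)
  coefᴸ-* (r ∷ p) q zero = trans (coefᴸ-+ (List.map (r *_) q) (0# ∷ p *ᴸ q) 0) (trans (+-identityʳ _) (coefᴸ-scale r q 0))
  coefᴸ-* (r ∷ p) q (suc n) = trans (coefᴸ-+ (List.map (r *_) q) (0# ∷ p *ᴸ q) (suc n)) (+-cong (coefᴸ-scale r q (suc n)) (coefᴸ-* p q n))

  coefᴸ-neg : ∀ p n → coefᴸ (List.map (-_) p) n ≈ - coefᴸ p n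
  coefᴸ-neg [] n = sym (RingProps.-0#≈0# ring)
  coefᴸ-neg (r ∷ p) zero = refl
  coefᴸ-neg (r ∷ p) (suc n) = coefᴸ-neg p n

  coefᴸ-one : ∀ n → coefᴸ (1# ∷ []) n ≈ one n
  coefᴸ-one zero = refl
  coefᴸ-one (suc n) = refl

  coefᴸ-bound : ∀ p n → List.length p ℕ.≤ n → coefᴸ p n ≈ 0#
  coefᴸ-bound [] n q = refl
  coefᴸ-bound (r ∷ p) (suc n) (ℕ.s≤s q) = coefᴸ-bound p n q

  tl : List Carrier → List Carrier
  tl [] = []
  tl (r ∷ p) = p

  coefᴸ-tl : ∀ p n → coefᴸ (tl p) n ≈ coefᴸ p (suc n)
  coefᴸ-tl [] n = refl
  coefᴸ-tl (r ∷ p) n = refl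

  -- Lists are compared through their coefficients, so trailing zeros are harmless and no
  -- coefficient has to be tested for being 0. The ring laws are pulled back along the injection
  -- `coefᴸ` into power series.
  rawPol : RawRing 0ℓ 0ℓ
  rawPol = record
    { Carrier = List Carrier
    ; _≈_ = λ p q → ∀ n → coefᴸ p n ≈ coefᴸ q n
    ; _+_ = _+ᴸ_ ; _*_ = _*ᴸ_ ; -_ = List.map (-_) ; 0# = [] ; 1# = 1# ∷ [] }

  private
    mono : IsRingMonomorphism rawPol (CRing.rawRing series) coefᴸ
    mono = record
      { isRingHomomorphism = record
        { isSemiringHomomorphism = record
          { isNearSemiringHomomorphism = record
            { +-isMonoidHomomorphism = record
              { isMagmaHomomorphism = record
                { isRelHomomorphism = record { cong = λ p → p } ; homo = coefᴸ-+ }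
              ; ε-homo = λ _ → refl }
            ; *-homo = coefᴸ-* }
          ; 1#-homo = coefᴸ-one }
        ; -‿homo = coefᴸ-neg }
      ; injective = λ p → p }

  opaque
    Pol : Ring
    Pol = record { isCommutativeRing = RingMono.isCommutativeRing mono (CRing.isCommutativeRing series) }

    coef : ∣ Pol ∣ → ℕ → Carrier
    coef = coefᴸ

    tail : ∣ Pol ∣ → ∣ Pol ∣
    tail = tl

    -- An upper bound for 1 + degree that depends on the representative; equal polynomials may have
    -- different bounds.
    bound : ∣ Pol ∣ → ℕ
    bound = List.length

    X : ∣ Pol ∣
    X = 0# ∷ 1# ∷ []

  private module P = CRing Pol

  opaque
    unfolding Pol
    constₕ : Hom R Pol
    constₕ = record
      { fn = λ r → r ∷ []
      ; cong = λ { p zero → p ; p (suc n) → refl }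
      ; +-homo = λ { a b zero → refl ; a b (suc n) → refl }
      ; *-homo = λ { a b zero → sym (+-identityʳ _) ; a b (suc zero) → refl ; a b (suc (suc n)) → refl }
      ; 1-homo = λ _ → refl }

  const : Carrier → ∣ Pol ∣
  const = fn constₕ

  opaque
    unfolding Pol constₕ
    ext : ∀ {a b} → (∀ n → coef a n ≈ coef b n) → a P.≈ b
    ext p = p

    coef-cong : ∀ {a b} → a P.≈ b → ∀ n → coef a n ≈ coef b n
    coef-cong p = p

    coef-+ : ∀ a b n → coef (a P.+ b) n ≈ coef a n + coef b n
    coef-+ = coefᴸ-+

    coef-neg : ∀ a n → coef (P.- a) n ≈ - coef a n
    coef-neg = coefᴸ-neg

    coef-0 : ∀ n → coef P.0# n ≈ 0#
    coef-0 n = refl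

    coef-const-0 : ∀ r → coef (const r) 0 ≈ r
    coef-const-0 r = refl

    coef-const-suc : ∀ r n → coef (const r) (suc n) ≈ 0#
    coef-const-suc r n = refl

    coef-const* : ∀ r a n → coef (const r P.* a) n ≈ r * coef a n
    coef-const* r a n = trans (coefᴸ-* (r ∷ []) a n) (lem n)
      where
      lem : ∀ n → mul (coefᴸ (r ∷ [])) (coefᴸ a) n ≈ r * coefᴸ a n
      lem zero = refl
      lem (suc n) = trans (+-congˡ (mul-zeroˡ (coefᴸ a) n)) (+-identityʳ _)

    coef-X*-0 : ∀ a → coef (X P.* a) 0 ≈ 0#
    coef-X*-0 a = trans (coefᴸ-* X a 0) (zeroˡ _)

    coef-X*-suc : ∀ a n → coef (X P.* a) (suc n) ≈ coef a n
    coef-X*-suc a n = trans (coefᴸ-* X a (suc n)) (trans (+-cong (zeroˡ _)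
      (trans (mul-cong {b = coefᴸ a} (λ { zero → refl ; (suc i) → refl }) (λ _ → refl) n) (mul-identityˡ (coefᴸ a) n))) (+-identityˡ _))

    coef-*-0 : ∀ a b → coef (a P.* b) 0 ≈ coef a 0 * coef b 0
    coef-*-0 a b = coefᴸ-* a b 0

    coef-*-suc : ∀ a b n → coef (a P.* b) (suc n) ≈ coef a 0 * coef b (suc n) + coef (tail a P.* b) n
    coef-*-suc a b n = trans (coefᴸ-* a b (suc n))
      (+-congˡ (sym (trans (coefᴸ-* (tl a) b n) (mul-cong {b = coefᴸ b} (coefᴸ-tl a) (λ _ → refl) n))))

    coef-tail : ∀ a n → coef (tail a) n ≈ coef a (suc n)
    coef-tail = coefᴸ-tl

    coef-bound : ∀ a n → bound a ℕ.≤ n → coef a n ≈ 0#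
    coef-bound = coefᴸ-bound

-- Evaluation of polynomials along a homomorphism

module _ {R S : Ring} (h : Hom R S) (x : ∣ S ∣) where
  private
    module R = CRing R
    module S = CRing S
  open SetoidReasoning S.setoid
  open Solver S using (_:+_; _:*_; _:=_; con; solve)

  private
    infixl 6 _+ᵣ_
    infixl 7 _*ᵣ_
    _+ᵣ_ _*ᵣ_ : List ∣ R ∣ → List ∣ R ∣ → List ∣ R ∣
    _+ᵣ_ = _+ᴸ_ R
    _*ᵣ_ = _*ᴸ_ R

    ev : List ∣ R ∣ → ∣ S ∣
    ev [] = S.0#
    ev (r ∷ p) = fn h r S.+ x S.* ev p

    ev-zero : ∀ p → (∀ n → coefᴸ R p n R.≈ R.0#) → ev p S.≈ S.0#
    ev-zero [] z = S.refl
    ev-zero (r ∷ p) z = begin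
      fn h r S.+ x S.* ev p ≈⟨ S.+-cong (S.trans (Hom.cong h (z 0)) (0-homo h)) (S.*-congˡ (ev-zero p (λ n → z (suc n)))) ⟩
      S.0# S.+ x S.* S.0# ≈⟨ S.trans (S.+-identityˡ _) (S.zeroʳ x) ⟩
      S.0# ∎

    ev-cong : ∀ p q → (∀ n → coefᴸ R p n R.≈ coefᴸ R q n) → ev p S.≈ ev q
    ev-cong [] q e = S.sym (ev-zero q (λ n → R.sym (e n)))
    ev-cong (r ∷ p) [] e = ev-zero (r ∷ p) e
    ev-cong (r ∷ p) (s ∷ q) e = S.+-cong (Hom.cong h (e 0)) (S.*-congˡ (ev-cong p q (λ n → e (suc n))))

    ev-+ : ∀ p q → ev (p +ᵣ q) S.≈ ev p S.+ ev q
    ev-+ [] q = S.sym (S.+-identityˡ _)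
    ev-+ (r ∷ p) [] = S.sym (S.+-identityʳ _)
    ev-+ (r ∷ p) (s ∷ q) = begin
      fn h (r R.+ s) S.+ x S.* ev (p +ᵣ q) ≈⟨ S.+-cong (+-homo h r s) (S.*-congˡ (ev-+ p q)) ⟩
      (fn h r S.+ fn h s) S.+ x S.* (ev p S.+ ev q)
        ≈⟨ solve 5 (λ a b x p q → (a :+ b) :+ x :* (p :+ q) := (a :+ x :* p) :+ (b :+ x :* q)) S.refl _ _ _ _ _ ⟩
      (fn h r S.+ x S.* ev p) S.+ (fn h s S.+ x S.* ev q) ∎

    ev-scale : ∀ r q → ev (List.map (r R.*_) q) S.≈ fn h r S.* ev q
    ev-scale r [] = S.sym (S.zeroʳ _)
    ev-scale r (s ∷ q) = begin
      fn h (r R.* s) S.+ x S.* ev (List.map (r R.*_) q) ≈⟨ S.+-cong (*-homo h r s) (S.*-congˡ (ev-scale r q)) ⟩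
      fn h r S.* fn h s S.+ x S.* (fn h r S.* ev q)
        ≈⟨ solve 4 (λ a b x q → a :* b :+ x :* (a :* q) := a :* (b :+ x :* q)) S.refl _ _ _ _ ⟩
      fn h r S.* (fn h s S.+ x S.* ev q) ∎

    ev-* : ∀ p q → ev (p *ᵣ q) S.≈ ev p S.* ev q
    ev-* [] q = S.sym (S.zeroˡ _)
    ev-* (r ∷ p) q = begin
      ev (List.map (r R.*_) q +ᵣ (R.0# ∷ p *ᵣ q)) ≈⟨ ev-+ (List.map (r R.*_) q) (R.0# ∷ p *ᵣ q) ⟩
      ev (List.map (r R.*_) q) S.+ (fn h R.0# S.+ x S.* ev (p *ᵣ q))
        ≈⟨ S.+-cong (ev-scale r q) (S.+-cong (0-homo h) (S.*-congˡ (ev-* p q))) ⟩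
      fn h r S.* ev q S.+ (S.0# S.+ x S.* (ev p S.* ev q))
        ≈⟨ S.+-congˡ (S.+-identityˡ _) ⟩
      fn h r S.* ev q S.+ x S.* (ev p S.* ev q)
        ≈⟨ solve 4 (λ a q x p → a :* q :+ x :* (p :* q) := (a :+ x :* p) :* q) S.refl _ _ _ _ ⟩
      (fn h r S.+ x S.* ev p) S.* ev q ∎

  opaque
    unfolding Pol constₕ
    eval : Hom (Pol R) S
    eval = record
      { fn = ev ; cong = λ {p} {q} → ev-cong p q ; +-homo = ev-+ ; *-homo = ev-*
      ; 1-homo = S.trans (S.+-cong (1-homo h) (S.zeroʳ x)) (S.+-identityʳ _) }

    eval-const : ∀ r → fn eval (const R r) S.≈ fn h r
    eval-const r = S.trans (S.+-congˡ (S.zeroʳ x)) (S.+-identityʳ _)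

    eval-X : fn eval (X R) S.≈ x
    eval-X = begin
      fn h R.0# S.+ x S.* (fn h R.1# S.+ x S.* S.0#)
        ≈⟨ S.+-cong (0-homo h) (S.*-congˡ (S.+-cong (1-homo h) (S.zeroʳ x))) ⟩
      S.0# S.+ x S.* (S.1# S.+ S.0#) ≈⟨ S.+-identityˡ _ ⟩
      x S.* (S.1# S.+ S.0#) ≈⟨ S.trans (S.*-congˡ (S.+-identityʳ _)) (S.*-identityʳ x) ⟩
      x ∎

-- Univariate polynomials

module _ (R : Ring) where
  open CRing R
  private
    module P = CRing (Pol R)
  open SemiringExp semiring using (_^_)
  open SemiringExp P.semiring using () renaming (_^_ to _^ₚ_)

  coef-const : ∀ r n → 1 ℕ.≤ n → coef R (const R r) n ≈ 0#
  coef-const r (suc n) _ = coef-const-suc R r n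

  Pol-decompose : ∀ a → a P.≈ const R (coef R a 0) P.+ X R P.* tail R a
  Pol-decompose a = ext R λ n → sym (trans (coef-+ R _ _ n) (lem n))
    where
    lem : ∀ n → coef R (const R (coef R a 0)) n + coef R (X R P.* tail R a) n ≈ coef R a n
    lem zero = trans (+-cong (coef-const-0 R _) (coef-X*-0 R _)) (+-identityʳ _)
    lem (suc n) = trans (+-cong (coef-const-suc R _ n) (coef-X*-suc R _ n)) (trans (+-identityˡ _) (coef-tail R a n))

  -- Bounds take the place of the degree, which cannot be computed over a ring where equality with 0
  -- is undecided. `deg< 0` characterises the zero polynomial.
  deg< : ℕ → ∣ Pol R ∣ → Set
  deg< n a = ∀ i → n ℕ.≤ i → coef R a i ≈ 0#

  deg<0⇒≈0 : ∀ {a} → deg< 0 a → a P.≈ P.0#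
  deg<0⇒≈0 z = ext R λ n → trans (z n z≤n) (sym (coef-0 R n))

  deg<-tail : ∀ {n a} → deg< (suc n) a → deg< n (tail R a)
  deg<-tail {a = a} z i n≤i = trans (coef-tail R a i) (z (suc i) (s≤s n≤i))

  deg<-cong : ∀ {n a b} → a P.≈ b → deg< n a → deg< n b
  deg<-cong e z i n≤i = trans (sym (coef-cong R e i)) (z i n≤i)

  deg<-mono : ∀ {m n a} → m ℕ.≤ n → deg< m a → deg< n a
  deg<-mono m≤n z i n≤i = z i (ℕP.≤-trans m≤n n≤i)

  deg<-0 : ∀ n → deg< n P.0#
  deg<-0 n i _ = coef-0 R i

  deg<-const : ∀ {n} r → 1 ℕ.≤ n → deg< n (const R r)
  deg<-const r 1≤n i n≤i = coef-const r i (ℕP.≤-trans 1≤n n≤i)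

  deg<-+ : ∀ {n a b} → deg< n a → deg< n b → deg< n (a P.+ b)
  deg<-+ {a = a} {b} y z i n≤i = trans (coef-+ R a b i) (trans (+-cong (y i n≤i) (z i n≤i)) (+-identityˡ 0#))

  deg<-neg : ∀ {n a} → deg< n a → deg< n (P.- a)
  deg<-neg {a = a} y i n≤i = trans (coef-neg R a i) (trans (-‿cong (y i n≤i)) (RingProps.-0#≈0# ring))

  deg<-const* : ∀ {n a} r → deg< n a → deg< n (const R r P.* a)
  deg<-const* {a = a} r y i n≤i = trans (coef-const* R r a i) (trans (*-congˡ (y i n≤i)) (zeroʳ r))

  deg<-X* : ∀ {n a} → deg< n a → deg< (suc n) (X R P.* a)
  deg<-X* {a = a} y (suc i) (s≤s n≤i) = trans (coef-X*-suc R a i) (y i n≤i)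

  deg<-bound : ∀ a → deg< (bound R a) a
  deg<-bound a i = coef-bound R a i

  -- Horner induction. It runs on the bound of a representative, whence the demand that Q respect
  -- equality.
  Pol-ind : ∀ {ℓ} (Q : ∣ Pol R ∣ → Set ℓ) → (∀ {a b} → a P.≈ b → Q a → Q b) → Q P.0# →
            (∀ r a → Q a → Q (const R r P.+ X R P.* a)) → ∀ a → Q a
  Pol-ind Q resp z s a = go (bound R a) a (deg<-bound a)
    where
    go : ∀ n a → deg< n a → Q a
    go zero a d = resp (P.sym (deg<0⇒≈0 d)) z
    go (suc n) a d = resp (P.sym (Pol-decompose a)) (s _ _ (go n (tail R a) (deg<-tail d)))

  coef-const+X* : ∀ r a n → coef R (const R r P.+ X R P.* a) (suc n) ≈ coef R a n
  coef-const+X* r a n = trans (coef-+ R _ _ (suc n)) (trans (+-cong (coef-const-suc R r n) (coef-X*-suc R a n)) (+-identityˡ _))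

  coef-const+X*-0 : ∀ r a → coef R (const R r P.+ X R P.* a) 0 ≈ r
  coef-const+X*-0 r a = trans (coef-+ R _ _ 0) (trans (+-cong (coef-const-0 R r) (coef-X*-0 R a)) (+-identityʳ _))

  X*-cancel : ∀ {a b} → X R P.* a P.≈ X R P.* b → a P.≈ b
  X*-cancel {a} {b} e = ext R λ n → trans (sym (coef-X*-suc R a n)) (trans (coef-cong R e (suc n)) (coef-X*-suc R b n))

  X∣ : ∀ {a} → coef R a 0 ≈ 0# → a P.≈ X R P.* tail R a
  X∣ {a} z = P.trans (Pol-decompose a) (P.trans (P.+-congʳ (P.trans (Hom.cong (constₕ R) z) (0-homo (constₕ R)))) (P.+-identityˡ _))

  coef-X^* : ∀ k a n → coef R (X R ^ₚ k P.* a) (k ℕ.+ n) ≈ coef R a n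
  coef-X^* zero a n = coef-cong R (P.*-identityˡ a) n
  coef-X^* (suc k) a n = trans (coef-cong R (P.*-assoc _ _ _) _) (trans (coef-X*-suc R _ _) (coef-X^* k a n))

  coef-X^*-< : ∀ k a n → n ℕ.< k → coef R (X R ^ₚ k P.* a) n ≈ 0#
  coef-X^*-< (suc k) a zero _ = trans (coef-cong R (P.*-assoc _ _ _) 0) (coef-X*-0 R _)
  coef-X^*-< (suc k) a (suc n) (s≤s n<k) = trans (coef-cong R (P.*-assoc _ _ _) (suc n)) (trans (coef-X*-suc R _ _) (coef-X^*-< k a n n<k))

  X^∣ : ∀ k a → (∀ i → i ℕ.< k → coef R a i ≈ 0#) → ∃ λ b → a P.≈ X R ^ₚ k P.* b
  X^∣ zero a z = a , P.sym (P.*-identityˡ a)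
  X^∣ (suc k) a z with X^∣ k (tail R a) (λ i i<k → trans (coef-tail R a i) (z (suc i) (s≤s i<k)))
  ... | b , e = b , P.trans (X∣ (z 0 (s≤s z≤n))) (P.trans (P.*-congˡ e) (P.sym (P.*-assoc _ _ _)))

  deg<-X^* : ∀ k {n a} → deg< n a → deg< (k ℕ.+ n) (X R ^ₚ k P.* a)
  deg<-X^* zero d = deg<-cong (P.sym (P.*-identityˡ _)) d
  deg<-X^* (suc k) d = deg<-cong (P.sym (P.*-assoc _ _ _)) (deg<-X* (deg<-X^* k d))

  -- The value v may be 0, so that `Top` is preserved by every homomorphism of coefficients;
  -- together with v ≠ 0 it says that the degree is k.
  record Top (k : ℕ) (v : Carrier) (a : ∣ Pol R ∣) : Set where
    constructor mkTop
    field
      lead : coef R a k ≈ v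
      degᵗ : deg< (suc k) a

  open Top public

  Top-cong : ∀ {k v w a b} → v ≈ w → a P.≈ b → Top k v a → Top k w b
  Top-cong p e (mkTop l d) = mkTop (trans (sym (coef-cong R e _)) (trans l p)) (deg<-cong e d)

  Top-* : ∀ k {l v w a b} → Top k v a → Top l w b → Top (k ℕ.+ l) (v * w) (a P.* b)
  Top-* zero {l} {v} {w} {a} {b} (mkTop p d) (mkTop q f) =
    mkTop (trans (coef-cong R e l) (trans (coef-const* R v b l) (*-congˡ q))) (deg<-cong (P.sym e) (deg<-const* v f))
    where
    e : a P.* b P.≈ const R v P.* b
    e = P.*-congʳ (ext R λ { zero → trans p (sym (coef-const-0 R v)) ; (suc i) → trans (d (suc i) (s≤s z≤n)) (sym (coef-const-suc R v i)) })
  Top-* (suc k) {l} {v} {w} {a} {b} (mkTop p d) (mkTop q f) = mkTop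
    (trans (coef-*-suc R a b _) (trans (+-cong (trans (*-congˡ (f _ (s≤s (ℕP.m≤n+m l k)))) (zeroʳ _)) (lead IH)) (+-identityˡ _)))
    λ { (suc i) (s≤s k+l≤i) → trans (coef-*-suc R a b i) (trans (+-cong (trans (*-congˡ
        (f (suc i) (s≤s (ℕP.≤-trans (ℕP.m≤n+m l (suc k)) k+l≤i)))) (zeroʳ _)) (degᵗ IH i k+l≤i)) (+-identityˡ _)) }
    where
    IH : Top (k ℕ.+ l) (v * w) (tail R a P.* b)
    IH = Top-* k (mkTop (trans (coef-tail R a k) p) (deg<-tail d)) (mkTop q f)

  Top-const : ∀ r → Top 0 r (const R r)
  Top-const r = mkTop (coef-const-0 R r) (deg<-const r (s≤s z≤n))

  Top-deg< : ∀ {k n v a} → Top k v a → k ℕ.< n → deg< n a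
  Top-deg< (mkTop _ d) k<n = deg<-mono k<n d

  Top-+ : ∀ {k v a b} → Top k v a → deg< k b → Top k v (a P.+ b)
  Top-+ {a = a} {b} (mkTop p d) z = mkTop
    (trans (coef-+ R a b _) (trans (+-cong p (z _ ℕP.≤-refl)) (+-identityʳ _)))
    (deg<-+ d (deg<-mono (ℕP.n≤1+n _) z))

  Top-0 : ∀ {k a} → deg< k a → Top k 0# a
  Top-0 z = mkTop (z _ ℕP.≤-refl) (deg<-mono (ℕP.n≤1+n _) z)

  Top-pred : ∀ {k a} → Top k 0# a → deg< k a
  Top-pred {k} (mkTop p d) i k≤i with ℕP.m≤n⇒m<n∨m≡n k≤i
  ... | inj₁ k<i = d i k<i
  ... | inj₂ ≡.refl = p

  -- Division with remainder that never inverts v: each step multiplies A by v and cancels its top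
  -- term against a·Xⁱ⁻ʲ·D. The exponent N counts these steps.
  pseudoDivide : ∀ {j v D} → Top j v D → ∀ n A → deg< n A →
    ∃ λ N → ∃ λ Q → ∃ λ Z → const R (v ^ N) P.* A P.≈ Q P.* D P.+ Z × deg< j Z
  pseudoDivide {j} {v} {D} t n A d with n ℕP.≤? j
  pseudoDivide {j} {v} {D} t n A d | yes n≤j = 0 , P.0# , A ,
    P.trans (P.trans (P.*-congʳ (1-homo (constₕ R))) (P.*-identityˡ A))
      (P.sym (P.trans (P.+-congʳ (P.zeroˡ D)) (P.+-identityˡ A))) , deg<-mono n≤j d
  pseudoDivide {j} {v} {D} t zero A d | no n≰j = ⊥-elim (n≰j z≤n)
  pseudoDivide {j} {v} {D} t (suc i) A d | no n≰j =
    suc N , Q P.+ cv P.* E , Z , eq , dZ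
    where
    a = coef R A i
    E = const R a P.* X R ^ₚ (i ℕ.∸ j)
    j≤i : j ℕ.≤ i
    j≤i = ℕP.≤-pred (ℕP.≰⇒> n≰j)
    ED = const R a P.* (X R ^ₚ (i ℕ.∸ j) P.* D)
    A₁ = const R v P.* A P.+ P.- ED
    i∸j+j : i ℕ.∸ j ℕ.+ j ≡ i
    i∸j+j = ℕP.m∸n+n≡m j≤i
    topED : Top i (a * v) ED
    topED = mkTop
      (trans (coef-const* R a _ i) (*-congˡ (trans (reflexive (≡.cong (coef R (X R ^ₚ (i ℕ.∸ j) P.* D)) (≡.sym i∸j+j)))
         (trans (coef-X^* (i ℕ.∸ j) D j) (lead t)))))
      (deg<-const* a (deg<-mono (ℕP.≤-reflexive (≡.trans (ℕP.+-suc _ _) (≡.cong suc i∸j+j))) (deg<-X^* (i ℕ.∸ j) (degᵗ t))))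
    dA₁ : deg< i A₁
    dA₁ = Top-pred (mkTop (trans (coef-+ R _ _ i) (trans (+-cong (coef-const* R v A i) (trans (coef-neg R ED i) (-‿cong (lead topED))))
        (trans (+-congˡ (-‿cong (*-comm a v))) (-‿inverseʳ _)))) (deg<-+ (deg<-const* v d) (deg<-neg (degᵗ topED))))
    rec = pseudoDivide t i A₁ dA₁
    N = proj₁ rec
    Q = proj₁ (proj₂ rec)
    Z = proj₁ (proj₂ (proj₂ rec))
    e = proj₁ (proj₂ (proj₂ (proj₂ rec)))
    dZ = proj₂ (proj₂ (proj₂ (proj₂ rec)))
    cv = const R (v ^ N)
    open SetoidReasoning P.setoid
    open Solver (Pol R) using (solve; _:+_; _:*_; _:-_; :-_; _:=_)
    eq : const R (v * v ^ N) P.* A P.≈ (Q P.+ cv P.* E) P.* D P.+ Z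
    eq = begin
      const R (v * v ^ N) P.* A
        ≈⟨ P.*-congʳ (*-homo (constₕ R) v (v ^ N)) ⟩
      (const R v P.* cv) P.* A
        ≈⟨ solve 6 (λ v c A a x D → (v :* c) :* A := c :* (v :* A :+ :- (a :* (x :* D))) :+ (c :* (a :* x)) :* D) P.refl
             (const R v) cv A (const R a) (X R ^ₚ (i ℕ.∸ j)) D ⟩
      cv P.* A₁ P.+ (cv P.* E) P.* D
        ≈⟨ P.+-congʳ e ⟩
      (Q P.* D P.+ Z) P.+ (cv P.* E) P.* D
        ≈⟨ solve 4 (λ Q D Z c → (Q :* D :+ Z) :+ c :* D := (Q :+ c) :* D :+ Z) P.refl Q D Z (cv P.* E) ⟩
      (Q P.+ cv P.* E) P.* D P.+ Z ∎

module _ {R S : Ring} (f g : Hom (Pol R) S) where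
  private
    module S = CRing S

  Pol-hom-ext : (∀ r → fn f (const R r) S.≈ fn g (const R r)) → fn f (X R) S.≈ fn g (X R) → ∀ a → fn f a S.≈ fn g a
  Pol-hom-ext c x = Pol-ind R _
    (λ e p → S.trans (Hom.cong f (P.sym e)) (S.trans p (Hom.cong g e)))
    (S.trans (0-homo f) (S.sym (0-homo g)))
    λ r a p → S.trans (+-homo f _ _) (S.trans (S.+-cong (c r) (S.trans (*-homo f _ _)
      (S.trans (S.*-cong x p) (S.sym (*-homo g _ _))))) (S.sym (+-homo g _ _)))
    where module P = CRing (Pol R)

-- Integral domains with decidable equality

record Domain (R : Ring) : Set where
  open CRing R
  field
    1≉0 : ¬ 1# ≈ 0#
    nzd : ∀ {a b} → a * b ≈ 0# → a ≈ 0# ⊎ b ≈ 0#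
    zero? : ∀ a → Dec (a ≈ 0#)

  *-nonzero : ∀ {a b} → ¬ a ≈ 0# → ¬ b ≈ 0# → ¬ a * b ≈ 0#
  *-nonzero a≉0 b≉0 ab≈0 with nzd ab≈0
  ... | inj₁ a≈0 = a≉0 a≈0
  ... | inj₂ b≈0 = b≉0 b≈0

  *-cancel : ∀ {a b c} → ¬ a ≈ 0# → a * b ≈ a * c → b ≈ c
  *-cancel {a} {b} {c} a≉0 e with nzd {a} {b - c} (trans (distribˡ a b (- c)) (trans (+-congˡ (sym (RingProps.-‿distribʳ-* ring a c)))
      (trans (+-congʳ e) (-‿inverseʳ _))))
  ... | inj₁ a≈0 = ⊥-elim (a≉0 a≈0)
  ... | inj₂ z = trans (trans (sym (+-identityʳ b)) (+-congˡ (sym (-‿inverseˡ c)))) (trans (sym (+-assoc _ _ _)) (trans (+-congʳ z) (+-identityˡ c)))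

  open SemiringExp semiring using (_^_)
  ^-nonzero : ∀ {a} n → ¬ a ≈ 0# → ¬ a ^ n ≈ 0#
  ^-nonzero zero a≉0 = 1≉0
  ^-nonzero (suc n) a≉0 = *-nonzero a≉0 (^-nonzero n a≉0)

  factorˡ-nonzero : ∀ {a b c} → a * b ≈ c → ¬ c ≈ 0# → ¬ a ≈ 0#
  factorˡ-nonzero {b = b} e c≉0 a≈0 = c≉0 (trans (sym e) (trans (*-congʳ a≈0) (zeroˡ b)))

  factorʳ-nonzero : ∀ {a b c} → a * b ≈ c → ¬ c ≈ 0# → ¬ b ≈ 0#
  factorʳ-nonzero {a} e c≉0 b≈0 = c≉0 (trans (sym e) (trans (*-congˡ b≈0) (zeroʳ a)))

module _ {R : Ring} (dom : Domain R) where
  open CRing R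
  open Domain dom
  private
    module P = CRing (Pol R)

  findTop : ∀ n a → deg< R n a → (∃ λ k → k ℕ.< n × ¬ coef R a k ≈ 0# × deg< R (suc k) a) ⊎ a P.≈ P.0#
  findTop zero a d = inj₂ (deg<0⇒≈0 R d)
  findTop (suc n) a d with zero? (coef R a n)
  ... | no ≉0 = inj₁ (n , ℕP.≤-refl , ≉0 , d)
  ... | yes ≈0 with findTop n a (Top-pred R (mkTop ≈0 d))
  ... | inj₁ (k , k<n , r) = inj₁ (k , ℕP.m≤n⇒m≤1+n k<n , r)
  ... | inj₂ z = inj₂ z

  topOf : ∀ a → ¬ a P.≈ P.0# → ∃ λ k → ¬ coef R a k ≈ 0# × Top R k (coef R a k) a
  topOf a a≉0 with findTop (bound R a) a (deg<-bound R a)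
  ... | inj₁ (k , _ , nz , d) = k , nz , mkTop refl d
  ... | inj₂ z = ⊥-elim (a≉0 z)

  Top⇒≉0 : ∀ {k v a} → ¬ v ≈ 0# → Top R k v a → ¬ a P.≈ P.0#
  Top⇒≉0 {k} v≉0 t a≈0 = v≉0 (trans (sym (lead t)) (trans (coef-cong R a≈0 k) (coef-0 R k)))

  const≉0 : ∀ {r} → ¬ r ≈ 0# → ¬ const R r P.≈ P.0#
  const≉0 {r} r≉0 = Top⇒≉0 r≉0 (Top-const R r)

  Top-unique : ∀ {k l v w a} → ¬ v ≈ 0# → ¬ w ≈ 0# → Top R k v a → Top R l w a → k ≡ l
  Top-unique {k} {l} v≉0 w≉0 s t with ℕP.<-cmp k l
  ... | tri< k<l _ _ = ⊥-elim (w≉0 (trans (sym (lead t)) (degᵗ s l k<l)))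
  ... | tri≈ _ k≡l _ = k≡l
  ... | tri> _ _ l<k = ⊥-elim (v≉0 (trans (sym (lead s)) (degᵗ t k l<k)))

  Pol-domain : Domain (Pol R)
  Pol-domain = record
    { 1≉0 = λ e → 1≉0 (trans (sym (coef-const-0 R 1#)) (trans (coef-cong R (P.trans (1-homo (constₕ R)) e) 0) (coef-0 R 0)))
    ; nzd = nzd′
    ; zero? = zero′ }
    where
    zero′ : ∀ a → Dec (a P.≈ P.0#)
    zero′ a with findTop (bound R a) a (deg<-bound R a)
    ... | inj₁ (k , _ , nz , d) = no (Top⇒≉0 nz (mkTop refl d))
    ... | inj₂ z = yes z
    nzd′ : ∀ {a b} → a P.* b P.≈ P.0# → a P.≈ P.0# ⊎ b P.≈ P.0#
    nzd′ {a} {b} e with zero′ a | zero′ b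
    ... | yes z | _ = inj₁ z
    ... | _ | yes z = inj₂ z
    ... | no na | no nb with topOf a na | topOf b nb
    ... | k , nk , s | l , nl , t = ⊥-elim (Top⇒≉0 (*-nonzero nk nl) (Top-* R k s t) e)

  -- Over a domain the leading coefficients have a nonzero product, so degrees add up; this is how
  -- the factors of a polynomial of known degree get their degrees.
  Top-factor : ∀ {n c a b} → ¬ c ≈ 0# → Top R n c (a P.* b) →
    ∃ λ k → ∃ λ l → k ℕ.+ l ≡ n × (¬ coef R a k ≈ 0# × Top R k (coef R a k) a) × (¬ coef R b l ≈ 0# × Top R l (coef R b l) b)
  Top-factor {n} {c} {a} {b} c≉0 t with topOf a (λ z → ab≉0 (P.trans (P.*-congʳ z) (P.zeroˡ b))) | topOf b (λ z → ab≉0 (P.trans (P.*-congˡ z) (P.zeroʳ a)))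
    where
    ab≉0 : ¬ a P.* b P.≈ P.0#
    ab≉0 = Top⇒≉0 c≉0 t
  ... | k , nk , s | l , nl , u = k , l , Top-unique (*-nonzero nk nl) c≉0 (Top-* R k s u) t , (nk , s) , (nl , u)

-- Factorisation into primes; its existence is asserted only up to double negation, as
-- divisibility is not decided here.

excluded-middle : ∀ {A : Set} → ¬ ¬ Dec A
excluded-middle k = k (no λ a → k (yes a))

module Divisibility (R : Ring) where
  open CRing R

  infix 4 _∣_
  _∣_ : Carrier → Carrier → Set
  a ∣ b = ∃ λ q → a * q ≈ b

  Unit : Carrier → Set
  Unit a = a ∣ 1#

  record Prime (π : Carrier) : Set where
    field
      nonzero : ¬ π ≈ 0#
      nonunit : ¬ Unit π
      -- Euclid's property in negative form: weaker than a disjunction while divisibility is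
      -- undecided, but sufficient in every proof of a contradiction.
      split : ∀ {a b} → π ∣ a * b → ¬ π ∣ a → ¬ π ∣ b → ⊥

  open Prime public

  prod : List Carrier → Carrier
  prod = List.foldr _*_ 1#

  Factored : Carrier → Set
  Factored a = ∃ λ u → ∃ λ ps → Unit u × All Prime ps × a ≈ u * prod ps

  ∣-respʳ : ∀ {a b c} → b ≈ c → a ∣ b → a ∣ c
  ∣-respʳ e (q , p) = q , trans p e

  ∣-*ʳ : ∀ {a b} c → a ∣ b → a ∣ b * c
  ∣-*ʳ c (q , p) = q * c , trans (sym (*-assoc _ _ _)) (*-congʳ p)

  ∣-*ˡ : ∀ {a b} c → a ∣ b → a ∣ c * b
  ∣-*ˡ c d = ∣-respʳ (*-comm _ _) (∣-*ʳ c d)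

  ∣-+ : ∀ {a b c} → a ∣ b → a ∣ c → a ∣ b + c
  ∣-+ (q , p) (r , s) = q + r , trans (distribˡ _ _ _) (+-cong p s)

  ∣-neg : ∀ {a b} → a ∣ b → a ∣ - b
  ∣-neg (q , p) = - q , trans (sym (RingProps.-‿distribʳ-* ring _ _)) (-‿cong p)

  ∣-zero : ∀ {a} → a ∣ 0#
  ∣-zero {a} = 0# , zeroʳ a

  prod-++ : ∀ ps qs → prod (ps List.++ qs) ≈ prod ps * prod qs
  prod-++ [] qs = sym (*-identityˡ _)
  prod-++ (p ∷ ps) qs = trans (*-congˡ (prod-++ ps qs)) (sym (*-assoc _ _ _))

  Unit-* : ∀ {a b} → Unit a → Unit b → Unit (a * b)
  Unit-* {a} {b} (c , p) (d , q) = c * d , trans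
    (Solver.solve R 4 (λ a b c d → (a :* b) :* (c :* d) := (a :* c) :* (b :* d)) refl a b c d)
    (trans (*-cong p q) (*-identityˡ 1#))
    where open Solver R using (_:*_; _:=_)

  Factored-* : ∀ {a b} → Factored a → Factored b → Factored (a * b)
  Factored-* {a} {b} (u , ps , uu , pps , e) (v , qs , uv , pqs , f) =
    u * v , ps List.++ qs , Unit-* uu uv , AllP.++⁺ pps pqs ,
    trans (*-cong e f) (trans
      (Solver.solve R 4 (λ u p v q → (u :* p) :* (v :* q) := (u :* v) :* (p :* q)) refl u (prod ps) v (prod qs))
      (*-congˡ (sym (prod-++ ps qs))))
    where open Solver R using (_:*_; _:=_)

  Factored-prime : ∀ {a} → Prime a → Factored a
  Factored-prime {a} p = 1# , a ∷ [] , (1# , *-identityˡ 1#) , p ∷ [] ,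
    trans (sym (*-identityʳ a)) (sym (*-identityˡ _))

  Factored-cong : ∀ {a b} → a ≈ b → Factored a → Factored b
  Factored-cong e (u , ps , uu , pps , f) = u , ps , uu , pps , trans (sym e) f

PrimeFactorisations : Ring → Set
PrimeFactorisations R = ∀ a → ¬ a ≈ 0# → ¬ ¬ Divisibility.Factored R a
  where open CRing R

module _ {R : Ring} (dom : Domain R) where
  open CRing R
  open Divisibility R
  open Domain dom
  open Solver R using (solve; _:+_; _:*_; :-_; _:=_)

  -- Primes p not divisible by π are passed over. If p = πw, primality of p makes p divide π, so
  -- that w is a unit and p can be exchanged for π; were p to divide w, π would be a unit.
  removePrime : ∀ {π} → Prime π → ∀ u ps → Unit u → All Prime ps → π ∣ u * prod ps →
    ¬ ¬ (∃ λ u′ → ∃ λ ps′ → Unit u′ × All Prime ps′ × List.length ps ≡ suc (List.length ps′) × u * prod ps ≈ π * (u′ * prod ps′))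
  removePrime {π} pπ u [] (v , uv) [] (q , e) k = nonunit pπ (q * v , trans (sym (*-assoc _ _ _))
    (trans (*-congʳ (trans e (*-identityʳ u))) uv))
  removePrime {π} pπ u (p ∷ ps) uu@(v , uv) (pp ∷ pps) d k = excluded-middle {π ∣ p} λ
    { (yes (w , πw≈p)) →
        split pp {π} {w} (1# , trans (*-identityʳ p) (sym πw≈p))
          (λ { (z , pz≈π) → k (u * w , ps , Unit-* uu (z , trans (*-comm _ _) (*-cancel (nonzero pp)
                (trans (sym (*-assoc _ _ _)) (trans (*-congʳ pz≈π) (trans πw≈p (sym (*-identityʳ p)))))))
              , pps , ≡.refl , trans (*-congˡ (*-congʳ (sym πw≈p)))
                (solve 4 (λ u π w r → u :* ((π :* w) :* r) := π :* ((u :* w) :* r)) refl u π w (prod ps))) })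
          (λ { (z , pz≈w) → nonunit pπ (z , *-cancel (nonzero pp) (trans
              (solve 3 (λ p π z → p :* (π :* z) := π :* (p :* z)) refl p π z)
              (trans (*-congˡ pz≈w) (trans πw≈p (sym (*-identityʳ p)))))) })
    ; (no π∤p) →
        split pπ {p} {u * prod ps} (∣-respʳ (solve 3 (λ u p r → u :* (p :* r) := p :* (u :* r)) refl u p (prod ps)) d) π∤p
          λ d′ → removePrime pπ u ps uu pps d′ λ { (u′ , ps′ , uu′ , pps′ , l , e) →
            k (u′ , p ∷ ps′ , uu′ , pp ∷ pps′ , ≡.cong suc l ,
              trans (solve 3 (λ u p r → u :* (p :* r) := p :* (u :* r)) refl u p (prod ps)) (trans (*-congˡ e)
                (solve 4 (λ p π u r → p :* (π :* (u :* r)) := π :* (u :* (p :* r))) refl p π u′ (prod ps′)))) } }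

module _ {R : Ring} (dom : Domain R) (factorR : PrimeFactorisations R) where
  private
    module R = CRing R
    module D = Divisibility R
    module dom = Domain dom
  open CRing (Pol R)
  open Divisibility (Pol R)
  open Domain (Pol-domain dom) using (*-cancel; *-nonzero; 1≉0)
  open Solver (Pol R) using (solve; _:+_; _:*_; :-_; _:=_)
  open SemiringExp R.semiring using (_^_)

  -- Gauss's argument as a descent: a constant term divisible by π is removed from its factor. When
  -- neither constant term is divisible, their product contradicts the primality of π in R.
  const-Prime : ∀ {π} → D.Prime π → Prime (const R π)
  const-Prime {π} p = record
    { nonzero = const≉0 dom (D.nonzero p)
    ; nonunit = λ { (q , e) → D.nonunit p (coef R q 0 , R.trans (R.sym (coef-const* R π q 0)) (R.trans (coef-cong R e 0)
        (R.trans (coef-cong R (sym (1-homo (constₕ R))) 0) (coef-const-0 R R.1#)))) }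
    ; split = λ {a} {b} → go _ _ a b (deg<-bound R a) (deg<-bound R b) }
    where
    c = const R π
    coef∣ : ∀ {r} → π D.∣ r → c ∣ const R r
    coef∣ (q , e) = const R q , trans (sym (*-homo (constₕ R) π q)) (Hom.cong (constₕ R) e)
    go : ∀ m n a b → deg< R m a → deg< R n b → c ∣ a * b → ¬ c ∣ a → ¬ c ∣ b → ⊥
    go zero n a b da db d na nb = na (∣-respʳ (sym (deg<0⇒≈0 R da)) ∣-zero)
    go (suc m) zero a b da db d na nb = nb (∣-respʳ (sym (deg<0⇒≈0 R db)) ∣-zero)
    go (suc m) (suc n) a b da db d na nb = excluded-middle {π D.∣ a₀} λ
      { (yes π∣a₀) → go m (suc n) (tail R a) b (deg<-tail R da) db
          (dropX (∣-respʳ (trans (+-congʳ (*-congʳ (Pol-decompose R a)))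
             (solve 4 (λ a₀ x t b → (a₀ :+ x :* t) :* b :+ :- (a₀ :* b) := x :* (t :* b)) refl (const R a₀) (X R) (tail R a) b))
             (∣-+ d (∣-neg (∣-*ʳ b (coef∣ π∣a₀))))))
          (λ { d′ → na (∣-respʳ (sym (Pol-decompose R a)) (∣-+ (coef∣ π∣a₀) (∣-*ˡ (X R) d′))) }) nb
      ; (no π∤a₀) → excluded-middle {π D.∣ b₀} λ
        { (yes π∣b₀) → go (suc m) n a (tail R b) da (deg<-tail R db)
            (dropX (∣-respʳ (trans (+-congʳ (*-congˡ (Pol-decompose R b)))
               (solve 4 (λ b₀ x t a → a :* (b₀ :+ x :* t) :+ :- (a :* b₀) := x :* (a :* t)) refl (const R b₀) (X R) (tail R b) a))
               (∣-+ d (∣-neg (∣-*ˡ a (coef∣ π∣b₀))))))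
            na (λ { d′ → nb (∣-respʳ (sym (Pol-decompose R b)) (∣-+ (coef∣ π∣b₀) (∣-*ˡ (X R) d′))) })
        ; (no π∤b₀) → D.split p (coef R (proj₁ d) 0 , R.trans (R.sym (coef-const* R π (proj₁ d) 0))
            (R.trans (coef-cong R (proj₂ d) 0) (coef-*-0 R a b))) π∤a₀ π∤b₀ } }
      where
      a₀ = coef R a 0
      b₀ = coef R b 0
      dropX : ∀ {e} → c ∣ X R * e → c ∣ e
      dropX {e} (q , cq≈Xe) = tail R q , ext R λ i → R.trans (coef-const* R π _ i) (R.trans (R.*-congˡ (coef-tail R q i))
        (R.trans (R.sym (coef-const* R π q (suc i))) (R.trans (coef-cong R cq≈Xe (suc i)) (coef-X*-suc R e i))))

  Primitive : ∣ Pol R ∣ → Set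
  Primitive F = ∀ {π} → D.Prime π → ¬ const R π ∣ F

  const-prod : ∀ u ps → const R (u R.* D.prod ps) ≈ const R u * prod (List.map (const R) ps)
  const-prod u ps = trans (*-homo (constₕ R) _ _) (*-congˡ (go ps))
    where
    go : ∀ ps → const R (D.prod ps) ≈ prod (List.map (const R) ps)
    go [] = 1-homo (constₕ R)
    go (p ∷ ps) = trans (*-homo (constₕ R) _ _) (*-congˡ (go ps))

  const-Unit : ∀ {u} → D.Unit u → Unit (const R u)
  const-Unit (v , e) = const R v , trans (sym (*-homo (constₕ R) _ _)) (trans (Hom.cong (constₕ R) e) (1-homo (constₕ R)))

  Factored-const : ∀ {r} → D.Factored r → Factored (const R r)
  Factored-const (u , ps , uu , pps , e) = const R u , List.map (const R) ps , const-Unit uu ,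
    AllP.map⁺ (All.map const-Prime pps) , trans (Hom.cong (constₕ R) e) (const-prod u ps)

  private
    stripPrimes : ∀ {F} → Primitive F → ∀ ps → All D.Prime ps → ∀ {G W} →
      prod (List.map (const R) ps) * G ≈ F * W → ¬ ¬ F ∣ G
    stripPrimes prim [] [] {G} {W} e k = k (W , trans (sym e) (*-identityˡ G))
    stripPrimes {F} prim (p ∷ ps) (pp ∷ pps) {G} {W} e k =
      split (const-Prime pp) {F} {W} (_ , trans (sym (*-assoc _ _ _)) e) (prim pp) λ { (W′ , e′) →
        stripPrimes prim ps pps {G} {W′} (*-cancel (const≉0 dom (D.nonzero pp)) (trans (sym (*-assoc _ _ _))
          (trans e (trans (*-congˡ (sym e′)) (solve 3 (λ f c w → f :* (c :* w) := c :* (f :* w)) refl F (const R p) W′))))) k }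

    -- Each prime on the left divides Q or E by `const-Prime` and is absorbed into c or c′.
    splitPrimes : ∀ ps → All D.Prime ps → ∀ {F Q E} → prod (List.map (const R) ps) * F ≈ Q * E →
      ¬ ¬ (∃ λ Q₁ → ∃ λ E₁ → ∃ λ c → ∃ λ c′ → F ≈ Q₁ * E₁ × Q ≈ const R c * Q₁ × E ≈ const R c′ * E₁)
    splitPrimes [] [] {F} {Q} {E} e k = k (Q , E , R.1# , R.1# , trans (sym (*-identityˡ F)) e , one* , one*)
      where
      one* : ∀ {a} → a ≈ const R R.1# * a
      one* {a} = sym (trans (*-congʳ (1-homo (constₕ R))) (*-identityˡ a))
    splitPrimes (p ∷ ps) (pp ∷ pps) {F} {Q} {E} e k =
      split (const-Prime pp) {Q} {E} (_ , trans (sym (*-assoc _ _ _)) e)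
        (λ { (Q′ , q) → splitPrimes ps pps {F} {Q′} {E} (cancel (trans (*-congʳ (sym q)) (*-assoc _ _ _)))
          λ { (Q₁ , E₁ , c , c′ , f , g , h) → k (Q₁ , E₁ , p R.* c , c′ , f ,
            trans (sym q) (trans (*-congˡ g) (trans (sym (*-assoc _ _ _)) (*-congʳ (sym (*-homo (constₕ R) p c))))) , h) } })
        (λ { (E′ , q) → splitPrimes ps pps {F} {Q} {E′} (cancel (trans (*-congˡ (sym q))
            (solve 3 (λ f c w → f :* (c :* w) := c :* (f :* w)) refl Q (const R p) E′)))
          λ { (Q₁ , E₁ , c , c′ , f , g , h) → k (Q₁ , E₁ , c , p R.* c′ , f , g ,
            trans (sym q) (trans (*-congˡ h) (trans (sym (*-assoc _ _ _)) (*-congʳ (sym (*-homo (constₕ R) p c′)))))) } })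
      where
      cancel : ∀ {w} → Q * E ≈ const R p * w → prod (List.map (const R) ps) * F ≈ w
      cancel e′ = *-cancel (const≉0 dom (D.nonzero pp)) (trans (sym (*-assoc _ _ _)) (trans e e′))

    unscale : ∀ {r u ps} → D.Unit u → r R.≈ u R.* D.prod ps → ∀ {G W} → const R r * G ≈ W →
      ∃ λ v → prod (List.map (const R) ps) * G ≈ const R v * W
    unscale {r} {u} {ps} (v , uv) r≈ {G} {W} e = v , (begin
      p * G ≈⟨ *-identityˡ _ ⟨
      1# * (p * G) ≈⟨ *-congʳ (proj₂ (const-Unit (v , uv))) ⟨
      const R u * const R v * (p * G) ≈⟨ solve 4 (λ u v p g → u :* v :* (p :* g) := v :* ((u :* p) :* g)) refl _ _ _ _ ⟩
      const R v * ((const R u * p) * G) ≈⟨ *-congˡ (*-congʳ (const-prod u ps)) ⟨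
      const R v * (const R (u R.* D.prod ps) * G) ≈⟨ *-congˡ (*-congʳ (Hom.cong (constₕ R) r≈)) ⟨
      const R v * (const R r * G) ≈⟨ *-congˡ e ⟩
      const R v * W ∎)
      where
      open SetoidReasoning setoid
      p = prod (List.map (const R) ps)

  -- Gauss's lemma: constants can be cancelled from a multiple of a primitive polynomial.
  strip : ∀ {F} → Primitive F → ∀ {r} → ¬ r R.≈ R.0# → ∀ {H W} → const R r * H ≈ F * W → ¬ ¬ F ∣ H
  strip {F} prim {r} r≉0 {H} {W} e k = factorR r r≉0 λ { (u , ps , uu , pps , r≈) →
    let (v , e′) = unscale {ps = ps} uu r≈ e in
    stripPrimes prim ps pps (trans e′ (solve 3 (λ v f w → v :* (f :* w) := f :* (v :* w)) refl (const R v) F W)) k }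

  -- A factorisation over the fraction field, written with denominator r, becomes one over R whose
  -- factors differ from the given ones by constants only.
  splitConst : ∀ {r F Q E} → ¬ r R.≈ R.0# → const R r * F ≈ Q * E →
    ¬ ¬ (∃ λ Q₁ → ∃ λ E₁ → ∃ λ c → F ≈ Q₁ * E₁ × E ≈ const R c * E₁)
  splitConst {r} r≉0 e k = factorR r r≉0 λ { (u , ps , uu , pps , r≈) →
    let (v , e′) = unscale {ps = ps} uu r≈ e in
    splitPrimes ps pps (trans e′ (sym (*-assoc _ _ _)))
      λ { (Q₁ , E₁ , _ , c′ , f , _ , h) → k (Q₁ , E₁ , c′ , f , h) } }

  Top-0⇒const : ∀ {v a} → Top R 0 v a → a ≈ const R v
  Top-0⇒const {v} {a} t = ext R λ
    { zero → R.trans (lead t) (R.sym (coef-const-0 R v))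
    ; (suc i) → R.trans (degᵗ t (suc i) (s≤s z≤n)) (R.sym (coef-const-suc R v i)) }

  private
    module Irreducible {F k v} (v≉0 : ¬ v R.≈ R.0#) (t : Top R (suc k) v F) (prim : Primitive F)
      (irr : ∀ {A B i j} → F ≈ A * B → Top R (suc i) (coef R A (suc i)) A → ¬ coef R A (suc i) R.≈ R.0# →
        Top R (suc j) (coef R B (suc j)) B → ¬ coef R B (suc j) R.≈ R.0# → suc i ℕ.+ suc j ≡ suc k → ⊥) where

      nonunitF : ¬ Unit F
      nonunitF (B , e) with Top-factor dom dom.1≉0 (Top-cong R R.refl (sym (trans e (sym (1-homo (constₕ R))))) (Top-const R R.1#))
      ... | zero , l , _ , (n , s) , _ with Top-unique dom n v≉0 s t
      ... | ()
      nonunitF (B , e) | suc _ , l , () , _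

      module _ {G H} (d : F ∣ G * H) (F∤G : ¬ F ∣ G) (F∤H : ¬ F ∣ H) where
        -- The Euclidean algorithm in the ideal (F, G), as induction on the degree j of an element
        -- E. A constant E = w makes F divide wH, hence H. A nonzero pseudo-remainder of F or G
        -- modulo E has smaller degree. If both remainders vanish, E divides F up to constants, so
        -- by `irr` it is F up to constants, and then F divides G.
        Ideal : ℕ → Set
        Ideal j = ∀ E a b w → ¬ w R.≈ R.0# → Top R j w E → E ≈ a * F + b * G → ⊥

        step : ∀ j → (∀ {i} → i ℕ.< j → Ideal i) → Ideal j
        step zero rec E a b w w≉0 s e = strip prim w≉0 (begin
          const R w * H ≈⟨ *-congʳ (trans (sym (Top-0⇒const s)) e) ⟩
          (a * F + b * G) * H ≈⟨ solve 5 (λ a F b G H → (a :* F :+ b :* G) :* H := F :* (a :* H) :+ b :* (G :* H)) refl a F b G H ⟩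
          F * (a * H) + b * (G * H) ≈⟨ +-congˡ (*-congˡ (proj₂ d)) ⟨
          F * (a * H) + b * (F * proj₁ d) ≈⟨ solve 4 (λ F y b q → F :* y :+ b :* (F :* q) := F :* (y :+ b :* q)) refl F (a * H) b (proj₁ d) ⟩
          F * (a * H + b * proj₁ d) ∎) F∤H
          where open SetoidReasoning setoid
        step (suc j) rec E a b w w≉0 s e
          with pseudoDivide R s (bound R F) F (deg<-bound R F) | pseudoDivide R s (bound R G) G (deg<-bound R G)
        ... | N , Q , Z , f , dZ | N′ , Q′ , Z′ , f′ , dZ′ with findTop dom (suc j) Z dZ | findTop dom (suc j) Z′ dZ′
        ... | inj₁ (i , i<j , n , z) | _ = rec i<j Z (const R (w ^ N) + - (Q * a)) (- (Q * b)) _ n (mkTop R.refl z) (begin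
              Z ≈⟨ solve 2 (λ Z y → Z := (y :+ Z) :+ :- y) refl Z (Q * E) ⟩
              (Q * E + Z) + - (Q * E) ≈⟨ +-cong (sym f) (-‿cong (*-congˡ e)) ⟩
              const R (w ^ N) * F + - (Q * (a * F + b * G))
                ≈⟨ solve 6 (λ r F Q a b G → r :* F :+ :- (Q :* (a :* F :+ b :* G)) := (r :+ :- (Q :* a)) :* F :+ :- (Q :* b) :* G) refl _ F Q a b G ⟩
              (const R (w ^ N) + - (Q * a)) * F + - (Q * b) * G ∎)
          where open SetoidReasoning setoid
        ... | _ | inj₁ (i , i<j , n , z) = rec i<j Z′ (- (Q′ * a)) (const R (w ^ N′) + - (Q′ * b)) _ n (mkTop R.refl z) (begin
              Z′ ≈⟨ solve 2 (λ Z y → Z := (y :+ Z) :+ :- y) refl Z′ (Q′ * E) ⟩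
              (Q′ * E + Z′) + - (Q′ * E) ≈⟨ +-cong (sym f′) (-‿cong (*-congˡ e)) ⟩
              const R (w ^ N′) * G + - (Q′ * (a * F + b * G))
                ≈⟨ solve 6 (λ r F Q a b G → r :* G :+ :- (Q :* (a :* F :+ b :* G)) := :- (Q :* a) :* F :+ (r :+ :- (Q :* b)) :* G) refl _ F Q′ a b G ⟩
              - (Q′ * a) * F + (const R (w ^ N′) + - (Q′ * b)) * G ∎)
          where open SetoidReasoning setoid
        ... | inj₂ Z≈0 | inj₂ Z′≈0 = splitConst {F = F} {Q} {E} (dom.^-nonzero N w≉0) (trans f (trans (+-congˡ Z≈0) (+-identityʳ _)))
          λ { (Q₁ , E₁ , c , F≈ , E≈) → caseFactor Q₁ E₁ c F≈ E≈ (Top-factor dom v≉0 (Top-cong R R.refl F≈ t)) }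
          where
          open SetoidReasoning setoid
          caseFactor : ∀ Q₁ E₁ c → F ≈ Q₁ * E₁ → E ≈ const R c * E₁ →
            (∃ λ i → ∃ λ j → i ℕ.+ j ≡ suc k × (¬ coef R Q₁ i R.≈ R.0# × Top R i (coef R Q₁ i) Q₁) × (¬ coef R E₁ j R.≈ R.0# × Top R j (coef R E₁ j) E₁)) → ⊥
          caseFactor Q₁ E₁ c F≈ E≈ (i , j′ , i+j′ , (nQ , tQ) , (nE , tE))
            with Top-unique dom (dom.*-nonzero c≉0 nE) w≉0 (Top-cong R R.refl (sym E≈) (Top-* R 0 (Top-const R c) tE)) s
            where
            c≉0 : ¬ c R.≈ R.0#
            c≉0 c≈0 = Top⇒≉0 dom w≉0 s (trans E≈ (trans (*-congʳ (trans (Hom.cong (constₕ R) c≈0) (0-homo (constₕ R)))) (zeroˡ E₁)))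
          caseFactor Q₁ E₁ c F≈ E≈ (suc i , _ , i+j′ , (nQ , tQ) , (nE , tE)) | ≡.refl = irr F≈ tQ nQ tE nE i+j′
          caseFactor Q₁ E₁ c F≈ E≈ (zero , _ , i+j′ , (nQ , tQ) , (nE , tE)) | ≡.refl =
            strip prim (dom.*-nonzero nQ (dom.^-nonzero N′ w≉0)) (begin
              const R (q R.* w ^ N′) * G ≈⟨ *-congʳ (*-homo (constₕ R) _ _) ⟩
              const R q * const R (w ^ N′) * G ≈⟨ *-assoc _ _ _ ⟩
              const R q * (const R (w ^ N′) * G) ≈⟨ *-congˡ (trans f′ (trans (+-congˡ Z′≈0) (+-identityʳ _))) ⟩
              const R q * (Q′ * E) ≈⟨ *-congˡ (*-congˡ E≈) ⟩
              const R q * (Q′ * (const R c * E₁)) ≈⟨ solve 4 (λ q Q′ c e → q :* (Q′ :* (c :* e)) := (q :* e) :* (Q′ :* c)) refl (const R q) Q′ (const R c) E₁ ⟩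
              const R q * E₁ * (Q′ * const R c) ≈⟨ *-congʳ (trans (*-congʳ (sym (Top-0⇒const tQ))) (sym F≈)) ⟩
              F * (Q′ * const R c) ∎) F∤G
            where q = coef R Q₁ 0

        contradiction : ⊥
        contradiction = <-rec Ideal (λ j rec → step j (λ {i} i<j → rec i<j)) (suc k) F 1# 0# v v≉0 t
          (sym (trans (+-cong (*-identityˡ F) (zeroˡ G)) (+-identityʳ F)))

      primeF : Prime F
      primeF = record { nonzero = Top⇒≉0 dom v≉0 t ; nonunit = nonunitF ; split = contradiction }

    FactoredAt : ℕ → Set
    FactoredAt k = ∀ F v → ¬ v R.≈ R.0# → Top R k v F → ¬ ¬ Factored F

    AtLead : ℕ → Carrier → R.Carrier → List R.Carrier → R.Carrier → Set
    AtLead k F u ps v = D.Unit u × All D.Prime ps × v R.≈ u R.* D.prod ps × ¬ v R.≈ R.0# × Top R k v F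

    -- Either a constant prime divides F, and also its leading coefficient, whose list of primes
    -- becomes shorter; or F splits into factors of positive, hence smaller, degree; or F is prime.
    -- The induction is thus on the degree and then on the number of primes in the leading
    -- coefficient.
    factorStep : ∀ k → (∀ {j} → j ℕ.< suc k → FactoredAt j) → ∀ u ps F v → AtLead (suc k) F u ps v →
      (∀ u′ ps′ F′ v′ → List.length ps ≡ suc (List.length ps′) → AtLead (suc k) F′ u′ ps′ v′ → ¬ ¬ Factored F′) → ¬ ¬ Factored F
    factorStep k rec u ps F v (uu , pps , v≈ , v≉0 , t) again K = excluded-middle {∃ λ π → D.Prime π × const R π ∣ F} λ
      { (yes (π , pπ , F′ , e)) →
          let v′ = coef R F′ (suc k)
              πv′≈v = R.trans (R.sym (coef-const* R π F′ (suc k))) (R.trans (coef-cong R e (suc k)) (lead t)) in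
          removePrime dom pπ u ps uu pps (v′ , R.trans πv′≈v v≈) λ { (u′ , ps′ , uu′ , pps′ , len′ , e′) →
            again u′ ps′ F′ v′ len′ (uu′ , pps′
              , dom.*-cancel (D.nonzero pπ) (R.trans πv′≈v (R.trans v≈ e′))
              , dom.factorʳ-nonzero πv′≈v v≉0
              , mkTop R.refl λ i le → coef≈0 pπ (R.trans (R.sym (coef-const* R π F′ i)) (R.trans (coef-cong R e i) (degᵗ t i le))))
              λ fF′ → K (Factored-cong e (Factored-* (Factored-prime (const-Prime pπ)) fF′)) }
      ; (no prim) → excluded-middle {∃ λ A → ∃ λ B → ∃ λ i → ∃ λ j → F ≈ A * B × (suc i ℕ.+ suc j ≡ suc k) ×
            (Top R (suc i) (coef R A (suc i)) A × ¬ coef R A (suc i) R.≈ R.0#) × (Top R (suc j) (coef R B (suc j)) B × ¬ coef R B (suc j) R.≈ R.0#)} λ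
        { (yes (A , B , i , j , e , i+j , (tA , nA) , (tB , nB))) →
            rec (≡.subst (suc i ℕ.<_) i+j (ℕP.m<m+n (suc i) (s≤s z≤n))) A _ nA tA λ fA →
            rec (≡.subst (suc j ℕ.<_) i+j (ℕP.m<n+m (suc j) (s≤s z≤n))) B _ nB tB λ fB →
            K (Factored-cong (sym e) (Factored-* fA fB))
        ; (no irr) → K (Factored-prime (Irreducible.primeF v≉0 t (λ pπ d → prim (_ , pπ , d))
            (λ e tA nA tB nB i+j → irr (_ , _ , _ , _ , e , i+j , (tA , nA) , (tB , nB))))) } }
      where
      coef≈0 : ∀ {π a} → D.Prime π → π R.* a R.≈ R.0# → a R.≈ R.0#
      coef≈0 pπ z with dom.nzd z
      ... | inj₁ π≈0 = ⊥-elim (D.nonzero pπ π≈0)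
      ... | inj₂ a≈0 = a≈0

    factorAt : ∀ k → (∀ {j} → j ℕ.< k → FactoredAt j) → ∀ l u ps F v → List.length ps ≡ l → AtLead k F u ps v → ¬ ¬ Factored F
    factorAt zero rec l u ps F v len (uu , pps , v≈ , v≉0 , t) K =
      K (Factored-cong (sym (Top-0⇒const t)) (Factored-const (u , ps , uu , pps , v≈)))
    factorAt (suc k) rec zero u [] F v len al = factorStep k rec u [] F v al λ { _ _ _ _ () }
    factorAt (suc k) rec (suc l) u ps F v len al = factorStep k rec u ps F v al
      λ u′ ps′ F′ v′ len′ → factorAt (suc k) rec l u′ ps′ F′ v′ (ℕP.suc-injective (≡.trans (≡.sym len′) len))

  Pol-factorisations : PrimeFactorisations (Pol R)
  Pol-factorisations F F≉0 with topOf dom F F≉0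
  ... | k , n , t = <-rec FactoredAt (λ j rec F v v≉0 t K → factorR v v≉0 λ { (u , ps , uu , pps , v≈) →
      factorAt j (λ {i} i<j → rec i<j) _ u ps F v ≡.refl (uu , pps , v≈ , v≉0 , t) K }) k F _ n t

-- Evaluation of polynomials in several variables

module _ {S : Ring} where
  open CRing S

  ι-unique : ∀ (h : Hom ℤR S) a → fn h a ≈ fn (ι S) a
  ι-unique h = go
    where
    pos : ∀ n → fn h (+ n) ≈ fn (ι S) (+ n)
    pos zero = trans (0-homo h) (sym (0-homo (ι S)))
    pos (suc n) = trans (+-homo h (+ 1) (+ n)) (trans (+-cong (trans (1-homo h) (sym (1-homo (ι S)))) (pos n))
      (sym (+-homo (ι S) (+ 1) (+ n))))
    go : ∀ a → fn h a ≈ fn (ι S) a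
    go (+ n) = pos n
    go -[1+ n ] = trans (-‿homo h (+ suc n)) (trans (-‿cong (pos (suc n))) (sym (-‿homo (ι S) (+ suc n))))

module _ (S : Ring) where
  open CRing S
  open RawSemiringDefs (RawRing.rawSemiring rawRing) using (product; _^_)

  monomial : ∀ {m} → Vec ℕ m → (Fin m → Carrier) → Carrier
  monomial α x = product (λ i → x i ^ lookup α i)

  evalP : ∀ {m} → Poly m → (Fin m → Carrier) → Carrier
  evalP f x = List.foldr (λ (a , α) s → fn (ι S) a * monomial α x + s) 0# f

module _ {S T : Ring} (h : Hom S T) where
  private
    module S = CRing S
    module T = CRing T
  open SemiringExp S.semiring using () renaming (_^_ to _^ₛ_)
  open SemiringExp T.semiring using () renaming (_^_ to _^ₜ_; ^-congˡ to ^ₜ-congˡ)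

  ^-homo : ∀ a n → fn h (a ^ₛ n) T.≈ fn h a ^ₜ n
  ^-homo a zero = 1-homo h
  ^-homo a (suc n) = T.trans (*-homo h _ _) (T.*-congˡ (^-homo a n))

  ι-homo : ∀ a → fn h (fn (ι S) a) T.≈ fn (ι T) a
  ι-homo = ι-unique (h ∘ₕ ι S)

  monomial-homo : ∀ {m} (α : Vec ℕ m) x → fn h (monomial S α x) T.≈ monomial T α (fn h ∘ x)
  monomial-homo [] x = 1-homo h
  monomial-homo (a ∷ α) x = T.trans (*-homo h _ _) (T.*-cong (^-homo _ a) (monomial-homo α (x ∘ suc)))

  evalP-homo : ∀ {m} (f : Poly m) x → fn h (evalP S f x) T.≈ evalP T f (fn h ∘ x)
  evalP-homo [] x = 0-homo h
  evalP-homo ((a , α) ∷ f) x = T.trans (+-homo h _ _) (T.+-cong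
    (T.trans (*-homo h _ _) (T.*-cong (ι-homo a) (monomial-homo α x))) (evalP-homo f x))

module _ (S : Ring) where
  open CRing S
  open SemiringExp semiring using (_^_; ^-congˡ; ^-homo-*)
  open Solver S using (solve; _:+_; _:*_; _:=_)

  monomial-cong : ∀ {m} (α : Vec ℕ m) {x y} → (∀ i → x i ≈ y i) → monomial S α x ≈ monomial S α y
  monomial-cong [] e = refl
  monomial-cong (a ∷ α) e = *-cong (^-congˡ a (e zero)) (monomial-cong α (e ∘ suc))

  evalP-cong : ∀ {m} (f : Poly m) {x y} → (∀ i → x i ≈ y i) → evalP S f x ≈ evalP S f y
  evalP-cong [] e = refl
  evalP-cong ((a , α) ∷ f) e = +-cong (*-congˡ (monomial-cong α e)) (evalP-cong f e)

  evalP-++ : ∀ {m} (f g : Poly m) x → evalP S (f List.++ g) x ≈ evalP S f x + evalP S g x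
  evalP-++ [] g x = sym (+-identityˡ _)
  evalP-++ ((a , α) ∷ f) g x = trans (+-congˡ (evalP-++ f g x)) (sym (+-assoc _ _ _))

  monomial-* : ∀ {m} (α β : Vec ℕ m) x → monomial S (Vec.zipWith ℕ._+_ α β) x ≈ monomial S α x * monomial S β x
  monomial-* [] [] x = sym (*-identityˡ _)
  monomial-* (a ∷ α) (b ∷ β) x = trans (*-cong (^-homo-* (x zero) a b) (monomial-* α β (x ∘ suc)))
    (solve 4 (λ a b c d → (a :* b) :* (c :* d) := (a :* c) :* (b :* d)) refl _ _ _ _)

  evalP-* : ∀ {m} (f g : Poly m) x → evalP S (f *ₚ g) x ≈ evalP S f x * evalP S g x
  evalP-* [] g x = sym (zeroˡ _)
  evalP-* {m} ((a , α) ∷ f) g x = trans (evalP-++ (List.map _ g) (f *ₚ g) x)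
    (trans (+-cong (go g) (evalP-* f g x)) (sym (distribʳ _ _ _)))
    where
    go : ∀ g → evalP S (List.map (λ (b , β) → a ℤ.* b , Vec.zipWith ℕ._+_ α β) g) x ≈ fn (ι S) a * monomial S α x * evalP S g x
    go [] = sym (zeroʳ _)
    go ((b , β) ∷ g) = trans (+-cong (trans (*-cong (*-homo (ι S) a b) (monomial-* α β x))
      (solve 4 (λ a b c d → (a :* b) :* (c :* d) := (a :* c) :* (b :* d)) refl _ _ _ _)) (go g)) (sym (distribˡ _ _ _))

-- The iterated polynomial ring ℤ[x₁, ..., xₘ] and its comparison with `Poly m`

Zm : ℕ → Ring
Zm zero = ℤR
Zm (suc m) = Pol (Zm m)

var : ∀ m → Fin m → ∣ Zm m ∣
var (suc m) zero = X (Zm m)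
var (suc m) (suc i) = const (Zm m) (var m i)

evZ : ∀ {m} (S : Ring) → (Fin m → ∣ S ∣) → Hom (Zm m) S
evZ {zero} S x = ι S
evZ {suc m} S x = eval (evZ S (x ∘ suc)) (x zero)

module _ (S : Ring) where
  open CRing S

  evZ-var : ∀ {m} (x : Fin m → Carrier) i → fn (evZ S x) (var m i) ≈ x i
  evZ-var {suc m} x zero = eval-X (evZ S (x ∘ suc)) (x zero)
  evZ-var {suc m} x (suc i) = trans (eval-const (evZ S (x ∘ suc)) (x zero) (var m i)) (evZ-var (x ∘ suc) i)

  -- It applies to `Pol (Pol ℤR)` as well: ℤ[T][s] is `Zm 2` by computation, with s as the outermost
  -- variable.
  Zm-hom-ext : ∀ m (f g : Hom (Zm m) S) → (∀ i → fn f (var m i) ≈ fn g (var m i)) → ∀ a → fn f a ≈ fn g a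
  Zm-hom-ext zero f g e a = trans (ι-unique f a) (sym (ι-unique g a))
  Zm-hom-ext (suc m) f g e = Pol-hom-ext f g
    (Zm-hom-ext m (f ∘ₕ constₕ (Zm m)) (g ∘ₕ constₕ (Zm m)) (e ∘ suc)) (e zero)

-- `Poly m` consists of representatives. Divisibility is studied in the iterated ring `Zm m`, and
-- `hat` transports a polynomial there as its value at the variables.
hat : ∀ {m} → Poly m → ∣ Zm m ∣
hat {m} f = evalP (Zm m) f (var m)

evZ-hat : ∀ {m} (S : Ring) (f : Poly m) x → CRing._≈_ S (fn (evZ S x) (hat f)) (evalP S f x)
evZ-hat {m} S f x = trans (evalP-homo (evZ S x) f (var m)) (evalP-cong S f (evZ-var S x))
  where open CRing S

coefZ : ∀ m → ∣ Zm m ∣ → Vec ℕ m → ℤ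
coefZ m a [] = a
coefZ (suc m) a (i ∷ α) = coefZ m (coef (Zm m) a i) α

coefZ-cong : ∀ m {a b : ∣ Zm m ∣} → CRing._≈_ (Zm m) a b → ∀ α → coefZ m a α ≡ coefZ m b α
coefZ-cong m e [] = e
coefZ-cong (suc m) e (i ∷ α) = coefZ-cong m (coef-cong (Zm m) e i) α

coefZ-ext : ∀ m {a b : ∣ Zm m ∣} → (∀ α → coefZ m a α ≡ coefZ m b α) → CRing._≈_ (Zm m) a b
coefZ-ext zero e = e []
coefZ-ext (suc m) e = ext (Zm m) λ i → coefZ-ext m (λ α → e (i ∷ α))

coefZ-+ : ∀ m (a b : ∣ Zm m ∣) α → coefZ m (CRing._+_ (Zm m) a b) α ≡ coefZ m a α ℤ.+ coefZ m b α
coefZ-+ m a b [] = ≡.refl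
coefZ-+ (suc m) a b (i ∷ α) = ≡.trans (coefZ-cong m (coef-+ (Zm m) a b i) α) (coefZ-+ m _ _ α)

coefZ-0 : ∀ m α → coefZ m (CRing.0# (Zm m)) α ≡ + 0
coefZ-0 m [] = ≡.refl
coefZ-0 (suc m) (i ∷ α) = ≡.trans (coefZ-cong m (coef-0 (Zm m) i) α) (coefZ-0 m α)

term : ∀ {m} → ℤ → Vec ℕ m → ∣ Zm m ∣
term {m} a α = fn (ι (Zm m)) a * monomial (Zm m) α (var m)
  where open CRing (Zm m)

module _ {m : ℕ} where
  private
    R = Zm m
    module Z = CRing R
  open CRing (Pol R)
  open SemiringExp semiring using (_^_)
  open Solver (Pol R) using (solve; _:*_; _:=_)

  term-∷ : ∀ a b (β : Vec ℕ m) → term a (b ∷ β) ≈ X R ^ b * const R (term a β)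
  term-∷ a b β = begin
    fn (ι (Pol R)) a * (X R ^ b * monomial (Pol R) β (λ i → const R (var m i)))
      ≈⟨ *-cong (ι-homo (constₕ R) a) (*-congˡ (monomial-homo (constₕ R) β (var m))) ⟨
    const R (fn (ι R) a) * (X R ^ b * const R (monomial R β (var m)))
      ≈⟨ solve 3 (λ a x c → a :* (x :* c) := x :* (a :* c)) refl _ _ _ ⟩
    X R ^ b * (const R (fn (ι R) a) * const R (monomial R β (var m)))
      ≈⟨ *-congˡ (*-homo (constₕ R) _ _) ⟨
    X R ^ b * const R (term a β) ∎
    where open SetoidReasoning setoid

  coef-term-≡ : ∀ a b (β : Vec ℕ m) → coef R (term a (b ∷ β)) b Z.≈ term a β
  coef-term-≡ a b β = Z.trans (coef-cong R (term-∷ a b β) b) (Z.trans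
    (Z.reflexive (≡.cong (coef R (X R ^ b * const R (term a β))) (≡.sym (ℕP.+-identityʳ b))))
    (Z.trans (coef-X^* R b _ 0) (coef-const-0 R _)))

  coef-term-≢ : ∀ a b j (β : Vec ℕ m) → b ≢ j → coef R (term a (b ∷ β)) j Z.≈ Z.0#
  coef-term-≢ a b j β b≢j with ℕP.<-cmp b j
  ... | tri≈ _ b≡j _ = ⊥-elim (b≢j b≡j)
  ... | tri> _ _ j<b = Z.trans (coef-cong R (term-∷ a b β) j) (coef-X^*-< R b _ j j<b)
  ... | tri< b<j _ _ = Z.trans (coef-cong R (term-∷ a b β) j) (Z.trans
    (Z.reflexive (≡.cong (coef R (X R ^ b * const R (term a β))) (≡.trans (≡.sym (ℕP.m+[n∸m]≡n b<j)) (≡.sym (ℕP.+-suc b _)))))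
    (Z.trans (coef-X^* R b _ _) (coef-const-suc R _ _)))

ι-ℤ : ∀ a → fn (ι ℤR) a ≡ a
ι-ℤ a = ≡.sym (ι-unique {ℤR} idₕ a)

coefZ-term-≡ : ∀ m a (α : Vec ℕ m) → coefZ m (term a α) α ≡ a
coefZ-term-≡ zero a [] = ≡.trans (ℤP.*-identityʳ _) (ι-ℤ a)
coefZ-term-≡ (suc m) a (i ∷ α) = ≡.trans (coefZ-cong m (coef-term-≡ a i α) α) (coefZ-term-≡ m a α)

coefZ-term-≢ : ∀ m a (α β : Vec ℕ m) → α ≢ β → coefZ m (term a α) β ≡ + 0
coefZ-term-≢ zero a [] [] ne = ⊥-elim (ne ≡.refl)
coefZ-term-≢ (suc m) a (i ∷ α) (j ∷ β) ne with i ℕP.≟ j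
... | yes ≡.refl = ≡.trans (coefZ-cong m (coef-term-≡ a i α) β) (coefZ-term-≢ m a α β λ e → ne (≡.cong (i ∷_) e))
... | no i≢j = ≡.trans (coefZ-cong m (coef-term-≢ a i j α i≢j) β) (coefZ-0 m β)

coefZ-hat : ∀ {m} (f : Poly m) α → coefZ m (hat f) α ≡ coeff f α
coefZ-hat {m} [] α = coefZ-0 m α
coefZ-hat {m} ((a , β) ∷ f) α with VecP.≡-dec ℕP._≟_ β α
... | yes ≡.refl = ≡.trans (coefZ-+ m (term a β) (hat f) α) (≡.cong₂ ℤ._+_ (coefZ-term-≡ m a β) (coefZ-hat f α))
... | no ne = ≡.trans (coefZ-+ m (term a β) (hat f) α) (≡.trans (≡.cong₂ ℤ._+_ (coefZ-term-≢ m a β α ne) (coefZ-hat f α)) (ℤP.+-identityˡ _))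

hat-cong : ∀ {m} (f g : Poly m) → f ≈ₚ g → CRing._≈_ (Zm m) (hat f) (hat g)
hat-cong {m} f g e = coefZ-ext m λ α → ≡.trans (coefZ-hat f α) (≡.trans (e α) (≡.sym (coefZ-hat g α)))

hat-injective : ∀ {m} (f g : Poly m) → CRing._≈_ (Zm m) (hat f) (hat g) → f ≈ₚ g
hat-injective {m} f g e α = ≡.trans (≡.sym (coefZ-hat f α)) (≡.trans (coefZ-cong m e α) (coefZ-hat g α))

-- `evalP` is defined on representatives. Invariance passes through `hat`, where agreement of
-- coefficients is equality in the ring.
evalP-≈ₚ : ∀ {m} (S : Ring) (f g : Poly m) → f ≈ₚ g → ∀ x → CRing._≈_ S (evalP S f x) (evalP S g x)
evalP-≈ₚ S f g e x = trans (sym (evZ-hat S f x)) (trans (Hom.cong (evZ S x) (hat-cong f g e)) (evZ-hat S g x))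
  where open CRing S

-- Carries factors found in `Zm m` back to `Poly m`, where irreducibility is stated.
hat-surjective : ∀ m (a : ∣ Zm m ∣) → ∃ λ f → CRing._≈_ (Zm m) (hat {m} f) a
hat-surjective zero a = (a , []) ∷ [] , ≡.trans (ℤP.+-identityʳ _) (≡.trans (ℤP.*-identityʳ _) (ι-ℤ a))
hat-surjective (suc m) = Pol-ind R _ (λ e (f , p) → f , trans p e) ([] , refl)
  λ r a (f , p) → let (g , q) = hat-surjective m r in
    List.map (λ (c , α) → c , 0 ∷ α) g List.++ List.map (λ (c , α) → c , Vec.updateAt α zero suc) f ,
    trans (evalP-++ (Pol R) (List.map (λ (c , α) → c , 0 ∷ α) g) _ (var (suc m)))
      (+-cong (trans (constants g) (Hom.cong (constₕ R) q)) (trans (shifted f) (*-congˡ p)))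
  where
  R = Zm m
  open CRing (Pol R)
  open Solver (Pol R) using (solve; _:*_; _:=_)
  constants : ∀ g → hat (List.map (λ (c , α) → c , 0 ∷ α) g) ≈ const R (hat g)
  constants [] = sym (0-homo (constₕ R))
  constants ((c , α) ∷ g) = trans (+-cong (trans (term-∷ c 0 α) (*-identityˡ _)) (constants g)) (sym (+-homo (constₕ R) _ _))
  shifted : ∀ f → hat (List.map (λ (c , α) → c , Vec.updateAt α zero suc) f) ≈ X R * hat f
  shifted [] = sym (zeroʳ _)
  shifted ((c , i ∷ α) ∷ f) = trans (+-cong
    (solve 4 (λ c x y z → c :* ((x :* y) :* z) := x :* (c :* (y :* z))) refl _ _ _ _)
    (shifted f)) (sym (distribˡ _ _ _))

-- Prime factorisation in ℤ[x₁, ..., xₘ]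

ℤ-domain : Domain ℤR
ℤ-domain = record
  { 1≉0 = λ () ; nzd = λ {a} {b} e → ℤP.i*j≡0⇒i≡0∨j≡0 a e ; zero? = λ a → a ℤP.≟ + 0 }

Zm-domain : ∀ m → Domain (Zm m)
Zm-domain zero = ℤ-domain
Zm-domain (suc m) = Pol-domain (Zm-domain m)

module _ where
  open Divisibility ℤR

  ∣ᵤ⇒∣ : ∀ {a b} → ℤ.∣ a ∣ ℕ∣.∣ ℤ.∣ b ∣ → a ∣ b
  ∣ᵤ⇒∣ {a} {b} d with ℤ∣.∣ᵤ⇒∣ {a} {b} d
  ... | ℤ∣.divides q e = q , ≡.trans (ℤP.*-comm a q) (≡.sym e)

  ∣⇒∣ᵤ : ∀ {a b} → a ∣ b → ℤ.∣ a ∣ ℕ∣.∣ ℤ.∣ b ∣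
  ∣⇒∣ᵤ {a} {b} (q , e) = ℤ∣.∣⇒∣ᵤ {a} {b} (ℤ∣.divides q (≡.trans (≡.sym e) (ℤP.*-comm a q)))

  ℤ-prime : ∀ {p} → ℕPrime.Prime p → Prime (+ p)
  ℤ-prime {p} pp = record
    { nonzero = λ e → ℕ.≢-nonZero⁻¹ p ⦃ ℕPrime.prime⇒nonZero pp ⦄ (ℤP.+-injective e)
    ; nonunit = λ d → ℕPrime.¬prime[1] (≡.subst ℕPrime.Prime (ℕ∣.∣1⇒≡1 (∣⇒∣ᵤ {+ p} {+ 1} d)) pp)
    ; split = λ {a} {b} d na nb → case a b na nb (ℕPrime.euclidsLemma ℤ.∣ a ∣ ℤ.∣ b ∣ pp
        (≡.subst (p ℕ∣.∣_) (ℤP.abs-* a b) (∣⇒∣ᵤ {+ p} {a ℤ.* b} d))) }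
    where
    case : ∀ a b → ¬ (+ p) ∣ a → ¬ (+ p) ∣ b → p ℕ∣.∣ ℤ.∣ a ∣ ⊎ p ℕ∣.∣ ℤ.∣ b ∣ → ⊥
    case a b na nb (inj₁ d) = na (∣ᵤ⇒∣ {+ p} {a} d)
    case a b na nb (inj₂ d) = nb (∣ᵤ⇒∣ {+ p} {b} d)

  ℤ-factorisations : PrimeFactorisations ℤR
  ℤ-factorisations a a≢0 k = k (factored a a≢0)
    where
    prods : ∀ ps → + ℕList.product ps ≡ prod (List.map (+_) ps)
    prods [] = ≡.refl
    prods (p ∷ ps) = ≡.trans (ℤP.pos-* p _) (≡.cong ((+ p) ℤ.*_) (prods ps))
    pos : ∀ n → ¬ n ≡ 0 → Factored (+ n)
    pos n n≢0 = + 1 , List.map (+_) (Factorisation.PrimeFactorisation.factors F) , (+ 1 , ≡.refl) ,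
      AllP.map⁺ (All.map ℤ-prime (Factorisation.PrimeFactorisation.factorsPrime F)) ,
      ≡.trans (≡.cong +_ (Factorisation.PrimeFactorisation.isFactorisation F)) (≡.trans (prods (Factorisation.PrimeFactorisation.factors F)) (≡.sym (ℤP.*-identityˡ _)))
      where F = Factorisation.factorise n ⦃ ℕ.≢-nonZero n≢0 ⦄
    factored : ∀ a → ¬ a ≡ + 0 → Factored a
    factored (+ n) n≢0 = pos n λ { ≡.refl → n≢0 ≡.refl }
    factored -[1+ n ] _ = Factored-cong {(ℤ.- + 1) ℤ.* + suc n} (≡.cong -[1+_] (ℕP.+-identityʳ n))
      (Factored-* {ℤ.- + 1} {+ suc n} (ℤ.- + 1 , [] , (ℤ.- + 1 , ≡.refl) , [] , ≡.refl) (pos (suc n) λ ()))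

Zm-factorisations : ∀ m → PrimeFactorisations (Zm m)
Zm-factorisations zero = ℤ-factorisations
Zm-factorisations (suc m) = Pol-factorisations (Zm-domain m) (Zm-factorisations m)

module _ {m : ℕ} where
  open CRing (Zm m)
  open Divisibility (Zm m)

  private
    monomial-1 : ∀ {k} (x : Fin k → Carrier) → monomial (Zm m) (Vec.replicate k 0) x ≈ 1#
    monomial-1 {zero} x = refl
    monomial-1 {suc k} x = trans (*-identityˡ _) (monomial-1 (x ∘ suc))

    hat-1 : hat {m} ((+ 1 , Vec.replicate m 0) ∷ []) ≈ 1#
    hat-1 = trans (+-identityʳ _) (trans (*-cong (1-homo (ι (Zm m))) (monomial-1 (var m))) (*-identityˡ 1#))

    open RawSemiringDefs (polyRawSemiring m) using () renaming (_∣_ to _∣ₚ_)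
    open RawMagmaDefs (RawSemiring.*-rawMagma (polyRawSemiring m)) using (_,_)

    hat-unit : ∀ f → f ∣ₚ ((+ 1 , Vec.replicate m 0) ∷ []) → Unit (hat {m} f)
    hat-unit f (q , e) = hat {m} q , trans (*-comm _ _) (trans (sym (evalP-* (Zm m) q f (var m))) (trans (hat-cong {m} (q *ₚ f) ((+ 1 , Vec.replicate m 0) ∷ []) e) hat-1))

  -- A prime factorisation of an irreducible element has exactly one prime: with none the element is
  -- a unit, and with two or more one of them would be a unit.
  hat-prime : ∀ {f} → Irreducible {m} f → ¬ ¬ Prime (hat {m} f)
  hat-prime {f} irr k = Zm-factorisations m (hat {m} f) nonzero-f λ
    { (u , [] , (v , uv) , [] , e) → unit-f (v , trans (*-congʳ (trans e (*-identityʳ u))) uv)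
    ; (u , p ∷ [] , (v , uv) , pp ∷ [] , e) → k record
        { nonzero = nonzero-f
        ; nonunit = unit-f
        ; split = λ d na nb → split pp (p∣f uv e d) (λ { (q , pq) → na (f∣p uv e pq) }) (λ { (q , pq) → nb (f∣p uv e pq) }) }
    ; (u , p ∷ p′ ∷ ps , uu , pp ∷ pp′ ∷ pps , e) → two u p p′ ps pp pp′ e }
    where
    open RawSemiringDefs.Irreducible {M = polyRawSemiring m} irr
    open Domain (Zm-domain m) using (1≉0)
    open Solver (Zm m) using (solve; _:*_; _:=_)

    factor : ∀ {a b} → hat {m} f ≈ a * b → Unit a ⊎ Unit b
    factor {a} {b} e with hat-surjective m a | hat-surjective m b
    ... | g , ga | h , hb with split-∣1 {g} {h} (hat-injective {m} f (g *ₚ h) (trans e (trans (sym (*-cong ga hb)) (sym (evalP-* (Zm m) g h (var m))))))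
    ... | inj₁ d = inj₁ (proj₁ (hat-unit g d) , trans (*-congʳ (sym ga)) (proj₂ (hat-unit g d)))
    ... | inj₂ d = inj₂ (proj₁ (hat-unit h d) , trans (*-congʳ (sym hb)) (proj₂ (hat-unit h d)))

    unit-f : ¬ Unit (hat {m} f)
    unit-f (b , fb) with hat-surjective m b
    ... | h , hb = p∤1 (h , hat-injective {m} (h *ₚ f) ((+ 1 , Vec.replicate m 0) ∷ [])
      (trans (evalP-* (Zm m) h f (var m)) (trans (*-congʳ hb) (trans (*-comm _ _) (trans fb (sym hat-1))))))

    nonzero-f : ¬ hat {m} f ≈ 0#
    nonzero-f z with factor {0#} {0#} (trans z (sym (zeroˡ 0#)))
    ... | inj₁ (q , e) = 1≉0 (trans (sym e) (zeroˡ q))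
    ... | inj₂ (q , e) = 1≉0 (trans (sym e) (zeroˡ q))

    p∣f : ∀ {u v p a b} → u * v ≈ 1# → hat {m} f ≈ u * (p * 1#) → hat {m} f ∣ a * b → p ∣ a * b
    p∣f {u} {v} {p} uv e (q , fq) = u * q , trans (sym (*-assoc _ _ _)) (trans (*-congʳ (*-comm p u))
      (trans (*-congʳ (trans (*-congˡ (sym (*-identityʳ p))) (sym e))) fq))

    f∣p : ∀ {u v p q a} → u * v ≈ 1# → hat {m} f ≈ u * (p * 1#) → p * q ≈ a → hat {m} f ∣ a
    f∣p {u} {v} {p} {q} {a} uv e pq = v * q , trans (*-congʳ (trans e (*-congˡ (*-identityʳ p))))
      (trans (solve 4 (λ u p v q → (u :* p) :* (v :* q) := (u :* v) :* (p :* q)) refl u p v q) (trans (*-cong uv pq) (*-identityˡ a)))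

    two : ∀ u p p′ ps → Prime p → Prime p′ → hat {m} f ≈ u * (p * (p′ * prod ps)) → ⊥
    two u p p′ ps pp pp′ e with factor {u * p} {p′ * prod ps} (trans e (sym (*-assoc _ _ _)))
    ... | inj₁ (w , upw) = nonunit pp (u * w , trans (trans (sym (*-assoc _ _ _)) (*-congʳ (*-comm p u))) upw)
    ... | inj₂ (w , p′w) = nonunit pp′ (prod ps * w , trans (sym (*-assoc _ _ _)) p′w)

-- Quotient rings

module _ (R : Ring) where
  open CRing R

  -- A quotient keeps the carrier and coarsens the equality: no representatives are chosen, and the
  -- projection is the identity on elements.
  record Congruence : Set₁ where
    field
      _~_ : Carrier → Carrier → Set
      fromEq : ∀ {a b} → a ≈ b → a ~ b
      ~-sym : ∀ {a b} → a ~ b → b ~ a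
      ~-trans : ∀ {a b c} → a ~ b → b ~ c → a ~ c
      ~-+ : ∀ {a b c d} → a ~ b → c ~ d → (a + c) ~ (b + d)
      ~-* : ∀ {a b c d} → a ~ b → c ~ d → (a * c) ~ (b * d)
      ~-neg : ∀ {a b} → a ~ b → (- a) ~ (- b)

  module _ (C : Congruence) where
    open Congruence C

    Quotient : Ring
    Quotient = record
      { Carrier = Carrier ; _≈_ = _~_ ; _+_ = _+_ ; _*_ = _*_ ; -_ = -_ ; 0# = 0# ; 1# = 1#
      ; isCommutativeRing = record
        { isRing = record
          { +-isAbelianGroup = record
            { isGroup = record
              { isMonoid = record
                { isSemigroup = record
                  { isMagma = record
                    { isEquivalence = record { refl = fromEq refl ; sym = ~-sym ; trans = ~-trans }
                    ; ∙-cong = ~-+ }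
                  ; assoc = λ a b c → fromEq (+-assoc a b c) }
                ; identity = (λ a → fromEq (+-identityˡ a)) , (λ a → fromEq (+-identityʳ a)) }
              ; inverse = (λ a → fromEq (-‿inverseˡ a)) , (λ a → fromEq (-‿inverseʳ a))
              ; ⁻¹-cong = ~-neg }
            ; comm = λ a b → fromEq (+-comm a b) }
          ; *-cong = ~-*
          ; *-assoc = λ a b c → fromEq (*-assoc a b c)
          ; *-identity = (λ a → fromEq (*-identityˡ a)) , (λ a → fromEq (*-identityʳ a))
          ; distrib = (λ a b c → fromEq (distribˡ a b c)) , (λ a b c → fromEq (distribʳ a b c)) }
        ; *-comm = λ a b → fromEq (*-comm a b) } }

    toQuotient : Hom R Quotient
    toQuotient = record
      { fn = λ a → a ; cong = fromEq ; +-homo = λ _ _ → fromEq refl ; *-homo = λ _ _ → fromEq refl ; 1-homo = fromEq refl }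

  open Divisibility R
  open Solver R using (solve; _:+_; _:*_; :-_; _:=_)

  principal : Carrier → Congruence
  principal n = record
    { _~_ = λ a b → n ∣ a - b
    ; fromEq = λ {a} {b} e → 0# , trans (zeroʳ n) (sym (trans (+-congʳ e) (-‿inverseʳ b)))
    ; ~-sym = λ {a} {b} d → ∣-respʳ (solve 2 (λ a b → :- (a :+ :- b) := b :+ :- a) refl a b) (∣-neg d)
    ; ~-trans = λ {a} {b} {c} d e → ∣-respʳ (solve 3 (λ a b c → (a :+ :- b) :+ (b :+ :- c) := a :+ :- c) refl a b c) (∣-+ d e)
    ; ~-+ = λ {a} {b} {c} {e} p q → ∣-respʳ (solve 4 (λ a b c e → (a :+ :- b) :+ (c :+ :- e) := (a :+ c) :+ :- (b :+ e)) refl a b c e) (∣-+ p q)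
    ; ~-* = λ {a} {b} {c} {e} p q → ∣-respʳ (solve 4 (λ a b c e → (a :+ :- b) :* c :+ b :* (c :+ :- e) := a :* c :+ :- (b :* e)) refl a b c e) (∣-+ (∣-*ʳ c p) (∣-*ˡ b q))
    ; ~-neg = λ {a} {b} p → ∣-respʳ (solve 2 (λ a b → :- (a :+ :- b) := :- a :+ :- (:- b)) refl a b) (∣-neg p) }

-- Taylor expansion and homogeneity

module Sums (S : Ring) where
  open CRing S
  open RawSemiringDefs (RawRing.rawSemiring rawRing) using (sum) public

  sum-cong : ∀ {n} (g h : Fin n → Carrier) → (∀ j → g j ≈ h j) → sum g ≈ sum h
  sum-cong {zero} g h e = refl
  sum-cong {suc n} g h e = +-cong (e zero) (sum-cong (g ∘ suc) (h ∘ suc) (e ∘ suc))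

  sum-+ : ∀ {n} (g h : Fin n → Carrier) → sum (λ j → g j + h j) ≈ sum g + sum h
  sum-+ = MonoidSum.∑-distrib-+ +-commutativeMonoid

  sum-*ˡ : ∀ {n} c (g : Fin n → Carrier) → c * sum g ≈ sum (λ j → c * g j)
  sum-*ˡ {zero} c g = zeroʳ c
  sum-*ˡ {suc n} c g = trans (distribˡ _ _ _) (+-congˡ (sum-*ˡ c (g ∘ suc)))

  sum-0 : ∀ {n} (g : Fin n → Carrier) → (∀ j → g j ≈ 0#) → sum g ≈ 0#
  sum-0 {zero} g e = refl
  sum-0 {suc n} g e = trans (+-cong (e zero) (sum-0 (g ∘ suc) (e ∘ suc))) (+-identityˡ 0#)

  sum-single : ∀ {n} (g : Fin n → Carrier) i → (∀ j → i ≢ j → g j ≈ 0#) → sum g ≈ g i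
  sum-single g zero e = trans (+-congˡ (sum-0 (g ∘ suc) (λ j → e (suc j) λ ()))) (+-identityʳ _)
  sum-single g (suc i) e = trans (+-cong (e zero λ ()) (sum-single (g ∘ suc) i (λ j i≢j → e (suc j) λ { ≡.refl → i≢j ≡.refl }))) (+-identityˡ _)

module _ (S : Ring) where
  open CRing S
  open RawSemiringDefs (RawRing.rawSemiring rawRing) using (_^_)
  open Sums S
  open Solver S using (solve; _:+_; _:*_; _:=_; con)
  private
    i : ℤ → Carrier
    i = fn (ι S)

  directional : ∀ {m} → Poly m → (Fin m → Carrier) → (Fin m → Carrier) → Carrier
  directional f y v = sum (λ j → evalP S (∂ j f) y * v j)

  private
    -- The derivative of yᵏ in the direction v. For k = 0 the truncated exponent is multiplied by 0.
    dpow : ℕ → Carrier → Carrier → Carrier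
    dpow k y v = i (+ k) * y ^ ℕ.pred k * v

    dpow-suc : ∀ k y v → y * dpow k y v + v * y ^ k ≈ dpow (suc k) y v
    dpow-suc zero y v = trans (+-congʳ (trans (*-congˡ (trans (*-congʳ (trans (*-congʳ (0-homo (ι S))) (zeroˡ _))) (zeroˡ v))) (zeroʳ y)))
      (trans (+-identityˡ _) (trans (*-comm v 1#) (*-congʳ (trans (sym (1-homo (ι S))) (sym (*-identityʳ _))))))
    dpow-suc (suc k) y v = begin
      y * (i (+ suc k) * y ^ k * v) + v * (y * y ^ k)
        ≈⟨ solve 4 (λ y n p v → y :* (n :* p :* v) :+ v :* (y :* p) := (con (+ 1) :+ n) :* (y :* p) :* v) refl y (i (+ suc k)) (y ^ k) v ⟩
      (i (+ 1) + i (+ suc k)) * (y * y ^ k) * v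
        ≈⟨ *-congʳ (*-congʳ (+-homo (ι S) (+ 1) (+ suc k))) ⟨
      i (+ suc (suc k)) * (y * y ^ k) * v ∎
      where open SetoidReasoning setoid

    dmono : ∀ {m} → Vec ℕ m → (Fin m → Carrier) → (Fin m → Carrier) → Carrier
    dmono [] y v = 0#
    dmono (k ∷ α) y v = dpow k (y zero) (v zero) * monomial S α (y ∘ suc) + y zero ^ k * dmono α (y ∘ suc) (v ∘ suc)

    Expansion : Carrier → Carrier → Carrier → Carrier → Set
    Expansion z a b d = ∃ λ r → a ≈ b + z * (d + z * r)

    pow-expand : ∀ z k y v → Expansion z ((y + z * v) ^ k) (y ^ k) (dpow k y v)
    pow-expand z zero y v = 0# , sym (trans (+-congˡ (trans (*-congˡ (trans (+-cong
      (trans (*-congʳ (trans (*-congʳ (0-homo (ι S))) (zeroˡ _))) (zeroˡ v)) (zeroʳ z)) (+-identityʳ _))) (zeroʳ z))) (+-identityʳ _))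
    pow-expand z (suc k) y v with pow-expand z k y v
    ... | r , e = y * r + v * (dpow k y v + z * r) , (begin
      (y + z * v) * (y + z * v) ^ k ≈⟨ *-congˡ e ⟩
      (y + z * v) * (y ^ k + z * (dpow k y v + z * r))
        ≈⟨ solve 6 (λ y z v p d r → (y :+ z :* v) :* (p :+ z :* (d :+ z :* r)) :=
             y :* p :+ z :* ((y :* d :+ v :* p) :+ z :* (y :* r :+ v :* (d :+ z :* r)))) refl y z v (y ^ k) (dpow k y v) r ⟩
      y * y ^ k + z * ((y * dpow k y v + v * y ^ k) + z * (y * r + v * (dpow k y v + z * r)))
        ≈⟨ +-congˡ (*-congˡ (+-congʳ (dpow-suc k y v))) ⟩
      y * y ^ k + z * (dpow (suc k) y v + z * (y * r + v * (dpow k y v + z * r))) ∎)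
      where open SetoidReasoning setoid

    mono-expand : ∀ z {m} (α : Vec ℕ m) y v → Expansion z (monomial S α (λ j → y j + z * v j)) (monomial S α y) (dmono α y v)
    mono-expand z [] y v = 0# , sym (trans (+-congˡ (trans (*-congˡ (trans (+-identityˡ _) (zeroʳ z))) (zeroʳ z))) (+-identityʳ _))
    mono-expand z (k ∷ α) y v with pow-expand z k (y zero) (v zero) | mono-expand z α (y ∘ suc) (v ∘ suc)
    ... | r , e | q , g = _ , trans (*-cong e g)
      (solve 7 (λ a d r b c q z → (a :+ z :* (d :+ z :* r)) :* (b :+ z :* (c :+ z :* q)) :=
        a :* b :+ z :* ((d :* b :+ a :* c) :+ z :* (r :* b :+ a :* q :+ (d :+ z :* r) :* (c :+ z :* q)))) refl
        (y zero ^ k) (dpow k (y zero) (v zero)) r (monomial S α (y ∘ suc)) (dmono α (y ∘ suc) (v ∘ suc)) q z)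

    dmono-sum : ∀ {m} (α : Vec ℕ m) y v →
      sum (λ j → i (+ lookup α j) * monomial S (Vec.updateAt α j ℕ.pred) y * v j) ≈ dmono α y v
    dmono-sum [] y v = refl
    dmono-sum {suc m} (k ∷ α) y v = +-cong
      (solve 4 (λ n p q v → n :* (p :* q) :* v := n :* p :* v :* q) refl _ _ _ _)
      (trans (sum-cong (λ j → i (+ lookup α j) * (y zero ^ k * M j) * v (suc j)) (λ j → y zero ^ k * (i (+ lookup α j) * M j * v (suc j)))
          λ j → solve 4 (λ n p q v → n :* (p :* q) :* v := p :* (n :* q :* v)) refl (i (+ lookup α j)) (y zero ^ k) (M j) (v (suc j)))
        (trans (sym (sum-*ˡ (y zero ^ k) (λ j → i (+ lookup α j) * M j * v (suc j)))) (*-congˡ (dmono-sum α (y ∘ suc) (v ∘ suc)))))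
      where
      M : Fin m → Carrier
      M j = monomial S (Vec.updateAt α j ℕ.pred) (y ∘ suc)

    directional-∷ : ∀ {m} a (α : Vec ℕ m) f y v → directional ((a , α) ∷ f) y v ≈ i a * dmono α y v + directional f y v
    directional-∷ a α f y v = begin
      sum (λ j → (i (a ℤ.* + lookup α j) * M j + evalP S (∂ j f) y) * v j)
        ≈⟨ sum-cong _ (λ j → i a * (i (+ lookup α j) * M j * v j) + evalP S (∂ j f) y * v j) (λ j → trans (distribʳ _ _ _) (+-congʳ (trans (*-congʳ (*-congʳ (*-homo (ι S) a _)))
             (solve 4 (λ a n m v → a :* n :* m :* v := a :* (n :* m :* v)) refl (i a) (i (+ lookup α j)) (M j) (v j))))) ⟩
      sum (λ j → i a * (i (+ lookup α j) * M j * v j) + evalP S (∂ j f) y * v j)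
        ≈⟨ sum-+ (λ j → i a * (i (+ lookup α j) * M j * v j)) (λ j → evalP S (∂ j f) y * v j) ⟩
      sum (λ j → i a * (i (+ lookup α j) * M j * v j)) + directional f y v
        ≈⟨ +-congʳ (trans (sym (sum-*ˡ (i a) (λ j → i (+ lookup α j) * M j * v j))) (*-congˡ (dmono-sum α y v))) ⟩
      i a * dmono α y v + directional f y v ∎
      where
      open SetoidReasoning setoid
      M = λ j → monomial S (Vec.updateAt α j ℕ.pred) y

  -- A quotient r in place of second derivatives makes the expansion valid over every ring. The
  -- increment z is any element: below it is a variable, a multiple of a power of s, or an integer
  -- divisible by a prime.
  taylor : ∀ {m} (f : Poly m) z y v →
    ∃ λ r → evalP S f (λ j → y j + z * v j) ≈ evalP S f y + z * (directional f y v + z * r)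
  taylor {m} [] z y v = 0# , sym (trans (+-congˡ (trans (*-congˡ (trans (+-cong (sum-0 (λ j → 0# * v j) (λ j → zeroˡ (v j))) (zeroʳ z)) (+-identityˡ _))) (zeroʳ z))) (+-identityʳ _))
  taylor ((a , α) ∷ f) z y v with mono-expand z α y v | taylor f z y v
  ... | r , e | q , g = i a * r + q , (begin
    i a * monomial S α _ + evalP S f _ ≈⟨ +-cong (*-congˡ e) g ⟩
    i a * (M + z * (dM + z * r)) + (F + z * (dF + z * q))
      ≈⟨ solve 8 (λ a M z d r F e q → a :* (M :+ z :* (d :+ z :* r)) :+ (F :+ z :* (e :+ z :* q)) :=
          (a :* M :+ F) :+ z :* ((a :* d :+ e) :+ z :* (a :* r :+ q))) refl (i a) M z dM r F dF q ⟩
    (i a * M + F) + z * ((i a * dM + dF) + z * (i a * r + q))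
      ≈⟨ +-congˡ (*-congˡ (+-congʳ (directional-∷ a α f y v))) ⟨
    (i a * M + F) + z * (directional ((a , α) ∷ f) y v + z * (i a * r + q)) ∎)
    where
    open SetoidReasoning setoid
    M = monomial S α y ; dM = dmono α y v ; F = evalP S f y ; dF = directional f y v

  directional-cong : ∀ {m} (f : Poly m) {y y′ v v′} → (∀ j → y j ≈ y′ j) → (∀ j → v j ≈ v′ j) → directional f y v ≈ directional f y′ v′
  directional-cong f {y} {y′} {v} {v′} p q = sum-cong (λ j → evalP S (∂ j f) y * v j) (λ j → evalP S (∂ j f) y′ * v′ j) λ j → *-cong (evalP-cong S (∂ j f) p) (q j)

module _ {S T : Ring} (h : Hom S T) where
  private
    module S = CRing S
    module T = CRing T
  open RawSemiringDefs (RawRing.rawSemiring S.rawRing) using () renaming (sum to sumₛ)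
  open RawSemiringDefs (RawRing.rawSemiring T.rawRing) using () renaming (sum to sumₜ)

  sum-homo : ∀ {n} (g : Fin n → ∣ S ∣) → fn h (sumₛ g) T.≈ sumₜ (fn h ∘ g)
  sum-homo {zero} g = 0-homo h
  sum-homo {suc n} g = T.trans (+-homo h _ _) (T.+-congˡ (sum-homo (g ∘ suc)))

  directional-homo : ∀ {m} (f : Poly m) y v → fn h (directional S f y v) T.≈ directional T f (fn h ∘ y) (fn h ∘ v)
  directional-homo f y v = T.trans (sum-homo (λ j → evalP S (∂ j f) y S.* v j))
    (Sums.sum-cong T (λ j → fn h (evalP S (∂ j f) y S.* v j)) (λ j → evalP T (∂ j f) (fn h ∘ y) T.* fn h (v j)) λ j →
    T.trans (*-homo h _ _) (T.*-congʳ (evalP-homo h (∂ j f) y)))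

-- `Homogeneous` restricts coefficients only, so a representative may contain cancelling terms of
-- other degrees. Dropping them gives an equal polynomial that is homogeneous term by term.
homogeneousPart : ∀ {m} → ℕ → Poly m → Poly m
homogeneousPart d [] = []
homogeneousPart d ((a , α) ∷ f) with Vec.sum α ℕP.≟ d
... | yes _ = (a , α) ∷ homogeneousPart d f
... | no _ = homogeneousPart d f

module _ {m d : ℕ} where
  private
    coeff-part : ∀ (f : Poly m) β → Vec.sum β ≡ d → coeff (homogeneousPart d f) β ≡ coeff f β
    coeff-part [] β e = ≡.refl
    coeff-part ((a , α) ∷ f) β e with Vec.sum α ℕP.≟ d | VecP.≡-dec ℕP._≟_ α β in eq
    ... | yes _ | yes α≡β rewrite eq = ≡.cong (λ n → a ℤ.+ n) (coeff-part f β e)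
    ... | yes _ | no α≢β rewrite eq = coeff-part f β e
    ... | no α≢d | yes ≡.refl = ⊥-elim (α≢d e)
    ... | no _ | no _ = coeff-part f β e

    coeff-part-0 : ∀ (f : Poly m) β → Vec.sum β ≢ d → coeff (homogeneousPart d f) β ≡ + 0
    coeff-part-0 [] β e = ≡.refl
    coeff-part-0 ((a , α) ∷ f) β e with Vec.sum α ℕP.≟ d
    ... | no _ = coeff-part-0 f β e
    ... | yes α≡d with VecP.≡-dec ℕP._≟_ α β
    ... | yes ≡.refl = ⊥-elim (e α≡d)
    ... | no _ = coeff-part-0 f β e

  part-≈ₚ : ∀ {f : Poly m} → Homogeneous d f → f ≈ₚ homogeneousPart d f
  part-≈ₚ {f} hom β with Vec.sum β ℕP.≟ d
  ... | yes e = ≡.sym (coeff-part f β e)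
  ... | no ne with coeff f β ℤP.≟ + 0
  ... | yes z = ≡.trans z (≡.sym (coeff-part-0 f β ne))
  ... | no nz = ⊥-elim (ne (hom β nz))

  module _ (S : Ring) {f : Poly m} (hom : Homogeneous d f) where
    open CRing S
    open SemiringExp semiring using (_^_; ^-homo-*)
    open Solver S using (solve; _:+_; _:*_; _:=_)

    private
      *-^ : ∀ a b k → (a * b) ^ k ≈ a ^ k * b ^ k
      *-^ a b zero = sym (*-identityˡ _)
      *-^ a b (suc k) = trans (*-congˡ (*-^ a b k)) (solve 4 (λ a b c d → (a :* b) :* (c :* d) := (a :* c) :* (b :* d)) refl _ _ _ _)

      mono-scale : ∀ {k} (α : Vec ℕ k) c x → monomial S α (λ j → c * x j) ≈ c ^ Vec.sum α * monomial S α x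
      mono-scale [] c x = sym (*-identityˡ _)
      mono-scale (k ∷ α) c x = trans (*-cong (*-^ c (x zero) k) (mono-scale α c (x ∘ suc)))
        (trans (solve 4 (λ a b c d → (a :* b) :* (c :* d) := (a :* c) :* (b :* d)) refl _ _ _ _) (*-congʳ (sym (^-homo-* c k _))))

      part-scale : ∀ (g : Poly m) c x → evalP S (homogeneousPart d g) (λ j → c * x j) ≈ c ^ d * evalP S (homogeneousPart d g) x
      part-scale [] c x = sym (zeroʳ _)
      part-scale ((a , α) ∷ g) c x with Vec.sum α ℕP.≟ d
      ... | no _ = part-scale g c x
      ... | yes ≡.refl = trans (+-cong (trans (*-congˡ (mono-scale α c x)) (solve 3 (λ a b c → a :* (b :* c) := b :* (a :* c)) refl _ _ _)) (part-scale g c x)) (sym (distribˡ _ _ _))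

    evalP-scale : ∀ c x → evalP S f (λ j → c * x j) ≈ c ^ d * evalP S f x
    evalP-scale c x = trans (evalP-≈ₚ S f (homogeneousPart d f) (part-≈ₚ {f} hom) _) (trans (part-scale f c x) (*-congˡ (sym (evalP-≈ₚ S f (homogeneousPart d f) (part-≈ₚ {f} hom) x))))

    private
      module P = CRing (Pol S)
      module PE = SemiringExp P.semiring

      Top-add : ∀ {k v w a b} → Top S k v a → Top S k w b → Top S k (v + w) (a P.+ b)
      Top-add (mkTop p d) (mkTop q e) = mkTop (trans (coef-+ S _ _ _) (+-cong p q)) (deg<-+ S d e)

      Top-^ : ∀ {e v a} k → Top S e v a → Top S (k ℕ.* e) (v ^ k) (a PE.^ k)
      Top-^ zero t = Top-cong S refl (1-homo (constₕ S)) (Top-const S 1#)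
      Top-^ (suc k) t = Top-* S _ t (Top-^ k t)

      Top-mono : ∀ {k e} (α : Vec ℕ k) {v x} → (∀ j → Top S e (v j) (x j)) → Top S (Vec.sum α ℕ.* e) (monomial S α v) (monomial (Pol S) α x)
      Top-mono [] t = Top-cong S refl (1-homo (constₕ S)) (Top-const S 1#)
      Top-mono {e = e} (k ∷ α) {v} {x} t = ≡.subst (λ n → Top S n (monomial S (k ∷ α) v) (monomial (Pol S) (k ∷ α) x)) (≡.sym (ℕP.*-distribʳ-+ e k (Vec.sum α)))
        (Top-* S _ (Top-^ k (t zero)) (Top-mono α (t ∘ suc)))

      Top-part : ∀ (g : Poly m) {e v x} → (∀ j → Top S e (v j) (x j)) → Top S (d ℕ.* e) (evalP S (homogeneousPart d g) v) (evalP (Pol S) (homogeneousPart d g) x)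
      Top-part [] t = Top-0 S (deg<-0 S _)
      Top-part ((a , α) ∷ g) t with Vec.sum α ℕP.≟ d
      ... | no _ = Top-part g t
      ... | yes ≡.refl = Top-add (Top-* S 0 (Top-cong S refl (ι-homo (constₕ S) a) (Top-const S _)) (Top-mono α t)) (Top-part g t)

    -- The top coefficients of the coordinates are substituted into f, whether or not the result is
    -- 0. Applied to the curve, this makes f(V) the leading coefficient of F.
    Top-evalP : ∀ {e v x} → (∀ j → Top S e (v j) (x j)) → Top S (d ℕ.* e) (evalP S f v) (evalP (Pol S) f x)
    Top-evalP t = Top-cong S (sym (evalP-≈ₚ S f (homogeneousPart d f) (part-≈ₚ {f} hom) _)) (P.sym (evalP-≈ₚ (Pol S) f (homogeneousPart d f) (part-≈ₚ {f} hom) _)) (Top-part f t)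

-- Formal power series

module _ (R : Ring) where
  open CRing R
  private
    module S = CRing (Series R)

    cₛ : Carrier → ∣ Series R ∣
    cₛ r = mkₛ R λ { zero → r ; (suc n) → 0# }

    tail-c : ∀ r → tailₛ R (cₛ r) S.≈ S.0#
    tail-c r = extₛ R λ n → trans (coefₛ-mk R _ n) (trans (coefₛ-mk R _ (suc n)) (sym (coefₛ-0 R n)))

    coef-c* : ∀ r b n → coefₛ R (cₛ r S.* b) n ≈ r * coefₛ R b n
    coef-c* r b zero = trans (coefₛ-*-0 R _ _) (*-congʳ (coefₛ-mk R _ 0))
    coef-c* r b (suc n) = trans (coefₛ-*-suc R _ _ n) (trans (+-cong (*-congʳ (coefₛ-mk R _ 0))
      (trans (coefₛ-cong R (S.trans (S.*-congʳ (tail-c r)) (S.zeroˡ b)) n) (coefₛ-0 R n))) (+-identityʳ _))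

  constₛ : Hom R (Series R)
  constₛ = record
    { fn = cₛ
    ; cong = λ p → extₛ R λ { zero → trans (coefₛ-mk R _ 0) (trans p (sym (coefₛ-mk R _ 0))) ; (suc n) → trans (coefₛ-mk R _ (suc n)) (sym (coefₛ-mk R _ (suc n))) }
    ; +-homo = λ a b → extₛ R λ
        { zero → trans (coefₛ-mk R _ 0) (sym (trans (coefₛ-+ R _ _ 0) (+-cong (coefₛ-mk R _ 0) (coefₛ-mk R _ 0))))
        ; (suc n) → trans (coefₛ-mk R _ (suc n)) (sym (trans (coefₛ-+ R _ _ (suc n)) (trans (+-cong (coefₛ-mk R _ (suc n)) (coefₛ-mk R _ (suc n))) (+-identityʳ _)))) }
    ; *-homo = λ a b → extₛ R λ
        { zero → trans (coefₛ-mk R _ 0) (sym (trans (coef-c* a (cₛ b) 0) (*-congˡ (coefₛ-mk R _ 0))))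
        ; (suc n) → trans (coefₛ-mk R _ (suc n)) (sym (trans (coef-c* a (cₛ b) (suc n)) (trans (*-congˡ (coefₛ-mk R _ (suc n))) (zeroʳ a)))) }
    ; 1-homo = extₛ R λ { zero → trans (coefₛ-mk R _ 0) (sym (coefₛ-1-0 R)) ; (suc n) → trans (coefₛ-mk R _ (suc n)) (sym (coefₛ-1 R n)) } }

  tₛ : ∣ Series R ∣
  tₛ = mkₛ R λ { (suc zero) → 1# ; _ → 0# }

  coef-constₛ* : ∀ r b n → coefₛ R (fn constₛ r S.* b) n ≈ r * coefₛ R b n
  coef-constₛ* = coef-c*

  coef-constₛ-0 : ∀ r → coefₛ R (fn constₛ r) 0 ≈ r
  coef-constₛ-0 r = coefₛ-mk R _ 0

  coef-constₛ-suc : ∀ r n → coefₛ R (fn constₛ r) (suc n) ≈ 0#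
  coef-constₛ-suc r n = coefₛ-mk R _ (suc n)

  coef-t*-0 : ∀ b → coefₛ R (tₛ S.* b) 0 ≈ 0#
  coef-t*-0 b = trans (coefₛ-*-0 R _ _) (trans (*-congʳ (coefₛ-mk R _ 0)) (zeroˡ _))

  coef-t*-suc : ∀ b n → coefₛ R (tₛ S.* b) (suc n) ≈ coefₛ R b n
  coef-t*-suc b n = trans (coefₛ-*-suc R _ _ n) (trans (+-cong (trans (*-congʳ (coefₛ-mk R _ 0)) (zeroˡ _))
    (coefₛ-cong R (S.trans (S.*-congʳ tail-t) (S.*-identityˡ b)) n)) (+-identityˡ _))
    where
    tail-t : tailₛ R tₛ S.≈ S.1#
    tail-t = extₛ R λ { zero → trans (coefₛ-mk R _ 0) (trans (coefₛ-mk R _ 1) (sym (coefₛ-1-0 R)))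
                      ; (suc n) → trans (coefₛ-mk R _ (suc n)) (trans (coefₛ-mk R _ (suc (suc n))) (sym (coefₛ-1 R n))) }

  toSeries : Hom (Pol R) (Series R)
  toSeries = eval constₛ tₛ

  coef-toSeries : ∀ a n → coefₛ R (fn toSeries a) n ≈ coef R a n
  coef-toSeries = Pol-ind R _
    (λ e p n → trans (coefₛ-cong R (Hom.cong toSeries (P.sym e)) n) (trans (p n) (coef-cong R e n)))
    (λ n → trans (coefₛ-cong R (0-homo toSeries) n) (trans (coefₛ-0 R n) (sym (coef-0 R n))))
    λ r a IH n → trans (coefₛ-cong R (S.trans (+-homo toSeries _ _) (S.+-cong (eval-const constₛ tₛ r)
      (S.trans (*-homo toSeries _ _) (S.*-congʳ (eval-X constₛ tₛ))))) n) (step r a IH n)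
    where
    module P = CRing (Pol R)
    step : ∀ r a → (∀ n → coefₛ R (fn toSeries a) n ≈ coef R a n) → ∀ n →
      coefₛ R (fn constₛ r S.+ tₛ S.* fn toSeries a) n ≈ coef R (const R r P.+ X R P.* a) n
    step r a IH zero = trans (coefₛ-+ R _ _ 0) (trans (+-cong (coef-constₛ-0 r) (coef-t*-0 _)) (trans (+-identityʳ r) (sym (coef-const+X*-0 R r a))))
    step r a IH (suc n) = trans (coefₛ-+ R _ _ (suc n)) (trans (+-cong (coef-constₛ-suc r n) (coef-t*-suc _ n))
      (trans (+-identityˡ _) (trans (IH n) (sym (coef-const+X* R r a n)))))

  coefₛ-*-local : ∀ n {a a′ b b′} → (∀ i → i ℕ.≤ n → coefₛ R a i ≈ coefₛ R a′ i) → (∀ i → i ℕ.≤ n → coefₛ R b i ≈ coefₛ R b′ i) →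
    coefₛ R (a S.* b) n ≈ coefₛ R (a′ S.* b′) n
  coefₛ-*-local zero p q = trans (coefₛ-*-0 R _ _) (trans (*-cong (p 0 z≤n) (q 0 z≤n)) (sym (coefₛ-*-0 R _ _)))
  coefₛ-*-local (suc n) p q = trans (coefₛ-*-suc R _ _ n) (trans (+-cong (*-cong (p 0 z≤n) (q (suc n) ℕP.≤-refl))
    (coefₛ-*-local n (λ i i≤n → trans (coefₛ-mk R _ i) (trans (p (suc i) (s≤s i≤n)) (sym (coefₛ-mk R _ i)))) (λ i i≤n → q i (ℕP.m≤n⇒m≤1+n i≤n))))
    (sym (coefₛ-*-suc R _ _ n)))

  truncation : ℕ → Congruence (Series R)
  truncation n = record
    { _~_ = λ a b → ∀ i → i ℕ.< n → coefₛ R a i ≈ coefₛ R b i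
    ; fromEq = λ e i _ → coefₛ-cong R e i
    ; ~-sym = λ p i i<n → sym (p i i<n)
    ; ~-trans = λ p q i i<n → trans (p i i<n) (q i i<n)
    ; ~-+ = λ p q i i<n → trans (coefₛ-+ R _ _ i) (trans (+-cong (p i i<n) (q i i<n)) (sym (coefₛ-+ R _ _ i)))
    ; ~-* = λ p q i i<n → coefₛ-*-local i (λ j j≤i → p j (ℕP.≤-<-trans j≤i i<n)) (λ j j≤i → q j (ℕP.≤-<-trans j≤i i<n))
    ; ~-neg = λ p i i<n → trans (coefₛ-neg R _ i) (trans (-‿cong (p i i<n)) (sym (coefₛ-neg R _ i))) }

  truncate : ℕ → ∣ Series R ∣ → ∣ Pol R ∣
  truncate zero a = CRing.0# (Pol R)
  truncate (suc n) a = const R (coefₛ R a 0) P.+ X R P.* truncate n (tailₛ R a)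
    where module P = CRing (Pol R)

  deg<-truncate : ∀ n a → deg< R n (truncate n a)
  deg<-truncate zero a = deg<-0 R 0
  deg<-truncate (suc n) a = deg<-+ R (deg<-const R _ (s≤s z≤n)) (deg<-X* R (deg<-truncate n (tailₛ R a)))

  coef-truncate : ∀ n a i → i ℕ.< n → coef R (truncate n a) i ≈ coefₛ R a i
  coef-truncate (suc n) a zero _ = coef-const+X*-0 R _ _
  coef-truncate (suc n) a (suc i) (s≤s i<n) = trans (coef-const+X* R _ _ i) (trans (coef-truncate n (tailₛ R a) i i<n) (coefₛ-mk R _ i))

  -- Newton's lemma for a polynomial A with A(0) = λ²t(…) and A′(0) = λ(1 + t(…)): after the
  -- substitution Y = λ t z and division by λ²t the equation becomes z = -(c + t Ψ(z)).
  module Hensel (A : ∣ Pol (Series R) ∣) (l : Carrier) (c e : ∣ Series R ∣)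
    (A₀ : coef (Series R) A 0 S.≈ fn constₛ l S.* fn constₛ l S.* (tₛ S.* c))
    (A₁ : coef (Series R) A 1 S.≈ fn constₛ l S.* (S.1# S.+ tₛ S.* e)) where

    private
      I : Hom (Series R) (Series R)
      I = idₕ {Series R}
      L : ∣ Series R ∣
      L = fn constₛ l
      module PS = CRing (Pol (Series R))
      B = tail (Series R) (tail (Series R) A)

      at : ∣ Series R ∣ → Hom (Pol (Series R)) (Series R)
      at y = eval I y

      Ψ Φ : ∣ Series R ∣ → ∣ Series R ∣
      Ψ z = z S.* e S.+ z S.* z S.* fn (at (L S.* (tₛ S.* z))) B
      Φ z = S.- (c S.+ tₛ S.* Ψ z)

      module _ (n : ℕ) where
        open Congruence (truncation n)
        Ψ-local : ∀ {z z′} → z ~ z′ → Ψ z ~ Ψ z′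
        Ψ-local {z} {z′} p = ~-+ {z S.* e} {z′ S.* e} (~-* {z} {z′} p (fromEq {e} S.refl))
          (~-* {z S.* z} {z′ S.* z′} (~-* {z} {z′} {z} {z′} p p) (Pol-hom-ext (toQuotient _ (truncation n) ∘ₕ at y) (toQuotient _ (truncation n) ∘ₕ at y′)
            (λ r → fromEq (S.trans (eval-const I y r) (S.sym (eval-const I y′ r))))
            (~-trans {fn (at y) (X (Series R))} {y} (fromEq (eval-X I y)) (~-trans {y} {y′} (~-* {L} {L} (fromEq {L} S.refl) (~-* {tₛ} {tₛ} (fromEq {tₛ} S.refl) p)) (fromEq (S.sym (eval-X I y′))))) B))
          where
          y = L S.* (tₛ S.* z)
          y′ = L S.* (tₛ S.* z′)

      -- Φ is a contraction: its factor t turns agreement modulo tⁿ into agreement modulo tⁿ⁺¹.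
      Φ-local : ∀ n {z z′} → Congruence._~_ (truncation n) z z′ → Congruence._~_ (truncation (suc n)) (Φ z) (Φ z′)
      Φ-local n {z} {z′} p i i<1+n = trans (coefₛ-neg R _ i) (trans (-‿cong (trans (coefₛ-+ R _ _ i) (trans (+-congˡ (go i i<1+n)) (sym (coefₛ-+ R _ _ i))))) (sym (coefₛ-neg R _ i)))
        where
        go : ∀ i → i ℕ.< suc n → coefₛ R (tₛ S.* Ψ z) i ≈ coefₛ R (tₛ S.* Ψ z′) i
        go zero _ = trans (coef-t*-0 _) (sym (coef-t*-0 _))
        go (suc i) (s≤s i<n) = trans (coef-t*-suc _ i) (trans (Ψ-local n p i i<n) (sym (coef-t*-suc _ i)))

      zs : ℕ → ∣ Series R ∣
      zs zero = S.0#
      zs (suc n) = Φ (zs n)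

      stable : ∀ n → Congruence._~_ (truncation n) (zs (suc n)) (zs n)
      stable (suc n) = Φ-local n (stable n)

    -- The diagonal of the iterates: coefficient n is read from iterate n + 1, from which on it is
    -- constant.
    z : ∣ Series R ∣
    z = mkₛ R λ n → coefₛ R (zs (suc n)) n

    private
      z~zs : ∀ n → Congruence._~_ (truncation n) z (zs n)
      z~zs (suc n) i (s≤s i≤n) with ℕP.m≤n⇒m<n∨m≡n i≤n
      ... | inj₂ ≡.refl = coefₛ-mk R _ i
      ... | inj₁ i<n = trans (z~zs n i i<n) (sym (stable n i i<n))

      fixed : z S.≈ Φ z
      fixed = extₛ R λ n → trans (coefₛ-mk R _ n) (sym (Φ-local n (z~zs n) n ℕP.≤-refl))

    root : fn (at (L S.* (tₛ S.* z))) A S.≈ S.0#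
    root = begin
      fn (at y) A
        ≈⟨ Hom.cong (at y) (PS.trans (Pol-decompose (Series R) A) (PS.+-congˡ (PS.*-congˡ (Pol-decompose (Series R) (tail (Series R) A))))) ⟩
      fn (at y) (const _ (coef _ A 0) PS.+ X _ PS.* (const _ (coef _ (tail _ A) 0) PS.+ X _ PS.* B))
        ≈⟨ expand (coef _ A 0) _ ⟩
      coef _ A 0 S.+ y S.* fn (at y) (const _ (coef _ (tail _ A) 0) PS.+ X _ PS.* B)
        ≈⟨ S.+-cong A₀ (S.*-congˡ (S.trans (expand _ B) (S.+-congʳ (S.trans (coef-tail _ A 0) A₁)))) ⟩
      L S.* L S.* (tₛ S.* c) S.+ y S.* (L S.* (S.1# S.+ tₛ S.* e) S.+ y S.* b)
        ≈⟨ solve 7 (λ L t c z o e b → L :* L :* (t :* c) :+ L :* (t :* z) :* (L :* (o :+ t :* e) :+ L :* (t :* z) :* b)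
             := L :* L :* t :* (o :* z :+ (c :+ t :* (z :* e :+ z :* z :* b)))) S.refl L tₛ c z S.1# e b ⟩
      L S.* L S.* tₛ S.* (S.1# S.* z S.+ (c S.+ tₛ S.* Ψ z))
        ≈⟨ S.*-congˡ (S.trans (S.+-congʳ (S.trans (S.*-identityˡ z) fixed)) (S.-‿inverseˡ _)) ⟩
      L S.* L S.* tₛ S.* S.0#
        ≈⟨ S.zeroʳ _ ⟩
      S.0# ∎
      where
      open SetoidReasoning S.setoid
      open Solver (Series R) using (solve; _:+_; _:*_; _:=_)
      y = L S.* (tₛ S.* z)
      b = fn (at y) B
      expand : ∀ r a → fn (at y) (const _ r PS.+ X _ PS.* a) S.≈ r S.+ y S.* fn (at y) a
      expand r a = S.trans (+-homo (at y) _ _) (S.+-cong (eval-const I y r) (S.trans (*-homo (at y) _ _) (S.*-congʳ (eval-X I y))))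

module _ {R S : Ring} (h : Hom R S) where
  private
    module R = CRing R
    module S = CRing S
    f : ∣ Series R ∣ → ∣ Series S ∣
    f a = mkₛ S λ n → fn h (coefₛ R a n)

    f-* : ∀ n a b → fn h (coefₛ R (CRing._*_ (Series R) a b) n) S.≈ coefₛ S (CRing._*_ (Series S) (f a) (f b)) n
    f-* zero a b = S.trans (Hom.cong h (coefₛ-*-0 R a b)) (S.trans (*-homo h _ _)
      (S.sym (S.trans (coefₛ-*-0 S _ _) (S.*-cong (coefₛ-mk S _ 0) (coefₛ-mk S _ 0)))))
    f-* (suc n) a b = S.trans (Hom.cong h (coefₛ-*-suc R a b n)) (S.trans (+-homo h _ _) (S.trans (S.+-cong (*-homo h _ _) (f-* n (tailₛ R a) b))
      (S.sym (S.trans (coefₛ-*-suc S _ _ n) (S.+-cong (S.*-cong (coefₛ-mk S _ 0) (coefₛ-mk S _ (suc n)))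
        (coefₛ-*-local S n (λ i _ → S.trans (coefₛ-mk S _ i) (S.trans (coefₛ-mk S _ (suc i)) (S.sym (S.trans (coefₛ-mk S _ i) (Hom.cong h (coefₛ-mk R _ i))))))
           (λ _ _ → S.refl)))))))

  mapₛ : Hom (Series R) (Series S)
  mapₛ = record
    { fn = f
    ; cong = λ p → extₛ S λ n → S.trans (coefₛ-mk S _ n) (S.trans (Hom.cong h (coefₛ-cong R p n)) (S.sym (coefₛ-mk S _ n)))
    ; +-homo = λ a b → extₛ S λ n → S.trans (coefₛ-mk S _ n) (S.trans (Hom.cong h (coefₛ-+ R a b n)) (S.trans (+-homo h _ _)
        (S.sym (S.trans (coefₛ-+ S _ _ n) (S.+-cong (coefₛ-mk S _ n) (coefₛ-mk S _ n))))))
    ; *-homo = λ a b → extₛ S λ n → S.trans (coefₛ-mk S _ n) (f-* n a b)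
    ; 1-homo = extₛ S λ { zero → S.trans (coefₛ-mk S _ 0) (S.trans (Hom.cong h (coefₛ-1-0 R)) (S.trans (1-homo h) (S.sym (coefₛ-1-0 S))))
                        ; (suc n) → S.trans (coefₛ-mk S _ (suc n)) (S.trans (Hom.cong h (coefₛ-1 R n)) (S.trans (0-homo h) (S.sym (coefₛ-1 S n)))) } }

  coef-mapₛ : ∀ a n → coefₛ S (fn mapₛ a) n S.≈ fn h (coefₛ R a n)
  coef-mapₛ a n = coefₛ-mk S _ n

  mapₚ : Hom (Pol R) (Pol S)
  mapₚ = eval (constₕ S ∘ₕ h) (X S)

  mapₚ-const : ∀ r → CRing._≈_ (Pol S) (fn mapₚ (const R r)) (const S (fn h r))
  mapₚ-const = eval-const (constₕ S ∘ₕ h) (X S)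

  mapₚ-X : CRing._≈_ (Pol S) (fn mapₚ (X R)) (X S)
  mapₚ-X = eval-X (constₕ S ∘ₕ h) (X S)

  coef-mapₚ : ∀ a n → coef S (fn mapₚ a) n S.≈ fn h (coef R a n)
  coef-mapₚ = Pol-ind R _
    (λ e p n → S.trans (coef-cong S (Hom.cong mapₚ (P.sym e)) n) (S.trans (p n) (Hom.cong h (coef-cong R e n))))
    (λ n → S.trans (coef-cong S (0-homo mapₚ) n) (S.trans (coef-0 S n) (S.sym (S.trans (Hom.cong h (coef-0 R n)) (0-homo h)))))
    λ r a IH n → S.trans (coef-cong S (Q.trans (+-homo mapₚ _ _) (Q.+-cong (mapₚ-const r)
      (Q.trans (*-homo mapₚ _ _) (Q.*-congʳ mapₚ-X)))) n) (step r a IH n)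
    where
    module P = CRing (Pol R)
    module Q = CRing (Pol S)
    step : ∀ r a → (∀ n → coef S (fn mapₚ a) n S.≈ fn h (coef R a n)) → ∀ n →
      coef S (const S (fn h r) Q.+ X S Q.* fn mapₚ a) n S.≈ fn h (coef R (const R r P.+ X R P.* a) n)
    step r a IH zero = S.trans (coef-const+X*-0 S _ _) (Hom.cong h (R.sym (coef-const+X*-0 R r a)))
    step r a IH (suc n) = S.trans (coef-const+X* S _ _ n) (S.trans (IH n) (Hom.cong h (R.sym (coef-const+X* R r a n))))

  deg<-mapₚ : ∀ {n a} → deg< R n a → deg< S n (fn mapₚ a)
  deg<-mapₚ d i n≤i = S.trans (coef-mapₚ _ i) (S.trans (Hom.cong h (d i n≤i)) (0-homo h))

  Top-mapₚ : ∀ {k v a} → Top R k v a → Top S k (fn h v) (fn mapₚ a)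
  Top-mapₚ (mkTop p d) = mkTop (S.trans (coef-mapₚ _ _) (Hom.cong h p)) (deg<-mapₚ d)

-- Dual functionals

module _ (R : Ring) where
  open CRing R
  open Sums R

  dot : List Carrier → (ℕ → Carrier) → Carrier
  dot [] v = 0#
  dot (c ∷ l) v = c * v 0 + dot l (v ∘ suc)

  -- Finitely supported functionals with lᵢ(bⱼ) = Δ·δᵢⱼ. The single denominator Δ replaces the
  -- inverse of a minor, so the data can be mapped along any homomorphism and remain useful as long
  -- as Δ stays nonzero.
  record Dual {K : ℕ} (b : Fin K → ℕ → Carrier) : Set where
    field
      Δ : Carrier
      l : Fin K → List Carrier
      diag : ∀ i → dot (l i) (b i) ≈ Δ
      off : ∀ i j → i ≢ j → dot (l i) (b j) ≈ 0#

  dot-local : ∀ l {u v} → (∀ k → k ℕ.< List.length l → u k ≈ v k) → dot l u ≈ dot l v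
  dot-local [] e = refl
  dot-local (c ∷ l) e = +-cong (*-congˡ (e 0 (s≤s z≤n))) (dot-local l λ k k<l → e (suc k) (s≤s k<l))

  dot-cong : ∀ l {u v} → (∀ k → u k ≈ v k) → dot l u ≈ dot l v
  dot-cong l e = dot-local l λ k _ → e k

  open Solver R using (solve; _:+_; _:*_; :-_; _:=_)

  dot-+ : ∀ l u v → dot l (λ k → u k + v k) ≈ dot l u + dot l v
  dot-+ [] u v = sym (+-identityˡ 0#)
  dot-+ (c ∷ l) u v = trans (+-congˡ (dot-+ l (u ∘ suc) (v ∘ suc)))
    (solve 5 (λ c u v x y → c :* (u :+ v) :+ (x :+ y) := (c :* u :+ x) :+ (c :* v :+ y)) refl c (u 0) (v 0) _ _)

  dot-* : ∀ l a v → dot l (λ k → a * v k) ≈ a * dot l v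
  dot-* [] a v = sym (zeroʳ a)
  dot-* (c ∷ l) a v = trans (+-congˡ (dot-* l a (v ∘ suc)))
    (solve 4 (λ c a v x → c :* (a :* v) :+ a :* x := a :* (c :* v :+ x)) refl c a (v 0) _)

  dot-0 : ∀ l → dot l (λ _ → 0#) ≈ 0#
  dot-0 [] = refl
  dot-0 (c ∷ l) = trans (+-cong (zeroʳ c) (dot-0 l)) (+-identityˡ 0#)

  dot-sum : ∀ l {n} (c : Fin n → Carrier) (v : Fin n → ℕ → Carrier) →
    dot l (λ k → sum (λ j → c j * v j k)) ≈ sum (λ j → c j * dot l (v j))
  dot-sum l {zero} c v = dot-0 l
  dot-sum l {suc n} c v = trans (dot-+ l (λ k → c zero * v zero k) (λ k → sum (λ j → c (suc j) * v (suc j) k)))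
    (+-cong (dot-* l (c zero) (v zero)) (dot-sum l (c ∘ suc) (v ∘ suc)))

  private
    scaleᴸ : Carrier → List Carrier → List Carrier
    scaleᴸ a = List.map (a *_)

    dot-scale : ∀ a l v → dot (scaleᴸ a l) v ≈ a * dot l v
    dot-scale a [] v = sym (zeroʳ a)
    dot-scale a (c ∷ l) v = trans (+-cong (*-assoc _ _ _) (dot-scale a l (v ∘ suc))) (sym (distribˡ _ _ _))

    addᴸ : List Carrier → List Carrier → List Carrier
    addᴸ = _+ᴸ_ R

    dot-add : ∀ l l′ v → dot (addᴸ l l′) v ≈ dot l v + dot l′ v
    dot-add [] l′ v = sym (+-identityˡ _)
    dot-add (c ∷ l) [] v = sym (+-identityʳ _)
    dot-add (c ∷ l) (d ∷ l′) v = trans (+-congˡ (dot-add l l′ (v ∘ suc)))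
      (solve 5 (λ c d v x y → (c :+ d) :* v :+ (x :+ y) := (c :* v :+ x) :+ (d :* v :+ y)) refl c d (v 0) _ _)

    unit : ℕ → List Carrier
    unit zero = 1# ∷ []
    unit (suc k) = 0# ∷ unit k

    dot-unit : ∀ k v → dot (unit k) v ≈ v k
    dot-unit zero v = trans (+-identityʳ _) (*-identityˡ _)
    dot-unit (suc k) v = trans (+-cong (zeroˡ _) (dot-unit k (v ∘ suc))) (+-identityˡ _)

    sumᴸ : ∀ {n} → (Fin n → List Carrier) → List Carrier
    sumᴸ {zero} g = []
    sumᴸ {suc n} g = addᴸ (g zero) (sumᴸ (g ∘ suc))

    dot-sumᴸ : ∀ {n} (g : Fin n → List Carrier) v → dot (sumᴸ g) v ≈ sum (λ j → dot (g j) v)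
    dot-sumᴸ {zero} g v = refl
    dot-sumᴸ {suc n} g v = trans (dot-add (g zero) _ v) (+-congˡ (dot-sumᴸ (g ∘ suc) v))

  -- A positive form of independence: a nontrivial combination comes with a position k where it is
  -- nonzero. The pivots of `dual` are found in this way.
  Independent : ∀ {K} → (Fin K → ℕ → Carrier) → Set
  Independent {K} b = ∀ (c : Fin K → Carrier) i → ¬ c i ≈ 0# → ∃ λ k → ¬ sum (λ j → c j * b j k) ≈ 0#

  module _ (dom : Domain R) where
    open Domain dom

    -- Elimination without division. A pivot π of the first vector clears its column from the
    -- others, giving b′; the functionals dual to b′, with denominator Δ′, extend to functionals
    -- dual to b with denominator πΔ′.
    dual : ∀ {K} (b : Fin K → ℕ → Carrier) → Independent b → ∃ λ (d : Dual b) → ¬ Dual.Δ d ≈ 0#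
    dual {zero} b ind = record { Δ = 1# ; l = λ () ; diag = λ () ; off = λ () } , 1≉0
    dual {suc K} b ind = record { Δ = π * Δ′ ; l = l ; diag = diag ; off = off } , *-nonzero π≉0 Δ′≉0
      where
      e₀ : Fin (suc K) → Carrier
      e₀ zero = 1#
      e₀ (suc _) = 0#
      pivot = ind e₀ zero 1≉0
      κ = proj₁ pivot
      π = b zero κ
      π≉0 : ¬ π ≈ 0#
      π≉0 z = proj₂ pivot (trans (+-cong (trans (*-identityˡ _) z) (sum-0 (λ j → e₀ (suc j) * b (suc j) κ) λ j → zeroˡ (b (suc j) κ))) (+-identityˡ 0#))
      b′ : Fin K → ℕ → Carrier
      b′ i k = π * b (suc i) k + - b (suc i) κ * b zero k
      ind′ : Independent b′
      ind′ c i c≉0 = proj₁ r , λ z → proj₂ r (trans (comb (proj₁ r)) z)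
        where
        open SetoidReasoning setoid
        c⁺ : Fin (suc K) → Carrier
        c⁺ zero = sum (λ j → c j * - b (suc j) κ)
        c⁺ (suc j) = π * c j
        r = ind c⁺ (suc i) (*-nonzero π≉0 c≉0)
        comb : ∀ k → sum (λ j → c⁺ j * b j k) ≈ sum (λ j → c j * b′ j k)
        comb k = begin
          c⁺ zero * b zero k + sum (λ j → π * c j * b (suc j) k)
            ≈⟨ +-congʳ (trans (*-comm _ _) (sum-*ˡ (b zero k) (λ j → c j * - b (suc j) κ))) ⟩
          sum (λ j → b zero k * (c j * - b (suc j) κ)) + sum (λ j → π * c j * b (suc j) k)
            ≈⟨ sum-+ (λ j → b zero k * (c j * - b (suc j) κ)) (λ j → π * c j * b (suc j) k) ⟨
          sum (λ j → b zero k * (c j * - b (suc j) κ) + π * c j * b (suc j) k)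
            ≈⟨ sum-cong (λ j → b zero k * (c j * - b (suc j) κ) + π * c j * b (suc j) k) (λ j → c j * b′ j k) (λ j → solve 5 (λ z c d p b → z :* (c :* :- d) :+ p :* c :* b := c :* (p :* b :+ :- d :* z)) refl (b zero k) (c j) (b (suc j) κ) π (b (suc j) k)) ⟩
          sum (λ j → c j * b′ j k) ∎
      rec = dual b′ ind′
      module D = Dual (proj₁ rec)
      Δ′ = D.Δ
      Δ′≉0 = proj₂ rec
      -- π·lᵢ is corrected by a multiple of the κ-th coordinate so that it kills the first vector;
      -- on the (j + 1)-st it then takes the value of lᵢ on b′ⱼ.
      ls : Fin K → List Carrier
      ls i = addᴸ (scaleᴸ π (D.l i)) (scaleᴸ (- dot (D.l i) (b zero)) (unit κ))
      dot-ls : ∀ i v → dot (ls i) v ≈ π * dot (D.l i) v + - dot (D.l i) (b zero) * v κ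
      dot-ls i v = trans (dot-add (scaleᴸ π (D.l i)) _ v) (+-cong (dot-scale π (D.l i) v) (trans (dot-scale _ (unit κ) v) (*-congˡ (dot-unit κ v))))
      ls-zero : ∀ i → dot (ls i) (b zero) ≈ 0#
      ls-zero i = trans (dot-ls i (b zero)) (trans (+-congˡ (trans (sym (RingProps.-‿distribˡ-* ring _ _)) (-‿cong (*-comm _ _)))) (-‿inverseʳ _))
      ls-suc : ∀ i j → dot (ls i) (b (suc j)) ≈ dot (D.l i) (b′ j)
      ls-suc i j = trans (dot-ls i (b (suc j))) (sym (trans (dot-+ (D.l i) (λ k → π * b (suc j) k) (λ k → - b (suc j) κ * b zero k))
        (+-cong (dot-* (D.l i) π (b (suc j))) (trans (dot-* (D.l i) (- b (suc j) κ) (b zero))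
          (solve 2 (λ x y → :- x :* y := :- y :* x) refl (b (suc j) κ) (dot (D.l i) (b zero)))))))
      -- Δ′ times the κ-th coordinate has the right value πΔ′ on the first vector; its values on the
      -- other vectors are removed by means of `ls`.
      l₀ : List Carrier
      l₀ = addᴸ (scaleᴸ Δ′ (unit κ)) (sumᴸ λ i → scaleᴸ (- b (suc i) κ) (ls i))
      dot-l₀ : ∀ v → dot l₀ v ≈ Δ′ * v κ + sum (λ i → - b (suc i) κ * dot (ls i) v)
      dot-l₀ v = trans (dot-add (scaleᴸ Δ′ (unit κ)) _ v) (+-cong (trans (dot-scale Δ′ (unit κ) v) (*-congˡ (dot-unit κ v)))
        (trans (dot-sumᴸ (λ i → scaleᴸ (- b (suc i) κ) (ls i)) v) (sum-cong (λ i → dot (scaleᴸ (- b (suc i) κ) (ls i)) v) (λ i → - b (suc i) κ * dot (ls i) v) λ i → dot-scale (- b (suc i) κ) (ls i) v)))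
      l : Fin (suc K) → List Carrier
      l zero = l₀
      l (suc i) = scaleᴸ π (ls i)
      diag : ∀ i → dot (l i) (b i) ≈ π * Δ′
      diag zero = trans (dot-l₀ (b zero)) (trans (+-cong (*-comm _ _) (sum-0 (λ i → - b (suc i) κ * dot (ls i) (b zero)) λ i → trans (*-congˡ (ls-zero i)) (zeroʳ _))) (+-identityʳ _))
      diag (suc i) = trans (dot-scale π (ls i) (b (suc i))) (*-congˡ (trans (ls-suc i i) (D.diag i)))
      off : ∀ i j → i ≢ j → dot (l i) (b j) ≈ 0#
      off zero zero ne = ⊥-elim (ne ≡.refl)
      off zero (suc j) ne = trans (dot-l₀ (b (suc j))) (trans (+-cong (*-comm _ _) (trans
        (sum-single (λ i → - b (suc i) κ * dot (ls i) (b (suc j))) j (λ i j≢i → trans (*-congˡ (trans (ls-suc i j) (D.off i j (λ e → j≢i (≡.sym e))))) (zeroʳ _)))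
        (trans (*-congˡ (trans (ls-suc j j) (D.diag j))) (sym (RingProps.-‿distribˡ-* ring _ _))))) (-‿inverseʳ _))
      off (suc i) zero ne = trans (dot-scale π (ls i) (b zero)) (trans (*-congˡ (ls-zero i)) (zeroʳ π))
      off (suc i) (suc j) ne = trans (dot-scale π (ls i) (b (suc j))) (trans (*-congˡ (trans (ls-suc i j) (D.off i j (λ e → ne (≡.cong suc e))))) (zeroʳ π))

  -- Reads a coefficient off a combination, up to the factor Δ. Later this shows coefficients to be
  -- 0, bounds them, or recovers θ from the coordinates of a point.
  dual-sum : ∀ {K} {b : Fin K → ℕ → Carrier} (d : Dual b) (c : Fin K → Carrier) i →
    dot (Dual.l d i) (λ k → sum (λ j → c j * b j k)) ≈ Dual.Δ d * c i
  dual-sum {b = b} d c i = trans (dot-sum (l i) c b) (trans (sum-single (λ j → c j * dot (l i) (b j)) i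
    (λ j i≢j → trans (*-congˡ (off i j i≢j)) (zeroʳ _))) (trans (*-congˡ (diag i)) (*-comm _ _)))
    where open Dual d

module _ {R S : Ring} (h : Hom R S) where
  private
    module S = CRing S

  dot-homo : ∀ l v → fn h (dot R l v) S.≈ dot S (List.map (fn h) l) (fn h ∘ v)
  dot-homo [] v = 0-homo h
  dot-homo (c ∷ l) v = S.trans (+-homo h _ _) (S.+-cong (*-homo h _ _) (dot-homo l (v ∘ suc)))

  Dual-map : ∀ {K} {b : Fin K → ℕ → ∣ R ∣} → Dual R b → Dual S (λ i k → fn h (b i k))
  Dual-map {b = b} d = record
    { Δ = fn h Δ
    ; l = λ i → List.map (fn h) (l i)
    ; diag = λ i → S.trans (S.sym (dot-homo (l i) (b i))) (Hom.cong h (diag i))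
    ; off = λ i j ne → S.trans (S.sym (dot-homo (l i) (b j))) (S.trans (Hom.cong h (off i j ne)) (0-homo h)) }
    where open Dual d

  Dual-cong : ∀ {K} {b b′ : Fin K → ℕ → ∣ S ∣} → (∀ i k → b i k S.≈ b′ i k) → Dual S b → Dual S b′
  Dual-cong e d = record { Δ = Δ ; l = l ; diag = λ i → S.trans (dot-cong S (l i) (λ k → S.sym (e i k))) (diag i)
                         ; off = λ i j ne → S.trans (dot-cong S (l i) (λ k → S.sym (e j k))) (off i j ne) }
    where open Dual d

-- Nonvanishing at integer points

-- By Horner's scheme: a positive integral root divides a nonzero constant term and so is bounded by
-- it; a zero constant term is divided out.
nonzero-large : ∀ a → ¬ CRing._≈_ (Pol ℤR) a (CRing.0# (Pol ℤR)) →
  ∃ λ B → ∀ k → B ℕ.< k → fn (eval {ℤR} idₕ (+ k)) a ≢ + 0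
nonzero-large = Pol-ind ℤR _
  (λ e p b≉0 → let (B , q) = p (λ z → b≉0 (P.trans (P.sym e) z)) in B , λ k B<k z → q k B<k (≡.trans (Hom.cong (at k) e) z))
  (λ z → ⊥-elim (z P.refl))
  step
  where
  module P = CRing (Pol ℤR)
  at : ∀ k → Hom (Pol ℤR) ℤR
  at k = eval {ℤR} idₕ (+ k)
  at-step : ∀ k r a → fn (at k) (const ℤR r P.+ X ℤR P.* a) ≡ r ℤ.+ + k ℤ.* fn (at k) a
  at-step k r a = ≡.trans (+-homo (at k) (const ℤR r) (X ℤR P.* a)) (≡.cong₂ ℤ._+_ (eval-const {ℤR} idₕ (+ k) r)
    (≡.trans (*-homo (at k) (X ℤR) a) (≡.cong (λ x → x ℤ.* fn (at k) a) (eval-X {ℤR} idₕ (+ k)))))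
  step : ∀ r a → (¬ a P.≈ P.0# → ∃ λ B → ∀ k → B ℕ.< k → fn (at k) a ≢ + 0) →
    ¬ (const ℤR r P.+ X ℤR P.* a) P.≈ P.0# → ∃ λ B → ∀ k → B ℕ.< k → fn (at k) (const ℤR r P.+ X ℤR P.* a) ≢ + 0
  step r a IH nz with r ℤP.≟ + 0
  ... | yes ≡.refl = let (B , q) = IH (λ a≈0 → nz (P.trans (P.+-cong (0-homo (constₕ ℤR)) (P.trans (P.*-congˡ a≈0) (P.zeroʳ _))) (P.+-identityˡ _))) in
    B , λ k B<k z → q k B<k (Domain.*-cancel ℤ-domain {+ k} (λ e → ℕP.<⇒≢ (ℕP.≤-<-trans z≤n B<k) (≡.sym (ℤP.+-injective e)))
      (≡.trans (≡.trans (≡.sym (ℤP.+-identityˡ _)) (≡.sym (at-step k (+ 0) a))) (≡.trans z (≡.sym (ℤP.*-zeroʳ (+ k))))))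
  ... | no r≢0 = ℤ.∣ r ∣ , λ k B<k z → ℕP.<⇒≱ B<k (ℕ∣.∣⇒≤ ⦃ ℕ.≢-nonZero (λ e → r≢0 (ℤP.∣i∣≡0⇒i≡0 e)) ⦄
      (∣⇒∣ᵤ {+ k} {r} (ℤ.- fn (at k) a , neg k (≡.trans (≡.sym (at-step k r a)) z))))
    where
    neg : ∀ k → r ℤ.+ + k ℤ.* fn (at k) a ≡ + 0 → + k ℤ.* (ℤ.- fn (at k) a) ≡ r
    neg k e = ≡.trans (≡.sym (ℤP.neg-distribʳ-* (+ k) _)) (≡.sym (RingProps.+-inverseˡ-unique (CRing.ring ℤR) r _ e))

-- The last variables are specialised so that the leading coefficient in the first one survives;
-- then the first variable is taken large.
nonzero-point : ∀ m a → ¬ CRing._≈_ (Zm m) a (CRing.0# (Zm m)) → ∃ λ ξ → fn (evZ {m} ℤR ξ) a ≢ + 0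
nonzero-point zero a a≉0 = (λ ()) , λ e → a≉0 (≡.trans (≡.sym (ι-ℤ a)) e)
nonzero-point (suc m) a a≉0 = ξ , λ z → proj₂ lg (suc (proj₁ lg)) ℕP.≤-refl (≡.trans
    (Pol-hom-ext (eval {ℤR} idₕ k ∘ₕ mapₚ h) (evZ ℤR ξ)
      (λ r → ≡.trans (Hom.cong (eval {ℤR} idₕ k) (mapₚ-const h r)) (≡.trans (eval-const {ℤR} idₕ k (fn h r)) (≡.sym (eval-const h k r))))
      (≡.trans (Hom.cong (eval {ℤR} idₕ k) (mapₚ-X h)) (≡.trans (eval-X {ℤR} idₕ k) (≡.sym (eval-X h k)))) a) z)
  where
  top = topOf (Zm-domain m) a a≉0
  pt = nonzero-point m (coef (Zm m) a (proj₁ top)) (proj₁ (proj₂ top))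
  h : Hom (Zm m) ℤR
  h = evZ ℤR (proj₁ pt)
  lg = nonzero-large (fn (mapₚ h) a) λ z → proj₂ pt (≡.trans (≡.sym (coef-mapₚ h a (proj₁ top))) (≡.trans (coef-cong ℤR z (proj₁ top)) (coef-0 ℤR (proj₁ top))))
  k = + suc (proj₁ lg)
  ξ : Fin (suc m) → ℤ
  ξ zero = k
  ξ (suc i) = proj₁ pt i

-- Derivatives and Bézout relations

module _ {R S : Ring} (h : Hom R S) where
  private
    module R = CRing R
    module S = CRing S
    module P = CRing (Pol R)

  -- The coefficients are recorded together with the expansion because they show that the derivative
  -- has smaller degree and is nonzero in characteristic 0.
  derivative : ∀ a → ∃ λ a′ → (∀ i → coef R a′ i R.≈ fn (ι R) (+ suc i) R.* coef R a (suc i)) ×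
    (∀ y z → ∃ λ r → fn (eval h (y S.+ z)) a S.≈ fn (eval h y) a S.+ z S.* (fn (eval h y) a′ S.+ z S.* r))
  derivative = Pol-ind R _
    (λ e (a′ , p , q) → a′ , (λ i → R.trans (p i) (R.*-congˡ (coef-cong R e (suc i)))) ,
      λ y z → proj₁ (q y z) , S.trans (Hom.cong (eval h (y S.+ z)) (P.sym e)) (S.trans (proj₂ (q y z)) (S.+-congʳ (Hom.cong (eval h y) e))))
    (P.0# , (λ i → R.trans (coef-0 R i) (R.sym (R.trans (R.*-congˡ (coef-0 R (suc i))) (R.zeroʳ _)))) ,
      λ y z → S.0# , S.trans (0-homo (eval h (y S.+ z))) (S.sym (S.trans (S.+-cong (0-homo (eval h y))
        (S.trans (S.*-congˡ (S.trans (S.+-cong (0-homo (eval h y)) (S.zeroʳ z)) (S.+-identityˡ _))) (S.zeroʳ z))) (S.+-identityˡ _))))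
    λ r a (a′ , p , q) → a P.+ X R P.* a′ , coefs r a a′ p , λ y z → taylorStep r a a′ y z (q y z)
    where
    coefs : ∀ r a a′ → (∀ i → coef R a′ i R.≈ fn (ι R) (+ suc i) R.* coef R a (suc i)) →
      ∀ i → coef R (a P.+ X R P.* a′) i R.≈ fn (ι R) (+ suc i) R.* coef R (const R r P.+ X R P.* a) (suc i)
    coefs r a a′ p zero = R.trans (coef-+ R _ _ 0) (R.trans (R.+-congˡ (coef-X*-0 R a′)) (R.trans (R.+-identityʳ _)
      (R.sym (R.trans (R.*-cong (1-homo (ι R)) (coef-const+X* R r a 0)) (R.*-identityˡ _)))))
    coefs r a a′ p (suc i) = R.trans (coef-+ R _ _ (suc i)) (R.trans (R.+-congˡ (R.trans (coef-X*-suc R a′ i) (p i)))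
      (R.sym (R.trans (R.*-cong (+-homo (ι R) (+ 1) (+ suc i)) (coef-const+X* R r a (suc i)))
        (R.trans (R.distribʳ _ _ _) (R.+-congʳ (R.trans (R.*-congʳ (1-homo (ι R))) (R.*-identityˡ _)))))))
    expand : ∀ r a y → fn (eval h y) (const R r P.+ X R P.* a) S.≈ fn h r S.+ y S.* fn (eval h y) a
    expand r a y = S.trans (+-homo (eval h y) _ _) (S.+-cong (eval-const h y r) (S.trans (*-homo (eval h y) _ _) (S.*-congʳ (eval-X h y))))
    taylorStep : ∀ r a a′ y z → (∃ λ q → fn (eval h (y S.+ z)) a S.≈ fn (eval h y) a S.+ z S.* (fn (eval h y) a′ S.+ z S.* q)) →
      ∃ λ q → fn (eval h (y S.+ z)) (const R r P.+ X R P.* a) S.≈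
        fn (eval h y) (const R r P.+ X R P.* a) S.+ z S.* (fn (eval h y) (a P.+ X R P.* a′) S.+ z S.* q)
    taylorStep r a a′ y z (q , e) = fn (eval h y) a′ S.+ z S.* q S.+ y S.* q , (begin
      fn (eval h (y S.+ z)) (const R r P.+ X R P.* a) ≈⟨ expand r a (y S.+ z) ⟩
      fn h r S.+ (y S.+ z) S.* fn (eval h (y S.+ z)) a ≈⟨ S.+-congˡ (S.*-congˡ e) ⟩
      fn h r S.+ (y S.+ z) S.* (A S.+ z S.* (A′ S.+ z S.* q))
        ≈⟨ solve 6 (λ r y z A A′ q → r :+ (y :+ z) :* (A :+ z :* (A′ :+ z :* q)) :=
             (r :+ y :* A) :+ z :* ((A :+ y :* A′) :+ z :* (A′ :+ z :* q :+ y :* q))) S.refl (fn h r) y z A A′ q ⟩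
      (fn h r S.+ y S.* A) S.+ z S.* ((A S.+ y S.* A′) S.+ z S.* (A′ S.+ z S.* q S.+ y S.* q))
        ≈⟨ S.+-cong (expand r a y) (S.*-congˡ (S.+-congʳ (S.trans (+-homo (eval h y) _ _)
             (S.+-congˡ (S.trans (*-homo (eval h y) _ _) (S.*-congʳ (eval-X h y))))))) ⟨
      fn (eval h y) (const R r P.+ X R P.* a) S.+ z S.* (fn (eval h y) (a P.+ X R P.* a′) S.+ z S.* (A′ S.+ z S.* q S.+ y S.* q)) ∎)
      where
      open SetoidReasoning S.setoid
      open Solver S using (solve; _:+_; _:*_; _:=_)
      A = fn (eval h y) a
      A′ = fn (eval h y) a′

module _ {R : Ring} (dom : Domain R) where
  private
    module R = CRing R
    module dom = Domain dom
  open CRing (Pol R)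
  open SemiringExp R.semiring using (_^_)
  open Solver (Pol R) using (solve; _:+_; _:*_; :-_; _:=_)

  -- Irreducibility over the fraction field without fractions: two nonzero polynomials of degree
  -- below n never have a product divisible by F. Constants H cover the factorisations of F with
  -- denominators.
  NoFactor : ℕ → ∣ Pol R ∣ → Set
  NoFactor n F = ∀ H B C → F * H ≈ B * C → deg< R n B → deg< R n C → ¬ B ≈ 0# → ¬ C ≈ 0# → ⊥

  -- Euclid's algorithm in the ideal (F, B). A nonconstant element E of degree below n leaves a
  -- nonzero remainder of F, since vᴺF = QE is excluded by `NoFactor`; the degree falls until a
  -- constant r is reached.
  bezout : ∀ {n c F} → ¬ c R.≈ R.0# → Top R n c F → NoFactor n F → ∀ B → deg< R n B → ¬ B ≈ 0# →
    ∃ λ a → ∃ λ b → ∃ λ r → ¬ r R.≈ R.0# × const R r ≈ a * F + b * B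
  bezout {n} {c} {F} c≉0 t irr B dB B≉0 with findTop dom n B dB
  ... | inj₂ z = ⊥-elim (B≉0 z)
  ... | inj₁ (j₀ , j₀<n , nz₀ , d₀) = <-rec Goal step j₀ B 0# 1# _ j₀<n nz₀ (mkTop R.refl d₀)
      (sym (trans (+-cong (zeroˡ F) (*-identityˡ B)) (+-identityˡ B)))
    where
    Goal : ℕ → Set
    Goal j = ∀ E a b v → j ℕ.< n → ¬ v R.≈ R.0# → Top R j v E → E ≈ a * F + b * B →
      ∃ λ a → ∃ λ b → ∃ λ r → ¬ r R.≈ R.0# × const R r ≈ a * F + b * B
    step : ∀ j → (∀ {i} → i ℕ.< j → Goal i) → Goal j
    step zero rec E a b v j<n v≉0 s e = a , b , v , v≉0 , trans (sym const-E) e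
      where
      const-E : E ≈ const R v
      const-E = ext R λ { zero → R.trans (lead s) (R.sym (coef-const-0 R v)) ; (suc i) → R.trans (degᵗ s (suc i) (s≤s z≤n)) (R.sym (coef-const-suc R v i)) }
    step (suc j) rec E a b v j<n v≉0 s e with pseudoDivide R s (suc n) F (degᵗ t)
    ... | N , Q , Z , f , dZ with findTop dom (suc j) Z dZ
    ... | inj₁ (i , i<j , nz , d) = rec i<j Z (const R (v ^ N) + - (Q * a)) (- (Q * b)) _ (ℕP.<-trans i<j j<n) nz (mkTop R.refl d) (begin
        Z ≈⟨ solve 2 (λ Z y → Z := (y :+ Z) :+ :- y) refl Z (Q * E) ⟩
        (Q * E + Z) + - (Q * E) ≈⟨ +-cong (sym f) (-‿cong (*-congˡ e)) ⟩
        const R (v ^ N) * F + - (Q * (a * F + b * B))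
          ≈⟨ solve 6 (λ r F Q a b G → r :* F :+ :- (Q :* (a :* F :+ b :* G)) := (r :+ :- (Q :* a)) :* F :+ :- (Q :* b) :* G) refl _ F Q a b B ⟩
        (const R (v ^ N) + - (Q * a)) * F + - (Q * b) * B ∎)
      where open SetoidReasoning setoid
    ... | inj₂ Z≈0 = ⊥-elim (contra (Top-factor dom (dom.*-nonzero (dom.^-nonzero N v≉0) c≉0) topQE))
      where
      QE : const R (v ^ N) * F ≈ Q * E
      QE = trans f (trans (+-congˡ Z≈0) (+-identityʳ _))
      topQE : Top R n (v ^ N R.* c) (Q * E)
      topQE = Top-cong R R.refl QE (Top-* R 0 (Top-const R (v ^ N)) t)
      contra : (∃ λ k → ∃ λ l → k ℕ.+ l ≡ n × (¬ coef R Q k R.≈ R.0# × Top R k (coef R Q k) Q) × (¬ coef R E l R.≈ R.0# × Top R l (coef R E l) E)) → ⊥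
      contra (k , l , k+l , (nQ , tQ) , (nE , tE)) with Top-unique dom nE v≉0 tE s
      ... | ≡.refl = irr (const R (v ^ N)) Q E (trans (*-comm _ _) QE)
        (Top-deg< R tQ (≡.subst (k ℕ.<_) k+l (ℕP.m<m+n k (s≤s z≤n)))) (Top-deg< R s j<n) (Top⇒≉0 dom nQ tQ) (Top⇒≉0 dom v≉0 s)

-- Curves through P

module _ (S : Ring) where
  open CRing S
  private
    module Pₛ = CRing (Pol S)
  open SemiringExp Pₛ.semiring using (_^_)

  at0 : Hom (Pol S) S
  at0 = eval (idₕ {S}) 0#

  at0-coef : ∀ a → fn at0 a ≈ coef S a 0
  at0-coef a = trans (Hom.cong at0 (Pol-decompose S a)) (trans (+-homo at0 _ _) (trans (+-cong (eval-const (idₕ {S}) 0# _)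
    (trans (*-homo at0 _ _) (trans (*-congʳ (eval-X (idₕ {S}) 0#)) (zeroˡ _)))) (+-identityʳ _)))

  Top-X^* : ∀ n v → Top S n v (X S ^ n Pₛ.* const S v)
  Top-X^* n v = mkTop
    (trans (reflexive (≡.cong (coef S (X S ^ n Pₛ.* const S v)) (≡.sym (ℕP.+-identityʳ n)))) (trans (coef-X^* S n (const S v) 0) (coef-const-0 S v)))
    (deg<-mono S (ℕP.≤-reflexive (ℕP.+-comm n 1)) (deg<-X^* S n (deg<-const S v (s≤s z≤n))))

  deg<-*const : ∀ {n a} r → deg< S n a → deg< S n (a Pₛ.* const S r)
  deg<-*const r d = deg<-cong S (Pₛ.*-comm _ _) (deg<-const* S r d)

  deg<-X : deg< S 2 (X S)
  deg<-X = deg<-cong S (Pₛ.*-identityʳ _) (deg<-X* S (deg<-cong S (1-homo (constₕ S)) (deg<-const S 1# (s≤s z≤n))))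

  ι-const : ∀ c → fn (ι (Pol S)) c Pₛ.≈ const S (fn (ι S) c)
  ι-const c = Pₛ.sym (ι-homo (constₕ S) c)

module _ (S : Ring) where
  open CRing S
  open Divisibility S
  open Sums S
  private
    module Pₛ = CRing (Pol S)

  -- The coordinates are congruent modulo z, hence so are the values.
  directional-mod : ∀ {m} (f : Poly m) z (y v w : Fin m → Carrier) → z ∣ directional S f (λ j → y j + z * v j) w - directional S f y w
  directional-mod f z y v w = Q.trans (directional-homo (toQuotient S C) f (λ j → y j + z * v j) w)
    (Q.trans (directional-cong (Quotient S C) f {λ j → y j + z * v j} {y} {w} {w} (λ j → v j , solve 3 (λ y z v → z :* v := (y :+ z :* v) :+ :- y) refl (y j) z (v j)) (λ j → Q.refl))
      (Q.sym (directional-homo (toQuotient S C) f y w)))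
    where
    open Solver S using (solve; _:+_; _:*_; :-_; _:=_)
    C = principal S z
    module Q = CRing (Quotient S C)

  coef-expansion : ∀ p q r → (coef S (const S p Pₛ.+ X S Pₛ.* (const S q Pₛ.+ X S Pₛ.* r)) 0 ≈ p) ×
    (coef S (const S p Pₛ.+ X S Pₛ.* (const S q Pₛ.+ X S Pₛ.* r)) 1 ≈ q)
  coef-expansion p q r = coef-const+X*-0 S p _ , trans (coef-const+X* S p _ 0) (coef-const+X*-0 S q r)

  evalP-line : ∀ {m} (f : Poly m) (y v : Fin m → Carrier) →
    (coef S (evalP (Pol S) f (λ j → const S (y j) Pₛ.+ X S Pₛ.* const S (v j))) 0 ≈ evalP S f y) ×
    (coef S (evalP (Pol S) f (λ j → const S (y j) Pₛ.+ X S Pₛ.* const S (v j))) 1 ≈ directional S f y v)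
  evalP-line f y v with taylor (Pol S) f (X S) (const S ∘ y) (const S ∘ v)
  ... | r , e = trans (coef-cong S e′ 0) (proj₁ (coef-expansion _ _ r)) , trans (coef-cong S e′ 1) (proj₂ (coef-expansion _ _ r))
    where
    e′ : evalP (Pol S) f (λ j → const S (y j) Pₛ.+ X S Pₛ.* const S (v j)) Pₛ.≈
      const S (evalP S f y) Pₛ.+ X S Pₛ.* (const S (directional S f y v) Pₛ.+ X S Pₛ.* r)
    e′ = Pₛ.trans e (Pₛ.+-cong (Pₛ.sym (evalP-homo (constₕ S) f y)) (Pₛ.*-congˡ (Pₛ.+-congʳ (Pₛ.sym (directional-homo (constₕ S) f y v)))))

  open SemiringExp semiring using (_^_)

  -- The derivative is homogeneous of degree d - 1; the extra factor c avoids that exponent. It is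
  -- the linear coefficient of f(cy + X·cv) = cᵈf(y + X·v).
  directional-scale : ∀ {m d} {f : Poly m} → Homogeneous d f → ∀ c y v → c * directional S f (λ j → c * y j) v ≈ c ^ d * directional S f y v
  directional-scale {d = d} {f} hom c y v = begin
    c * directional S f (λ j → c * y j) v
      ≈⟨ trans (sum-*ˡ c (λ j → evalP S (∂ j f) (λ j → c * y j) * v j)) (sum-cong (λ j → c * (evalP S (∂ j f) (λ j → c * y j) * v j)) (λ j → evalP S (∂ j f) (λ j → c * y j) * (c * v j))
           λ j → solve 3 (λ c e v → c :* (e :* v) := e :* (c :* v)) refl c _ (v j)) ⟩
    directional S f (λ j → c * y j) (λ j → c * v j)
      ≈⟨ proj₂ (evalP-line f (λ j → c * y j) (λ j → c * v j)) ⟨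
    coef S (evalP (Pol S) f (λ j → const S (c * y j) Pₛ.+ X S Pₛ.* const S (c * v j))) 1
      ≈⟨ coef-cong S (evalP-cong (Pol S) f λ j → Pₛ.trans (Pₛ.+-cong (*-homo (constₕ S) c (y j)) (Pₛ.*-congˡ (*-homo (constₕ S) c (v j))))
           (PolSolver.solve 4 (λ c y x v → c PolSolver.:* y PolSolver.:+ x PolSolver.:* (c PolSolver.:* v) PolSolver.:= c PolSolver.:* (y PolSolver.:+ x PolSolver.:* v))
             Pₛ.refl (const S c) (const S (y j)) (X S) (const S (v j)))) 1 ⟩
    coef S (evalP (Pol S) f (λ j → const S c Pₛ.* line j)) 1
      ≈⟨ coef-cong S (Pₛ.trans (evalP-scale (Pol S) {f} hom (const S c) line) (Pₛ.*-congʳ (Pₛ.sym (^-homo (constₕ S) c d)))) 1 ⟩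
    coef S (const S (c ^ d) Pₛ.* evalP (Pol S) f line) 1
      ≈⟨ trans (coef-const* S (c ^ d) _ 1) (*-congˡ (proj₂ (evalP-line f y v))) ⟩
    c ^ d * directional S f y v ∎
    where
    open SetoidReasoning setoid
    open Solver S using (solve; _:+_; _:*_; _:=_)
    module PolSolver = Solver (Pol S)
    line = λ j → const S (y j) Pₛ.+ X S Pₛ.* const S (v j)

-- The curve x(s) = Qω(P + φV + l²sξ) + sᵃ(Q(T + s) + sᵏ)V meets the hypersurface at s = 0 with
-- multiplicity a, or a + 1 if T = 0, and F is the remaining factor of f(x(s)).
module Curves {m d : ℕ} (f : Poly m) (hom : Homogeneous d f) (P V : Fin m → ℤ) (f[P]≡0 : evalP ℤR f P ≡ + 0)
  (Q ω : ℤ) (a k n : ℕ) (2≤k : 2 ℕ.≤ k) (degrees : d ℕ.* (a ℕ.+ k) ≡ a ℕ.+ n) where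

  l : ℤ
  l = directional ℤR f P V

  -- In effect Q(Qω)ᵈ⁻¹l. It is the linear coefficient of F at the origin, both in T and in s
  -- (`F-01`, `F-10`).
  μ : ℤ
  μ = Q ℤ.* directional ℤR f (λ i → (Q ℤ.* ω) ℤ.* P i) V

  module Shape (R : Ring) (x̄ : Fin m → ∣ R ∣) where
    private
      𝔹 = Pol R
      module PR = CRing 𝔹
      module PB = CRing (Pol 𝔹)
      module S = CRing (Series R)
    open SemiringExp PB.semiring using (_^_)

    lift : Hom (Pol R) (Pol 𝔹)
    lift = mapₚ (constₕ R)

    y₁ : ∣ Pol R ∣ → Fin m → ∣ Pol R ∣
    y₁ φ i = (fn (ι 𝔹) (P i) PR.+ φ PR.* fn (ι 𝔹) (V i)) PR.+ (fn (ι 𝔹) (l ℤ.* l) PR.* X R) PR.* const R (x̄ i)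

    T s η : ∣ Pol 𝔹 ∣
    T = const 𝔹 (X R)
    s = X 𝔹
    η = fn (ι (Pol 𝔹)) Q PB.* (T PB.+ s) PB.+ s ^ k

    point : ∣ Pol R ∣ → Fin m → ∣ Pol 𝔹 ∣
    point φ i = fn (ι (Pol 𝔹)) (Q ℤ.* ω) PB.* fn lift (y₁ φ i) PB.+ (s ^ a PB.* η) PB.* fn (ι (Pol 𝔹)) (V i)

    -- T = μ²t puts the factor μ²t into F(T, 0), as Newton's lemma with λ = μ requires; so the
    -- branch ŷ has its coefficients in R, without denominators.
    scaleT : Hom 𝔹 (Series R)
    scaleT = eval (constₛ R) (fn (ι (Series R)) (μ ℤ.* μ) S.* tₛ R)

    at : ∣ Series R ∣ → Hom (Pol 𝔹) (Series R)
    at y = eval scaleT y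

  -- The properties of the curve over a general coefficient ring, so that it can be built for an
  -- indeterminate direction and then mapped to ℤ.
  record Curve (R : Ring) (x̄ : Fin m → ∣ R ∣) : Set where
    open Shape R x̄
    private
      module R = CRing R
      module PR = CRing (Pol R)
      module PB = CRing (Pol (Pol R))
      module S = CRing (Series R)
      open SemiringExp PR.semiring using () renaming (_^_ to _^ᵣ_)
      open SemiringExp PB.semiring using (_^_)
    field
      φ h₁ : ∣ Pol R ∣
      F : ∣ Pol (Pol R) ∣
      ŷ : ∣ Series R ∣
      φ-0 : coef R φ 0 R.≈ R.0#
      φ-deg : deg< R (2 ℕ.+ a) φ
      y₁-eq : evalP (Pol R) f (y₁ φ) PR.≈ X R ^ᵣ (2 ℕ.+ a) PR.* h₁
      F-eq : X (Pol R) ^ a PB.* F PB.≈ evalP (Pol (Pol R)) f (point φ)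
      F-top : Top (Pol R) n (fn (ι (Pol R)) (evalP ℤR f V)) F
      F-00 : coef R (coef (Pol R) F 0) 0 R.≈ R.0#
      F-01 : coef R (coef (Pol R) F 0) 1 R.≈ fn (ι R) μ
      F-10 : coef R (coef (Pol R) F 1) 0 R.≈ fn (ι R) μ
      ŷ-0 : coefₛ R ŷ 0 R.≈ R.0#
      F-ŷ : fn (at ŷ) F S.≈ S.0#

  module Construct (R : Ring) (x̄ : Fin m → ∣ R ∣) where
    open Shape R x̄
    private
      𝔹 = Pol R
      module R = CRing R
      module PR = CRing 𝔹
      module PB = CRing (Pol 𝔹)
      module S = CRing (Series R)
      module PS = CRing (Pol (Series R))
      module DS = Divisibility (Series R)
      module DR = Divisibility 𝔹
    open SemiringExp PR.semiring using () renaming (_^_ to _^ᵣ_)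
    open SemiringExp PB.semiring using (_^_; ^-homo-*)

    private
      iS : ℤ → ∣ Series R ∣
      iS = fn (ι (Series R))
      t = tₛ R
      L : ∣ Series R ∣
      L = fn (constₛ R) (fn (ι R) l)
      z = L S.* L S.* t
      L≈ : L S.≈ iS l
      L≈ = ι-homo (constₛ R) l

      yS : Fin m → ∣ Series R ∣
      yS i = iS (P i) S.+ z S.* fn (constₛ R) (x̄ i)

      A : ∣ Pol (Series R) ∣
      A = evalP (Pol (Series R)) f (λ i → const (Series R) (yS i) PS.+ X (Series R) PS.* const (Series R) (iS (V i)))

      z∣f : z DS.∣ evalP (Series R) f yS
      z∣f with taylor (Series R) f z (iS ∘ P) (fn (constₛ R) ∘ x̄)
      ... | r , e = _ , S.sym (S.trans e (S.trans (S.+-congʳ (S.trans (S.sym (evalP-homo (ι (Series R)) f P)) (S.trans (Hom.cong (ι (Series R)) f[P]≡0) (0-homo (ι (Series R)))))) (S.+-identityˡ _)))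

      z∣dir : z DS.∣ directional (Series R) f yS (iS ∘ V) S.- L
      z∣dir = DS.∣-respʳ (S.+-congˡ (S.-‿cong (S.trans (S.sym (directional-homo (ι (Series R)) f P V)) (S.sym L≈))))
        (directional-mod (Series R) f z (iS ∘ P) (fn (constₛ R) ∘ x̄) (iS ∘ V))

      open Solver (Series R) using (solve; _:+_; _:*_; :-_; _:=_)

      -- Newton's lemma with λ = l: the constant term f(P + l²tξ) is a multiple of l²t because f(P)
      -- = 0, and the slope along V differs from l by a multiple of l²t. This is the origin of the
      -- factor l² in the curve.
      module H = Hensel R A (fn (ι R) l) (proj₁ z∣f) (L S.* proj₁ z∣dir)
        (S.trans (proj₁ (evalP-line (Series R) f yS (iS ∘ V))) (S.trans (S.sym (proj₂ z∣f)) (S.*-assoc _ _ _)))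
        (S.trans (proj₂ (evalP-line (Series R) f yS (iS ∘ V))) (S.trans
          (solve 2 (λ D L → D := L :+ (D :+ :- L)) S.refl _ L)
          (S.trans (S.+-congˡ (S.sym (proj₂ z∣dir)))
          (S.trans (solve 3 (λ L t q → L :+ (L :* L :* t) :* q := L :+ L :* (t :* (L :* q))) S.refl L t (proj₁ z∣dir))
          (S.trans (S.+-congʳ (S.sym (S.*-identityʳ L))) (S.sym (S.distribˡ L _ _)))))))

      φ̂ : ∣ Series R ∣
      φ̂ = L S.* (t S.* H.z)

      f[φ̂] : evalP (Series R) f (λ i → yS i S.+ φ̂ S.* iS (V i)) S.≈ S.0#
      f[φ̂] = S.trans (S.sym (S.trans (evalP-homo e f _) (evalP-cong (Series R) f λ i →
        S.trans (+-homo e _ _) (S.+-cong (eval-const I φ̂ _) (S.trans (*-homo e _ _) (S.*-cong (eval-X I φ̂) (eval-const I φ̂ _))))))) H.root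
        where
        I : Hom (Series R) (Series R)
        I = idₕ {Series R}
        e = eval I φ̂

    -- The series φ̂ makes f vanish identically. Its truncation still leaves f(y₁) divisible by
    -- sᵃ⁺², and its degree, at most a + 1, stays below the degree a + k of the leading term of the
    -- curve.
    φ : ∣ Pol R ∣
    φ = truncate R (2 ℕ.+ a) φ̂

    φ-0 : coef R φ 0 R.≈ R.0#
    φ-0 = R.trans (coef-truncate R (2 ℕ.+ a) φ̂ 0 (s≤s z≤n)) (R.trans (coef-constₛ* R _ _ 0) (R.trans (R.*-congˡ (coef-t*-0 R _)) (R.zeroʳ _)))

    φ-deg : deg< R (2 ℕ.+ a) φ
    φ-deg = deg<-truncate R (2 ℕ.+ a) φ̂

    private
      C = truncation R (2 ℕ.+ a)
      module C = Congruence C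
      module Qt = CRing (Quotient (Series R) C)
      toS = toSeries R

      φ~φ̂ : fn toS φ C.~ φ̂
      φ~φ̂ i i<n = R.trans (coef-toSeries R φ i) (coef-truncate R (2 ℕ.+ a) φ̂ i i<n)

      y₁~ : ∀ i → fn toS (y₁ φ i) C.~ (yS i S.+ φ̂ S.* iS (V i))
      y₁~ i = C.~-trans {fn toS (y₁ φ i)} (C.fromEq (S.trans (+-homo toS _ _) (S.+-cong
          (S.trans (+-homo toS _ _) (S.+-cong (ι-homo toS (P i)) (S.trans (*-homo toS _ _) (S.*-congˡ (ι-homo toS (V i))))))
          (S.trans (*-homo toS _ _) (S.*-cong (S.trans (*-homo toS _ _) (S.*-cong (S.trans (ι-homo toS (l ℤ.* l))
            (S.trans (*-homo (ι (Series R)) l l) (S.*-cong (S.sym L≈) (S.sym L≈)))) (eval-X (constₛ R) t))) (eval-const (constₛ R) t (x̄ i)))))))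
        (C.~-trans {(iS (P i) S.+ fn toS φ S.* iS (V i)) S.+ z S.* fn (constₛ R) (x̄ i)}
          (C.~-+ {iS (P i) S.+ fn toS φ S.* iS (V i)} {iS (P i) S.+ φ̂ S.* iS (V i)} (C.~-+ {iS (P i)} {iS (P i)} (C.fromEq {iS (P i)} S.refl) (C.~-* {fn toS φ} {φ̂} φ~φ̂ (C.fromEq {iS (V i)} S.refl))) (C.fromEq {z S.* fn (constₛ R) (x̄ i)} S.refl))
          (C.fromEq (solve 3 (λ p v x → (p :+ v) :+ x := (p :+ x) :+ v) S.refl _ _ _)))

      vanish : ∀ i → i ℕ.< 2 ℕ.+ a → coef R (evalP (Pol R) f (y₁ φ)) i R.≈ R.0#
      vanish i i<n = R.trans (R.sym (coef-toSeries R _ i)) (R.trans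
        (Qt.trans {fn toS (evalP (Pol R) f (y₁ φ))} {evalP (Quotient (Series R) C) f (fn toS ∘ y₁ φ)}
          (evalP-homo (toQuotient (Series R) C ∘ₕ toS) f (y₁ φ))
          (Qt.trans {evalP (Quotient (Series R) C) f (fn toS ∘ y₁ φ)} {evalP (Quotient (Series R) C) f (λ i → yS i S.+ φ̂ S.* iS (V i))}
            (evalP-cong (Quotient (Series R) C) f y₁~)
            (Qt.trans {evalP (Quotient (Series R) C) f (λ i → yS i S.+ φ̂ S.* iS (V i))} {evalP (Series R) f (λ i → yS i S.+ φ̂ S.* iS (V i))} {S.0#}
              (Qt.sym {evalP (Series R) f (λ i → yS i S.+ φ̂ S.* iS (V i))} (evalP-homo (toQuotient (Series R) C) f _)) (C.fromEq f[φ̂]))) i i<n)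
        (coefₛ-0 R i))

    h₁ : ∣ Pol R ∣
    h₁ = proj₁ (X^∣ R (2 ℕ.+ a) _ vanish)

    y₁-eq : evalP (Pol R) f (y₁ φ) PR.≈ X R ^ᵣ (2 ℕ.+ a) PR.* h₁
    y₁-eq = proj₂ (X^∣ R (2 ℕ.+ a) _ vanish)

    private
      iB : ℤ → ∣ Pol 𝔹 ∣
      iB = fn (ι (Pol 𝔹))
      N = iB (Q ℤ.* ω)
      Y : Fin m → ∣ Pol 𝔹 ∣
      Y i = N PB.* fn lift (y₁ φ i)
      tay = taylor (Pol 𝔹) f (s ^ a PB.* η) Y (iB ∘ V)
      DV = directional (Pol 𝔹) f Y (iB ∘ V)
      W = DV PB.+ (s ^ a PB.* η) PB.* proj₁ tay
      open Solver (Pol 𝔹) using () renaming (solve to solveᴮ; _:+_ to _⊕_; _:*_ to _⊗_; _:=_ to _⊜_)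

      lift-X^ : ∀ j → fn lift (X R ^ᵣ j) PB.≈ s ^ j
      lift-X^ j = PB.trans (^-homo lift (X R) j) (SemiringExp.^-congˡ PB.semiring j (mapₚ-X (constₕ R)))

      f[Y] : evalP (Pol 𝔹) f Y PB.≈ N ^ d PB.* (s PB.* (s PB.* s ^ a) PB.* fn lift h₁)
      f[Y] = PB.trans (evalP-scale (Pol 𝔹) {f} hom N (fn lift ∘ y₁ φ)) (PB.*-congˡ (PB.trans (PB.sym (evalP-homo lift f (y₁ φ)))
        (PB.trans (Hom.cong lift y₁-eq) (PB.trans (*-homo lift _ _) (PB.*-congʳ (lift-X^ (2 ℕ.+ a)))))))

    -- Taylor along V gives f(Y + sᵃηV) = f(Y) + sᵃηW, and f(Y) = Nᵈsᵃ⁺²·h₁ by homogeneity; this is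
    -- the quotient by sᵃ.
    F : ∣ Pol 𝔹 ∣
    F = N ^ d PB.* (s PB.* s PB.* fn lift h₁) PB.+ η PB.* W

    F-eq : s ^ a PB.* F PB.≈ evalP (Pol 𝔹) f (point φ)
    F-eq = PB.sym (PB.trans (proj₂ tay) (PB.trans (PB.+-congʳ f[Y])
      (solveᴮ 6 (λ n s sa h e w → n ⊗ (s ⊗ (s ⊗ sa) ⊗ h) ⊕ (sa ⊗ e) ⊗ w ⊜ sa ⊗ (n ⊗ (s ⊗ s ⊗ h) ⊕ e ⊗ w)) PB.refl
        (N ^ d) s (s ^ a) (fn lift h₁) η W)))

    private
      y₁-deg : ∀ i → deg< R (2 ℕ.+ a) (y₁ φ i)
      y₁-deg i = deg<-+ R (deg<-+ R (deg<-cong R (PR.sym (ι-const R _)) (deg<-const R _ (s≤s z≤n)))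
          (deg<-cong R (PR.*-congˡ (PR.sym (ι-const R _))) (deg<-*const R _ φ-deg)))
        (deg<-*const R _ (deg<-mono R (s≤s (s≤s z≤n)) (deg<-cong R (PR.*-congʳ (PR.sym (ι-const R _))) (deg<-const* R _ (deg<-X R)))))

      2+a≤e : 2 ℕ.+ a ℕ.≤ a ℕ.+ k
      2+a≤e = ≡.subst (ℕ._≤ a ℕ.+ k) (ℕP.+-comm a 2) (ℕP.+-monoʳ-≤ a 2≤k)

      point-top : ∀ i → Top 𝔹 (a ℕ.+ k) (fn (ι 𝔹) (V i)) (point φ i)
      point-top i = Top-cong 𝔹 PR.refl (PB.sym split) (Top-+ 𝔹 (Top-X^* 𝔹 (a ℕ.+ k) (fn (ι 𝔹) (V i))) (deg<-mono 𝔹 2+a≤e (deg<-+ 𝔹 Y-deg rest-deg)))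
        where
        Y-deg : deg< 𝔹 (2 ℕ.+ a) (Y i)
        Y-deg = deg<-cong 𝔹 (PB.*-congʳ (PB.sym (ι-const 𝔹 _))) (deg<-const* 𝔹 _ (deg<-mapₚ (constₕ R) (y₁-deg i)))
        T+s-deg : deg< 𝔹 2 (iB Q PB.* (T PB.+ s))
        T+s-deg = deg<-cong 𝔹 (PB.*-congʳ (PB.sym (ι-const 𝔹 _))) (deg<-const* 𝔹 _ (deg<-+ 𝔹 (deg<-const 𝔹 _ (s≤s z≤n)) (deg<-X 𝔹)))
        rest-deg : deg< 𝔹 (2 ℕ.+ a) (s ^ a PB.* (iB Q PB.* (T PB.+ s) PB.* const 𝔹 (fn (ι 𝔹) (V i))))
        rest-deg = deg<-mono 𝔹 (ℕP.≤-reflexive (ℕP.+-comm a 2)) (deg<-X^* 𝔹 a (deg<-*const 𝔹 _ T+s-deg))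
        v = const 𝔹 (fn (ι 𝔹) (V i))
        split : point φ i PB.≈ s ^ (a ℕ.+ k) PB.* v PB.+ (Y i PB.+ s ^ a PB.* (iB Q PB.* (T PB.+ s) PB.* v))
        split = PB.trans (PB.+-congˡ (PB.*-congˡ (ι-const 𝔹 (V i)))) (PB.trans
          (solveᴮ 5 (λ y sa q sk v → y ⊕ (sa ⊗ (q ⊕ sk)) ⊗ v ⊜ (sa ⊗ sk) ⊗ v ⊕ (y ⊕ sa ⊗ (q ⊗ v))) PB.refl (Y i) (s ^ a) (iB Q PB.* (T PB.+ s)) (s ^ k) v)
          (PB.+-congʳ (PB.*-congʳ (PB.sym (^-homo-* s a k)))))

    F-top : Top 𝔹 n (fn (ι 𝔹) (evalP ℤR f V)) F
    F-top = mkTop (PR.trans (shift n) (PR.trans (PR.reflexive (≡.cong (coef 𝔹 _) (≡.sym degrees))) (PR.trans (lead big) (PR.sym (evalP-homo (ι 𝔹) f V)))))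
      λ i n<i → PR.trans (shift i) (degᵗ big (a ℕ.+ i) (≡.subst (ℕ._< a ℕ.+ i) (≡.sym degrees) (ℕP.+-monoʳ-< a n<i)))
      where
      big : Top 𝔹 (d ℕ.* (a ℕ.+ k)) (evalP 𝔹 f (fn (ι 𝔹) ∘ V)) (evalP (Pol 𝔹) f (point φ))
      big = Top-evalP 𝔹 {f} hom point-top
      shift : ∀ i → coef 𝔹 F i PR.≈ coef 𝔹 (evalP (Pol 𝔹) f (point φ)) (a ℕ.+ i)
      shift i = PR.trans (PR.sym (coef-X^* 𝔹 a F i)) (coef-cong 𝔹 F-eq (a ℕ.+ i))

    private
      ε : Hom (Pol 𝔹) R
      ε = at0 R ∘ₕ at0 𝔹

      ε-s^ : ∀ j → 1 ℕ.≤ j → fn (at0 𝔹) (s ^ j) PR.≈ PR.0#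
      ε-s^ (suc j) _ = PR.trans (*-homo (at0 𝔹) _ _) (PR.trans (PR.*-congʳ (eval-X (idₕ {𝔹}) PR.0#)) (PR.zeroˡ _))

      ε-T : fn ε T R.≈ R.0#
      ε-T = R.trans (Hom.cong (at0 R) (eval-const (idₕ {𝔹}) PR.0# (X R))) (eval-X (idₕ {R}) R.0#)

      ε-s : fn ε s R.≈ R.0#
      ε-s = R.trans (Hom.cong (at0 R) (eval-X (idₕ {𝔹}) PR.0#)) (0-homo (at0 R))

      ε-η : fn ε η R.≈ R.0#
      ε-η = R.trans (+-homo ε _ _) (R.trans (R.+-cong (R.trans (*-homo ε _ _) (R.trans (R.*-congˡ (R.trans (+-homo ε _ _)
          (R.trans (R.+-cong ε-T ε-s) (R.+-identityˡ _)))) (R.zeroʳ _)))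
        (R.trans (Hom.cong (at0 R) (ε-s^ k (ℕP.≤-trans (s≤s z≤n) 2≤k))) (0-homo (at0 R)))) (R.+-identityˡ _))

      ε-lift : ∀ p → fn ε (fn lift p) R.≈ fn (at0 R) p
      ε-lift = Pol-hom-ext (ε ∘ₕ lift) (at0 R)
        (λ r → R.trans (Hom.cong ε (mapₚ-const (constₕ R) r)) (Hom.cong (at0 R) (eval-const (idₕ {𝔹}) PR.0# _)))
        (R.trans (Hom.cong ε (mapₚ-X (constₕ R))) (R.trans ε-s (R.sym (eval-X (idₕ {R}) R.0#))))

      ε-Y : ∀ i → fn ε (Y i) R.≈ fn (ι R) ((Q ℤ.* ω) ℤ.* P i)
      ε-Y i = R.trans (*-homo ε _ _) (R.trans (R.*-cong (ι-homo ε _) (R.trans (ε-lift (y₁ φ i)) at0-y₁)) (R.sym (*-homo (ι R) _ _)))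
        where
        h = at0 R
        at0-y₁ : fn h (y₁ φ i) R.≈ fn (ι R) (P i)
        at0-y₁ = R.trans (+-homo h _ _) (R.trans (R.+-cong (R.trans (+-homo h _ _) (R.trans (R.+-cong (ι-homo h (P i))
            (R.trans (*-homo h _ _) (R.trans (R.*-congʳ (R.trans (at0-coef R φ) φ-0)) (R.zeroˡ _)))) (R.+-identityʳ _)))
          (R.trans (*-homo h _ _) (R.trans (R.*-congʳ (R.trans (*-homo h _ _) (R.trans (R.*-congˡ (eval-X (idₕ {R}) R.0#)) (R.zeroʳ _)))) (R.zeroˡ _)))) (R.+-identityʳ _))

      W-00 : coef R (coef 𝔹 W 0) 0 R.≈ fn (ι R) (directional ℤR f (λ i → (Q ℤ.* ω) ℤ.* P i) V)
      W-00 = R.trans (R.trans (coef-cong R (PR.sym (at0-coef 𝔹 W)) 0) (R.sym (at0-coef R _)))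
        (R.trans (+-homo ε _ _) (R.trans (R.+-cong
          (R.trans (directional-homo ε f Y (iB ∘ V)) (R.trans (directional-cong R f ε-Y (λ i → ι-homo ε (V i))) (R.sym (directional-homo (ι R) f _ V))))
          (R.trans (*-homo ε _ _) (R.trans (R.*-congʳ (R.trans (*-homo ε _ _) (R.trans (R.*-congˡ ε-η) (R.zeroʳ _)))) (R.zeroˡ _)))) (R.+-identityʳ _)))

      G : ℕ → ∣ Pol 𝔹 ∣
      G k′ = N ^ d PB.* (s PB.* fn lift h₁) PB.+ (iB Q PB.+ s ^ k′) PB.* W

      -- Displays the terms of F of low degree in s: the constant term is QT·W₀, and the linear one
      -- is QW₀ modulo T. Since k ≥ 2, the power s^(k-1) does not reach the latter, and both slopes
      -- equal Q·W₀(0) = μ.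
      F-split : ∀ k′ → k ≡ suc k′ → F PB.≈ const 𝔹 (fn (ι 𝔹) Q PR.* X R) PB.* W PB.+ s PB.* G k′
      F-split k′ ≡.refl = PB.trans
        (solveᴮ 7 (λ n s h q t sk w → n ⊗ (s ⊗ s ⊗ h) ⊕ (q ⊗ (t ⊕ s) ⊕ s ⊗ sk) ⊗ w ⊜ (q ⊗ t) ⊗ w ⊕ s ⊗ (n ⊗ (s ⊗ h) ⊕ (q ⊕ sk) ⊗ w)) PB.refl
          (N ^ d) s (fn lift h₁) (iB Q) T (s ^ k′) W)
        (PB.+-congʳ (PB.*-congʳ (PB.trans (PB.*-congʳ (ι-const 𝔹 Q)) (PB.sym (*-homo (constₕ 𝔹) _ _)))))

      k′ = ℕ.pred k
      k≡ : k ≡ suc k′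
      k≡ = ≡.sym (ℕP.suc-pred k ⦃ ℕ.>-nonZero (ℕP.≤-trans (s≤s z≤n) 2≤k) ⦄)
      W₀ = coef 𝔹 W 0
      iR : ℤ → ∣ R ∣
      iR = fn (ι R)

      QX* : ∀ p → (fn (ι 𝔹) Q PR.* X R) PR.* p PR.≈ const R (iR Q) PR.* (X R PR.* p)
      QX* p = PR.trans (PR.*-assoc _ _ _) (PR.*-congʳ (ι-const R Q))

      coef-F-0 : coef 𝔹 F 0 PR.≈ const R (iR Q) PR.* (X R PR.* W₀)
      coef-F-0 = PR.trans (coef-cong 𝔹 (F-split k′ k≡) 0) (PR.trans (coef-+ 𝔹 _ _ 0) (PR.trans (PR.+-cong (PR.trans (coef-const* 𝔹 _ W 0) (QX* W₀)) (coef-X*-0 𝔹 _)) (PR.+-identityʳ _)))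

      coef-G-0 : coef 𝔹 (G k′) 0 PR.≈ const R (iR Q) PR.* W₀
      coef-G-0 = PR.trans (PR.sym (at0-coef 𝔹 _)) (PR.trans (+-homo h _ _) (PR.trans (PR.+-cong
          (PR.trans (*-homo h _ _) (PR.trans (PR.*-congˡ (PR.trans (*-homo h _ _) (PR.trans (PR.*-congʳ (eval-X (idₕ {𝔹}) PR.0#)) (PR.zeroˡ _)))) (PR.zeroʳ _)))
          (PR.trans (*-homo h _ _) (PR.*-cong (PR.trans (+-homo h _ _) (PR.trans (PR.+-cong (PR.trans (ι-homo h Q) (ι-const R Q)) (ε-s^ k′ (ℕP.≤-pred (≡.subst (2 ℕ.≤_) k≡ 2≤k)))) (PR.+-identityʳ _))) (at0-coef 𝔹 W))))
          (PR.+-identityˡ _)))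
        where h = at0 𝔹

      μ-eq : iR Q R.* coef R W₀ 0 R.≈ iR μ
      μ-eq = R.trans (R.*-congˡ W-00) (R.sym (*-homo (ι R) Q _))

    F-00 : coef R (coef 𝔹 F 0) 0 R.≈ R.0#
    F-00 = R.trans (coef-cong R coef-F-0 0) (R.trans (coef-const* R _ _ 0) (R.trans (R.*-congˡ (coef-X*-0 R _)) (R.zeroʳ _)))

    F-01 : coef R (coef 𝔹 F 0) 1 R.≈ iR μ
    F-01 = R.trans (coef-cong R coef-F-0 1) (R.trans (coef-const* R _ _ 1) (R.trans (R.*-congˡ (coef-X*-suc R _ 0)) μ-eq))

    F-10 : coef R (coef 𝔹 F 1) 0 R.≈ iR μ
    F-10 = R.trans (coef-cong R (PR.trans (coef-cong 𝔹 (F-split k′ k≡) 1) (PR.trans (coef-+ 𝔹 _ _ 1) (PR.+-cong (PR.trans (coef-const* 𝔹 _ W 1) (QX* (coef 𝔹 W 1))) (PR.trans (coef-X*-suc 𝔹 _ 0) coef-G-0)))) 0)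
      (R.trans (coef-+ R _ _ 0) (R.trans (R.+-cong (R.trans (coef-const* R _ _ 0) (R.trans (R.*-congˡ (coef-X*-0 R _)) (R.zeroʳ _))) (R.trans (coef-const* R _ _ 0) μ-eq)) (R.+-identityˡ _)))

    private
      M : ∣ Series R ∣
      M = fn (constₛ R) (iR μ)
      M≈ : iS (μ ℤ.* μ) S.≈ M S.* M
      M≈ = S.trans (*-homo (ι (Series R)) μ μ) (S.sym (S.*-cong (ι-homo (constₛ R) μ) (ι-homo (constₛ R) μ)))

      scale-expand : ∀ p → fn scaleT p S.≈ fn (constₛ R) (coef R p 0) S.+ (M S.* M S.* t) S.* fn scaleT (tail R p)
      scale-expand p = S.trans (Hom.cong scaleT (Pol-decompose R p)) (S.trans (+-homo scaleT _ _) (S.+-cong (eval-const (constₛ R) _ _)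
        (S.trans (*-homo scaleT _ _) (S.*-congʳ (S.trans (eval-X (constₛ R) _) (S.*-congʳ M≈))))))

      AF : ∣ Pol (Series R) ∣
      AF = fn (mapₚ scaleT) F

      module HF = Hensel R AF (iR μ) (fn scaleT (tail R (coef 𝔹 F 0))) (M S.* fn scaleT (tail R (coef 𝔹 F 1)))
        (S.trans (coef-mapₚ scaleT F 0) (S.trans (scale-expand _) (S.trans (S.+-cong (S.trans (Hom.cong (constₛ R) F-00) (0-homo (constₛ R))) (S.*-assoc _ _ _)) (S.+-identityˡ _))))
        (S.trans (coef-mapₚ scaleT F 1) (S.trans (scale-expand _) (S.trans (S.+-congʳ (Hom.cong (constₛ R) F-10))
          (S.trans (solve 3 (λ L t q → L :+ (L :* L :* t) :* q := L :+ L :* (t :* (L :* q))) S.refl M t (fn scaleT (tail R (coef 𝔹 F 1))))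
          (S.trans (S.+-congʳ (S.sym (S.*-identityʳ M))) (S.sym (S.distribˡ M _ _)))))))

    ŷ : ∣ Series R ∣
    ŷ = M S.* (t S.* HF.z)

    ŷ-0 : coefₛ R ŷ 0 R.≈ R.0#
    ŷ-0 = R.trans (coef-constₛ* R _ _ 0) (R.trans (R.*-congˡ (coef-t*-0 R _)) (R.zeroʳ _))

    F-ŷ : fn (at ŷ) F S.≈ S.0#
    F-ŷ = S.trans (Pol-hom-ext (at ŷ) (e ∘ₕ mapₚ scaleT)
      (λ r → S.trans (eval-const scaleT ŷ r) (S.sym (S.trans (Hom.cong e (mapₚ-const scaleT r)) (eval-const I ŷ _))))
      (S.trans (eval-X scaleT ŷ) (S.sym (S.trans (Hom.cong e (mapₚ-X scaleT)) (eval-X I ŷ)))) F) HF.root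
      where
      I : Hom (Series R) (Series R)
      I = idₕ {Series R}
      e = eval I ŷ

    curve : Curve R x̄
    curve = record
      { φ = φ ; h₁ = h₁ ; F = F ; ŷ = ŷ ; φ-0 = φ-0 ; φ-deg = φ-deg ; y₁-eq = y₁-eq ; F-eq = F-eq
      ; F-top = F-top ; F-00 = F-00 ; F-01 = F-01 ; F-10 = F-10 ; ŷ-0 = ŷ-0 ; F-ŷ = F-ŷ }

-- The rational numbers

ℚR : Ring
ℚR = ℚP.+-*-commutativeRing

private
  ℤ→ℚ : Hom ℤR ℚR
  ℤ→ℚ = record
    { fn = λ c → c ℚ./ 1
    ; cong = λ { ≡.refl → ≡.refl }
    ; +-homo = λ a b → ℚP.toℚᵘ-injective (ℚᵘP.≃-trans (un (a ℤ.+ b)) (ℚᵘP.≃-trans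
        (ℚᵘ.*≡* (≡.cong (ℤ._* + 1) (≡.cong₂ ℤ._+_ (≡.sym (ℤP.*-identityʳ a)) (≡.sym (ℤP.*-identityʳ b)))))
        (ℚᵘP.≃-trans (ℚᵘP.+-cong (ℚᵘP.≃-sym (un a)) (ℚᵘP.≃-sym (un b))) (ℚᵘP.≃-sym (ℚP.toℚᵘ-homo-+ (a ℚ./ 1) (b ℚ./ 1))))))
    ; *-homo = λ a b → ℚP.toℚᵘ-injective (ℚᵘP.≃-trans (un (a ℤ.* b)) (ℚᵘP.≃-trans (ℚᵘ.*≡* ≡.refl)
        (ℚᵘP.≃-trans (ℚᵘP.*-cong (ℚᵘP.≃-sym (un a)) (ℚᵘP.≃-sym (un b))) (ℚᵘP.≃-sym (ℚP.toℚᵘ-homo-* (a ℚ./ 1) (b ℚ./ 1))))))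
    ; 1-homo = ≡.refl }
    where
    un : ∀ c → ℚ.toℚᵘ (c ℚ./ 1) ℚᵘ.≃ mkℚᵘ c 0
    un c = ℚP.toℚᵘ-fromℚᵘ (mkℚᵘ c 0)

ι-ℚ : ∀ c → fn (ι ℚR) c ≡ c ℚ./ 1
ι-ℚ c = ≡.sym (ι-unique {ℚR} ℤ→ℚ c)

ι-ℚ-injective : ∀ {c} → fn (ι ℚR) c ≡ ℚ.0ℚ → c ≡ + 0
ι-ℚ-injective {c} e with ℚP.fromℚᵘ-injective {mkℚᵘ c 0} {mkℚᵘ (+ 0) 0} (≡.trans (≡.sym (ι-ℚ c)) e)
... | ℚᵘ.*≡* p = ≡.trans (≡.sym (ℤP.*-identityʳ c)) p

ℚ-domain : Domain ℚR
ℚ-domain = record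
  { 1≉0 = λ () ; nzd = λ {p} {q} → nzd p q ; zero? = λ p → p ℚP.≟ ℚ.0ℚ }
  where
  nzd : ∀ p q → p ℚ.* q ≡ ℚ.0ℚ → p ≡ ℚ.0ℚ ⊎ q ≡ ℚ.0ℚ
  nzd p q e with p ℚP.≟ ℚ.0ℚ
  ... | yes z = inj₁ z
  ... | no nz = inj₂ (≡.trans (≡.trans (≡.sym (ℚP.*-identityˡ q)) (≡.trans (≡.cong (ℚ._* q) (≡.sym (ℚP.*-inverseˡ p)))
      (ℚP.*-assoc (ℚ.1/ p) p q))) (≡.trans (≡.cong ((ℚ.1/ p) ℚ.*_) e) (ℚP.*-zeroʳ (ℚ.1/ p))))
    where instance _ = ℚ.≢-nonZero nz

ℚ-inverse : ∀ p → p ≢ ℚ.0ℚ → ∃ λ q → p ℚ.* q ≡ ℚ.1ℚ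
ℚ-inverse p nz = ℚ.1/ p , ℚP.*-inverseʳ p
  where instance _ = ℚ.≢-nonZero nz

-- Induction over the subring generated by the variables

module _ {m : ℕ} {S : Ring} (h : Hom (Zm m) S) where
  open CRing S

  generated : (G : Carrier → Set) → (∀ {a b} → a ≈ b → G a → G b) → (∀ {a b} → G a → G b → G (a + b)) →
    (∀ {a b} → G a → G b → G (a * b)) → (∀ c → G (fn (ι S) c)) → (∀ i → G (fn h (var m i))) → ∀ a → G (fn h a)
  generated G resp plus times int vars = go m h vars
    where
    go : ∀ m (h : Hom (Zm m) S) → (∀ i → G (fn h (var m i))) → ∀ a → G (fn h a)
    go zero h vars a = resp (sym (ι-unique h a)) (int a)
    go (suc m) h vars = Pol-ind (Zm m) _ (λ e → resp (Hom.cong h e)) (resp (trans (0-homo (ι S)) (sym (0-homo h))) (int (+ 0)))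
      λ r a g → resp (sym (+-homo h _ _)) (plus (go m (h ∘ₕ constₕ (Zm m)) (vars ∘ suc) r)
        (resp (sym (*-homo h _ _)) (times (vars zero) g)))

-- Transport of a curve along a homomorphism of coefficient rings

module _ {m d : ℕ} {f : Poly m} (hom : Homogeneous d f) (P V : Fin m → ℤ) (f[P]≡0 : evalP ℤR f P ≡ + 0)
  (Q ω : ℤ) (a k n : ℕ) (2≤k : 2 ℕ.≤ k) (degrees : d ℕ.* (a ℕ.+ k) ≡ a ℕ.+ n) where

  open Curves f hom P V f[P]≡0 Q ω a k n 2≤k degrees

  module MapCurve {R R′ : Ring} (h : Hom R R′) (x̄ : Fin m → ∣ R ∣) (C : Curve R x̄) where
    private
      module R = CRing R
      module R′ = CRing R′
      module Q1 = CRing (Pol R′)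
      module Q2 = CRing (Pol (Pol R′))
      module S′ = CRing (Series R′)
      module C = Curve C
      module A = Shape R x̄
      module B = Shape R′ (fn h ∘ x̄)
    open SemiringExp Q2.semiring using (^-congˡ)

    H₁ : Hom (Pol R) (Pol R′)
    H₁ = mapₚ h

    H₂ : Hom (Pol (Pol R)) (Pol (Pol R′))
    H₂ = mapₚ H₁

    φ′ : ∣ Pol R′ ∣
    φ′ = fn H₁ C.φ

    y₁-map : ∀ i → fn H₁ (A.y₁ C.φ i) Q1.≈ B.y₁ φ′ i
    y₁-map i = Q1.trans (+-homo H₁ _ _) (Q1.+-cong
      (Q1.trans (+-homo H₁ _ _) (Q1.+-cong (ι-homo H₁ (P i)) (Q1.trans (*-homo H₁ _ _) (Q1.*-congˡ (ι-homo H₁ (V i))))))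
      (Q1.trans (*-homo H₁ _ _) (Q1.*-cong (Q1.trans (*-homo H₁ _ _) (Q1.*-cong (ι-homo H₁ _) (mapₚ-X h))) (mapₚ-const h _))))

    lift-map : ∀ p → fn H₂ (fn A.lift p) Q2.≈ fn B.lift (fn H₁ p)
    lift-map = Pol-hom-ext (H₂ ∘ₕ A.lift) (B.lift ∘ₕ H₁)
      (λ r → Q2.trans (Q2.trans (Hom.cong H₂ (mapₚ-const (constₕ R) r)) (Q2.trans (mapₚ-const H₁ _) (Hom.cong (constₕ (Pol R′)) (mapₚ-const h r))))
        (Q2.sym (Q2.trans (Hom.cong B.lift (mapₚ-const h r)) (mapₚ-const (constₕ R′) _))))
      (Q2.trans (Q2.trans (Hom.cong H₂ (mapₚ-X (constₕ R))) (mapₚ-X H₁)) (Q2.sym (Q2.trans (Hom.cong B.lift (mapₚ-X h)) (mapₚ-X (constₕ R′)))))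

    s^-map : ∀ j → fn H₂ (SemiringExp._^_ (CRing.semiring (Pol (Pol R))) A.s j) Q2.≈ SemiringExp._^_ Q2.semiring B.s j
    s^-map j = Q2.trans (^-homo H₂ A.s j) (^-congˡ j (mapₚ-X H₁))

    η-map : fn H₂ A.η Q2.≈ B.η
    η-map = Q2.trans (+-homo H₂ _ _) (Q2.+-cong (Q2.trans (*-homo H₂ _ _) (Q2.*-cong (ι-homo H₂ Q)
      (Q2.trans (+-homo H₂ _ _) (Q2.+-cong (Q2.trans (mapₚ-const H₁ _) (Hom.cong (constₕ (Pol R′)) (mapₚ-X h))) (mapₚ-X H₁))))) (s^-map k))

    point-map : ∀ i → fn H₂ (A.point C.φ i) Q2.≈ B.point φ′ i
    point-map i = Q2.trans (+-homo H₂ _ _) (Q2.+-cong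
      (Q2.trans (*-homo H₂ _ _) (Q2.*-cong (ι-homo H₂ _) (Q2.trans (lift-map _) (Hom.cong B.lift (y₁-map i)))))
      (Q2.trans (*-homo H₂ _ _) (Q2.*-cong (Q2.trans (*-homo H₂ _ _) (Q2.*-cong (s^-map a) η-map)) (ι-homo H₂ (V i)))))

    scaleT-map : ∀ p → fn (mapₛ h) (fn A.scaleT p) S′.≈ fn B.scaleT (fn H₁ p)
    scaleT-map = Pol-hom-ext (mapₛ h ∘ₕ A.scaleT) (B.scaleT ∘ₕ H₁)
      (λ r → S′.trans (Hom.cong (mapₛ h) (eval-const (constₛ R) _ r)) (S′.trans (mapₛ-constₛ r) (S′.sym (S′.trans (Hom.cong B.scaleT (mapₚ-const h r)) (eval-const (constₛ R′) _ _)))))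
      (S′.trans (Hom.cong (mapₛ h) (eval-X (constₛ R) _)) (S′.trans (*-homo (mapₛ h) _ _) (S′.trans (S′.*-cong (ι-homo (mapₛ h) _) mapₛ-t)
        (S′.sym (S′.trans (Hom.cong B.scaleT (mapₚ-X h)) (eval-X (constₛ R′) _))))))
      where
      mapₛ-constₛ : ∀ r → fn (mapₛ h) (fn (constₛ R) r) S′.≈ fn (constₛ R′) (fn h r)
      mapₛ-constₛ r = extₛ R′ λ { zero → R′.trans (coef-mapₛ h _ 0) (R′.trans (Hom.cong h (coef-constₛ-0 R r)) (R′.sym (coef-constₛ-0 R′ _)))
                                ; (suc j) → R′.trans (coef-mapₛ h _ (suc j)) (R′.trans (Hom.cong h (coef-constₛ-suc R r j)) (R′.trans (0-homo h) (R′.sym (coef-constₛ-suc R′ _ j)))) }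
      mapₛ-t : fn (mapₛ h) (tₛ R) S′.≈ tₛ R′
      mapₛ-t = extₛ R′ λ { zero → R′.trans (coef-mapₛ h _ 0) (R′.trans (Hom.cong h (coefₛ-mk R _ 0)) (R′.trans (0-homo h) (R′.sym (coefₛ-mk R′ _ 0))))
                         ; (suc zero) → R′.trans (coef-mapₛ h _ 1) (R′.trans (Hom.cong h (coefₛ-mk R _ 1)) (R′.trans (1-homo h) (R′.sym (coefₛ-mk R′ _ 1))))
                         ; (suc (suc j)) → R′.trans (coef-mapₛ h _ (suc (suc j))) (R′.trans (Hom.cong h (coefₛ-mk R _ (suc (suc j)))) (R′.trans (0-homo h) (R′.sym (coefₛ-mk R′ _ (suc (suc j)))))) }

    ŷ′ : ∣ Series R′ ∣
    ŷ′ = fn (mapₛ h) C.ŷ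

    at-map : ∀ p → fn (mapₛ h) (fn (A.at C.ŷ) p) S′.≈ fn (B.at ŷ′) (fn H₂ p)
    at-map = Pol-hom-ext (mapₛ h ∘ₕ A.at C.ŷ) (B.at ŷ′ ∘ₕ H₂)
      (λ r → S′.trans (Hom.cong (mapₛ h) (eval-const A.scaleT C.ŷ r)) (S′.trans (scaleT-map r) (S′.sym (S′.trans (Hom.cong (B.at ŷ′) (mapₚ-const H₁ r)) (eval-const B.scaleT ŷ′ _)))))
      (S′.trans (Hom.cong (mapₛ h) (eval-X A.scaleT C.ŷ)) (S′.sym (S′.trans (Hom.cong (B.at ŷ′) (mapₚ-X H₁)) (eval-X B.scaleT ŷ′))))

    private
      coef² : ∀ i j {c} → coef R (coef (Pol R) C.F i) j R.≈ c → coef R′ (coef (Pol R′) (fn H₂ C.F) i) j R′.≈ fn h c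
      coef² i j e = R′.trans (coef-cong R′ (coef-mapₚ H₁ C.F i) j) (R′.trans (coef-mapₚ h _ j) (Hom.cong h e))

    mapCurve : Curve R′ (fn h ∘ x̄)
    mapCurve = record
      { φ = φ′ ; h₁ = fn H₁ C.h₁ ; F = fn H₂ C.F ; ŷ = ŷ′
      ; φ-0 = R′.trans (coef-mapₚ h C.φ 0) (R′.trans (Hom.cong h C.φ-0) (0-homo h))
      ; φ-deg = deg<-mapₚ h C.φ-deg
      ; y₁-eq = Q1.trans (evalP-cong (Pol R′) f (λ i → Q1.sym (y₁-map i))) (Q1.trans (Q1.sym (evalP-homo H₁ f (A.y₁ C.φ)))
          (Q1.trans (Hom.cong H₁ C.y₁-eq) (Q1.trans (*-homo H₁ _ _) (Q1.*-congʳ (Q1.trans (^-homo H₁ (X R) (2 ℕ.+ a)) (SemiringExp.^-congˡ Q1.semiring (2 ℕ.+ a) (mapₚ-X h)))))))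
      ; F-eq = Q2.trans (Q2.*-congʳ (Q2.sym (s^-map a))) (Q2.trans (Q2.sym (*-homo H₂ _ _)) (Q2.trans (Hom.cong H₂ C.F-eq)
          (Q2.trans (evalP-homo H₂ f (A.point C.φ)) (evalP-cong (Pol (Pol R′)) f point-map))))
      ; F-top = Top-cong (Pol R′) (ι-homo H₁ _) Q2.refl (Top-mapₚ H₁ C.F-top)
      ; F-00 = R′.trans (coef² 0 0 C.F-00) (0-homo h)
      ; F-01 = R′.trans (coef² 0 1 C.F-01) (ι-homo h μ)
      ; F-10 = R′.trans (coef² 1 0 C.F-10) (ι-homo h μ)
      ; ŷ-0 = R′.trans (coef-mapₛ h C.ŷ 0) (R′.trans (Hom.cong h C.ŷ-0) (0-homo h))
      ; F-ŷ = S′.trans (S′.sym (at-map C.F)) (S′.trans (Hom.cong (mapₛ h) C.F-ŷ) (0-homo (mapₛ h))) }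

-- Irreducibility of the generic intersection

module _ {R : Ring} where
  open CRing R
  open Divisibility R
  open SemiringExp semiring using (_^_)

  prime-^ : ∀ {p x y} n → Prime p → ¬ p ∣ x → p ∣ x ^ n * y → ¬ p ∣ y → ⊥
  prime-^ zero pp np d ny = ny (∣-respʳ (*-identityˡ _) d)
  prime-^ (suc n) pp np d ny = split pp (∣-respʳ (*-assoc _ _ _) d) np λ d′ → prime-^ n pp np d′ ny

  *-^ : ∀ a b k → (a * b) ^ k ≈ a ^ k * b ^ k
  *-^ a b zero = sym (*-identityˡ _)
  *-^ a b (suc k) = trans (*-congˡ (*-^ a b k))
    (Solver.solve R 4 (λ a b c d → (a :* b) :* (c :* d) := (a :* c) :* (b :* d)) refl a b (a ^ k) (b ^ k))
    where open Solver R using (_:*_; _:=_)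

module GenericIrreducible {m d : ℕ} {f : Poly m} (hom : Homogeneous d f) (1≤d : 1 ℕ.≤ d)
  (primef : Divisibility.Prime (Zm m) (hat f)) (P V : Fin m → ℤ) (f[P]≡0 : evalP ℤR f P ≡ + 0)
  (f[V]≢0 : evalP ℤR f V ≢ + 0) (l≢0 : directional ℤR f P V ≢ + 0)
  (Q ω : ℤ) (Q≢0 : Q ≢ + 0) (ω≢0 : ω ≢ + 0) (a k n : ℕ) (2≤k : 2 ℕ.≤ k) (degrees : d ℕ.* (a ℕ.+ k) ≡ a ℕ.+ n) where

  open Curves f hom P V f[P]≡0 Q ω a k n 2≤k degrees
  open Domain ℤ-domain using () renaming (*-nonzero to ℤ-*-nonzero; ^-nonzero to ℤ-^-nonzero; factorʳ-nonzero to ℤ-factorʳ)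

  μ≢0 : μ ≢ + 0
  μ≢0 = ℤ-*-nonzero Q≢0 (ℤ-factorʳ {Q ℤ.* ω} (directional-scale ℤR {f = f} hom (Q ℤ.* ω) P V)
    (ℤ-*-nonzero (ℤ-^-nonzero {Q ℤ.* ω} d (ℤ-*-nonzero Q≢0 ω≢0)) l≢0))

  private
    𝔸 = Zm m
    𝔹 = Pol 𝔸
    module A = CRing 𝔸
    module B = CRing 𝔹
    domA = Zm-domain m
    domB = Pol-domain domA
  open CRing (Pol 𝔹)
  open SemiringExp semiring using (_^_; ^-homo-*; ^-congˡ)
  open Divisibility (Pol 𝔹)
  open Shape 𝔸 (var m)
  open Solver (Pol 𝔹) using (solve; _:+_; _:*_; :-_; _:=_)

  ι-nonzero : ∀ m {c} → c ≢ + 0 → ¬ CRing._≈_ (Zm m) (fn (ι (Zm m)) c) (CRing.0# (Zm m))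
  ι-nonzero zero {c} nz e = nz (≡.trans (≡.sym (ι-ℤ c)) e)
  ι-nonzero (suc m) {c} nz e = const≉0 (Zm-domain m) (ι-nonzero m nz) (CRing.trans (Zm (suc m)) (ι-homo (constₕ (Zm m)) c) e)

  module _ (C : Curve 𝔸 (var m)) where
    open Curve C

    module Substitution where
      i : ℤ → Carrier
      i = fn (ι (Pol 𝔹))
      N K σ υ : Carrier
      N = i (Q ℤ.* ω)
      K = N * i (l ℤ.* l)
      σ = K * s
      υ = N * fn lift φ + s ^ a * η
      cc : ∣ 𝔸 ∣ → Carrier
      cc r = const 𝔹 (const 𝔸 r)

      β-𝔸 : Hom 𝔸 (Pol 𝔹)
      β-𝔸 = evZ (Pol 𝔹) (point φ)
      β-𝔹 : Hom 𝔹 (Pol 𝔹)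
      β-𝔹 = eval β-𝔸 υ
      -- The substitution x ↦ x(s), T ↦ υ, s ↦ s, which sends f to sᵃF. As x(s) = N·P + υV + σx, it
      -- can be inverted once s and the nonzero constants are.
      β : Hom (Pol 𝔹) (Pol 𝔹)
      β = eval β-𝔹 s

      β-s : fn β s ≈ s
      β-s = eval-X β-𝔹 s

      β-T : fn β T ≈ υ
      β-T = trans (eval-const β-𝔹 s _) (eval-X β-𝔸 υ)

      β-cc : ∀ r → fn β (cc r) ≈ fn β-𝔸 r
      β-cc r = trans (eval-const β-𝔹 s _) (eval-const β-𝔸 υ r)

      β-σ : fn β σ ≈ σ
      β-σ = trans (*-homo β _ _) (*-cong (trans (*-homo β _ _) (*-cong (ι-homo β _) (ι-homo β _))) β-s)

      lift-const : ∀ r → fn lift (const 𝔸 r) ≈ cc r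
      lift-const = mapₚ-const (constₕ 𝔸)

      point-split : ∀ j → point φ j ≈ (N * i (P j) + υ * i (V j)) + σ * cc (var m j)
      point-split j = begin
        N * fn lift (y₁ φ j) + (s ^ a * η) * i (V j)
          ≈⟨ +-congʳ (*-congˡ (trans (+-homo lift _ _) (+-cong
               (trans (+-homo lift _ _) (+-cong (ι-homo lift (P j)) (trans (*-homo lift _ _) (*-congˡ (ι-homo lift (V j))))))
               (trans (*-homo lift _ _) (*-cong (trans (*-homo lift _ _) (*-cong (ι-homo lift _) (mapₚ-X (constₕ 𝔸)))) (lift-const _)))))) ⟩
        N * ((i (P j) + fn lift φ * i (V j)) + i (l ℤ.* l) * s * cc (var m j)) + (s ^ a * η) * i (V j)
          ≈⟨ solve 8 (λ N p φ v L s x e → N :* ((p :+ φ :* v) :+ L :* s :* x) :+ e :* v := (N :* p :+ (N :* φ :+ e) :* v) :+ N :* L :* s :* x) refl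
               N (i (P j)) (fn lift φ) (i (V j)) (i (l ℤ.* l)) s (cc (var m j)) (s ^ a * η) ⟩
        (N * i (P j) + υ * i (V j)) + σ * cc (var m j) ∎
        where open SetoidReasoning setoid

      -- E lies in the image of β up to a power of σ. That every E is good (`good`) is one half of
      -- the birationality of β; `β-injective` is the other.
      Good : Carrier → Set
      Good E = ∃ λ J → ∃ λ E* → fn β E* ≈ σ ^ J * E

      Good-resp : ∀ {E E′} → E ≈ E′ → Good E → Good E′
      Good-resp e (J , E* , p) = J , E* , trans p (*-congˡ e)

      Good-image : ∀ {E} E* → fn β E* ≈ E → Good E
      Good-image E* p = 0 , E* , trans p (sym (*-identityˡ _))

      Good-* : ∀ {E E′} → Good E → Good E′ → Good (E * E′)
      Good-* {E} {E′} (J , E* , p) (J′ , E′* , p′) = J ℕ.+ J′ , E* * E′* , trans (*-homo β _ _) (trans (*-cong p p′)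
        (trans (solve 4 (λ a b c d → (a :* b) :* (c :* d) := (a :* c) :* (b :* d)) refl _ E _ E′) (*-congʳ (sym (^-homo-* σ J J′)))))

      β-σ^ : ∀ J → fn β (σ ^ J) ≈ σ ^ J
      β-σ^ J = trans (^-homo β σ J) (^-congˡ J β-σ)

      Good-+ : ∀ {E E′} → Good E → Good E′ → Good (E + E′)
      Good-+ {E} {E′} (J , E* , p) (J′ , E′* , p′) = J ℕ.+ J′ , σ ^ J′ * E* + σ ^ J * E′* ,
        trans (+-homo β _ _) (trans (+-cong (trans (*-homo β _ _) (*-cong (β-σ^ J′) p)) (trans (*-homo β _ _) (*-cong (β-σ^ J) p′)))
        (trans (solve 4 (λ a b E F → b :* (a :* E) :+ a :* (b :* F) := (a :* b) :* (E :+ F)) refl (σ ^ J) (σ ^ J′) E E′) (*-congʳ (sym (^-homo-* σ J J′)))))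

      Good-i : ∀ c → Good (i c)
      Good-i c = Good-image (i c) (ι-homo β c)

      Good-s : Good s
      Good-s = Good-image s β-s

      Good-^ : ∀ {E} j → Good E → Good (E ^ j)
      Good-^ zero g = Good-resp (1-homo (ι (Pol 𝔹))) (Good-i (+ 1))
      Good-^ (suc j) g = Good-* g (Good-^ j g)

      Good-neg : ∀ {E} → Good E → Good (- E)
      Good-neg {E} g = Good-resp (trans (*-congʳ (trans (-‿homo (ι (Pol 𝔹)) (+ 1)) (-‿cong (1-homo (ι (Pol 𝔹)))))) (RingProps.-1*x≈-x ring E)) (Good-* (Good-i (ℤ.- + 1)) g)

      Good-σ^ : ∀ {E} j → Good (σ ^ j * E) → Good E
      Good-σ^ j (J , E* , p) = J ℕ.+ j , E* , trans p (trans (sym (*-assoc _ _ _)) (*-congʳ (sym (^-homo-* σ J j))))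

      -- The coordinate is recovered from σxⱼ = β(xⱼ) - N·Pⱼ - β(T)Vⱼ.
      Good-var : ∀ j → Good (cc (var m j))
      Good-var j = 1 , cc (var m j) + - (N * i (P j) + T * i (V j)) , (begin
        fn β (cc (var m j) + - (N * i (P j) + T * i (V j)))
          ≈⟨ trans (+-homo β _ _) (+-cong (trans (β-cc _) (trans (evZ-var (Pol 𝔹) (point φ) j) (point-split j))) (trans (-‿homo β _) (-‿cong
               (trans (+-homo β _ _) (+-cong (trans (*-homo β _ _) (*-cong (ι-homo β _) (ι-homo β _))) (trans (*-homo β _ _) (*-cong β-T (ι-homo β _)))))))) ⟩
        ((N * i (P j) + υ * i (V j)) + σ * cc (var m j)) + - (N * i (P j) + υ * i (V j))
          ≈⟨ solve 2 (λ x y → (x :+ y) :+ :- x := y) refl _ _ ⟩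
        σ * cc (var m j) ≈⟨ *-congʳ (*-identityʳ σ) ⟨
        σ ^ 1 * cc (var m j) ∎)
        where open SetoidReasoning setoid

      Good-cc : ∀ r → Good (cc r)
      Good-cc = generated (constₕ 𝔹 ∘ₕ constₕ 𝔸) Good Good-resp Good-+ Good-* Good-i Good-var

      Good-lift : ∀ p → Good (fn lift p)
      Good-lift = Pol-ind 𝔸 _ (λ e → Good-resp (Hom.cong lift e)) (Good-resp (trans (0-homo (ι (Pol 𝔹))) (sym (0-homo lift))) (Good-i (+ 0)))
        λ r p g → Good-resp (sym (trans (+-homo lift _ _) (+-cong (lift-const r) (trans (*-homo lift _ _) (*-congʳ (mapₚ-X (constₕ 𝔸)))))))
          (Good-+ (Good-cc r) (Good-* Good-s g))

      -- The equation υ = Nφ + sᵃ(Q(T + s) + sᵏ) is solved for T.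
      Good-T : Good T
      -- The multiplier Kᵃ·ωl²s completes the coefficient Qsᵃ of T to σᵃ⁺¹.
      Good-T = Good-σ^ (suc a) (Good-resp eq (Good-* (Good-* (Good-* (Good-^ a (Good-* (Good-i _) (Good-i _))) (Good-* (Good-i ω) (Good-i (l ℤ.* l)))) Good-s)
        (Good-+ (Good-image T β-T) (Good-neg (Good-+ (Good-* (Good-i _) (Good-lift φ)) (Good-* (Good-^ a Good-s) (Good-+ (Good-* (Good-i Q) Good-s) (Good-^ k Good-s))))))))
        where
        open SetoidReasoning setoid
        eq : (K ^ a * (i ω * i (l ℤ.* l)) * s) * (υ + - (N * fn lift φ + s ^ a * (i Q * s + s ^ k))) ≈ σ ^ suc a * T
        eq = begin
          (K ^ a * (i ω * i (l ℤ.* l)) * s) * (υ + - (N * fn lift φ + s ^ a * (i Q * s + s ^ k)))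
            ≈⟨ solve 10 (λ Ka w L s Nφ sa q sk t z → (Ka :* (w :* L) :* s) :* ((Nφ :+ sa :* (q :* (t :+ s) :+ sk)) :+ :- (Nφ :+ sa :* (q :* s :+ sk)))
                 := ((q :* w) :* L :* s) :* (Ka :* sa) :* t) refl (K ^ a) (i ω) (i (l ℤ.* l)) s (N * fn lift φ) (s ^ a) (i Q) (s ^ k) T T ⟩
          ((i Q * i ω) * i (l ℤ.* l) * s) * (K ^ a * s ^ a) * T
            ≈⟨ *-congʳ (*-cong (*-congʳ (*-congʳ (sym (*-homo (ι (Pol 𝔹)) Q ω)))) (sym (*-^ {Pol 𝔹} K s a))) ⟩
          σ ^ suc a * T ∎

      good : ∀ E → Good E
      good = Pol-ind 𝔹 _ Good-resp (Good-resp (0-homo (ι (Pol 𝔹))) (Good-i (+ 0))) λ r E g → Good-+ (good-𝔹 r) (Good-* Good-s g)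
        where
        good-𝔹 : ∀ r → Good (const 𝔹 r)
        good-𝔹 = Pol-ind 𝔸 _ (λ e → Good-resp (Hom.cong (constₕ 𝔹) e)) (Good-resp (trans (0-homo (ι (Pol 𝔹))) (sym (0-homo (constₕ 𝔹)))) (Good-i (+ 0)))
          λ r p g → Good-resp (sym (trans (+-homo (constₕ 𝔹) _ _) (+-congˡ (*-homo (constₕ 𝔹) _ _)))) (Good-+ (Good-cc r) (Good-* Good-T g))

      -- β hits rational points: at integers where A·s is nonzero, the equations for x(s) and υ are
      -- solved first for x and then for T over ℚ. The value of β(A) at the solution is the value of
      -- A at the chosen integers, hence nonzero. The factor s keeps σ invertible.
      module Injective (A : Carrier) (A≉0 : ¬ A ≈ 0#) (βA≈0 : fn β A ≈ 0#) where
        open CRing ℚR using () renaming (_+_ to _+q_; _*_ to _*q_; -_ to -q_)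
        module q = Solver ℚR
        s≉0 : ¬ s ≈ 0#
        s≉0 e = Domain.1≉0 domB (B.trans (B.sym (coef-const-0 𝔹 B.1#)) (B.trans (B.sym (coef-X*-suc 𝔹 (const 𝔹 B.1#) 0))
          (B.trans (coef-cong 𝔹 (trans (*-congʳ e) (zeroˡ _)) 1) (coef-0 𝔹 1))))
        pt = nonzero-point (2 ℕ.+ m) (A * s) (Domain.*-nonzero (Pol-domain domB) A≉0 s≉0)
        ξ : Fin (2 ℕ.+ m) → ℤ
        ξ = proj₁ pt
        e₀ : Hom (Pol 𝔹) ℤR
        e₀ = evZ ℤR ξ
        A[ξ]≢0 : fn e₀ A ≢ + 0
        A[ξ]≢0 z = proj₂ pt (≡.trans (*-homo e₀ A s) (≡.cong (ℤ._* fn e₀ s) z))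
        s₀≢0 : ξ zero ≢ + 0
        s₀≢0 z = proj₂ pt (≡.trans (*-homo e₀ A s) (≡.trans (≡.cong (fn e₀ A ℤ.*_) (≡.trans (evZ-var ℤR ξ zero) z)) (ℤP.*-zeroʳ (fn e₀ A))))
        iq : ℤ → ℚ
        iq = fn (ι ℚR)
        iq≢0 : ∀ {c} → c ≢ + 0 → iq c ≢ ℚ.0ℚ
        iq≢0 nz e = nz (ι-ℚ-injective e)
        s₀ u₀ : ℚ
        s₀ = iq (ξ zero)
        u₀ = iq (ξ (suc zero))
        nq = iq (Q ℤ.* ω)
        Kq = nq *q iq (l ℤ.* l)
        open Domain ℚ-domain using () renaming (*-nonzero to q-*-nonzero; ^-nonzero to q-^-nonzero)
        open SemiringExp (CRing.semiring ℚR) using () renaming (_^_ to _^q_; ^-congˡ to ^q-cong)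
        σ⁻ = ℚ-inverse (Kq *q s₀) (q-*-nonzero (q-*-nonzero (iq≢0 (ℤ-*-nonzero Q≢0 ω≢0)) (iq≢0 (ℤ-*-nonzero l≢0 l≢0))) (iq≢0 s₀≢0))
        xq : Fin m → ℚ
        xq j = (iq (ξ (suc (suc j))) +q -q (nq *q iq (P j) +q u₀ *q iq (V j))) *q proj₁ σ⁻
        eA : Hom 𝔸 ℚR
        eA = evZ ℚR xq
        φq = fn (eval eA s₀) φ
        Q⁻ = ℚ-inverse (s₀ ^q a *q iq Q) (q-*-nonzero (q-^-nonzero a (iq≢0 s₀≢0)) (iq≢0 Q≢0))
        Tq = (u₀ +q -q (nq *q φq +q s₀ ^q a *q (iq Q *q s₀ +q s₀ ^q k))) *q proj₁ Q⁻
        eB : Hom 𝔹 ℚR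
        eB = eval eA Tq
        e : Hom (Pol 𝔹) ℚR
        e = eval eB s₀
        e-s : fn e s ≡ s₀
        e-s = eval-X eB s₀
        e-T : fn e T ≡ Tq
        e-T = ≡.trans (eval-const eB s₀ _) (eval-X eA Tq)
        e-lift : ∀ p → fn e (fn lift p) ≡ fn (eval eA s₀) p
        e-lift = Pol-hom-ext (e ∘ₕ lift) (eval eA s₀)
          (λ r → ≡.trans (Hom.cong e (lift-const r)) (≡.trans (eval-const eB s₀ _) (≡.trans (eval-const eA Tq r) (≡.sym (eval-const eA s₀ r)))))
          (≡.trans (Hom.cong e (mapₚ-X (constₕ 𝔸))) (≡.trans e-s (≡.sym (eval-X eA s₀))))
        e-υ : fn e υ ≡ u₀
        e-υ = ≡.trans (+-homo e _ _) (≡.trans (≡.cong₂ _+q_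
          (≡.trans (*-homo e _ _) (≡.cong₂ _*q_ (ι-homo e _) (e-lift φ)))
          (≡.trans (*-homo e _ _) (≡.cong₂ _*q_ (≡.trans (^-homo e s a) (^q-cong a e-s))
            (≡.trans (+-homo e _ _) (≡.cong₂ _+q_ (≡.trans (*-homo e _ _) (≡.cong₂ _*q_ (ι-homo e Q) (≡.trans (+-homo e _ _) (≡.cong₂ _+q_ e-T e-s))))
              (≡.trans (^-homo e s k) (^q-cong k e-s)))))))
          (≡.trans (q.solve 7 (λ nφ sa qq s sk u r → nφ q.:+ sa q.:* (qq q.:* ((u q.:+ q.:- (nφ q.:+ sa q.:* (qq q.:* s q.:+ sk))) q.:* r q.:+ s) q.:+ sk)
               q.:= (sa q.:* qq q.:* r) q.:* (u q.:+ q.:- (nφ q.:+ sa q.:* (qq q.:* s q.:+ sk))) q.:+ (nφ q.:+ sa q.:* (qq q.:* s q.:+ sk)))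
             ≡.refl (nq *q φq) (s₀ ^q a) (iq Q) s₀ (s₀ ^q k) u₀ (proj₁ Q⁻))
           (≡.trans (≡.cong (λ z → z *q (u₀ +q -q w) +q w) (proj₂ Q⁻)) (≡.trans (≡.cong (_+q w) (ℚP.*-identityˡ (u₀ +q -q w))) (q.solve 2 (λ u w → (u q.:+ q.:- w) q.:+ w q.:= u) ≡.refl u₀ w)))))
          where w = nq *q φq +q s₀ ^q a *q (iq Q *q s₀ +q s₀ ^q k)
        e-σ : fn e σ ≡ Kq *q s₀
        e-σ = ≡.trans (*-homo e _ _) (≡.cong₂ _*q_ (≡.trans (*-homo e _ _) (≡.cong₂ _*q_ (ι-homo e _) (ι-homo e _))) e-s)
        e-point : ∀ j → fn e (point φ j) ≡ iq (ξ (suc (suc j)))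
        e-point j = ≡.trans (Hom.cong e (point-split j)) (≡.trans (+-homo e _ _) (≡.trans (≡.cong₂ _+q_
            (≡.trans (+-homo e _ _) (≡.cong₂ _+q_ (≡.trans (*-homo e _ _) (≡.cong₂ _*q_ (ι-homo e _) (ι-homo e _))) (≡.trans (*-homo e _ _) (≡.cong₂ _*q_ e-υ (ι-homo e _)))))
            (≡.trans (*-homo e _ _) (≡.cong₂ _*q_ e-σ (≡.trans (eval-const eB s₀ _) (≡.trans (eval-const eA Tq _) (evZ-var ℚR xq j))))))
          (≡.trans (q.solve 4 (λ w σ x r → w q.:+ σ q.:* ((x q.:+ q.:- w) q.:* r) q.:= (σ q.:* r) q.:* (x q.:+ q.:- w) q.:+ w) ≡.refl w (Kq *q s₀) x (proj₁ σ⁻))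
          (≡.trans (≡.cong (λ z → z *q (x +q -q w) +q w) (proj₂ σ⁻)) (≡.trans (≡.cong (_+q w) (ℚP.*-identityˡ (x +q -q w))) (q.solve 2 (λ u w → (u q.:+ q.:- w) q.:+ w q.:= u) ≡.refl x w))))))
          where
          w = nq *q iq (P j) +q u₀ *q iq (V j)
          x = iq (ξ (suc (suc j)))
        agree : ∀ E → fn e (fn β E) ≡ iq (fn e₀ E)
        agree = Zm-hom-ext ℚR (2 ℕ.+ m) (e ∘ₕ β) (ι ℚR ∘ₕ e₀) λ
          { zero → ≡.trans (Hom.cong e β-s) (≡.trans e-s (≡.sym (≡.cong iq (evZ-var ℤR ξ zero))))
          ; (suc zero) → ≡.trans (Hom.cong e β-T) (≡.trans e-υ (≡.sym (≡.cong iq (evZ-var ℤR ξ (suc zero)))))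
          ; (suc (suc j)) → ≡.trans (Hom.cong e (trans (β-cc _) (evZ-var (Pol 𝔹) (point φ) j))) (≡.trans (e-point j) (≡.sym (≡.cong iq (evZ-var ℤR ξ (suc (suc j)))))) }
        contradiction : ⊥
        contradiction = A[ξ]≢0 (ι-ℚ-injective (≡.trans (≡.sym (agree A)) (≡.trans (Hom.cong e βA≈0) (0-homo e))))

      β-injective : ∀ {A B} → fn β A ≈ fn β B → A ≈ B
      β-injective {A} {B} p with Domain.zero? (Pol-domain domB) (A + - B)
      ... | yes z = trans (solve 2 (λ A B → A := (A :+ :- B) :+ B) refl A B) (trans (+-congʳ z) (+-identityˡ B))
      ... | no nz = ⊥-elim (Injective.contradiction (A + - B) nz (trans (+-homo β _ _) (trans (+-cong p (-‿homo β B)) (-‿inverseʳ _))))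

      F₀≉0 : ¬ coef 𝔹 F 0 B.≈ B.0#
      F₀≉0 z = ι-nonzero m μ≢0 (A.trans (A.sym F-01) (A.trans (coef-cong 𝔸 z 1) (coef-0 𝔸 1)))

      c≉0 : ¬ fn (ι 𝔹) (evalP ℤR f V) B.≈ B.0#
      c≉0 = ι-nonzero (suc m) f[V]≢0

      -- F is prime to s, and its degree is n.
      no-multiple : ∀ j {E W} → deg< 𝔹 n E → ¬ E ≈ 0# → s ^ j * E ≈ F * W → ⊥
      no-multiple zero {E} {W} dE E≉0 e with Top-factor domB (proj₁ (proj₂ (topOf domB E E≉0))) (Top-cong 𝔹 B.refl (trans (sym (*-identityˡ E)) e) (proj₂ (proj₂ (topOf domB E E≉0))))
      ... | k₁ , l₁ , k+l , (nF , tF) , _ with Top-unique domB nF c≉0 tF F-top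
      ... | ≡.refl = proj₁ (proj₂ (topOf domB E E≉0)) (dE _ (≡.subst (n ℕ.≤_) k+l (ℕP.m≤m+n n l₁)))
      no-multiple (suc j) {E} {W} dE E≉0 e with Domain.nzd domB (B.trans (B.sym (coef-*-0 𝔹 F W)) (B.trans (coef-cong 𝔹 (sym e) 0) (B.trans (coef-cong 𝔹 (*-assoc _ _ _) 0) (coef-X*-0 𝔹 _))))
      ... | inj₁ z = F₀≉0 z
      ... | inj₂ z = no-multiple j dE E≉0 (X*-cancel 𝔹 (trans (sym (*-assoc _ _ _)) (trans e (trans (*-congˡ (X∣ 𝔹 z))
          (solve 3 (λ F s w → F :* (s :* w) := s :* (F :* w)) refl F s (tail 𝔹 W))))))

      ĥ : Carrier
      ĥ = cc (hat f)

      ĥ-prime : Prime ĥ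
      ĥ-prime = const-Prime domB (Zm-factorisations (suc m)) (const-Prime domA (Zm-factorisations m) primef)

      β-ĥ : fn β ĥ ≈ s ^ a * F
      β-ĥ = trans (β-cc _) (trans (evZ-hat (Pol 𝔹) f (point φ)) (sym F-eq))

      ĥ∤s : ¬ ĥ ∣ s
      ĥ∤s (q , e) = Divisibility.nonunit (const-Prime domA (Zm-factorisations m) primef) (coef 𝔹 q 1 ,
        B.trans (B.sym (coef-const* 𝔹 _ q 1)) (B.trans (coef-cong 𝔹 (trans e (trans (sym (*-identityʳ s)) (*-congˡ (sym (1-homo (constₕ 𝔹)))))) 1) (B.trans (coef-X*-suc 𝔹 _ 0) (coef-const-0 𝔹 _))))

      -- On the line X·V, f has degree d ≥ 1 and leading coefficient f(V), so it divides no nonzero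
      -- constant.
      hat∤ι : ∀ {c} → c ≢ + 0 → ¬ Divisibility._∣_ 𝔸 (hat f) (fn (ι 𝔸) c)
      hat∤ι {c} nz (g , e) = absurd (Top-factor ℤ-domain nz (Top-cong ℤR (ι-ℤ c) (Z.trans (ι-homo (constₕ ℤR) c) (Z.trans (Z.sym (ι-homo τ c)) (Z.trans (Hom.cong τ (A.sym e)) (*-homo τ _ _)))) (Top-const ℤR (fn (ι ℤR) c))))
        where
        module Z = CRing (Pol ℤR)
        τ : Hom 𝔸 (Pol ℤR)
        τ = evZ (Pol ℤR) (λ j → SemiringExp._^_ Z.semiring (X ℤR) 1 Z.* const ℤR (V j))
        topF : Top ℤR (d ℕ.* 1) (evalP ℤR f V) (fn τ (hat f))
        topF = Top-cong ℤR ≡.refl (Z.sym (evZ-hat (Pol ℤR) f _)) (Top-evalP ℤR {f} hom λ j → Top-X^* ℤR 1 (V j))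
        absurd : _ → ⊥
        absurd (k₁ , l₁ , k+l , (nF , tF) , _) with Top-unique ℤ-domain nF f[V]≢0 tF topF
        ... | ≡.refl = ℕP.1+n≰n (ℕP.≤-trans (≡.subst (1 ℕ.≤_) (≡.sym (ℕP.*-identityʳ d)) 1≤d) (ℕP.≤-trans (ℕP.m≤m+n (d ℕ.* 1) l₁) (ℕP.≤-reflexive k+l)))

      ĥ∤i : ∀ {c} → c ≢ + 0 → ¬ ĥ ∣ i c
      ĥ∤i {c} nz (q , e) = hat∤ι nz (coef 𝔸 (coef 𝔹 q 0) 0 , A.trans (A.sym (coef-const* 𝔸 _ _ 0)) (A.trans (coef-cong 𝔸 (B.sym (coef-const* 𝔹 _ q 0)) 0)
        (A.trans (coef-cong 𝔸 (coef-cong 𝔹 e 0) 0) (A.trans (coef-cong 𝔸 (B.trans (coef-cong 𝔹 (ι-const 𝔹 c) 0) (coef-const-0 𝔹 _)) 0)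
        (A.trans (coef-cong 𝔸 (ι-const 𝔸 c) 0) (coef-const-0 𝔸 _))))))

      K≈ : K ≈ i ((Q ℤ.* ω) ℤ.* (l ℤ.* l))
      K≈ = sym (*-homo (ι (Pol 𝔹)) _ _)

      ĥ∤σ : ¬ ĥ ∣ σ
      ĥ∤σ d′ = split ĥ-prime d′ (λ e → ĥ∤i (ℤ-*-nonzero (ℤ-*-nonzero Q≢0 ω≢0) (ℤ-*-nonzero l≢0 l≢0)) (∣-respʳ K≈ e)) ĥ∤s

      -- If f divided E*, then β would make F divide σᴶE times its constant. By `no-multiple` no
      -- power of s times a nonzero polynomial of degree below n is a multiple of F.
      ĥ∤* : ∀ {E} → deg< 𝔹 n E → ¬ E ≈ 0# → ∀ {J E*} → fn β E* ≈ σ ^ J * E → ¬ ĥ ∣ E*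
      ĥ∤* {E} dE E≉0 {J} {E*} p (W , e) = no-multiple J {const 𝔹 κ * E} {s ^ a * fn β W} (deg<-const* 𝔹 κ dE) (Domain.*-nonzero (Pol-domain domB) κ≉0 E≉0) (begin
        s ^ J * (const 𝔹 κ * E) ≈⟨ solve 3 (λ s κ E → s :* (κ :* E) := (κ :* s) :* E) refl _ _ E ⟩
        (const 𝔹 κ * s ^ J) * E ≈⟨ *-congʳ (trans (*-congʳ (trans (^-homo (constₕ 𝔹) _ J) (^-congˡ J (sym (trans K≈ (ι-const 𝔹 _)))))) (sym (*-^ {Pol 𝔹} K s J))) ⟩
        σ ^ J * E ≈⟨ p ⟨
        fn β E* ≈⟨ Hom.cong β e ⟨
        fn β (ĥ * W) ≈⟨ trans (*-homo β _ _) (*-congʳ β-ĥ) ⟩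
        s ^ a * F * fn β W ≈⟨ solve 3 (λ s F w → s :* F :* w := F :* (s :* w)) refl _ _ _ ⟩
        F * (s ^ a * fn β W) ∎)
        where
        open SetoidReasoning setoid
        κ₀ = fn (ι 𝔹) ((Q ℤ.* ω) ℤ.* (l ℤ.* l))
        κ = SemiringExp._^_ B.semiring κ₀ J
        κ≉0 : ¬ const 𝔹 κ ≈ 0#
        κ≉0 = const≉0 domB (Domain.^-nonzero domB J (ι-nonzero (suc m) (ℤ-*-nonzero (ℤ-*-nonzero Q≢0 ω≢0) (ℤ-*-nonzero l≢0 l≢0))))

    open Substitution

    -- The relation FH = EG is pulled back along β. Up to powers of s and σ, which f does not
    -- divide, the prime f then divides E*·G*, hence one of the factors, against `ĥ∤*`.
    F-irreducible : NoFactor domB n F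
    F-irreducible H E G FH≈EG dE dG E≉0 G≉0 = split₂ (good H) (good E) (good G)
      where
      split₂ : Good H → Good E → Good G → ⊥
      split₂ (J , H* , pH) (J₁ , E* , pE) (J₂ , G* , pG) =
        prime-^ {Pol 𝔹} a ĥ-prime ĥ∤s (∣-respʳ ĥdiv (H* * σ ^ (J₁ ℕ.+ J₂) , refl)) λ d₁ →
        prime-^ {Pol 𝔹} J ĥ-prime ĥ∤σ d₁ λ d₂ → split ĥ-prime d₂ (ĥ∤* dE E≉0 {J₁} pE) (ĥ∤* dG G≉0 {J₂} pG)
        where
        open SetoidReasoning setoid
        ĥdiv : ĥ * (H* * σ ^ (J₁ ℕ.+ J₂)) ≈ s ^ a * (σ ^ J * (E* * G*))
        ĥdiv = β-injective (begin
          fn β (ĥ * (H* * σ ^ (J₁ ℕ.+ J₂))) ≈⟨ trans (*-homo β _ _) (*-cong β-ĥ (trans (*-homo β _ _) (*-cong pH (trans (β-σ^ (J₁ ℕ.+ J₂)) (^-homo-* σ J₁ J₂))))) ⟩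
          s ^ a * F * (σ ^ J * H * (σ ^ J₁ * σ ^ J₂))
            ≈⟨ solve 6 (λ s F x H y z → s :* F :* (x :* H :* (y :* z)) := s :* (x :* (y :* z :* (F :* H)))) refl (s ^ a) F (σ ^ J) H (σ ^ J₁) (σ ^ J₂) ⟩
          s ^ a * (σ ^ J * (σ ^ J₁ * σ ^ J₂ * (F * H))) ≈⟨ *-congˡ (*-congˡ (*-congˡ FH≈EG)) ⟩
          s ^ a * (σ ^ J * (σ ^ J₁ * σ ^ J₂ * (E * G)))
            ≈⟨ solve 6 (λ s x y z E G → s :* (x :* (y :* z :* (E :* G))) := s :* (x :* (y :* E :* (z :* G)))) refl (s ^ a) (σ ^ J) (σ ^ J₁) (σ ^ J₂) E G ⟩
          s ^ a * (σ ^ J * (σ ^ J₁ * E * (σ ^ J₂ * G)))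
            ≈⟨ trans (*-homo β _ _) (*-cong (trans (^-homo β s a) (^-congˡ a β-s)) (trans (*-homo β _ _) (*-cong (β-σ^ J) (trans (*-homo β _ _) (*-cong pE pG))))) ⟨
          fn β (s ^ a * (σ ^ J * (E* * G*))) ∎)

-- Linear independence of the monomials Tⁱsʲ along the branch

module _ (R : Ring) where
  open CRing R
  open Sums R
  private
    module P = CRing (Pol R)

  δ : ∀ {n} → Fin n → Fin n → Carrier
  δ zero zero = 1#
  δ zero (suc j) = 0#
  δ (suc i) zero = 0#
  δ (suc i) (suc j) = δ i j

  linear-expand : ∀ {n} (g : (Fin n → Carrier) → Carrier) → (∀ {c c′} → (∀ i → c i ≈ c′ i) → g c ≈ g c′) →
    (∀ c c′ → g (λ i → c i + c′ i) ≈ g c + g c′) → (∀ r c → g (λ i → r * c i) ≈ r * g c) →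
    ∀ c → g c ≈ sum (λ i → c i * g (δ i))
  linear-expand {zero} g g-cong g-+ g-* c = trans (g-cong λ ()) (trans (g-* 0# c) (zeroˡ _))
  linear-expand {suc n} g g-cong g-+ g-* c = begin
    g c ≈⟨ g-cong (λ { zero → sym (trans (+-congʳ (*-identityʳ _)) (+-identityʳ _)) ; (suc i) → sym (trans (+-congʳ (zeroʳ _)) (+-identityˡ _)) }) ⟩
    g (λ i → c zero * δ zero i + shift (c ∘ suc) i) ≈⟨ g-+ (λ i → c zero * δ zero i) (shift (c ∘ suc)) ⟩
    g (λ i → c zero * δ zero i) + g (shift (c ∘ suc)) ≈⟨ +-cong (g-* (c zero) (δ zero)) (linear-expand (g ∘ shift) shift-cong shift-+ shift-* (c ∘ suc)) ⟩
    c zero * g (δ zero) + sum (λ i → c (suc i) * g (shift (δ i)))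
      ≈⟨ +-congˡ (sum-cong (λ i → c (suc i) * g (shift (δ i))) (λ i → c (suc i) * g (δ (suc i))) λ i → *-congˡ (g-cong λ { zero → refl ; (suc j) → refl })) ⟩
    c zero * g (δ zero) + sum (λ i → c (suc i) * g (δ (suc i))) ∎
    where
    open SetoidReasoning setoid
    shift : (Fin n → Carrier) → Fin (suc n) → Carrier
    shift c zero = 0#
    shift c (suc i) = c i
    shift-cong : ∀ {c c′} → (∀ i → c i ≈ c′ i) → g (shift c) ≈ g (shift c′)
    shift-cong e = g-cong λ { zero → refl ; (suc i) → e i }
    shift-+ : ∀ c c′ → g (shift (λ i → c i + c′ i)) ≈ g (shift c) + g (shift c′)
    shift-+ c c′ = trans (g-cong λ { zero → sym (+-identityˡ 0#) ; (suc i) → refl }) (g-+ (shift c) (shift c′))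
    shift-* : ∀ r c → g (shift (λ i → r * c i)) ≈ r * g (shift c)
    shift-* r c = trans (g-cong λ { zero → sym (zeroʳ r) ; (suc i) → refl }) (g-* r (shift c))

  build : ∀ {n} → (Fin n → Carrier) → ∣ Pol R ∣
  build {zero} c = P.0#
  build {suc n} c = const R (c zero) P.+ X R P.* build (c ∘ suc)

  build-cong : ∀ {n} {c c′ : Fin n → Carrier} → (∀ i → c i ≈ c′ i) → build c P.≈ build c′
  build-cong {zero} e = P.refl
  build-cong {suc n} e = P.+-cong (Hom.cong (constₕ R) (e zero)) (P.*-congˡ (build-cong (e ∘ suc)))

  build-+ : ∀ {n} (c c′ : Fin n → Carrier) → build (λ i → c i + c′ i) P.≈ build c P.+ build c′
  build-+ {zero} c c′ = P.sym (P.+-identityˡ _)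
  build-+ {suc n} c c′ = P.trans (P.+-cong (+-homo (constₕ R) _ _) (P.*-congˡ (build-+ (c ∘ suc) (c′ ∘ suc))))
    (solve 5 (λ a b x p q → (a :+ b) :+ x :* (p :+ q) := (a :+ x :* p) :+ (b :+ x :* q)) P.refl _ _ _ _ _)
    where open Solver (Pol R) using (solve; _:+_; _:*_; _:=_)

  build-* : ∀ {n} r (c : Fin n → Carrier) → build (λ i → r * c i) P.≈ const R r P.* build c
  build-* {zero} r c = P.sym (P.zeroʳ _)
  build-* {suc n} r c = P.trans (P.+-cong (*-homo (constₕ R) _ _) (P.*-congˡ (build-* r (c ∘ suc))))
    (solve 4 (λ r c x p → r :* c :+ x :* (r :* p) := r :* (c :+ x :* p)) P.refl _ _ _ _)
    where open Solver (Pol R) using (solve; _:+_; _:*_; _:=_)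

  build-deg : ∀ {n} (c : Fin n → Carrier) → deg< R n (build c)
  build-deg {zero} c = deg<-0 R 0
  build-deg {suc n} c = deg<-+ R (deg<-const R _ (s≤s z≤n)) (deg<-X* R (build-deg (c ∘ suc)))

  coef-build : ∀ {n} (c : Fin n → Carrier) i → coef R (build c) (Fin.toℕ i) ≈ c i
  coef-build c zero = coef-const+X*-0 R _ _
  coef-build c (suc i) = trans (coef-const+X* R _ _ _) (coef-build (c ∘ suc) i)

  build-coef : ∀ n {p} → deg< R n p → build {n} (λ i → coef R p (Fin.toℕ i)) P.≈ p
  build-coef zero d = P.sym (deg<0⇒≈0 R d)
  build-coef (suc n) {p} d = P.sym (P.trans (Pol-decompose R p) (P.+-congˡ (P.*-congˡ (P.sym
    (P.trans (build-cong {n} {λ i → coef R p (suc (Fin.toℕ i))} {λ i → coef R (tail R p) (Fin.toℕ i)} λ i → sym (coef-tail R p (Fin.toℕ i))) (build-coef n (deg<-tail R d)))))))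

module _ {R S : Ring} (h : Hom R S) where
  private
    module S = CRing S
    module Q = CRing (Pol S)

  δ-homo : ∀ {n} (i j : Fin n) → fn h (δ R i j) S.≈ δ S i j
  δ-homo zero zero = 1-homo h
  δ-homo zero (suc j) = 0-homo h
  δ-homo (suc i) zero = 0-homo h
  δ-homo (suc i) (suc j) = δ-homo i j

  build-homo : ∀ {n} (c : Fin n → ∣ R ∣) → fn (mapₚ h) (build R c) Q.≈ build S (fn h ∘ c)
  build-homo {zero} c = 0-homo (mapₚ h)
  build-homo {suc n} c = Q.trans (+-homo (mapₚ h) _ _) (Q.+-cong (mapₚ-const h _) (Q.trans (*-homo (mapₚ h) _ _) (Q.*-cong (mapₚ-X h) (build-homo (c ∘ suc)))))

module _ (R : Ring) (n M : ℕ) where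
  open CRing R
  open Sums R
  private
    𝔹 = Pol R
    module B = CRing 𝔹
    module PB = CRing (Pol 𝔹)
    module S = CRing (Series R)

  -- The coefficients of sʲTⁱ for j < n and i < M, flattened to a single index.
  polynomial : (Fin (n ℕ.* M) → Carrier) → ∣ Pol 𝔹 ∣
  polynomial c = build 𝔹 {n} λ j → build R {M} λ i → c (Fin.combine {n} {M} j i)

  polynomial-coef : ∀ c j i → coef R (coef 𝔹 (polynomial c) (Fin.toℕ {n} j)) (Fin.toℕ {M} i) ≈ c (Fin.combine {n} {M} j i)
  polynomial-coef c j i = trans (coef-cong R (coef-build 𝔹 (λ j → build R {M} λ i → c (Fin.combine {n} {M} j i)) j) _) (coef-build R (λ i → c (Fin.combine {n} {M} j i)) i)

  polynomial-≉0 : ∀ c x → ¬ c x ≈ 0# → ¬ polynomial c PB.≈ PB.0#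
  polynomial-≉0 c x c≉0 z with FinP.combine-surjective {n} {M} x
  ... | j , i , ≡.refl = c≉0 (trans (sym (polynomial-coef c j i)) (trans (coef-cong R (B.trans (coef-cong 𝔹 z _) (coef-0 𝔹 _)) _) (coef-0 R _)))

  polynomial-deg : ∀ c → deg< 𝔹 n (polynomial c)
  polynomial-deg c = build-deg 𝔹 (λ j → build R {M} λ i → c (Fin.combine {n} {M} j i))

  coefficients : ∣ Pol 𝔹 ∣ → Fin (n ℕ.* M) → Carrier
  coefficients p x = coef R (coef 𝔹 p (Fin.toℕ (proj₁ (Fin.remQuot {n} M x)))) (Fin.toℕ (proj₂ (Fin.remQuot {n} M x)))

  polynomial-coefficients : ∀ {p} → deg< 𝔹 n p → (∀ j → deg< R M (coef 𝔹 p j)) → polynomial (coefficients p) PB.≈ p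
  polynomial-coefficients {p} d e = PB.trans (build-cong 𝔹 λ j → B.trans
    (build-cong R λ i → reflexive (≡.cong (λ (j , i) → coef R (coef 𝔹 p (Fin.toℕ j)) (Fin.toℕ i)) (FinP.remQuot-combine {n} {M} j i)))
    (build-coef R M (e (Fin.toℕ j)))) (build-coef 𝔹 n d)

  module _ (Ev : Hom (Pol 𝔹) (Series R)) where

    -- `polynomial (δ R x)` is the monomial sʲTⁱ with number x, so this is its expansion along the
    -- branch.
    family : Fin (n ℕ.* M) → ℕ → Carrier
    family x k = coefₛ R (fn Ev (polynomial (δ R x))) k

    private
      scalar : ∀ r k p → coefₛ R (fn Ev (const 𝔹 (const R r) PB.* p)) k ≈ coefₛ R (fn Ev (const 𝔹 (const R r)) S.* fn Ev p) k
      scalar r k p = coefₛ-cong R (*-homo Ev _ _) k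

    family-sum : (∀ r → fn Ev (const 𝔹 (const R r)) S.≈ fn (constₛ R) r) →
      ∀ c k → sum (λ x → c x * family x k) ≈ coefₛ R (fn Ev (polynomial c)) k
    family-sum Ev-const c k = sym (linear-expand R (λ c → coefₛ R (fn Ev (polynomial c)) k)
      (λ e → coefₛ-cong R (Hom.cong Ev (build-cong 𝔹 λ j → build-cong R λ i → e (Fin.combine {n} {M} j i))) k)
      (λ c c′ → trans (coefₛ-cong R (S.trans (Hom.cong Ev (PB.trans (build-cong 𝔹 λ j → build-+ R (λ i → c (Fin.combine {n} {M} j i)) (λ i → c′ (Fin.combine {n} {M} j i)))
          (build-+ 𝔹 (λ j → build R λ i → c (Fin.combine {n} {M} j i)) (λ j → build R λ i → c′ (Fin.combine {n} {M} j i))))) (+-homo Ev _ _)) k) (coefₛ-+ R _ _ k))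
      (λ r c → trans (coefₛ-cong R (Hom.cong Ev (PB.trans (build-cong 𝔹 λ j → build-* R r (λ i → c (Fin.combine {n} {M} j i)))
          (build-* 𝔹 (const R r) (λ j → build R λ i → c (Fin.combine {n} {M} j i))))) k)
        (trans (scalar r k (polynomial c)) (trans (coefₛ-cong R (S.*-congʳ (Ev-const r)) k) (coef-constₛ* R r _ k)))) c)

searchBelow : ∀ {P : ℕ → Set} → (∀ k → Dec (P k)) → ∀ n → (∀ k → k ℕ.< n → P k) ⊎ (∃ λ k → k ℕ.< n × ¬ P k)
searchBelow P? zero = inj₁ λ _ ()
searchBelow P? (suc n) with searchBelow P? n | P? n
... | inj₂ (k , k<n , np) | _ = inj₂ (k , ℕP.m≤n⇒m≤1+n k<n , np)
... | inj₁ all | no np = inj₂ (n , ℕP.≤-refl , np)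
... | inj₁ all | yes p = inj₁ λ k k<1+n → case k k<1+n (ℕP.m≤n⇒m<n∨m≡n (ℕP.≤-pred k<1+n))
  where
  case : ∀ k → k ℕ.< suc n → k ℕ.< n ⊎ k ≡ n → _
  case k _ (inj₁ k<n) = all k k<n
  case k _ (inj₂ ≡.refl) = p

module _ (R : Ring) (dom : Domain R) (n M : ℕ) (Ev : Hom (Pol (Pol R)) (Series R)) where
  private
    module R = CRing R
    module S = CRing (Series R)
    𝔹 = Pol R

  -- A nonzero combination p has degree below n in s, so Bézout gives aF + bp = r with r ≠ 0 free of
  -- s. On the branch F vanishes and r = bp. If p vanished there through order k₀, the coefficient
  -- of r at k₀ would be 0, contrary to the choice of k₀.
  independent-family : (∀ r → fn Ev (const 𝔹 (const R r)) S.≈ fn (constₛ R) r) →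
    (∀ p k → ¬ coef R p k R.≈ R.0# → ¬ coefₛ R (fn Ev (const 𝔹 p)) k R.≈ R.0#) →
    ∀ {c F} → ¬ CRing._≈_ 𝔹 c (CRing.0# 𝔹) → Top 𝔹 n c F → NoFactor (Pol-domain dom) n F → fn Ev F S.≈ S.0# →
    Independent R (family R n M Ev)
  independent-family Ev-const injective {c₀} {F} c₀≉0 top irr F-root c x cx≉0 = conclude (bezout (Pol-domain dom) c₀≉0 top irr p (polynomial-deg R n M c) (polynomial-≉0 R n M c x cx≉0))
    where
    module B = CRing 𝔹
    module PB = CRing (Pol 𝔹)
    p = polynomial R n M c
    conclude : (∃ λ a → ∃ λ b → ∃ λ r → ¬ r B.≈ B.0# × const 𝔹 r PB.≈ a PB.* F PB.+ b PB.* p) →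
      ∃ λ k → ¬ Sums.sum R (λ j → c j R.* family R n M Ev j k) R.≈ R.0#
    conclude (a , b , r , r≉0 , e) with topOf dom r r≉0
    ... | k₀ , nz , _ = search (searchBelow (λ k → Domain.zero? dom (coefₛ R (fn Ev p) k)) (suc k₀))
      where
      value : fn Ev (const 𝔹 r) S.≈ fn Ev b S.* fn Ev p
      value = S.trans (Hom.cong Ev e) (S.trans (+-homo Ev _ _)
        (S.trans (S.+-cong (S.trans (*-homo Ev a F) (S.trans (S.*-congˡ F-root) (S.zeroʳ _))) (*-homo Ev b p)) (S.+-identityˡ _)))
      search : (∀ k → k ℕ.< suc k₀ → coefₛ R (fn Ev p) k R.≈ R.0#) ⊎ (∃ λ k → k ℕ.< suc k₀ × ¬ coefₛ R (fn Ev p) k R.≈ R.0#) →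
        ∃ λ k → ¬ Sums.sum R (λ j → c j R.* family R n M Ev j k) R.≈ R.0#
      search (inj₂ (k , _ , nk)) = k , λ z → nk (R.trans (R.sym (family-sum R n M Ev Ev-const c k)) z)
      search (inj₁ zs) = ⊥-elim (injective r k₀ nz (R.trans (coefₛ-cong R value k₀)
        (R.trans (coefₛ-*-local R k₀ (λ _ _ → R.refl) (λ k k≤k₀ → R.trans (zs k (s≤s k≤k₀)) (R.sym (coefₛ-0 R k)))) (R.trans (coefₛ-cong R (S.zeroʳ _) k₀) (coefₛ-0 R k₀)))))

Top-complement : ∀ {R} (dom : Domain R) (let open CRing R) {n c a b k v} → ¬ c ≈ 0# → Top R n c (CRing._*_ (Pol R) a b) →
  ¬ v ≈ 0# → Top R k v a → ∃ λ l → k ℕ.+ l ≡ n × ¬ coef R b l ≈ 0# × Top R l (coef R b l) b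
Top-complement dom c≉0 t v≉0 s with Top-factor dom c≉0 t
... | k , l , k+l , (na , ta) , (nb , tb) with Top-unique dom na v≉0 ta s
... | ≡.refl = l , k+l , nb , tb

module _ {A : Set} {m : ℕ} (z : A) where
  -- Extends a finite vector to a sequence by the default z, so that `Dual` applies to it.
  pad : (Fin m → A) → ℕ → A
  pad v k with k ℕP.<? m
  ... | yes k<m = v (Fin.fromℕ< k<m)
  ... | no _ = z

  pad-toℕ : ∀ v j → pad v (Fin.toℕ j) ≡ v j
  pad-toℕ v j with Fin.toℕ j ℕP.<? m
  ... | yes j<m = ≡.cong v (FinP.fromℕ<-toℕ j j<m)
  ... | no j≮m = ⊥-elim (j≮m (FinP.toℕ<n j))

pad-map : ∀ {A B : Set} {m} (g : A → B) z (v : Fin m → A) k → pad (g z) (g ∘ v) k ≡ g (pad z v k)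
pad-map {m = m} g z v k with k ℕP.<? m
... | yes _ = ≡.refl
... | no _ = ≡.refl

coefficient-degrees : ∀ R (p : ∣ Pol (Pol R) ∣) → ∃ λ W → ∀ j → deg< R W (coef (Pol R) p j)
coefficient-degrees R = Pol-ind (Pol R) _
  (λ e (W , d) → W , λ j → deg<-cong R (coef-cong (Pol R) e j) (d j))
  (0 , λ j → deg<-cong R (CRing.sym (Pol R) (coef-0 (Pol R) j)) (deg<-0 R 0))
  λ r p (W , d) → bound R r ℕ.+ W , λ
    { zero → deg<-cong R (CRing.sym (Pol R) (coef-const+X*-0 (Pol R) r p)) (deg<-mono R (ℕP.m≤m+n _ W) (deg<-bound R r))
    ; (suc j) → deg<-cong R (CRing.sym (Pol R) (coef-const+X* (Pol R) r p j)) (deg<-mono R (ℕP.m≤n+m W _) (d j)) }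

module GenericIndependence {m d : ℕ} {f : Poly m} (hom : Homogeneous d f) (2≤d : 2 ℕ.≤ d)
  (primef : Divisibility.Prime (Zm m) (hat f)) (P V : Fin m → ℤ) (f[P]≡0 : evalP ℤR f P ≡ + 0) (P≢0 : ∃ λ j → P j ≢ + 0)
  (f[V]≢0 : evalP ℤR f V ≢ + 0) (l≢0 : directional ℤR f P V ≢ + 0)
  (Q ω : ℤ) (Q≢0 : Q ≢ + 0) (ω≢0 : ω ≢ + 0) (a k n : ℕ) (2≤k : 2 ℕ.≤ k) (degrees : d ℕ.* (a ℕ.+ k) ≡ a ℕ.+ n) where

  open Curves f hom P V f[P]≡0 Q ω a k n 2≤k degrees
  open GenericIrreducible {f = f} hom (ℕP.≤-trans (s≤s z≤n) 2≤d) primef P V f[P]≡0 f[V]≢0 l≢0 Q ω Q≢0 ω≢0 a k n 2≤k degrees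

  private
    𝔸 = Zm m
    𝔹 = Pol 𝔸
    module A = CRing 𝔸
    module B = CRing 𝔹
    module S = CRing (Series 𝔸)
    domA = Zm-domain m
    domB = Pol-domain domA
    domS = Pol-domain domB
  open CRing (Pol 𝔹)
  open Shape 𝔸 (var m)
  open Sums 𝔸

  scaleT-const : ∀ y r → fn (at y) (const 𝔹 (const 𝔸 r)) S.≈ fn (constₛ 𝔸) r
  scaleT-const y r = S.trans (eval-const scaleT y _) (eval-const (constₛ 𝔸) _ r)

  private
    -- T = μ²t multiplies the coefficient of index k by the nonzero number μ²ᵏ.
    scaleT-injective : ∀ p k → ¬ coef 𝔸 p k A.≈ A.0# → ¬ coefₛ 𝔸 (fn scaleT p) k A.≈ A.0#
    scaleT-injective p k nz z = nz (go k p z)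
      where
      step : ∀ p → fn scaleT p S.≈ fn (constₛ 𝔸) (coef 𝔸 p 0) S.+ fn (constₛ 𝔸) (fn (ι 𝔸) (μ ℤ.* μ)) S.* (tₛ 𝔸 S.* fn scaleT (tail 𝔸 p))
      step p = S.trans (Hom.cong scaleT (Pol-decompose 𝔸 p)) (S.trans (+-homo scaleT _ _) (S.+-cong (eval-const (constₛ 𝔸) _ _)
        (S.trans (*-homo scaleT _ _) (S.trans (S.*-congʳ (S.trans (eval-X (constₛ 𝔸) _) (S.*-congʳ (S.sym (ι-homo (constₛ 𝔸) _))))) (S.*-assoc _ _ _)))))
      go : ∀ k p → coefₛ 𝔸 (fn scaleT p) k A.≈ A.0# → coef 𝔸 p k A.≈ A.0#
      go zero p z = A.trans (A.sym (A.trans (coefₛ-cong 𝔸 (step p) 0) (A.trans (coefₛ-+ 𝔸 _ _ 0) (A.trans (A.+-cong (coef-constₛ-0 𝔸 _)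
        (A.trans (coef-constₛ* 𝔸 _ _ 0) (A.trans (A.*-congˡ (coef-t*-0 𝔸 _)) (A.zeroʳ _)))) (A.+-identityʳ _))))) z
      go (suc k) p z with Domain.nzd domA (A.trans (A.sym (A.trans (coefₛ-cong 𝔸 (step p) (suc k)) (A.trans (coefₛ-+ 𝔸 _ _ (suc k)) (A.trans (A.+-cong (coef-constₛ-suc 𝔸 _ k)
        (A.trans (coef-constₛ* 𝔸 _ _ (suc k)) (A.*-congˡ (coef-t*-suc 𝔸 _ k)))) (A.+-identityˡ _))))) z)
      ... | inj₁ z′ = ⊥-elim (ι-nonzero m (Domain.*-nonzero ℤ-domain {μ} {μ} μ≢0 μ≢0) z′)
      ... | inj₂ z′ = A.trans (A.sym (coef-tail 𝔸 p k)) (go k (tail 𝔸 p) z′)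

  module _ (C : Curve 𝔸 (var m)) where
    open Curve C
    open Substitution C using (i; N; σ; υ; cc; point-split; c≉0)

    family-independent : ∀ M → Independent 𝔸 (family 𝔸 n M (at ŷ))
    family-independent M = independent-family 𝔸 domA n M (at ŷ) (scaleT-const ŷ)
      (λ r k nz z → scaleT-injective r k nz (A.trans (coefₛ-cong 𝔸 (S.sym (eval-const scaleT ŷ r)) k) z)) c≉0 F-top (F-irreducible C) F-ŷ

    -- The point x(s) is a combination of these three vectors in which the coefficient of ξ is l²s
    -- times that of P. Their independence allows s to be recovered from ratios of coordinates.
    vectors : Fin 3 → ℕ → ∣ 𝔸 ∣
    vectors zero = pad A.0# (fn (ι 𝔸) ∘ P)
    vectors (suc zero) = pad A.0# (fn (ι 𝔸) ∘ V)
    vectors (suc (suc zero)) = pad A.0# (var m)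

    private
      -- If γx = -(αP + βV) then γᵈ f(x(s)) is divisible by υγ - σβ, contradicting irreducibility.
      module Dependent (α β γ : ∣ 𝔸 ∣) (dep : ∀ j → (α A.* fn (ι 𝔸) (P j) A.+ β A.* fn (ι 𝔸) (V j)) A.+ γ A.* var m j A.≈ A.0#) where
        open SemiringExp semiring using (_^_; ^-homo-*; ^-congˡ)
        open SemiringExp A.semiring using () renaming (_^_ to _^A_)
        cc-hom : Hom 𝔸 (Pol 𝔹)
        cc-hom = constₕ 𝔹 ∘ₕ constₕ 𝔸
        α′ = cc α
        β′ = cc β
        γ′ = cc γ

        module _ (γ≉0 : ¬ γ A.≈ A.0#) where
          open Solver (Pol 𝔹) using (solve; _:+_; _:*_; :-_; _:=_)
          E G : Carrier
          E = N * γ′ + - (σ * α′)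
          G = υ * γ′ + - (σ * β′)

          dep′ : ∀ j → (α′ * i (P j) + β′ * i (V j)) + γ′ * cc (var m j) ≈ 0#
          dep′ j = trans (sym (trans (+-homo cc-hom _ _) (+-cong (trans (+-homo cc-hom _ _) (+-cong
            (trans (*-homo cc-hom _ _) (*-congˡ (ι-homo cc-hom _))) (trans (*-homo cc-hom _ _) (*-congˡ (ι-homo cc-hom _))))) (*-homo cc-hom _ _))))
            (trans (Hom.cong cc-hom (dep j)) (0-homo cc-hom))

          scaled-point : ∀ j → γ′ * point φ j ≈ E * i (P j) + G * i (V j)
          scaled-point j = begin
            γ′ * point φ j ≈⟨ *-congˡ (point-split j) ⟩
            γ′ * ((N * p + υ * v) + σ * x)
              ≈⟨ solve 9 (λ g N p u v s x a b → g :* ((N :* p :+ u :* v) :+ s :* x) :=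
                   ((N :* g :+ :- (s :* a)) :* p :+ (u :* g :+ :- (s :* b)) :* v) :+ s :* ((a :* p :+ b :* v) :+ g :* x)) refl γ′ N p υ v σ x α′ β′ ⟩
            (E * p + G * v) + σ * ((α′ * p + β′ * v) + γ′ * x) ≈⟨ +-congˡ (trans (*-congˡ (dep′ j)) (zeroʳ σ)) ⟩
            (E * p + G * v) + 0# ≈⟨ +-identityʳ _ ⟩
            E * p + G * v ∎
            where
            open SetoidReasoning setoid
            p = i (P j) ; v = i (V j) ; x = cc (var m j)

          tay = taylor (Pol 𝔹) f G (λ j → E * i (P j)) (i ∘ V)
          W = directional (Pol 𝔹) f (λ j → E * i (P j)) (i ∘ V) + G * proj₁ tay
          H = γ′ ^ d * s ^ a

          factorisation : F * H ≈ G * W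
          factorisation = begin
            F * (γ′ ^ d * s ^ a) ≈⟨ solve 3 (λ F g s → F :* (g :* s) := g :* (s :* F)) refl F (γ′ ^ d) (s ^ a) ⟩
            γ′ ^ d * (s ^ a * F) ≈⟨ *-congˡ F-eq ⟩
            γ′ ^ d * evalP (Pol 𝔹) f (point φ) ≈⟨ evalP-scale (Pol 𝔹) {f} hom γ′ (point φ) ⟨
            evalP (Pol 𝔹) f (λ j → γ′ * point φ j) ≈⟨ evalP-cong (Pol 𝔹) f scaled-point ⟩
            evalP (Pol 𝔹) f (λ j → E * i (P j) + G * i (V j)) ≈⟨ proj₂ tay ⟩
            evalP (Pol 𝔹) f (λ j → E * i (P j)) + G * W
              ≈⟨ +-congʳ (trans (evalP-scale (Pol 𝔹) {f} hom E (i ∘ P)) (trans (*-congˡ (trans (sym (evalP-homo (ι (Pol 𝔹)) f P)) (trans (Hom.cong (ι (Pol 𝔹)) f[P]≡0) (0-homo (ι (Pol 𝔹)))))) (zeroʳ _))) ⟩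
            0# + G * W ≈⟨ +-identityˡ _ ⟩
            G * W ∎
            where open SetoidReasoning setoid

          2+a≤a+k : 2 ℕ.+ a ℕ.≤ a ℕ.+ k
          2+a≤a+k = ≡.subst (ℕ._≤ a ℕ.+ k) (ℕP.+-comm a 2) (ℕP.+-monoʳ-≤ a 2≤k)

          c𝔹 : ∀ c → i c ≈ const 𝔹 (fn (ι 𝔹) c)
          c𝔹 = ι-const 𝔹

          G-top : Top 𝔹 (a ℕ.+ k) (const 𝔸 γ) G
          G-top = Top-cong 𝔹 B.refl (sym split) (Top-+ 𝔹 (Top-X^* 𝔹 (a ℕ.+ k) (const 𝔸 γ)) (deg<-mono 𝔹 2+a≤a+k (deg<-+ 𝔹 (deg<-*const 𝔹 _ (deg<-+ 𝔹 φ-part s-part)) (deg<-neg 𝔹 (deg<-*const 𝔹 _ σ-part)))))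
            where
            φ-part : deg< 𝔹 (2 ℕ.+ a) (N * fn lift φ)
            φ-part = deg<-cong 𝔹 (*-congʳ (sym (c𝔹 _))) (deg<-const* 𝔹 _ (deg<-mapₚ (constₕ 𝔸) φ-deg))
            s-part : deg< 𝔹 (2 ℕ.+ a) (s ^ a * (i Q * (T + s)))
            s-part = deg<-mono 𝔹 (ℕP.≤-reflexive (ℕP.+-comm a 2)) (deg<-X^* 𝔹 a (deg<-cong 𝔹 (*-congʳ (sym (c𝔹 Q))) (deg<-const* 𝔹 _ (deg<-+ 𝔹 (deg<-const 𝔹 _ (s≤s z≤n)) (deg<-X 𝔹)))))
            σ-part : deg< 𝔹 (2 ℕ.+ a) σ
            σ-part = deg<-mono 𝔹 (s≤s (s≤s z≤n)) (deg<-cong 𝔹 (*-congʳ (sym (trans K≈′ (c𝔹 _)))) (deg<-const* 𝔹 _ (deg<-X 𝔹)))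
              where
              K≈′ : N * i (l ℤ.* l) ≈ i ((Q ℤ.* ω) ℤ.* (l ℤ.* l))
              K≈′ = sym (*-homo (ι (Pol 𝔹)) _ _)
            split : G ≈ s ^ (a ℕ.+ k) * γ′ + ((N * fn lift φ + s ^ a * (i Q * (T + s))) * γ′ + - (σ * β′))
            split = trans (solve 6 (λ x sa y sk g z → (x :+ sa :* (y :+ sk)) :* g :+ z := (sa :* sk) :* g :+ ((x :+ sa :* y) :* g :+ z)) refl
              (N * fn lift φ) (s ^ a) (i Q * (T + s)) (s ^ k) γ′ (- (σ * β′))) (+-congʳ (*-congʳ (sym (^-homo-* s a k))))

          FH-top : Top 𝔹 (n ℕ.+ (0 ℕ.+ (a ℕ.+ 0))) (fn (ι 𝔹) (evalP ℤR f V) B.* (SemiringExp._^_ B.semiring (const 𝔸 γ) d B.* (B.1# B.* B.1#))) (F * H)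
          FH-top = Top-* 𝔹 n F-top (Top-* 𝔹 0 (Top-cong 𝔹 B.refl (^-homo (constₕ 𝔹) _ d) (Top-const 𝔹 _))
            (Top-cong 𝔹 B.refl (trans (*-assoc _ _ _) (trans (*-congˡ (*-identityˡ _)) (trans (*-congˡ (1-homo (constₕ 𝔹))) (*-identityʳ _))))
              (Top-* 𝔹 a (Top-cong 𝔹 B.refl (*-congˡ (1-homo (constₕ 𝔹))) (Top-X^* 𝔹 a B.1#)) (Top-const 𝔹 B.1#))))

          lead≉0 : ¬ fn (ι 𝔹) (evalP ℤR f V) B.* (SemiringExp._^_ B.semiring (const 𝔸 γ) d B.* (B.1# B.* B.1#)) B.≈ B.0#
          lead≉0 = Domain.*-nonzero domB c≉0 (Domain.*-nonzero domB (Domain.^-nonzero domB d (const≉0 domA γ≉0)) (Domain.*-nonzero domB (Domain.1≉0 domB) (Domain.1≉0 domB)))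

          a+k<n : a ℕ.+ k ℕ.< n
          a+k<n = ℕP.+-cancelˡ-< a (a ℕ.+ k) n (≡.subst (a ℕ.+ (a ℕ.+ k) ℕ.<_) degrees (ℕP.<-≤-trans
            (ℕP.+-monoˡ-< (a ℕ.+ k) (ℕP.m<m+n a (ℕP.≤-trans (s≤s z≤n) 2≤k)))
            (≡.subst (ℕ._≤ d ℕ.* (a ℕ.+ k)) (≡.cong ((a ℕ.+ k) ℕ.+_) (ℕP.+-identityʳ (a ℕ.+ k))) (ℕP.*-monoˡ-≤ (a ℕ.+ k) 2≤d))))

          contradiction : ⊥
          contradiction = conclude (Top-complement domB lead≉0 (Top-cong 𝔹 B.refl factorisation FH-top) (const≉0 domA γ≉0) G-top)
            where
            conclude : (∃ λ l₁ → a ℕ.+ k ℕ.+ l₁ ≡ n ℕ.+ (0 ℕ.+ (a ℕ.+ 0)) × ¬ coef 𝔹 W l₁ B.≈ B.0# × Top 𝔹 l₁ (coef 𝔹 W l₁) W) → ⊥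
            conclude (l₁ , k+l , nW , tW) = F-irreducible C H G W factorisation (Top-deg< 𝔹 G-top a+k<n)
              (Top-deg< 𝔹 tW l₁<n) (Top⇒≉0 domB (const≉0 domA γ≉0) G-top) (Top⇒≉0 domB nW tW)
              where
              l₁<n : l₁ ℕ.< n
              l₁<n = ℕP.+-cancelˡ-< a l₁ n (ℕP.<-≤-trans (ℕP.+-monoʳ-< a (ℕP.m<n+m l₁ (ℕP.≤-trans (s≤s z≤n) 2≤k)))
                (ℕP.≤-reflexive (≡.trans (≡.sym (ℕP.+-assoc a k l₁)) (≡.trans k+l (≡.trans (≡.cong (n ℕ.+_) (ℕP.+-identityʳ a)) (ℕP.+-comm n a))))))

        module _ (γ≈0 : γ A.≈ A.0#) where
          βV≈ : ∀ j → β A.* fn (ι 𝔸) (V j) A.≈ (A.- α) A.* fn (ι 𝔸) (P j)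
          βV≈ j = A.trans (RingProps.+-inverseʳ-unique A.ring (α A.* fn (ι 𝔸) (P j)) _ (A.trans (A.sym (A.trans (A.+-congˡ (A.trans (A.*-congʳ γ≈0) (A.zeroˡ _))) (A.+-identityʳ _))) (dep j)))
            (RingProps.-‿distribˡ-* A.ring _ _)
          -- From βV = -αP, homogeneity gives βᵈf(V) = (-α)ᵈf(P) = 0, so β = 0, and then α = 0
          -- because P has a nonzero coordinate.
          value : (β ^A d) A.* fn (ι 𝔸) (evalP ℤR f V) A.≈ A.0#
          value = A.trans (A.*-congˡ (evalP-homo (ι 𝔸) f V)) (A.trans (A.sym (evalP-scale 𝔸 {f} hom β (fn (ι 𝔸) ∘ V))) (A.trans (evalP-cong 𝔸 f βV≈)
            (A.trans (evalP-scale 𝔸 {f} hom (A.- α) (fn (ι 𝔸) ∘ P)) (A.trans (A.*-congˡ (A.trans (A.sym (evalP-homo (ι 𝔸) f P)) (A.trans (Hom.cong (ι 𝔸) f[P]≡0) (0-homo (ι 𝔸))))) (A.zeroʳ _)))))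
          β≈0 : β A.≈ A.0#
          β≈0 with Domain.zero? domA β
          ... | yes z = z
          ... | no nz = ⊥-elim (Domain.*-nonzero domA (Domain.^-nonzero domA d nz) (ι-nonzero m f[V]≢0) value)
          α≈0 : α A.≈ A.0#
          α≈0 with Domain.nzd domA {α} {fn (ι 𝔸) (P (proj₁ P≢0))} (A.trans (A.sym (A.trans (A.+-cong (A.trans (A.+-congˡ (A.trans (A.*-congʳ β≈0) (A.zeroˡ _))) (A.+-identityʳ _))
              (A.trans (A.*-congʳ γ≈0) (A.zeroˡ _))) (A.+-identityʳ _))) (dep (proj₁ P≢0)))
          ... | inj₁ z = z
          ... | inj₂ z = ⊥-elim (ι-nonzero m (proj₂ P≢0) z)

        all-zero : α A.≈ A.0# × β A.≈ A.0# × γ A.≈ A.0#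
        all-zero with Domain.zero? domA γ
        ... | yes z = α≈0 z , β≈0 z , z
        ... | no nz = ⊥-elim (contradiction nz)

    vectors-independent : Independent 𝔸 vectors
    vectors-independent c x c≉0′ with searchBelow (λ k → Domain.zero? domA (sum (λ j → c j A.* vectors j k))) m
    ... | inj₂ (k , _ , nk) = k , nk
    ... | inj₁ zs = ⊥-elim (absurd x (Dependent.all-zero (c zero) (c (suc zero)) (c (suc (suc zero))) dep) c≉0′)
      where
      dep : ∀ j → (c zero A.* fn (ι 𝔸) (P j) A.+ c (suc zero) A.* fn (ι 𝔸) (V j)) A.+ c (suc (suc zero)) A.* var m j A.≈ A.0#
      dep j = A.trans (A.+-assoc _ _ _) (A.trans (A.+-cong (A.*-congˡ (A.sym (A.reflexive (pad-toℕ A.0# (fn (ι 𝔸) ∘ P) j)))) (A.+-cong (A.*-congˡ (A.sym (A.reflexive (pad-toℕ A.0# (fn (ι 𝔸) ∘ V) j))))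
        (A.trans (A.*-congˡ (A.sym (A.reflexive (pad-toℕ A.0# (var m) j)))) (A.sym (A.+-identityʳ _))))) (zs (Fin.toℕ j) (FinP.toℕ<n j)))
      absurd : ∀ x → c zero A.≈ A.0# × c (suc zero) A.≈ A.0# × c (suc (suc zero)) A.≈ A.0# → ¬ c x A.≈ A.0# → ⊥
      absurd zero (p , q , r) nz = nz p
      absurd (suc zero) (p , q , r) nz = nz q
      absurd (suc (suc zero)) (p , q , r) nz = nz r

-- Specialisation of the direction

polynomial-homo : ∀ {R S} (h : Hom R S) n M c → CRing._≈_ (Pol (Pol S)) (fn (mapₚ (mapₚ h)) (polynomial R n M c)) (polynomial S n M (fn h ∘ c))
polynomial-homo {R} {S} h n M c = Q.trans (build-homo (mapₚ h) {n} (λ j → build R {M} λ i → c (Fin.combine j i)))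
  (build-cong (Pol S) {n} λ j → build-homo h {M} (λ i → c (Fin.combine j i)))
  where module Q = CRing (Pol (Pol S))

vectorsℤ : ∀ {m} (P V ξ : Fin m → ℤ) → Fin 3 → ℕ → ℤ
vectorsℤ P V ξ zero = pad (+ 0) P
vectorsℤ P V ξ (suc zero) = pad (+ 0) V
vectorsℤ P V ξ (suc (suc zero)) = pad (+ 0) ξ

module Specialise {m d : ℕ} {f : Poly m} (hom : Homogeneous d f) (2≤d : 2 ℕ.≤ d)
  (primef : Divisibility.Prime (Zm m) (hat f)) (P V : Fin m → ℤ) (f[P]≡0 : evalP ℤR f P ≡ + 0) (P≢0 : ∃ λ j → P j ≢ + 0)
  (f[V]≢0 : evalP ℤR f V ≢ + 0) (l≢0 : directional ℤR f P V ≢ + 0)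
  (Q ω : ℤ) (Q≢0 : Q ≢ + 0) (ω≢0 : ω ≢ + 0) (a k n : ℕ) (2≤k : 2 ℕ.≤ k) (degrees : d ℕ.* (a ℕ.+ k) ≡ a ℕ.+ n) where

  open Curves f hom P V f[P]≡0 Q ω a k n 2≤k degrees public

  -- Two families of monomials occur, with exponents of T up to W and up to W + 1, because the
  -- argument at a large prime multiplies a polynomial by T once. The three denominators are kept
  -- nonzero by one choice of ξ.
  record Specialised : Set where
    field
      ξ : Fin m → ℤ
      C : Curve ℤR ξ
      W : ℕ
      F-width : ∀ j → deg< ℤR W (coef (Pol ℤR) (Curve.F C) j)
      dual₁ : Dual ℤR (family ℤR n (suc W) (Shape.at ℤR ξ (Curve.ŷ C)))
      dual₁≢0 : Dual.Δ dual₁ ≢ + 0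
      dual₂ : Dual ℤR (family ℤR n (suc (suc W)) (Shape.at ℤR ξ (Curve.ŷ C)))
      dual₂≢0 : Dual.Δ dual₂ ≢ + 0
      dualV : Dual ℤR (vectorsℤ P V ξ)
      dualV≢0 : Dual.Δ dualV ≢ + 0

  open GenericIndependence {f = f} hom 2≤d primef P V f[P]≡0 P≢0 f[V]≢0 l≢0 Q ω Q≢0 ω≢0 a k n 2≤k degrees

  specialised : Specialised
  specialised = record
    { ξ = ξ ; C = C′ ; W = W
    ; F-width = λ j → deg<-cong ℤR (Z.sym (coef-mapₚ (mapₚ h) (Curve.F C₀) j)) (deg<-mapₚ h (proj₂ width j))
    ; dual₁ = move (proj₁ d₁) ; dual₁≢0 = proj₁ nonzeros
    ; dual₂ = move (proj₁ d₂) ; dual₂≢0 = proj₁ (proj₂ nonzeros)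
    ; dualV = Dual-cong {ℤR} {ℤR} idₕ move-vectors (Dual-map h (proj₁ d₃)) ; dualV≢0 = proj₂ (proj₂ nonzeros) }
    where
    𝔸 = Zm m
    module A = CRing 𝔸
    module Z = CRing (Pol ℤR)
    module SZ = CRing (Series ℤR)
    domA = Zm-domain m
    C₀ : Curve 𝔸 (var m)
    C₀ = Construct.curve 𝔸 (var m)
    width = coefficient-degrees 𝔸 (Curve.F C₀)
    W = proj₁ width
    d₁ = dual 𝔸 domA (family 𝔸 n (suc W) (Shape.at 𝔸 (var m) (Curve.ŷ C₀))) (family-independent C₀ (suc W))
    d₂ = dual 𝔸 domA (family 𝔸 n (suc (suc W)) (Shape.at 𝔸 (var m) (Curve.ŷ C₀))) (family-independent C₀ (suc (suc W)))
    d₃ = dual 𝔸 domA (vectors C₀) (vectors-independent C₀)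
    Δ₁ = Dual.Δ (proj₁ d₁)
    Δ₂ = Dual.Δ (proj₁ d₂)
    Δ₃ = Dual.Δ (proj₁ d₃)
    pt = nonzero-point m (Δ₁ A.* (Δ₂ A.* Δ₃)) (Domain.*-nonzero domA (proj₂ d₁) (Domain.*-nonzero domA (proj₂ d₂) (proj₂ d₃)))
    h : Hom 𝔸 ℤR
    h = evZ ℤR (proj₁ pt)
    ξ : Fin m → ℤ
    ξ i = fn h (var m i)
    nonzeros : fn h Δ₁ ≢ + 0 × fn h Δ₂ ≢ + 0 × fn h Δ₃ ≢ + 0
    nonzeros = D.factorˡ-nonzero {b = fn h (Δ₂ A.* Δ₃)} (≡.sym (*-homo h Δ₁ _)) (proj₂ pt)
      , D.factorˡ-nonzero {b = fn h Δ₃} (≡.sym (*-homo h Δ₂ Δ₃)) rest , D.factorʳ-nonzero {a = fn h Δ₂} (≡.sym (*-homo h Δ₂ Δ₃)) rest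
      where
      module D = Domain ℤ-domain
      rest : fn h (Δ₂ A.* Δ₃) ≢ + 0
      rest = D.factorʳ-nonzero {a = fn h Δ₁} (≡.sym (*-homo h Δ₁ _)) (proj₂ pt)
    module MC = MapCurve {f = f} hom P V f[P]≡0 Q ω a k n 2≤k degrees h (var m) C₀
    C′ : Curve ℤR ξ
    C′ = MC.mapCurve
    move : ∀ {M} → Dual 𝔸 (family 𝔸 n M (Shape.at 𝔸 (var m) (Curve.ŷ C₀))) → Dual ℤR (family ℤR n M (Shape.at ℤR ξ (Curve.ŷ C′)))
    move {M} D = Dual-cong {ℤR} {ℤR} idₕ eq (Dual-map h D)
      where
      eq : ∀ x j → fn h (family 𝔸 n M (Shape.at 𝔸 (var m) (Curve.ŷ C₀)) x j) ≡ family ℤR n M (Shape.at ℤR ξ (Curve.ŷ C′)) x j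
      eq x j = ≡.trans (≡.sym (coef-mapₛ h _ j)) (≡.trans (coefₛ-cong ℤR (MC.at-map (polynomial 𝔸 n M (δ 𝔸 x))) j)
        (coefₛ-cong ℤR (Hom.cong (Shape.at ℤR ξ (Curve.ŷ C′)) (PP.trans (polynomial-homo h n M (δ 𝔸 x))
          (build-cong (Pol ℤR) {n} λ j → build-cong ℤR {M} λ i → δ-homo h x (Fin.combine j i)))) j))
        where module PP = CRing (Pol (Pol ℤR))
    pad-≡ : ∀ {z w} → z ≡ w → {u v : Fin m → ℤ} → (∀ i → u i ≡ v i) → ∀ j → pad z u j ≡ pad w v j
    pad-≡ ≡.refl e j with j ℕP.<? m
    ... | yes _ = e _
    ... | no _ = ≡.refl
    move-vectors : ∀ i j → fn h (vectors C₀ i j) ≡ vectorsℤ P V ξ i j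
    move-vectors zero j = ≡.trans (≡.sym (pad-map (fn h) A.0# (fn (ι 𝔸) ∘ P) j)) (pad-≡ (0-homo h) (λ i → ≡.trans (ι-homo h (P i)) (ι-ℤ _)) j)
    move-vectors (suc zero) j = ≡.trans (≡.sym (pad-map (fn h) A.0# (fn (ι 𝔸) ∘ V) j)) (pad-≡ (0-homo h) (λ i → ≡.trans (ι-homo h (V i)) (ι-ℤ _)) j)
    move-vectors (suc (suc zero)) j = ≡.trans (≡.sym (pad-map (fn h) A.0# (var m) j)) (≡.cong (λ z → pad z ξ j) (0-homo h))

-- Evaluation of integral power series modulo prime powers

open Divisibility ℤR using () renaming (_∣_ to _∣ℤ_) public

infixr 8 _^ℤ_
_^ℤ_ : ℤ → ℕ → ℤ
_^ℤ_ = SemiringExp._^_ (CRing.semiring ℤR)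

x-y≈0⇒x≈y : ∀ (R : Ring) (let open CRing R) x y → x - y ≈ 0# → x ≈ y
x-y≈0⇒x≈y R = x∙y⁻¹≈ε⇒x≈y
  where open import Algebra.Properties.Group (CRing.+-group R) using (x∙y⁻¹≈ε⇒x≈y)

1∣ℤ : ∀ x → (+ 1) ∣ℤ x
1∣ℤ x = x , ℤP.*-identityˡ x

module _ where
  private
    module D = Divisibility ℤR
    open Solver ℤR using (solve; _:+_; _:*_; :-_; _:=_)

  ∣ℤ-cancel : ∀ {p a b} → p ≢ + 0 → (p ℤ.* a) ∣ℤ (p ℤ.* b) → a ∣ℤ b
  ∣ℤ-cancel {p} {a} p≢0 (q , e) = q , Domain.*-cancel ℤ-domain {p} p≢0 (≡.trans (≡.sym (ℤP.*-assoc p a q)) e)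

  ∣ℤ-*-mono : ∀ {a b c e} → a ∣ℤ b → c ∣ℤ e → (a ℤ.* c) ∣ℤ (b ℤ.* e)
  ∣ℤ-*-mono {a} {b} {c} {e} (q , x) (r , y) = q ℤ.* r , ≡.trans (solve 4 (λ a c q r → (a :* c) :* (q :* r) := (a :* q) :* (c :* r)) ≡.refl a c q r) (≡.cong₂ ℤ._*_ x y)

  ^ℤ-mono : ∀ p {j k} → j ℕ.≤ k → (p ^ℤ j) ∣ℤ (p ^ℤ k)
  ^ℤ-mono p {zero} {k} _ = p ^ℤ k , ℤP.*-identityˡ _
  ^ℤ-mono p {suc j} {suc k} (s≤s j≤k) = ∣ℤ-*-mono {p} {p} {p ^ℤ j} {p ^ℤ k} (+ 1 , ℤP.*-identityʳ p) (^ℤ-mono p j≤k)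

  -- For ν′ = ν + ν₁ - τνν₁ one has τν′ - 1 = -(τν₁ - 1)(τν - 1), which gains a factor p over τν -
  -- 1.
  inverse-mod : ∀ {p τ ν₁} → p ∣ℤ (τ ℤ.* ν₁ ℤ.- + 1) → ∀ K → ∃ λ ν → (p ^ℤ K) ∣ℤ (τ ℤ.* ν ℤ.- + 1)
  inverse-mod {p} {τ} {ν₁} d zero = + 0 , 1∣ℤ _
  inverse-mod {p} {τ} {ν₁} d (suc K) with inverse-mod {p} {τ} {ν₁} d K
  ... | ν , e = ν ℤ.+ ν₁ ℤ.+ ℤ.- (τ ℤ.* ν ℤ.* ν₁) , D.∣-respʳ {p ^ℤ suc K}
    (solve 4 (λ τ ν ν₁ o → :- ((τ :* ν₁ :+ :- o) :* (τ :* ν :+ :- o)) := τ :* (o :* ν :+ o :* ν₁ :+ :- (τ :* ν :* ν₁)) :+ :- (o :* o)) ≡.refl τ ν ν₁ (+ 1) ⊙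
      ≡.cong₂ (λ x y → τ ℤ.* (x ℤ.+ y ℤ.+ ℤ.- (τ ℤ.* ν ℤ.* ν₁)) ℤ.+ ℤ.- + 1) (ℤP.*-identityˡ ν) (ℤP.*-identityˡ ν₁))
    (D.∣-neg {p ^ℤ suc K} (∣ℤ-*-mono {p} {τ ℤ.* ν₁ ℤ.- + 1} {p ^ℤ K} {τ ℤ.* ν ℤ.- + 1} d e))
    where
    infixl 5 _⊙_
    _⊙_ : ∀ {x y z : ℤ} → x ≡ y → y ≡ z → x ≡ z
    _⊙_ = ≡.trans

module PAdic (p ν : ℤ) where
  private
    module D = Divisibility ℤR
    open Solver ℤR using (solve; _:+_; _:*_; :-_; _:=_)
    q = p ℤ.* ν

  -- The first K terms of a series at t = pν, by Horner. As τν ≡ 1 modulo pᴷ, this is the argument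
  -- where T = τt takes the value p.
  E : ℕ → (ℕ → ℤ) → ℤ
  E zero s = + 0
  E (suc K) s = s 0 ℤ.+ q ℤ.* E K (s ∘ suc)

  E-cong : ∀ K {s s′} → (∀ k → k ℕ.< K → s k ≡ s′ k) → E K s ≡ E K s′
  E-cong zero e = ≡.refl
  E-cong (suc K) e = ≡.cong₂ (λ x y → x ℤ.+ q ℤ.* y) (e 0 (s≤s z≤n)) (E-cong K λ k k<K → e (suc k) (s≤s k<K))

  E-+ : ∀ K s s′ → E K (λ k → s k ℤ.+ s′ k) ≡ E K s ℤ.+ E K s′
  E-+ zero s s′ = ≡.refl
  E-+ (suc K) s s′ = ≡.trans (≡.cong (λ x → (s 0 ℤ.+ s′ 0) ℤ.+ q ℤ.* x) (E-+ K (s ∘ suc) (s′ ∘ suc)))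
    (solve 5 (λ a b q x y → (a :+ b) :+ q :* (x :+ y) := (a :+ q :* x) :+ (b :+ q :* y)) ≡.refl (s 0) (s′ 0) q _ _)

  E-* : ∀ K r s → E K (λ k → r ℤ.* s k) ≡ r ℤ.* E K s
  E-* zero r s = ≡.sym (ℤP.*-zeroʳ r)
  E-* (suc K) r s = ≡.trans (≡.cong (λ x → r ℤ.* s 0 ℤ.+ q ℤ.* x) (E-* K r (s ∘ suc)))
    (solve 4 (λ r a q x → r :* a :+ q :* (r :* x) := r :* (a :+ q :* x)) ≡.refl r (s 0) q _)

  q-lift : ∀ K {x} → (p ^ℤ K) ∣ℤ x → (p ^ℤ suc K) ∣ℤ (q ℤ.* x)
  q-lift K {x} d = ∣ℤ-*-mono {p} {q} {p ^ℤ K} {x} (ν , ≡.refl) d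

  E-step : ∀ K s → (p ^ℤ K) ∣ℤ (E (suc K) s ℤ.- E K s)
  E-step zero s = 1∣ℤ _
  E-step (suc K) s = D.∣-respʳ {p ^ℤ suc K} (solve 4 (λ a q x y → q :* (x :+ :- y) := (a :+ q :* x) :+ :- (a :+ q :* y)) ≡.refl (s 0) q _ _) (q-lift K (E-step K (s ∘ suc)))

  -- Truncation respects products only modulo pᴷ: the omitted terms carry (pν)ᴷ.
  E-mul : ∀ K a b → (p ^ℤ K) ∣ℤ (E K (coefₛ ℤR (CRing._*_ (Series ℤR) a b)) ℤ.- E K (coefₛ ℤR a) ℤ.* E K (coefₛ ℤR b))
  E-mul zero a b = 1∣ℤ _
  E-mul (suc K) a b = D.∣-respʳ {p ^ℤ suc K} eq (D.∣-+ {p ^ℤ suc K} (q-lift K (E-mul K (tailₛ ℤR a) b)) (q-lift K (D.∣-neg {p ^ℤ K} (D.∣-*ˡ {p ^ℤ K} A′ (E-step K (coefₛ ℤR b))))))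
    where
    a₀ = coefₛ ℤR a 0
    b₀ = coefₛ ℤR b 0
    A′ = E K (coefₛ ℤR (tailₛ ℤR a))
    A″ = E K (coefₛ ℤR a ∘ suc)
    B′ = E K (coefₛ ℤR b ∘ suc)
    B = E K (coefₛ ℤR b)
    AB = E K (coefₛ ℤR (CRing._*_ (Series ℤR) (tailₛ ℤR a) b))
    A′≡A″ : A′ ≡ A″
    A′≡A″ = E-cong K λ k _ → coefₛ-mk ℤR _ k
    product : E (suc K) (coefₛ ℤR (CRing._*_ (Series ℤR) a b)) ≡ a₀ ℤ.* b₀ ℤ.+ q ℤ.* (a₀ ℤ.* B′ ℤ.+ AB)
    product = ≡.cong₂ (λ x y → x ℤ.+ q ℤ.* y) (coefₛ-*-0 ℤR a b) (≡.trans (E-cong K λ k _ → coefₛ-*-suc ℤR a b k)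
      (≡.trans (E-+ K (λ k → a₀ ℤ.* coefₛ ℤR b (suc k)) _) (≡.cong (λ z → z ℤ.+ AB) (E-* K a₀ (coefₛ ℤR b ∘ suc)))))
    eq : q ℤ.* (AB ℤ.- A′ ℤ.* B) ℤ.+ q ℤ.* ℤ.- (A′ ℤ.* (E (suc K) (coefₛ ℤR b) ℤ.- B)) ≡ E (suc K) (coefₛ ℤR (CRing._*_ (Series ℤR) a b)) ℤ.- E (suc K) (coefₛ ℤR a) ℤ.* E (suc K) (coefₛ ℤR b)
    eq = ≡.trans (≡.trans
      (solve 7 (λ q AB A B a b B′ → q :* (AB :+ :- (A :* B)) :+ q :* :- (A :* ((b :+ q :* B′) :+ :- B)) := (a :* b :+ q :* (a :* B′ :+ AB)) :+ :- ((a :+ q :* A) :* (b :+ q :* B′))) ≡.refl q AB A′ B a₀ b₀ B′)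
      (≡.cong (λ x → (a₀ ℤ.* b₀ ℤ.+ q ℤ.* (a₀ ℤ.* B′ ℤ.+ AB)) ℤ.+ ℤ.- ((a₀ ℤ.+ q ℤ.* x) ℤ.* (b₀ ℤ.+ q ℤ.* B′))) A′≡A″)) (≡.cong (λ z → z ℤ.- E (suc K) (coefₛ ℤR a) ℤ.* E (suc K) (coefₛ ℤR b)) (≡.sym product))

  modulo : ℕ → Ring
  modulo K = Quotient ℤR (principal ℤR (p ^ℤ K))

  -- Substitution of t = pν as a homomorphism to ℤ/pᴷ. Congruences for all K take the place of
  -- p-adic numbers.
  Θ : ∀ K → Hom (Series ℤR) (modulo K)
  Θ K = record
    { fn = λ a → E K (coefₛ ℤR a)
    ; cong = λ e → fromEq (E-cong K λ k _ → coefₛ-cong ℤR e k)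
    ; +-homo = λ a b → fromEq (≡.trans (E-cong K λ k _ → coefₛ-+ ℤR a b k) (E-+ K _ _))
    ; *-homo = E-mul K
    ; 1-homo = one K }
    where
    open Congruence (principal ℤR (p ^ℤ K)) using (fromEq)
    E-0 : ∀ K s → (∀ k → s k ≡ + 0) → E K s ≡ + 0
    E-0 zero s z = ≡.refl
    E-0 (suc K) s z = ≡.trans (≡.cong₂ (λ x y → x ℤ.+ q ℤ.* y) (z 0) (E-0 K (s ∘ suc) (z ∘ suc))) (≡.trans (ℤP.+-identityˡ _) (ℤP.*-zeroʳ q))
    one : ∀ K → (p ^ℤ K) ∣ℤ (E K (coefₛ ℤR (CRing.1# (Series ℤR))) ℤ.- + 1)
    one zero = 1∣ℤ _
    one (suc K) = + 0 , ≡.trans (ℤP.*-zeroʳ (p ^ℤ suc K)) (≡.sym (≡.cong (λ z → z ℤ.- + 1) (≡.trans (≡.cong₂ (λ x y → x ℤ.+ q ℤ.* y) (coefₛ-1-0 ℤR) (E-0 K _ (coefₛ-1 ℤR)))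
      (≡.trans (≡.cong (λ z → + 1 ℤ.+ z) (ℤP.*-zeroʳ q)) (ℤP.+-identityʳ (+ 1))))))

  shiftSeq : (ℕ → ℤ) → ℕ → ℤ
  shiftSeq κ zero = + 0
  shiftSeq κ (suc k) = κ k

  -- Long division by p - τt of a series vanishing at t = pν modulo pᴷ.
  divide : ∀ {τ} → p ≢ + 0 → ∀ K → (p ^ℤ K) ∣ℤ (τ ℤ.* ν ℤ.- + 1) → ∀ s → (p ^ℤ K) ∣ℤ E K s →
    ∃ λ κ → (∀ k → k ℕ.< K → s k ≡ p ℤ.* κ k ℤ.- τ ℤ.* shiftSeq κ k) ×
      (∀ C c → ℤ.∣ τ ∣ ℕ.≤ ℤ.∣ p ∣ → ℤ.∣ s 0 ∣ ℕ.≤ ℤ.∣ p ∣ ℕ.* (C ℕ.+ c) → (∀ k → suc k ℕ.< K → ℤ.∣ s (suc k) ∣ ℕ.≤ ℤ.∣ p ∣ ℕ.* C) →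
        ∀ k → k ℕ.< K → ℤ.∣ κ k ∣ ℕ.≤ c ℕ.+ suc k ℕ.* C)
  divide p≢0 zero dν s d = (λ _ → + 0) , (λ _ ()) , λ _ _ _ _ _ _ ()
  divide {τ} p≢0 (suc K) dν s d = κ , eqs , bounds
    where
    E′ = E K (s ∘ suc)
    p∣s₀ : p ∣ℤ s 0
    p∣s₀ = D.∣-respʳ {p} (solve 2 (λ a b → (a :+ b) :+ :- b := a) ≡.refl (s 0) (q ℤ.* E′)) (D.∣-+ {p}
      (proj₁ d′ , proj₂ d′) (D.∣-neg {p} (D.∣-*ʳ {p} E′ (ν , ≡.refl))))
      where
      d′ : p ∣ℤ E (suc K) s
      d′ = p ^ℤ K ℤ.* proj₁ d , ≡.trans (≡.sym (ℤP.*-assoc p (p ^ℤ K) (proj₁ d))) (proj₂ d)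
    κ₀ = proj₁ p∣s₀
    -- s = (p - τt)κ forces s₁ + τκ₀ = pκ₁, so τκ₀ is carried into the next coefficient. That the
    -- rest still vanishes modulo pᴷ follows by cancelling p and using τν ≡ 1.
    s′ : ℕ → ℤ
    s′ zero = s 1 ℤ.+ τ ℤ.* κ₀
    s′ (suc k) = s (suc (suc k))
    smaller : (p ^ℤ K) ∣ℤ (τ ℤ.* ν ℤ.- + 1)
    smaller = p ℤ.* proj₁ dν , ≡.trans (solve 3 (λ a p b → a :* (p :* b) := (p :* a) :* b) ≡.refl (p ^ℤ K) p (proj₁ dν)) (proj₂ dν)
    vanish : ∀ K → (p ^ℤ suc K) ∣ℤ E (suc K) s → (p ^ℤ K) ∣ℤ (τ ℤ.* ν ℤ.- + 1) → (p ^ℤ K) ∣ℤ E K s′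
    vanish zero d dν = 1∣ℤ _
    vanish (suc K) d dν = D.∣-respʳ {p ^ℤ suc K} (solve 6 (λ τ κ ν e o s → τ :* (κ :+ ν :* e) :+ :- ((τ :* ν :+ :- o) :* e) := τ :* κ :+ o :* e) ≡.refl τ κ₀ ν e (+ 1) (s 1) ⊙
        ≡.cong (λ z → τ ℤ.* κ₀ ℤ.+ z) (ℤP.*-identityˡ e) ⊙ solve 4 (λ t s q x → t :+ (s :+ q :* x) := (s :+ t) :+ q :* x) ≡.refl (τ ℤ.* κ₀) (s 1) q _)
      (D.∣-+ {p ^ℤ suc K} (D.∣-*ˡ {p ^ℤ suc K} τ (∣ℤ-cancel {p} p≢0 (D.∣-respʳ {p ^ℤ suc (suc K)} (≡.trans (≡.cong (λ z → z ℤ.+ q ℤ.* e) (≡.sym (proj₂ p∣s₀)))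
        (solve 4 (λ p κ ν e → p :* κ :+ (p :* ν) :* e := p :* (κ :+ ν :* e)) ≡.refl p κ₀ ν e)) d))) (D.∣-neg {p ^ℤ suc K} (D.∣-*ʳ {p ^ℤ suc K} e dν)))
      where
      e = E (suc K) (s ∘ suc)
      infixl 5 _⊙_
      _⊙_ : ∀ {x y z : ℤ} → x ≡ y → y ≡ z → x ≡ z
      _⊙_ = ≡.trans
    rec = divide {τ} p≢0 K smaller s′ (vanish K d smaller)
    κ′ = proj₁ rec
    κ : ℕ → ℤ
    κ zero = κ₀
    κ (suc k) = κ′ k
    eqs : ∀ k → k ℕ.< suc K → s k ≡ p ℤ.* κ k ℤ.- τ ℤ.* shiftSeq κ k
    eqs zero _ = ≡.trans (≡.sym (proj₂ p∣s₀)) (≡.sym (≡.trans (≡.cong (λ x → p ℤ.* κ₀ ℤ.- x) (ℤP.*-zeroʳ τ)) (ℤP.+-identityʳ (p ℤ.* κ₀))))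
    eqs (suc zero) (s≤s 0<K) = ≡.trans (solve 2 (λ a b → a := (a :+ b) :+ :- b) ≡.refl (s 1) (τ ℤ.* κ₀)) (≡.cong (λ z → z ℤ.- τ ℤ.* κ₀)
      (≡.trans (proj₁ (proj₂ rec) 0 0<K) (≡.trans (≡.cong (λ x → p ℤ.* κ′ 0 ℤ.- x) (ℤP.*-zeroʳ τ)) (ℤP.+-identityʳ (p ℤ.* κ′ 0)))))
    eqs (suc (suc k)) (s≤s k<K) = proj₁ (proj₂ rec) (suc k) k<K
    -- The parameter c bounds the carry. A step replaces it by C + c, because |τ| is at most |p|;
    -- hence the linear growth in k and a bound free of p.
    bounds : ∀ C c → ℤ.∣ τ ∣ ℕ.≤ ℤ.∣ p ∣ → ℤ.∣ s 0 ∣ ℕ.≤ ℤ.∣ p ∣ ℕ.* (C ℕ.+ c) → (∀ k → suc k ℕ.< suc K → ℤ.∣ s (suc k) ∣ ℕ.≤ ℤ.∣ p ∣ ℕ.* C) →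
      ∀ k → k ℕ.< suc K → ℤ.∣ κ k ∣ ℕ.≤ c ℕ.+ suc k ℕ.* C
    bounds C c τ≤p b₀ b₁ = go
      where
      κ₀-bound : ℤ.∣ κ₀ ∣ ℕ.≤ C ℕ.+ c
      κ₀-bound = ℕP.*-cancelˡ-≤ ℤ.∣ p ∣ ⦃ ℕ.≢-nonZero (λ e → p≢0 (ℤP.∣i∣≡0⇒i≡0 e)) ⦄
        (≡.subst (ℕ._≤ ℤ.∣ p ∣ ℕ.* (C ℕ.+ c)) (≡.trans (≡.cong ℤ.∣_∣ (≡.sym (proj₂ p∣s₀))) (ℤP.abs-* p κ₀)) b₀)
      go : ∀ k → k ℕ.< suc K → ℤ.∣ κ k ∣ ℕ.≤ c ℕ.+ suc k ℕ.* C
      go zero _ = ℕP.≤-trans κ₀-bound (ℕP.≤-reflexive (≡.trans (ℕP.+-comm C c) (≡.cong (λ z → c ℕ.+ z) (≡.sym (ℕP.+-identityʳ C)))))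
      go (suc k) (s≤s k<K) = ℕP.≤-trans (proj₂ (proj₂ rec) C (C ℕ.+ c) τ≤p s′₀-bound (λ j j<K → b₁ (suc j) (s≤s j<K)) k k<K)
        (ℕP.≤-reflexive (≡.trans (≡.cong (λ z → z ℕ.+ suc k ℕ.* C) (ℕP.+-comm C c)) (ℕP.+-assoc c C _)))
        where
        0<K : 0 ℕ.< K
        0<K = ℕP.≤-trans (s≤s z≤n) k<K
        s′₀-bound : ℤ.∣ s′ 0 ∣ ℕ.≤ ℤ.∣ p ∣ ℕ.* (C ℕ.+ (C ℕ.+ c))
        s′₀-bound = ℕP.≤-trans (ℤP.∣i+j∣≤∣i∣+∣j∣ (s 1) (τ ℤ.* κ₀)) (≡.subst (λ z → ℤ.∣ s 1 ∣ ℕ.+ ℤ.∣ τ ℤ.* κ₀ ∣ ℕ.≤ z) (≡.sym (ℕP.*-distribˡ-+ ℤ.∣ p ∣ C (C ℕ.+ c)))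
          (ℕP.+-mono-≤ (b₁ 0 (s≤s 0<K)) (ℕP.≤-trans (ℕP.≤-reflexive (ℤP.abs-* τ κ₀)) (ℕP.*-mono-≤ τ≤p κ₀-bound))))

-- Sprindžuk's argument: a polynomial of small degree and small height cannot vanish
-- at the branch modulo a high power of a large prime.

sumℕ : ∀ {n} → (Fin n → ℕ) → ℕ
sumℕ {zero} g = 0
sumℕ {suc n} g = g zero ℕ.+ sumℕ (g ∘ suc)

≤sumℕ : ∀ {n} (g : Fin n → ℕ) i → g i ℕ.≤ sumℕ g
≤sumℕ g zero = ℕP.m≤m+n _ _
≤sumℕ g (suc i) = ℕP.≤-trans (≤sumℕ (g ∘ suc) i) (ℕP.m≤n+m _ _)

sumBelow : ℕ → (ℕ → ℕ) → ℕ
sumBelow zero g = 0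
sumBelow (suc n) g = g n ℕ.+ sumBelow n g

≤sumBelow : ∀ n g k → k ℕ.< n → g k ℕ.≤ sumBelow n g
≤sumBelow (suc n) g k k<1+n with ℕP.m≤n⇒m<n∨m≡n (ℕP.≤-pred k<1+n)
... | inj₁ k<n = ℕP.≤-trans (≤sumBelow n g k k<n) (ℕP.m≤n+m _ _)
... | inj₂ ≡.refl = ℕP.m≤m+n _ _

module _ where
  open Sums ℤR

  abs-sum : ∀ {n} (g : Fin n → ℤ) (h : Fin n → ℕ) → (∀ i → ℤ.∣ g i ∣ ℕ.≤ h i) → ℤ.∣ sum g ∣ ℕ.≤ sumℕ h
  abs-sum {zero} g h b = z≤n
  abs-sum {suc n} g h b = ℕP.≤-trans (ℤP.∣i+j∣≤∣i∣+∣j∣ (g zero) (sum (g ∘ suc))) (ℕP.+-mono-≤ (b zero) (abs-sum (g ∘ suc) (h ∘ suc) (b ∘ suc)))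

  sumℕ-* : ∀ {n} a (h : Fin n → ℕ) → sumℕ (λ i → a ℕ.* h i) ≡ a ℕ.* sumℕ h
  sumℕ-* {zero} a h = ≡.sym (ℕP.*-zeroʳ a)
  sumℕ-* {suc n} a h = ≡.trans (≡.cong (λ z → a ℕ.* h zero ℕ.+ z) (sumℕ-* a (h ∘ suc))) (≡.sym (ℕP.*-distribˡ-+ a (h zero) _))

  norm : List ℤ → ℕ
  norm [] = 0
  norm (c ∷ l) = ℤ.∣ c ∣ ℕ.+ norm l

  abs-dot : ∀ l v b → (∀ k → k ℕ.< List.length l → ℤ.∣ v k ∣ ℕ.≤ b) → ℤ.∣ dot ℤR l v ∣ ℕ.≤ norm l ℕ.* b
  abs-dot [] v b h = z≤n
  abs-dot (c ∷ l) v b h = ℕP.≤-trans (ℤP.∣i+j∣≤∣i∣+∣j∣ (c ℤ.* v 0) (dot ℤR l (v ∘ suc))) (ℕP.≤-trans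
    (ℕP.+-mono-≤ (ℕP.≤-trans (ℕP.≤-reflexive (ℤP.abs-* c (v 0))) (ℕP.*-monoʳ-≤ ℤ.∣ c ∣ (h 0 (s≤s z≤n)))) (abs-dot l (v ∘ suc) b λ k k<l → h (suc k) (s≤s k<l)))
    (ℕP.≤-reflexive (≡.sym (ℕP.*-distribʳ-+ b ℤ.∣ c ∣ (norm l)))))

∣∧<⇒≡0 : ∀ {p x} → (+ p) ∣ℤ x → ℤ.∣ x ∣ ℕ.< p → x ≡ + 0
∣∧<⇒≡0 {p} {x} d x<p with ℤ.∣ x ∣ ℕP.≟ 0
... | yes z = ℤP.∣i∣≡0⇒i≡0 z
... | no nz = ⊥-elim (ℕP.<⇒≱ x<p (ℕ∣.∣⇒≤ ⦃ ℕ.≢-nonZero nz ⦄ (∣⇒∣ᵤ {+ p} {x} d)))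

module Sprindžuk (n M : ℕ) (τ : ℤ) (τ≢0 : τ ≢ + 0) (Ev : Hom (Pol (Pol ℤR)) (Series ℤR))
  (Ev-const : ∀ r → CRing._≈_ (Series ℤR) (fn Ev (const (Pol ℤR) (const ℤR r))) (fn (constₛ ℤR) r))
  (Ev-T : CRing._≈_ (Series ℤR) (fn Ev (const (Pol ℤR) (X ℤR))) (CRing._*_ (Series ℤR) (fn (constₛ ℤR) τ) (tₛ ℤR)))
  (d₁ : Dual ℤR (family ℤR n M Ev)) (Δ₁≢0 : Dual.Δ d₁ ≢ + 0)
  (d₂ : Dual ℤR (family ℤR n (suc M) Ev)) (Δ₂≢0 : Dual.Δ d₂ ≢ + 0) where

  private
    module d₁ = Dual d₁
    module d₂ = Dual d₂
    𝔹 = Pol ℤR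
    module B = CRing 𝔹
    module PB = CRing (Pol 𝔹)
    module S = CRing (Series ℤR)
    fam = family ℤR n M Ev
  open Sums ℤR
  open Domain ℤ-domain using (*-cancel)

  -- Exceeds the length of every functional in both duals, so that statements about the first N
  -- coefficients suffice for them. The additional 1 ensures that p divides pᴺ.
  N : ℕ
  N = suc (sumℕ (λ x → List.length (d₁.l x)) ℕ.+ sumℕ (λ x → List.length (d₂.l x)))

  private
    l₁<N : ∀ x k → k ℕ.< List.length (d₁.l x) → k ℕ.< N
    l₁<N x k k<l = ℕP.≤-trans k<l (ℕP.m≤n⇒m≤1+n (ℕP.≤-trans (≤sumℕ (λ x → List.length (d₁.l x)) x) (ℕP.m≤m+n _ _)))

    l₂<N : ∀ x k → k ℕ.< List.length (d₂.l x) → k ℕ.< N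
    l₂<N x k k<l = ℕP.≤-trans k<l (ℕP.m≤n⇒m≤1+n (ℕP.≤-trans (≤sumℕ (λ x → List.length (d₂.l x)) x) (ℕP.m≤n+m _ _)))

    fam-size : Fin (n ℕ.* M) → ℕ
    fam-size x = sumBelow N (λ k → ℤ.∣ fam x k ∣)
    C κ-size w-size : ℕ
    C = sumℕ fam-size
    κ-size = N ℕ.* C
    w-size = (ℤ.∣ d₁.Δ ∣ ℕ.+ sumℕ (λ x → norm (d₁.l x) ℕ.* fam-size x)) ℕ.* κ-size

  -- For larger p, no nonzero defect `w` and no divisor of τ can be a multiple of p; both summands
  -- are independent of p.
  threshold : ℕ
  threshold = w-size ℕ.+ ℤ.∣ τ ∣

  module _ {p : ℕ} (prime : ℕPrime.Prime p) (large : threshold ℕ.< p) (ν : ℤ) (inverse : ((+ p) ^ℤ N) ∣ℤ (τ ℤ.* ν ℤ.- + 1)) where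
    open PAdic (+ p) ν

    private
      p≢0 : + p ≢ + 0
      p≢0 = Divisibility.nonzero (ℤ-prime prime)

      atp : Hom 𝔹 ℤR
      atp = eval idℤ (+ p)

    -- The series s of g on the branch vanishes at T = p modulo pᴺ, so s = pκ - τ·tκ with κ bounded
    -- independently of p. The defects of κ and of its shift from being expansions of polynomials B₂
    -- and B₁ are then bounded multiples of p, hence 0. Now τB₁ = TB₂ on the branch to order N,
    -- hence identically, and Δ₁g = (p - T)B₂ is killed by T = p.
    small-vanishing : ∀ (g : Fin (n ℕ.* M) → ℤ) → (∀ x → ℤ.∣ g x ∣ ℕ.≤ p) → ((+ p) ^ℤ N) ∣ℤ E N (coefₛ ℤR (fn Ev (polynomial ℤR n M g))) →
      fn (mapₚ atp) (polynomial ℤR n M g) B.≈ B.0#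
    small-vanishing g g≤p vanishes = result
      where
      s : ℕ → ℤ
      s k = coefₛ ℤR (fn Ev (polynomial ℤR n M g)) k
      s≡ : ∀ k → s k ≡ sum (λ x → g x ℤ.* fam x k)
      s≡ k = ≡.sym (family-sum ℤR n M Ev Ev-const g k)
      s-bound : ∀ k → k ℕ.< N → ℤ.∣ s k ∣ ℕ.≤ p ℕ.* C
      s-bound k k<N = ≡.subst (ℕ._≤ p ℕ.* C) (≡.cong ℤ.∣_∣ (≡.sym (s≡ k))) (ℕP.≤-trans (abs-sum (λ x → g x ℤ.* fam x k) (λ x → p ℕ.* fam-size x)
        λ x → ℕP.≤-trans (ℕP.≤-reflexive (ℤP.abs-* (g x) (fam x k))) (ℕP.*-mono-≤ (g≤p x) (≤sumBelow N _ k k<N))) (ℕP.≤-reflexive (sumℕ-* p fam-size)))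
      τ≤p : ℤ.∣ τ ∣ ℕ.≤ p
      τ≤p = ℕP.≤-trans (ℕP.m≤n+m _ w-size) (ℕP.<⇒≤ large)
      dv = divide {τ} p≢0 N inverse s vanishes
      κ = proj₁ dv
      κ⁺ = shiftSeq κ
      eqs : ∀ k → k ℕ.< N → s k ≡ + p ℤ.* κ k ℤ.- τ ℤ.* κ⁺ k
      eqs = proj₁ (proj₂ dv)
      κ-bound : ∀ k → k ℕ.< N → ℤ.∣ κ k ∣ ℕ.≤ κ-size
      κ-bound k k<N = ℕP.≤-trans (proj₂ (proj₂ dv) C 0 τ≤p (≡.subst (λ c → ℤ.∣ s 0 ∣ ℕ.≤ p ℕ.* c) (≡.sym (ℕP.+-identityʳ C)) (s-bound 0 (s≤s z≤n))) (λ k → s-bound (suc k)) k k<N)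
        (ℕP.*-monoˡ-≤ C k<N)
      κ⁺-bound : ∀ k → k ℕ.< N → ℤ.∣ κ⁺ k ∣ ℕ.≤ κ-size
      κ⁺-bound zero _ = z≤n
      κ⁺-bound (suc k) k<N = κ-bound k (ℕP.<-trans (ℕP.n<1+n k) k<N)

      L : (ℕ → ℤ) → Fin (n ℕ.* M) → ℤ
      L v x = dot ℤR (d₁.l x) v
      -- The defect of v: Δ₁v minus the combination of the family that the functionals of `d₁`
      -- predict.
      w : (ℕ → ℤ) → ℕ → ℤ
      w v k = d₁.Δ ℤ.* v k ℤ.- sum (λ x → L v x ℤ.* fam x k)

      L-s : ∀ x → L s x ≡ d₁.Δ ℤ.* g x
      L-s x = ≡.trans (dot-cong ℤR (d₁.l x) s≡) (dual-sum ℤR d₁ g x)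

      L-split : ∀ x → L s x ≡ + p ℤ.* L κ x ℤ.- τ ℤ.* L κ⁺ x
      L-split x = ≡.trans (dot-local ℤR (d₁.l x) (λ k k<l → ≡.trans (eqs k (l₁<N x k k<l)) (≡.cong (λ z → + p ℤ.* κ k ℤ.+ z) (ℤP.neg-distribˡ-* τ (κ⁺ k)))))
        (≡.trans (dot-+ ℤR (d₁.l x) (λ k → + p ℤ.* κ k) (λ k → ℤ.- τ ℤ.* κ⁺ k)) (≡.cong₂ ℤ._+_ (dot-* ℤR (d₁.l x) (+ p) κ)
          (≡.trans (dot-* ℤR (d₁.l x) (ℤ.- τ) κ⁺) (≡.sym (ℤP.neg-distribˡ-* τ (L κ⁺ x))))))

      open Solver ℤR using (solve; _:+_; _:*_; :-_; _:=_)

      -- The series s is a combination of the family and has defect 0, so the relation s = pκ - τκ⁺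
      -- passes to the defects.
      w-relation : ∀ k → k ℕ.< N → + p ℤ.* w κ k ≡ τ ℤ.* w κ⁺ k
      w-relation k k<N = x-y≈0⇒x≈y ℤR (+ p ℤ.* w κ k) (τ ℤ.* w κ⁺ k) (begin
        + p ℤ.* w κ k ℤ.- τ ℤ.* w κ⁺ k
          ≡⟨ solve 7 (λ p t Δ x y a b → p :* (Δ :* x :+ :- a) :+ :- (t :* (Δ :* y :+ :- b)) := Δ :* (p :* x :+ :- (t :* y)) :+ :- (p :* a :+ :- t :* b)) ≡.refl
               (+ p) τ d₁.Δ (κ k) (κ⁺ k) Σκ Σκ⁺ ⟩
        d₁.Δ ℤ.* (+ p ℤ.* κ k ℤ.- τ ℤ.* κ⁺ k) ℤ.- (+ p ℤ.* Σκ ℤ.+ ℤ.- τ ℤ.* Σκ⁺)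
          ≡⟨ ≡.cong₂ (λ x y → d₁.Δ ℤ.* x ℤ.- y) (≡.sym (≡.trans (≡.sym (s≡ k)) (eqs k k<N))) combine-sums ⟩
        d₁.Δ ℤ.* sum (λ x → g x ℤ.* fam x k) ℤ.- sum (λ x → L s x ℤ.* fam x k)
          ≡⟨ ≡.cong₂ ℤ._-_ (sum-*ˡ d₁.Δ (λ x → g x ℤ.* fam x k)) (sum-cong (λ x → L s x ℤ.* fam x k) (λ x → d₁.Δ ℤ.* (g x ℤ.* fam x k))
               (λ x → ≡.trans (≡.cong (λ z → z ℤ.* fam x k) (L-s x)) (ℤP.*-assoc d₁.Δ (g x) (fam x k)))) ⟩
        sum (λ x → d₁.Δ ℤ.* (g x ℤ.* fam x k)) ℤ.- sum (λ x → d₁.Δ ℤ.* (g x ℤ.* fam x k))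
          ≡⟨ ℤP.+-inverseʳ (sum (λ x → d₁.Δ ℤ.* (g x ℤ.* fam x k))) ⟩
        + 0 ∎)
        where
        open ≡.≡-Reasoning
        Σκ = sum (λ x → L κ x ℤ.* fam x k)
        Σκ⁺ = sum (λ x → L κ⁺ x ℤ.* fam x k)
        combine-sums : + p ℤ.* Σκ ℤ.+ ℤ.- τ ℤ.* Σκ⁺ ≡ sum (λ x → L s x ℤ.* fam x k)
        combine-sums = ≡.trans (≡.cong₂ ℤ._+_ (sum-*ˡ (+ p) (λ x → L κ x ℤ.* fam x k)) (sum-*ˡ (ℤ.- τ) (λ x → L κ⁺ x ℤ.* fam x k)))
          (≡.trans (≡.sym (sum-+ (λ x → + p ℤ.* (L κ x ℤ.* fam x k)) (λ x → ℤ.- τ ℤ.* (L κ⁺ x ℤ.* fam x k))))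
          (sum-cong (λ x → + p ℤ.* (L κ x ℤ.* fam x k) ℤ.+ ℤ.- τ ℤ.* (L κ⁺ x ℤ.* fam x k)) (λ x → L s x ℤ.* fam x k) λ x → ≡.trans
            (solve 5 (λ p t a b c → p :* (a :* c) :+ :- t :* (b :* c) := (p :* a :+ :- (t :* b)) :* c) ≡.refl (+ p) τ (L κ x) (L κ⁺ x) (fam x k))
            (≡.cong (λ z → z ℤ.* fam x k) (≡.sym (L-split x)))))

      w-bound : ∀ v → (∀ k → k ℕ.< N → ℤ.∣ v k ∣ ℕ.≤ κ-size) → ∀ k → k ℕ.< N → ℤ.∣ w v k ∣ ℕ.≤ w-size
      w-bound v b k k<N = ℕP.≤-trans (ℤP.∣i-j∣≤∣i∣+∣j∣ (d₁.Δ ℤ.* v k) (sum (λ x → L v x ℤ.* fam x k))) (ℕP.≤-trans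
        (ℕP.+-mono-≤ (ℕP.≤-trans (ℕP.≤-reflexive (ℤP.abs-* d₁.Δ (v k))) (ℕP.*-monoʳ-≤ ℤ.∣ d₁.Δ ∣ (b k k<N)))
          (ℕP.≤-trans (abs-sum (λ x → L v x ℤ.* fam x k) (λ x → κ-size ℕ.* (norm (d₁.l x) ℕ.* fam-size x)) term-bound)
            (ℕP.≤-reflexive (≡.trans (sumℕ-* κ-size (λ x → norm (d₁.l x) ℕ.* fam-size x)) (ℕP.*-comm κ-size _)))))
        (ℕP.≤-reflexive (≡.sym (ℕP.*-distribʳ-+ κ-size ℤ.∣ d₁.Δ ∣ (sumℕ λ x → norm (d₁.l x) ℕ.* fam-size x)))))
        where
        term-bound : ∀ x → ℤ.∣ L v x ℤ.* fam x k ∣ ℕ.≤ κ-size ℕ.* (norm (d₁.l x) ℕ.* fam-size x)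
        term-bound x = ℕP.≤-trans (ℕP.≤-reflexive (ℤP.abs-* (L v x) (fam x k))) (ℕP.≤-trans
          (ℕP.*-mono-≤ (abs-dot (d₁.l x) v κ-size (λ j j<l → b j (l₁<N x j j<l))) (≤sumBelow N _ k k<N))
          (ℕP.≤-reflexive (≡.trans (≡.cong (λ z → z ℕ.* fam-size x) (ℕP.*-comm (norm (d₁.l x)) κ-size)) (ℕP.*-assoc κ-size _ _))))

      ¬p∣τ : ¬ (+ p) ∣ℤ τ
      ¬p∣τ d = τ≢0 (∣∧<⇒≡0 {p} {τ} d (ℕP.≤-<-trans (ℕP.m≤n+m _ w-size) large))

      -- p divides τ·w(κ⁺) but not τ, and w(κ⁺) is smaller than p.
      w-κ⁺ : ∀ k → k ℕ.< N → w κ⁺ k ≡ + 0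
      w-κ⁺ k k<N with w κ⁺ k ℤP.≟ + 0
      ... | yes z = z
      ... | no nz = ⊥-elim (Divisibility.split (ℤ-prime prime) {τ} {w κ⁺ k} (w κ k , w-relation k k<N) ¬p∣τ
        λ d → nz (∣∧<⇒≡0 {p} {w κ⁺ k} d (ℕP.≤-<-trans (w-bound κ⁺ κ⁺-bound k k<N) (ℕP.≤-<-trans (ℕP.m≤m+n w-size _) large))))

      w-κ : ∀ k → k ℕ.< N → w κ k ≡ + 0
      w-κ k k<N = *-cancel {+ p} p≢0 (≡.trans (w-relation k k<N) (≡.trans (≡.cong (λ z → τ ℤ.* z) (w-κ⁺ k k<N)) (≡.trans (ℤP.*-zeroʳ τ) (≡.sym (ℤP.*-zeroʳ (+ p))))))

      represent : ∀ v → (∀ k → k ℕ.< N → w v k ≡ + 0) → ∀ k → k ℕ.< N → coefₛ ℤR (fn Ev (polynomial ℤR n M (L v))) k ≡ d₁.Δ ℤ.* v k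
      represent v z k k<N = ≡.trans (≡.sym (family-sum ℤR n M Ev Ev-const (L v) k)) (≡.sym (x-y≈0⇒x≈y ℤR (d₁.Δ ℤ.* v k) (sum (λ x → L v x ℤ.* fam x k)) (z k k<N)))

      B₂ B₁ T Dᵈ : PB.Carrier
      B₂ = polynomial ℤR n M (L κ)
      B₁ = polynomial ℤR n M (L κ⁺)
      T = const 𝔹 (X ℤR)
      cτ = const 𝔹 (const ℤR τ)
      Dᵈ = cτ PB.* B₁ PB.+ PB.- (T PB.* B₂)

      EvT* : ∀ a → fn Ev (T PB.* a) S.≈ fn (constₛ ℤR) τ S.* (tₛ ℤR S.* fn Ev a)
      EvT* a = S.trans (*-homo Ev _ _) (S.trans (S.*-congʳ Ev-T) (S.*-assoc _ _ _))

      -- On the branch T = τt, and multiplication by t turns κ into κ⁺, so the two terms cancel in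
      -- the first N coefficients.
      Ev-D : ∀ k → k ℕ.< N → coefₛ ℤR (fn Ev Dᵈ) k ≡ + 0
      Ev-D k k<N = ≡.trans (coefₛ-cong ℤR (S.trans (+-homo Ev _ _) (S.+-cong (S.trans (*-homo Ev _ _) (S.*-congʳ (Ev-const τ))) (S.trans (-‿homo Ev _) (S.-‿cong (EvT* B₂))))) k)
        (≡.trans (coefₛ-+ ℤR _ _ k) (≡.trans (≡.cong₂ ℤ._+_ (≡.trans (coef-constₛ* ℤR τ _ k) (≡.cong (λ z → τ ℤ.* z) (represent κ⁺ w-κ⁺ k k<N)))
          (≡.trans (coefₛ-neg ℤR _ k) (≡.cong ℤ.-_ (≡.trans (coef-constₛ* ℤR τ _ k) (≡.cong (λ z → τ ℤ.* z) (shifted k k<N)))))) (ℤP.+-inverseʳ (τ ℤ.* (d₁.Δ ℤ.* κ⁺ k)))))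
        where
        shifted : ∀ k → k ℕ.< N → coefₛ ℤR (tₛ ℤR S.* fn Ev B₂) k ≡ d₁.Δ ℤ.* κ⁺ k
        shifted zero _ = ≡.trans (coef-t*-0 ℤR _) (≡.sym (ℤP.*-zeroʳ d₁.Δ))
        shifted (suc k) k<N = ≡.trans (coef-t*-suc ℤR _ k) (represent κ w-κ k (ℕP.<-trans (ℕP.n<1+n k) k<N))

      inner-deg : ∀ c j → deg< ℤR M (coef 𝔹 (polynomial ℤR n M c) j)
      inner-deg c j with j ℕP.<? n
      ... | yes j<n = deg<-cong ℤR (B.sym (B.trans (B.reflexive (≡.cong (coef 𝔹 (polynomial ℤR n M c)) (≡.sym (FinP.toℕ-fromℕ< j<n))))
        (coef-build 𝔹 (λ j → build ℤR {M} λ i → c (Fin.combine {n} {M} j i)) (Fin.fromℕ< j<n)))) (build-deg ℤR (λ i → c (Fin.combine {n} {M} (Fin.fromℕ< j<n) i)))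
      ... | no j≮n = deg<-cong ℤR (B.sym (polynomial-deg ℤR n M c j (ℕP.≮⇒≥ j≮n))) (deg<-0 ℤR M)

      D-deg : deg< 𝔹 n Dᵈ
      D-deg = deg<-+ 𝔹 (deg<-const* 𝔹 _ (polynomial-deg ℤR n M (L κ⁺))) (deg<-neg 𝔹 (deg<-const* 𝔹 _ (polynomial-deg ℤR n M (L κ))))

      D-inner : ∀ j → deg< ℤR (suc M) (coef 𝔹 Dᵈ j)
      D-inner j = deg<-cong ℤR (B.sym (B.trans (coef-+ 𝔹 _ _ j) (B.+-cong (coef-const* 𝔹 _ B₁ j) (B.trans (coef-neg 𝔹 _ j) (B.-‿cong (coef-const* 𝔹 _ B₂ j))))))
        (deg<-+ ℤR (deg<-mono ℤR (ℕP.n≤1+n M) (deg<-const* ℤR τ (inner-deg (L κ⁺) j))) (deg<-neg ℤR (deg<-X* ℤR (inner-deg (L κ) j))))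

      -- The factor T raises the degree in T by one, so it is the larger family whose functionals
      -- annihilate the coefficients of D.
      D≈0 : Dᵈ PB.≈ PB.0#
      D≈0 = PB.trans (PB.sym rep) (PB.trans (build-cong 𝔹 {n} λ j → build-cong ℤR {suc M} λ i → coefficient-0 (Fin.combine {n} {suc M} j i)) zero-polynomial)
        where
        rep : polynomial ℤR n (suc M) (coefficients ℤR n (suc M) Dᵈ) PB.≈ Dᵈ
        rep = polynomial-coefficients ℤR n (suc M) D-deg D-inner
        -- Zero is written as 0·0 so that `build-*` displays the polynomial with these coefficients
        -- as a multiple of the constant 0.
        coefficient-0 : ∀ x → coefficients ℤR n (suc M) Dᵈ x ≡ + 0 ℤ.* + 0
        coefficient-0 x = *-cancel {d₂.Δ} Δ₂≢0 (≡.trans (≡.sym (dual-sum ℤR d₂ (coefficients ℤR n (suc M) Dᵈ) x)) (≡.trans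
          (dot-local ℤR (d₂.l x) (λ k k<l → ≡.trans (family-sum ℤR n (suc M) Ev Ev-const (coefficients ℤR n (suc M) Dᵈ) k) (≡.trans (coefₛ-cong ℤR (Hom.cong Ev rep) k) (Ev-D k (l₂<N x k k<l)))))
          (≡.trans (dot-0 ℤR (d₂.l x)) (≡.sym (ℤP.*-zeroʳ d₂.Δ)))))
        zero-polynomial : polynomial ℤR n (suc M) (λ _ → + 0 ℤ.* + 0) PB.≈ PB.0#
        zero-polynomial = PB.trans (build-cong 𝔹 {n} λ j → build-* ℤR {suc M} (+ 0) (λ i → + 0)) (PB.trans (build-* 𝔹 {n} (const ℤR (+ 0)) (λ j → build ℤR {suc M} λ i → + 0))
          (PB.trans (PB.*-congʳ (PB.trans (Hom.cong (constₕ 𝔹) (0-homo (constₕ ℤR))) (0-homo (constₕ 𝔹)))) (PB.zeroˡ _)))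

      scaled : const 𝔹 (const ℤR d₁.Δ) PB.* polynomial ℤR n M g PB.≈ const 𝔹 (const ℤR (+ p)) PB.* B₂ PB.+ PB.- (cτ PB.* B₁)
      scaled = PB.trans (PB.sym (scale d₁.Δ g)) (PB.trans (build-cong 𝔹 {n} λ j → build-cong ℤR {M} λ i → ≡.trans (≡.sym (L-s (Fin.combine {n} {M} j i))) (≡.trans (L-split (Fin.combine {n} {M} j i))
          (≡.cong (λ z → + p ℤ.* L κ (Fin.combine {n} {M} j i) ℤ.+ z) (ℤP.neg-distribˡ-* τ (L κ⁺ (Fin.combine {n} {M} j i))))))
        (PB.trans (PB.trans (build-cong 𝔹 {n} λ j → build-+ ℤR (λ i → + p ℤ.* L κ (Fin.combine {n} {M} j i)) (λ i → ℤ.- τ ℤ.* L κ⁺ (Fin.combine {n} {M} j i)))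
          (build-+ 𝔹 (λ j → build ℤR λ i → + p ℤ.* L κ (Fin.combine {n} {M} j i)) (λ j → build ℤR λ i → ℤ.- τ ℤ.* L κ⁺ (Fin.combine {n} {M} j i))))
        (PB.+-cong (scale (+ p) (L κ)) (PB.trans (scale (ℤ.- τ) (L κ⁺)) (PB.trans (PB.*-congʳ (PB.trans (Hom.cong (constₕ 𝔹) (-‿homo (constₕ ℤR) τ)) (-‿homo (constₕ 𝔹) _)))
          (PB.sym (RingProps.-‿distribˡ-* PB.ring _ _)))))))
        where
        scale : ∀ r c → polynomial ℤR n M (λ x → r ℤ.* c x) PB.≈ const 𝔹 (const ℤR r) PB.* polynomial ℤR n M c
        scale r c = PB.trans (build-cong 𝔹 {n} λ j → build-* ℤR r (λ i → c (Fin.combine {n} {M} j i))) (build-* 𝔹 (const ℤR r) (λ j → build ℤR λ i → c (Fin.combine {n} {M} j i)))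

      h : Hom (Pol 𝔹) 𝔹
      h = mapₚ atp
      h-const : ∀ r → fn h (const 𝔹 (const ℤR r)) B.≈ const ℤR r
      h-const r = B.trans (mapₚ-const atp _) (Hom.cong (constₕ ℤR) (eval-const idℤ (+ p) r))

      result : fn h (polynomial ℤR n M g) B.≈ B.0#
      result = conclude (Domain.nzd (Pol-domain ℤ-domain) {const ℤR d₁.Δ} {fn h (polynomial ℤR n M g)} (begin
        const ℤR d₁.Δ B.* fn h (polynomial ℤR n M g) ≈⟨ B.*-congʳ (h-const d₁.Δ) ⟨
        fn h (const 𝔹 (const ℤR d₁.Δ)) B.* fn h (polynomial ℤR n M g) ≈⟨ *-homo h _ _ ⟨
        fn h (const 𝔹 (const ℤR d₁.Δ) PB.* polynomial ℤR n M g) ≈⟨ Hom.cong h scaled ⟩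
        fn h (const 𝔹 (const ℤR (+ p)) PB.* B₂ PB.+ PB.- (cτ PB.* B₁)) ≈⟨ Hom.cong h (PB.+-congˡ (PB.-‿cong (x-y≈0⇒x≈y (Pol 𝔹) _ _ D≈0))) ⟩
        fn h (const 𝔹 (const ℤR (+ p)) PB.* B₂ PB.+ PB.- (T PB.* B₂))
          ≈⟨ B.trans (+-homo h _ _) (B.+-cong (B.trans (*-homo h _ _) (B.*-congʳ (h-const (+ p)))) (B.trans (-‿homo h _) (B.-‿cong (B.trans (*-homo h _ _)
               (B.*-congʳ (B.trans (mapₚ-const atp _) (Hom.cong (constₕ ℤR) (eval-X idℤ (+ p))))))))) ⟩
        const ℤR (+ p) B.* fn h B₂ B.+ B.- (const ℤR (+ p) B.* fn h B₂) ≈⟨ B.-‿inverseʳ _ ⟩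
        B.0# ∎))
        where
        open SetoidReasoning B.setoid
        conclude : const ℤR d₁.Δ B.≈ B.0# ⊎ fn h (polynomial ℤR n M g) B.≈ B.0# → fn h (polynomial ℤR n M g) B.≈ B.0#
        conclude (inj₁ z) = ⊥-elim (const≉0 ℤ-domain Δ₁≢0 z)
        conclude (inj₂ z) = z

-- Coefficients of integral factors

module _ where
  private
    module Z = CRing (Pol ℤR)
    module B2 = CRing (Pol (Pol ℤR))
  open Sums ℤR

  value : ℤ → ∣ Pol ℤR ∣ → ℤ
  value x = fn (eval idℤ x)

  value-decompose : ∀ x a → value x a ≡ coef ℤR a 0 ℤ.+ x ℤ.* value x (tail ℤR a)
  value-decompose x a = ≡.trans (Hom.cong e (Pol-decompose ℤR a)) (≡.trans (+-homo e _ _) (≡.cong₂ ℤ._+_ (eval-const idℤ x _)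
    (≡.trans (*-homo e _ _) (≡.cong (λ z → z ℤ.* value x (tail ℤR a)) (eval-X idℤ x)))))
    where e = eval idℤ x

  value-bound : ∀ W a p → 1 ℕ.≤ p → deg< ℤR W a → ℤ.∣ value (+ p) a ∣ ℕ.≤ sumBelow W (λ j → ℤ.∣ coef ℤR a j ∣) ℕ.* p ℕ.^ W
  value-bound W a p 1≤p d = ℕP.≤-trans (go W a d) (ℕP.≤-reflexive (≡.cong (λ z → z ℕ.* p ℕ.^ W) (sums W a)))
    where
    sumUp : ℕ → (ℕ → ℕ) → ℕ
    sumUp zero g = 0
    sumUp (suc n) g = g 0 ℕ.+ sumUp n (g ∘ suc)
    sumUp-last : ∀ n g → sumUp (suc n) g ≡ g n ℕ.+ sumUp n g
    sumUp-last zero g = ≡.refl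
    sumUp-last (suc n) g = ≡.trans (≡.cong (λ z → g 0 ℕ.+ z) (sumUp-last n (g ∘ suc))) (≡.trans (≡.sym (ℕP.+-assoc (g 0) _ _)) (≡.trans (≡.cong (λ z → z ℕ.+ sumUp n (g ∘ suc)) (ℕP.+-comm (g 0) (g (suc n)))) (ℕP.+-assoc (g (suc n)) (g 0) (sumUp n (g ∘ suc)))))
    sums : ∀ n a → sumUp n (λ j → ℤ.∣ coef ℤR a j ∣) ≡ sumBelow n (λ j → ℤ.∣ coef ℤR a j ∣)
    sums zero a = ≡.refl
    sums (suc n) a = ≡.trans (sumUp-last n (λ j → ℤ.∣ coef ℤR a j ∣)) (≡.cong (λ z → ℤ.∣ coef ℤR a n ∣ ℕ.+ z) (sums n a))
    sumUp-cong : ∀ n {g h} → (∀ j → g j ≡ h j) → sumUp n g ≡ sumUp n h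
    sumUp-cong zero e = ≡.refl
    sumUp-cong (suc n) e = ≡.cong₂ ℕ._+_ (e 0) (sumUp-cong n (e ∘ suc))
    go : ∀ W a → deg< ℤR W a → ℤ.∣ value (+ p) a ∣ ℕ.≤ sumUp W (λ j → ℤ.∣ coef ℤR a j ∣) ℕ.* p ℕ.^ W
    go zero a d = ℕP.≤-reflexive (≡.cong ℤ.∣_∣ (≡.trans (Hom.cong (eval idℤ (+ p)) (deg<0⇒≈0 ℤR d)) (0-homo (eval idℤ (+ p)))))
    go (suc W) a d = ℕP.≤-trans (ℕP.≤-reflexive (≡.cong ℤ.∣_∣ (value-decompose (+ p) a))) (ℕP.≤-trans (ℤP.∣i+j∣≤∣i∣+∣j∣ (coef ℤR a 0) _)
      (ℕP.≤-trans (ℕP.+-mono-≤ (ℕP.≤-trans (ℕP.≤-reflexive (≡.sym (ℕP.*-identityʳ _))) (ℕP.*-monoʳ-≤ ℤ.∣ coef ℤR a 0 ∣ 1≤p^)) rest)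
        (ℕP.≤-reflexive (≡.sym (ℕP.*-distribʳ-+ (p ℕ.^ suc W) ℤ.∣ coef ℤR a 0 ∣ _)))))
      where
      1≤p^ : 1 ℕ.≤ p ℕ.^ suc W
      1≤p^ = ℕP.m^n>0 p ⦃ ℕ.>-nonZero 1≤p ⦄ (suc W)
      S = sumUp W (λ j → ℤ.∣ coef ℤR a (suc j) ∣)
      rest : ℤ.∣ + p ℤ.* value (+ p) (tail ℤR a) ∣ ℕ.≤ S ℕ.* p ℕ.^ suc W
      rest = ℕP.≤-trans (ℕP.≤-reflexive (ℤP.abs-* (+ p) _)) (ℕP.≤-trans (ℕP.*-monoʳ-≤ p (go W (tail ℤR a) (deg<-tail ℤR d)))
        (ℕP.≤-reflexive (≡.trans (≡.cong (λ s → p ℕ.* (s ℕ.* p ℕ.^ W)) (sumUp-cong W λ j → ≡.cong ℤ.∣_∣ (coef-tail ℤR a j)))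
          (≡.trans (≡.sym (ℕP.*-assoc p S _)) (≡.trans (≡.cong (λ z → z ℕ.* p ℕ.^ W) (ℕP.*-comm p S)) (ℕP.*-assoc S p _))))))

  deg<-eval-const : ∀ W x p → (∀ j → deg< ℤR W (coef (Pol ℤR) p j)) → deg< ℤR W (fn (eval (idₕ {Pol ℤR}) (const ℤR x)) p)
  deg<-eval-const W x p = go (bound (Pol ℤR) p) p (deg<-bound (Pol ℤR) p)
    where
    h = eval (idₕ {Pol ℤR}) (const ℤR x)
    go : ∀ n p → deg< (Pol ℤR) n p → (∀ j → deg< ℤR W (coef (Pol ℤR) p j)) → deg< ℤR W (fn h p)
    go zero p d e = deg<-cong ℤR (Z.sym (Z.trans (Hom.cong h (deg<0⇒≈0 (Pol ℤR) d)) (0-homo h))) (deg<-0 ℤR W)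
    go (suc n) p d e = deg<-cong ℤR (Z.sym (Z.trans (Hom.cong h (Pol-decompose (Pol ℤR) p)) (Z.trans (+-homo h _ _) (Z.+-cong (eval-const (idₕ {Pol ℤR}) (const ℤR x) _)
      (Z.trans (*-homo h _ _) (Z.*-congʳ (eval-X (idₕ {Pol ℤR}) (const ℤR x))))))))
      (deg<-+ ℤR (e 0) (deg<-const* ℤR x (go n (tail (Pol ℤR) p) (deg<-tail (Pol ℤR) d) λ j → deg<-cong ℤR (Z.sym (coef-tail (Pol ℤR) p j)) (e (suc j)))))

  module Interpolation (n : ℕ) where
    vandermonde : Fin n → ℕ → ℤ
    vandermonde j k = value (+ suc k) (build ℤR (δ ℤR j))

    vandermonde-sum : ∀ c k → value (+ suc k) (build ℤR c) ≡ sum (λ j → c j ℤ.* vandermonde j k)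
    vandermonde-sum c k = linear-expand ℤR (λ c → value (+ suc k) (build ℤR c)) (λ e → Hom.cong h (build-cong ℤR e))
      (λ c c′ → ≡.trans (Hom.cong h (build-+ ℤR c c′)) (+-homo h _ _))
      (λ r c → ≡.trans (Hom.cong h (build-* ℤR r c)) (≡.trans (*-homo h _ _) (≡.cong (λ z → z ℤ.* value (+ suc k) (build ℤR c)) (eval-const idℤ (+ suc k) r)))) c
      where h = eval idℤ (+ suc k)

    vandermonde-independent : Independent ℤR vandermonde
    vandermonde-independent c i c≢0 with nonzero-large (build ℤR c) (λ z → c≢0 (≡.trans (≡.sym (coef-build ℤR c i)) (≡.trans (coef-cong ℤR z (Fin.toℕ i)) (coef-0 ℤR (Fin.toℕ i)))))
    ... | b , nz = b , λ z → nz (suc b) ℕP.≤-refl (≡.trans (vandermonde-sum c b) z)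

    dual₀ = dual ℤR ℤ-domain vandermonde vandermonde-independent
    private
      module d₀ = Dual (proj₁ dual₀)

    N₀ : ℕ
    N₀ = sumℕ λ j → List.length (d₀.l j)

    -- The dual of the Vandermonde vectors bounds the coefficients by the values at 1, ..., N₀, with
    -- a constant that depends on n only.
    interpolation-bound : ∀ {G} b → deg< ℤR n G → (∀ k → k ℕ.< N₀ → ℤ.∣ value (+ suc k) G ∣ ℕ.≤ b) → ∀ j → ℤ.∣ coef ℤR G (Fin.toℕ {n} j) ∣ ℕ.≤ sumℕ (λ j → norm (d₀.l j)) ℕ.* b
    interpolation-bound {G} b d h j = ℕP.≤-trans (ℕP.m≤n*m ℤ.∣ g j ∣ ℤ.∣ d₀.Δ ∣ ⦃ ℕ.≢-nonZero (λ e → proj₂ dual₀ (ℤP.∣i∣≡0⇒i≡0 e)) ⦄)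
      (ℕP.≤-trans (ℕP.≤-reflexive (≡.trans (≡.sym (ℤP.abs-* d₀.Δ (g j))) (≡.cong ℤ.∣_∣ (≡.sym (≡.trans (dot-cong ℤR (d₀.l j) λ k → ≡.trans (Hom.cong (eval idℤ (+ suc k)) (Z.sym (build-coef ℤR n d))) (vandermonde-sum g k)) (dual-sum ℤR (proj₁ dual₀) g j))))))
      (ℕP.≤-trans (abs-dot (d₀.l j) (λ k → value (+ suc k) G) b λ k k<l → h k (ℕP.<-≤-trans k<l (≤sumℕ (λ j → List.length (d₀.l j)) j)))
        (ℕP.*-monoˡ-≤ b (≤sumℕ (λ j → norm (d₀.l j)) j))))
      where
      g : Fin n → ℤ
      g j = coef ℤR G (Fin.toℕ j)

  digitsℕ : ∀ p → ⦃ _ : ℕ.NonZero p ⦄ → ∀ M x → x ℕ.< p ℕ.^ M → ∃ λ (c : Fin M → ℕ) → (∀ i → c i ℕ.≤ p) × + x ≡ value (+ p) (build ℤR (λ i → + c i))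
  digitsℕ p zero zero _ = (λ ()) , (λ ()) , ≡.sym (0-homo (eval idℤ (+ p)))
  digitsℕ p zero (suc x) (s≤s ())
  digitsℕ p (suc M) x x<p^ with digitsℕ p M (x ℕ./ p) (ℕDivMod.m<n*o⇒m/o<n (≡.subst (x ℕ.<_) (ℕP.*-comm p (p ℕ.^ M)) x<p^))
  ... | c , c≤ , e = c′ , c′≤ , ≡.trans (≡.cong +_ (ℕDivMod.m≡m%n+[m/n]*n x p)) (≡.trans (ℤP.pos-+ (x ℕ.% p) _) (≡.trans
      (≡.cong (λ z → + (x ℕ.% p) ℤ.+ z) (≡.trans (ℤP.pos-* (x ℕ./ p) p) (≡.trans (ℤP.*-comm (+ (x ℕ./ p)) (+ p)) (≡.cong (λ z → + p ℤ.* z) e))))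
      (≡.sym (≡.trans (+-homo h (const ℤR (+ (x ℕ.% p))) _) (≡.cong₂ ℤ._+_ (eval-const idℤ (+ p) _) (≡.trans (*-homo h _ _) (≡.cong (λ z → z ℤ.* value (+ p) (build ℤR (λ i → + c i))) (eval-X idℤ (+ p)))))))))
    where
    h = eval idℤ (+ p)
    c′ : Fin (suc M) → ℕ
    c′ zero = x ℕ.% p
    c′ (suc i) = c i
    c′≤ : ∀ i → c′ i ℕ.≤ p
    c′≤ zero = ℕP.<⇒≤ (ℕDivMod.m%n<n x p)
    c′≤ (suc i) = c≤ i

  digits : ∀ p → ⦃ _ : ℕ.NonZero p ⦄ → ∀ M x → ℤ.∣ x ∣ ℕ.< p ℕ.^ M → ∃ λ (c : Fin M → ℤ) → (∀ i → ℤ.∣ c i ∣ ℕ.≤ p) × x ≡ value (+ p) (build ℤR c)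
  digits p M (+ x) b with digitsℕ p M x b
  ... | c , c≤ , e = (λ i → + c i) , c≤ , e
  digits p M -[1+ x ] b with digitsℕ p M (suc x) b
  ... | c , c≤ , e = (λ i → (ℤ.- + 1) ℤ.* + c i) , (λ i → ≡.subst (ℕ._≤ p) (≡.sym (≡.trans (ℤP.abs-* (ℤ.- + 1) (+ c i)) (ℕP.+-identityʳ _))) (c≤ i)) ,
    ≡.trans (≡.cong ℤ.-_ e) (≡.trans (≡.sym (ℤP.-1*i≡-i (value (+ p) (build ℤR (λ i → + c i))))) (≡.sym (≡.trans (Hom.cong h (build-* ℤR (ℤ.- + 1) (λ i → + c i))) (≡.trans (*-homo h _ _) (≡.cong (λ z → z ℤ.* value (+ p) (build ℤR (λ i → + c i))) (eval-const idℤ (+ p) (ℤ.- + 1)))))))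
    where h = eval idℤ (+ p)

  -- Base-p digits of the coefficients lift G to a polynomial in T and s with coefficients at most
  -- p, the height that `small-vanishing` asks for; T = p gives G back.
  digit-polynomial : ∀ p → ⦃ _ : ℕ.NonZero p ⦄ → ∀ n M G → deg< ℤR n G → (∀ j → ℤ.∣ coef ℤR G (Fin.toℕ {n} j) ∣ ℕ.< p ℕ.^ M) →
    ∃ λ (g : Fin (n ℕ.* M) → ℤ) → (∀ x → ℤ.∣ g x ∣ ℕ.≤ p) × fn (mapₚ (eval idℤ (+ p))) (polynomial ℤR n M g) Z.≈ G
  digit-polynomial p n M G d small = g , (λ x → proj₁ (proj₂ (dig (proj₁ (Fin.remQuot {n} M x)))) _) ,
    Z.trans (build-homo h (λ j → build ℤR {M} λ i → g (Fin.combine {n} {M} j i))) (Z.trans (build-cong ℤR {n} λ j → ≡.trans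
      (Hom.cong h (build-cong ℤR {M} λ i → ≡.cong (λ (j , i) → proj₁ (dig j) i) (FinP.remQuot-combine {n} {M} j i))) (≡.sym (proj₂ (proj₂ (dig j))))) (build-coef ℤR n d))
    where
    h = eval idℤ (+ p)
    dig : (j : Fin n) → ∃ λ (c : Fin M → ℤ) → (∀ i → ℤ.∣ c i ∣ ℕ.≤ p) × coef ℤR G (Fin.toℕ j) ≡ value (+ p) (build ℤR c)
    dig j = digits p M (coef ℤR G (Fin.toℕ j)) (small j)
    g : Fin (n ℕ.* M) → ℤ
    g x = proj₁ (dig (proj₁ (Fin.remQuot {n} M x))) (proj₂ (Fin.remQuot {n} M x))

-- Specialisation of T at a large prime

small-not-multiple : ∀ {R} (dom : Domain R) (let open CRing R) {n k c π A} → ¬ c ≈ 0# → Top R k c π → n ℕ.≤ k → deg< R n A →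
  ¬ CRing._≈_ (Pol R) A (CRing.0# (Pol R)) → ¬ Divisibility._∣_ (Pol R) π A
small-not-multiple {R} dom {n} {k} {A = A} c≉0 t n≤k d A≉0 (q , e) with topOf dom A A≉0
... | j , nA , tA with Top-complement dom nA (Top-cong R (CRing.refl R) (CRing.sym (Pol R) e) tA) c≉0 t
... | l , k+l , _ = nA (d j (ℕP.≤-trans n≤k (ℕP.≤-trans (ℕP.m≤m+n k l) (ℕP.≤-reflexive k+l))))

inverse-mod-prime : ∀ {p τ} → ℕPrime.Prime p → ¬ (+ p) ∣ℤ τ → ∃ λ ν → (+ p) ∣ℤ (τ ℤ.* ν ℤ.- + 1)
inverse-mod-prime {p} {τ} pp ¬d = signed (absolute (Coprimality.coprime-Bézout coprime))
  where
  module D = Divisibility ℤR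
  open Solver ℤR using (solve; _:+_; _:*_; :-_; _:=_)
  t = ℤ.∣ τ ∣
  coprime : Coprimality.Coprime p t
  coprime {i} (i∣p , i∣t) with ℕPrime.prime⇒irreducible pp i∣p
  ... | inj₁ i≡1 = i≡1
  ... | inj₂ ≡.refl = ⊥-elim (¬d (∣ᵤ⇒∣ {+ p} {τ} i∣t))
  absolute : ℕGCD.Bézout.Identity 1 p t → ∃ λ ν → (+ p) ∣ℤ (+ t ℤ.* ν ℤ.- + 1)
  absolute (ℕGCD.Bézout.+- x y e) = ℤ.- + y , ℤ.- + x , (begin
    + p ℤ.* (ℤ.- + x) ≡⟨ solve 2 (λ p x → p :* :- x := :- (x :* p)) ≡.refl (+ p) (+ x) ⟩
    ℤ.- (+ x ℤ.* + p) ≡⟨ ≡.cong ℤ.-_ (≡.trans (≡.sym (ℤP.pos-* x p)) (≡.trans (≡.cong +_ (≡.sym e)) (≡.trans (ℤP.pos-+ 1 (y ℕ.* t)) (≡.cong (λ z → + 1 ℤ.+ z) (ℤP.pos-* y t))))) ⟩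
    ℤ.- (+ 1 ℤ.+ + y ℤ.* + t) ≡⟨ solve 3 (λ o y t → :- (o :+ y :* t) := t :* :- y :+ :- o) ≡.refl (+ 1) (+ y) (+ t) ⟩
    + t ℤ.* (ℤ.- + y) ℤ.- + 1 ∎)
    where open ≡.≡-Reasoning
  absolute (ℕGCD.Bézout.-+ x y e) = + y , + x , (begin
    + p ℤ.* + x ≡⟨ solve 3 (λ o p x → p :* x := (o :+ x :* p) :+ :- o) ≡.refl (+ 1) (+ p) (+ x) ⟩
    (+ 1 ℤ.+ + x ℤ.* + p) ℤ.- + 1 ≡⟨ ≡.cong (λ z → z ℤ.- + 1) (≡.trans (≡.cong (λ z → + 1 ℤ.+ z) (≡.sym (ℤP.pos-* x p))) (≡.trans (≡.sym (ℤP.pos-+ 1 (x ℕ.* p))) (≡.trans (≡.cong +_ e) (≡.trans (ℤP.pos-* y t) (ℤP.*-comm (+ y) (+ t)))))) ⟩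
    + t ℤ.* + y ℤ.- + 1 ∎)
    where open ≡.≡-Reasoning
  signed : (∃ λ ν → (+ p) ∣ℤ (+ t ℤ.* ν ℤ.- + 1)) → ∃ λ ν → (+ p) ∣ℤ (τ ℤ.* ν ℤ.- + 1)
  signed (ν , d) with ℤP.+∣i∣≡i⊎+∣i∣≡-i τ
  ... | inj₁ e = ν , ≡.subst (λ z → (+ p) ∣ℤ (z ℤ.* ν ℤ.- + 1)) e d
  ... | inj₂ e = ℤ.- ν , ≡.subst (λ z → (+ p) ∣ℤ (z ℤ.- + 1)) (≡.trans (≡.cong (λ z → z ℤ.* ν) e) (≡.trans (≡.sym (ℤP.neg-distribˡ-* τ ν)) (ℤP.neg-distribʳ-* τ ν))) d

coprime-power : ∀ {p a} → ℕPrime.Prime p → ¬ (+ p) ∣ℤ a → ∀ K g → ((+ p) ^ℤ K) ∣ℤ (a ℤ.* g) → ((+ p) ^ℤ K) ∣ℤ g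
coprime-power {p} {a} pp na zero g d = g , ℤP.*-identityˡ g
coprime-power {p} {a} pp na (suc K) g d with ℕPrime.euclidsLemma ℤ.∣ a ∣ ℤ.∣ g ∣ pp
  (≡.subst (p ℕ∣.∣_) (ℤP.abs-* a g) (∣⇒∣ᵤ {+ p} {a ℤ.* g} ((+ p) ^ℤ K ℤ.* proj₁ d , ≡.trans (≡.sym (ℤP.*-assoc (+ p) _ _)) (proj₂ d))))
... | inj₁ h = ⊥-elim (na (∣ᵤ⇒∣ {+ p} {a} h))
... | inj₂ h with ∣ᵤ⇒∣ {+ p} {g} h
... | g′ , ≡.refl = ∣ℤ-*-mono {+ p} (+ 1 , ℤP.*-identityʳ (+ p)) (coprime-power pp na K g′ (∣ℤ-cancel {+ p} (Divisibility.nonzero (ℤ-prime pp))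
  (Divisibility.∣-respʳ ℤR {(+ p) ^ℤ suc K} (Solver.solve ℤR 3 (λ a p g → a :* (p :* g) := p :* (a :* g)) ≡.refl a (+ p) g′) d)))
  where open Solver ℤR using (_:*_; _:=_)

module Fibres {m d : ℕ} {f : Poly m} (hom : Homogeneous d f) (P V : Fin m → ℤ) (f[P]≡0 : evalP ℤR f P ≡ + 0)
  (f[V]≢0 : evalP ℤR f V ≢ + 0) (Q ω : ℤ) (Q≢0 : Q ≢ + 0) (a k n : ℕ) (2≤k : 2 ℕ.≤ k) (degrees : d ℕ.* (a ℕ.+ k) ≡ a ℕ.+ n)
  (μ≢0 : Curves.μ f hom P V f[P]≡0 Q ω a k n 2≤k degrees ≢ + 0) (ξ : Fin m → ℤ) (C : Curves.Curve f hom P V f[P]≡0 Q ω a k n 2≤k degrees ℤR ξ)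
  (W : ℕ) (F-width : ∀ j → deg< ℤR W (coef (Pol ℤR) (Curves.Curve.F C) j))
  (dual₁ : Dual ℤR (family ℤR n (suc W) (Curves.Shape.at f hom P V f[P]≡0 Q ω a k n 2≤k degrees ℤR ξ (Curves.Curve.ŷ C)))) (dual₁≢0 : Dual.Δ dual₁ ≢ + 0)
  (dual₂ : Dual ℤR (family ℤR n (suc (suc W)) (Curves.Shape.at f hom P V f[P]≡0 Q ω a k n 2≤k degrees ℤR ξ (Curves.Curve.ŷ C)))) (dual₂≢0 : Dual.Δ dual₂ ≢ + 0) where

  open Curves f hom P V f[P]≡0 Q ω a k n 2≤k degrees
  open Shape ℤR ξ
  open Curve C

  private
    𝔹 = Pol ℤR
    module B = CRing 𝔹
    module PB = CRing (Pol 𝔹)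
    module S = CRing (Series ℤR)
    module DZ = Divisibility ℤR
    module DB = Divisibility 𝔹
    domB = Pol-domain ℤ-domain
    open Domain ℤ-domain using (*-nonzero; ^-nonzero)
    open Solver ℤR using () renaming (solve to solveᶻ; _:+_ to _⊕_; _:*_ to _⊗_; :-_ to ⊝_; _:=_ to _⊜_)

  Ev : Hom (Pol 𝔹) (Series ℤR)
  Ev = at ŷ

  τ : ℤ
  τ = μ ℤ.* μ

  private
    τ≢0 : τ ≢ + 0
    τ≢0 = *-nonzero {μ} {μ} μ≢0 μ≢0

    Ev-const : ∀ r → fn Ev (const 𝔹 (const ℤR r)) S.≈ fn (constₛ ℤR) r
    Ev-const r = S.trans (eval-const scaleT ŷ _) (eval-const (constₛ ℤR) _ r)

    ι-S : ∀ c → fn (ι (Series ℤR)) c S.≈ fn (constₛ ℤR) c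
    ι-S c = S.trans (S.sym (ι-homo (constₛ ℤR) c)) (Hom.cong (constₛ ℤR) (ι-ℤ c))

    Ev-T : fn Ev (const 𝔹 (X ℤR)) S.≈ fn (constₛ ℤR) τ S.* tₛ ℤR
    Ev-T = S.trans (eval-const scaleT ŷ _) (S.trans (eval-X (constₛ ℤR) _) (S.*-congʳ (ι-S τ)))

  open Sprindžuk n (suc W) τ τ≢0 Ev Ev-const Ev-T dual₁ dual₁≢0 dual₂ dual₂≢0 renaming (threshold to threshold₁)
  open Interpolation n

  private
    -- F(T, j + 1) as a polynomial in T. Its value at T = p is divisible by the value at j + 1 of
    -- each factor of F(p, ·).
    fibre : ℕ → ∣ 𝔹 ∣
    fibre j = fn (eval (idₕ {𝔹}) (const ℤR (+ suc j))) F

    -- At s = x the point of the curve is T·xᵃQV plus a constant vector, so f has degree d in T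
    -- there, with leading coefficient (xᵃQ)ᵈf(V).
    fibre≉0 : ∀ j → ¬ fibre j B.≈ B.0#
    fibre≉0 j z = Top⇒≉0 ℤ-domain lead≢0 top (B.trans (evalP-cong 𝔹 f (λ i → B.sym (shape i))) (B.trans (B.sym (evalP-homo e f (point φ))) (B.trans (Hom.cong e (PB.sym F-eq))
        (B.trans (*-homo e _ F) (B.trans (B.*-congˡ z) (B.zeroʳ _))))))
      where
      x = + suc j
      e : Hom (Pol 𝔹) 𝔹
      e = eval (idₕ {𝔹}) (const ℤR x)
      xa = x ^ℤ a
      c : ℤ → ∣ 𝔹 ∣
      c = const ℤR
      ι-c : ∀ r → fn (ι 𝔹) r B.≈ c r
      ι-c r = B.trans (ι-const ℤR r) (Hom.cong (constₕ ℤR) (ι-ℤ r))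
      e-s^ : ∀ i → fn e (SemiringExp._^_ PB.semiring s i) B.≈ c (x ^ℤ i)
      e-s^ i = B.trans (^-homo e s i) (B.trans (SemiringExp.^-congˡ B.semiring i (eval-X (idₕ {𝔹}) (c x))) (B.sym (^-homo (constₕ ℤR) x i)))
      e-lift : ∀ p → fn e (fn lift p) B.≈ c (value x p)
      e-lift = Pol-hom-ext (e ∘ₕ lift) (constₕ ℤR ∘ₕ eval idℤ x)
        (λ r → B.trans (Hom.cong e (mapₚ-const (constₕ ℤR) r)) (B.trans (eval-const (idₕ {𝔹}) (c x) _) (Hom.cong (constₕ ℤR) (≡.sym (eval-const idℤ x r)))))
        (B.trans (Hom.cong e (mapₚ-X (constₕ ℤR))) (B.trans (eval-X (idₕ {𝔹}) (c x)) (Hom.cong (constₕ ℤR) (≡.sym (eval-X idℤ x)))))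
      v w : Fin m → ℤ
      v i = (xa ℤ.* Q) ℤ.* V i
      w i = (Q ℤ.* ω) ℤ.* value x (y₁ φ i) ℤ.+ xa ℤ.* (Q ℤ.* x ℤ.+ x ^ℤ k) ℤ.* V i
      line : Fin m → ∣ 𝔹 ∣
      line i = SemiringExp._^_ B.semiring (X ℤR) 1 B.* c (v i) B.+ c (w i)
      shape : ∀ i → fn e (point φ i) B.≈ line i
      shape i = B.trans images (B.trans (solve 9 (λ n y xa q X x xk v o → n :* y :+ (xa :* (q :* (X :+ x) :+ xk)) :* v := X :* (xa :* q :* v) :+ (n :* y :+ xa :* (q :* x :+ xk) :* v)) B.refl
          (c (Q ℤ.* ω)) (c (value x (y₁ φ i))) (c xa) (c Q) (X ℤR) (c x) (c (x ^ℤ k)) (c (V i)) B.1#)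
        (B.+-cong (B.*-cong (B.sym (B.*-identityʳ _)) (B.sym c-v)) (B.sym c-w)))
        where
        open Solver 𝔹 using (solve; _:+_; _:*_; _:=_)
        c-+ : ∀ r t → c (r ℤ.+ t) B.≈ c r B.+ c t
        c-+ = +-homo (constₕ ℤR)
        c-* : ∀ r t → c (r ℤ.* t) B.≈ c r B.* c t
        c-* = *-homo (constₕ ℤR)
        e-η : fn e η B.≈ c Q B.* (X ℤR B.+ c x) B.+ c (x ^ℤ k)
        e-η = B.trans (+-homo e _ _) (B.+-cong (B.trans (*-homo e _ _) (B.*-cong (B.trans (ι-homo e Q) (ι-c Q))
          (B.trans (+-homo e _ _) (B.+-cong (eval-const (idₕ {𝔹}) (c x) _) (eval-X (idₕ {𝔹}) (c x)))))) (e-s^ k))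
        images : fn e (point φ i) B.≈ c (Q ℤ.* ω) B.* c (value x (y₁ φ i)) B.+ (c xa B.* (c Q B.* (X ℤR B.+ c x) B.+ c (x ^ℤ k))) B.* c (V i)
        images = B.trans (+-homo e _ _) (B.+-cong (B.trans (*-homo e _ _) (B.*-cong (B.trans (ι-homo e _) (ι-c _)) (e-lift _)))
          (B.trans (*-homo e _ _) (B.*-cong (B.trans (*-homo e _ _) (B.*-cong (e-s^ a) e-η)) (B.trans (ι-homo e (V i)) (ι-c (V i))))))
        c-v : c (v i) B.≈ c xa B.* c Q B.* c (V i)
        c-v = B.trans (c-* _ _) (B.*-congʳ (c-* _ _))
        c-w : c (w i) B.≈ c (Q ℤ.* ω) B.* c (value x (y₁ φ i)) B.+ c xa B.* (c Q B.* c x B.+ c (x ^ℤ k)) B.* c (V i)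
        c-w = B.trans (c-+ _ _) (B.+-cong (c-* _ _) (B.trans (c-* _ _) (B.*-congʳ (B.trans (c-* _ _) (B.*-congˡ (B.trans (c-+ _ _) (B.+-congʳ (c-* _ _))))))))
      top : Top ℤR (d ℕ.* 1) (evalP ℤR f v) (evalP 𝔹 f line)
      top = Top-evalP ℤR {f} hom λ i → Top-+ ℤR (Top-X^* ℤR 1 (v i)) (deg<-const ℤR (w i) (s≤s z≤n))
      lead≢0 : evalP ℤR f v ≢ + 0
      lead≢0 e′ = *-nonzero {(xa ℤ.* Q) ^ℤ d} (^-nonzero {xa ℤ.* Q} d (*-nonzero {xa} (^-nonzero {x} a λ ()) Q≢0)) f[V]≢0 (≡.trans (≡.sym (evalP-scale ℤR {f} hom (xa ℤ.* Q) V)) e′)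

    width-fibre : ∀ j → deg< ℤR W (fibre j)
    width-fibre j = deg<-eval-const W (+ suc j) F F-width

    fibre-threshold fibre-norm : ℕ → ℕ
    fibre-threshold j = proj₁ (nonzero-large (fibre j) (fibre≉0 j))
    fibre-norm j = sumBelow W (λ i → ℤ.∣ coef ℤR (fibre j) i ∣)
    factor-size : ℕ
    factor-size = sumℕ (λ j → norm (Dual.l (proj₁ dual₀) j)) ℕ.* sumBelow N₀ fibre-norm

  -- In turn, the summands secure `small-vanishing`, the nonvanishing of F(p, j + 1) at the
  -- interpolation points, coefficients of a factor below pᵂ⁺¹, and that p does not divide μ.
  threshold : ℕ
  threshold = threshold₁ ℕ.+ (sumBelow N₀ fibre-threshold ℕ.+ (factor-size ℕ.+ ℤ.∣ μ ∣))

  module AtPrime {p : ℕ} (prime : ℕPrime.Prime p) (large : threshold ℕ.< p) where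
    private
      instance
        p-nonZero : ℕ.NonZero p
        p-nonZero = ℕPrime.prime⇒nonZero prime
      p≢0 : + p ≢ + 0
      p≢0 = Divisibility.nonzero (ℤ-prime prime)
      t₁<p : threshold₁ ℕ.< p
      t₁<p = ℕP.≤-<-trans (ℕP.m≤m+n threshold₁ _) large
      t₂<p : sumBelow N₀ fibre-threshold ℕ.< p
      t₂<p = ℕP.≤-<-trans (ℕP.≤-trans (ℕP.m≤m+n _ _) (ℕP.m≤n+m _ threshold₁)) large
      t₃<p : factor-size ℕ.< p
      t₃<p = ℕP.≤-<-trans (ℕP.≤-trans (ℕP.≤-trans (ℕP.m≤m+n factor-size _) (ℕP.m≤n+m _ (sumBelow N₀ fibre-threshold))) (ℕP.m≤n+m _ threshold₁)) large
      t₄<p : ℤ.∣ μ ∣ ℕ.< p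
      t₄<p = ℕP.≤-<-trans (ℕP.≤-trans (ℕP.≤-trans (ℕP.m≤n+m ℤ.∣ μ ∣ factor-size) (ℕP.m≤n+m _ (sumBelow N₀ fibre-threshold))) (ℕP.m≤n+m _ threshold₁)) large

      ¬p∣μ : ¬ (+ p) ∣ℤ μ
      ¬p∣μ d = μ≢0 (∣∧<⇒≡0 d t₄<p)
      ¬p∣τ : ¬ (+ p) ∣ℤ τ
      ¬p∣τ d = Divisibility.split (ℤ-prime prime) {μ} {μ} d ¬p∣μ ¬p∣μ

      ν₁ = inverse-mod-prime {p} {τ} prime ¬p∣τ
      νs : ∀ K → ∃ λ ν → ((+ p) ^ℤ K) ∣ℤ (τ ℤ.* ν ℤ.- + 1)
      νs = inverse-mod {+ p} {τ} {proj₁ ν₁} (proj₂ ν₁)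

      atp : Hom 𝔹 ℤR
      atp = eval idℤ (+ p)

    Fₚ : ∣ 𝔹 ∣
    Fₚ = fn (mapₚ atp) F

    Fₚ-top : Top ℤR n (evalP ℤR f V) Fₚ
    Fₚ-top = Top-cong ℤR (≡.trans (ι-homo atp _) (ι-ℤ _)) B.refl (Top-mapₚ atp F-top)

    module Branch (K : ℕ) where
      private
        ν = proj₁ (νs K)
      open PAdic (+ p) ν public
      private
        module M = CRing (modulo K)

      y : ℤ
      y = E K (coefₛ ℤR ŷ)

      private
        q : Hom ℤR (modulo K)
        q = toQuotient ℤR (principal ℤR ((+ p) ^ℤ K))

        Θ-ι : ∀ c → fn (Θ K) (fn (constₛ ℤR) c) M.≈ c
        Θ-ι c = M.trans {fn (Θ K) (fn (constₛ ℤR) c)} (Hom.cong (Θ K) (S.sym (ι-S c))) (M.trans {fn (Θ K) (fn (ι (Series ℤR)) c)} (ι-homo (Θ K) c) (M.sym {c} (ι-unique q c)))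

        Θ-t : fn (Θ K) (tₛ ℤR) M.≈ + p ℤ.* ν
        Θ-t = go K
          where
          go : ∀ K → ((+ p) ^ℤ K) ∣ℤ (E K (coefₛ ℤR (tₛ ℤR)) ℤ.- + p ℤ.* ν)
          go zero = _ , ℤP.*-identityˡ _
          go (suc K) = DZ.∣-respʳ {(+ p) ^ℤ suc K} (≡.trans
              (solveᶻ 3 (λ q e o → q ⊗ (e ⊕ ⊝ o) ⊜ q ⊗ e ⊕ ⊝ (q ⊗ o)) ≡.refl (+ p ℤ.* ν) (E K (coefₛ ℤR S.1#)) (+ 1))
              (≡.cong₂ ℤ._-_ (≡.trans (≡.sym (ℤP.+-identityˡ ((+ p ℤ.* ν) ℤ.* E K (coefₛ ℤR S.1#)))) (≡.cong₂ (λ x z → x ℤ.+ + p ℤ.* ν ℤ.* z) (≡.sym (coefₛ-mk ℤR _ 0)) (E-cong K λ j _ → unit j))) (ℤP.*-identityʳ (+ p ℤ.* ν))))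
            (q-lift K (1-homo (Θ K)))
            where
            unit : ∀ j → coefₛ ℤR S.1# j ≡ coefₛ ℤR (tₛ ℤR) (suc j)
            unit zero = ≡.trans (coefₛ-1-0 ℤR) (≡.sym (coefₛ-mk ℤR _ 1))
            unit (suc j) = ≡.trans (coefₛ-1 ℤR j) (≡.sym (coefₛ-mk ℤR _ (suc (suc j))))

        Θ-T : fn (Θ K) (fn Ev (const 𝔹 (X ℤR))) M.≈ + p
        Θ-T = M.trans {fn (Θ K) (fn Ev (const 𝔹 (X ℤR)))} (Hom.cong (Θ K) Ev-T) (M.trans {fn (Θ K) (fn (constₛ ℤR) τ S.* tₛ ℤR)} (*-homo (Θ K) _ _)
          (M.trans {fn (Θ K) (fn (constₛ ℤR) τ) ℤ.* fn (Θ K) (tₛ ℤR)} (M.*-cong {fn (Θ K) (fn (constₛ ℤR) τ)} {τ} {fn (Θ K) (tₛ ℤR)} {+ p ℤ.* ν} (Θ-ι τ) Θ-t)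
            (DZ.∣-respʳ {(+ p) ^ℤ K} (solveᶻ 4 (λ p t n o → p ⊗ (t ⊗ n ⊕ ⊝ o) ⊜ t ⊗ (p ⊗ n) ⊕ ⊝ (p ⊗ o)) ≡.refl (+ p) τ ν (+ 1)
              ⊙ ≡.cong (λ z → τ ℤ.* (+ p ℤ.* ν) ℤ.- z) (ℤP.*-identityʳ (+ p))) (DZ.∣-*ˡ {(+ p) ^ℤ K} (+ p) (proj₂ (νs K))))))
          where
          infixl 5 _⊙_
          _⊙_ : ∀ {x y z : ℤ} → x ≡ y → y ≡ z → x ≡ z
          _⊙_ = ≡.trans

      -- Both sides are homomorphisms on ℤ[T][s], so only T and s need comparison: on the branch T =
      -- τt, which at t = pν is p modulo pᴷ, and s becomes y.
      Θ-Ev : ∀ r → fn (Θ K) (fn Ev r) M.≈ value y (fn (mapₚ atp) r)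
      Θ-Ev = Zm-hom-ext (modulo K) 2 (Θ K ∘ₕ Ev) (q ∘ₕ (eval idℤ y ∘ₕ mapₚ atp)) λ
        { zero → M.trans {fn (Θ K) (fn Ev (X 𝔹))} (Hom.cong (Θ K) (eval-X scaleT ŷ)) (M.reflexive (≡.sym (≡.trans (Hom.cong (eval idℤ y) (mapₚ-X atp)) (eval-X idℤ y))))
        ; (suc zero) → M.trans {fn (Θ K) (fn Ev (const 𝔹 (X ℤR)))} Θ-T (M.reflexive (≡.sym (≡.trans (Hom.cong (eval idℤ y) (mapₚ-const atp (X ℤR))) (≡.trans (eval-const idℤ y _) (eval-X idℤ (+ p)))))) }

      root : ((+ p) ^ℤ K) ∣ℤ value y Fₚ
      root = DZ.∣-respʳ {(+ p) ^ℤ K} (solveᶻ 2 (λ a b → ⊝ (a ⊕ ⊝ b) ⊕ a ⊜ b) ≡.refl (fn (Θ K) (fn Ev F)) (value y Fₚ))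
        (DZ.∣-+ {(+ p) ^ℤ K} {ℤ.- (fn (Θ K) (fn Ev F) ℤ.- value y Fₚ)} (DZ.∣-neg {(+ p) ^ℤ K} {fn (Θ K) (fn Ev F) ℤ.- value y Fₚ} (Θ-Ev F)) (DZ.∣-respʳ {(+ p) ^ℤ K} (ℤP.+-identityʳ (fn (Θ K) (fn Ev F)))
          (M.trans {fn (Θ K) (fn Ev F)} {fn (Θ K) S.0#} {+ 0} (Hom.cong (Θ K) F-ŷ) (0-homo (Θ K)))))

    roots : ∀ K → ∃ λ y → ((+ p) ^ℤ K) ∣ℤ value y Fₚ
    roots K = Branch.y K , Branch.root K

    private
      open Branch N using (y; root; Θ-Ev; E)

      p∣y : (+ p) ∣ℤ y
      p∣y = ν ℤ.* E (ℕ.pred N) (coefₛ ℤR ŷ ∘ suc) , ≡.sym (≡.trans (≡.cong (λ z → z ℤ.+ (+ p ℤ.* ν) ℤ.* E (ℕ.pred N) (coefₛ ℤR ŷ ∘ suc)) ŷ-0)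
        (≡.trans (ℤP.+-identityˡ _) (ℤP.*-assoc (+ p) ν (E (ℕ.pred N) (coefₛ ℤR ŷ ∘ suc)))))
        where ν = proj₁ (νs N)

      p∣coef : ∀ {A} → (+ p) ∣ℤ value y A → (+ p) ∣ℤ coef ℤR A 0
      p∣coef {A} d = DZ.∣-respʳ {+ p} (≡.trans (≡.cong (λ z → z ℤ.- y ℤ.* value y (tail ℤR A)) (value-decompose y A))
        (solveᶻ 2 (λ a b → (a ⊕ b) ⊕ ⊝ b ⊜ a) ≡.refl (coef ℤR A 0) (y ℤ.* value y (tail ℤR A))))
        (DZ.∣-+ {+ p} {value y A} d (DZ.∣-neg {+ p} {y ℤ.* value y (tail ℤR A)} (DZ.∣-*ʳ {+ p} {y} (value y (tail ℤR A)) p∣y)))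

      p^N⇒p : ∀ {x} → ((+ p) ^ℤ N) ∣ℤ x → (+ p) ∣ℤ x
      p^N⇒p (r , e) = (+ p) ^ℤ ℕ.pred N ℤ.* r , ≡.trans (≡.sym (ℤP.*-assoc (+ p) _ r)) e

      -- Modulo p the linear coefficient of F(p, ·) is that of F(0, ·), namely μ.
      ¬p∣F₁ : ¬ (+ p) ∣ℤ coef ℤR Fₚ 1
      ¬p∣F₁ d = ¬p∣μ (DZ.∣-respʳ {+ p} (≡.trans (≡.cong (λ z → z ℤ.- + p ℤ.* t) (≡.trans (coef-mapₚ atp F 1) (value-decompose (+ p) (coef 𝔹 F 1))))
          (≡.trans (solveᶻ 2 (λ a b → (a ⊕ b) ⊕ ⊝ b ⊜ a) ≡.refl (coef ℤR (coef 𝔹 F 1) 0) (+ p ℤ.* t)) (≡.trans F-10 (ι-ℤ μ))))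
        (DZ.∣-+ {+ p} {coef ℤR Fₚ 1} d (DZ.∣-neg {+ p} {+ p ℤ.* t} (t , ≡.refl))))
        where t = value (+ p) (tail ℤR (coef 𝔹 F 1))

      coef-product-1 : ∀ A G H → coef ℤR ((A B.* G) B.* H) 1 ≡
        coef ℤR A 0 ℤ.* coef ℤR G 0 ℤ.* coef ℤR H 1 ℤ.+ (coef ℤR A 0 ℤ.* coef ℤR G 1 ℤ.+ coef ℤR (tail ℤR A) 0 ℤ.* coef ℤR G 0) ℤ.* coef ℤR H 0
      coef-product-1 A G H = ≡.trans (coef-*-suc ℤR (A B.* G) H 0) (≡.cong₂ ℤ._+_ (≡.cong (λ z → z ℤ.* coef ℤR H 1) (coef-*-0 ℤR A G))
        (≡.trans (coef-*-0 ℤR (tail ℤR (A B.* G)) H) (≡.cong (λ z → z ℤ.* coef ℤR H 0) (≡.trans (coef-tail ℤR (A B.* G) 0)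
          (≡.trans (coef-*-suc ℤR A G 0) (≡.cong (λ z → coef ℤR A 0 ℤ.* coef ℤR G 1 ℤ.+ z) (coef-*-0 ℤR (tail ℤR A) G)))))))

      not-both : ∀ {A G H} → Fₚ B.≈ (A B.* G) B.* H → (+ p) ∣ℤ value y A → (+ p) ∣ℤ value y G → ⊥
      not-both {A} {G} {H} e hA hG = ¬p∣F₁ (DZ.∣-respʳ {+ p} (≡.sym (≡.trans (coef-cong ℤR e 1) (coef-product-1 A G H)))
        (DZ.∣-+ {+ p} {coef ℤR A 0 ℤ.* coef ℤR G 0 ℤ.* coef ℤR H 1} (DZ.∣-*ʳ {+ p} {coef ℤR A 0 ℤ.* coef ℤR G 0} (coef ℤR H 1) (DZ.∣-*ʳ {+ p} {coef ℤR A 0} (coef ℤR G 0) A₀))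
          (DZ.∣-*ʳ {+ p} {coef ℤR A 0 ℤ.* coef ℤR G 1 ℤ.+ coef ℤR (tail ℤR A) 0 ℤ.* coef ℤR G 0} (coef ℤR H 0)
            (DZ.∣-+ {+ p} {coef ℤR A 0 ℤ.* coef ℤR G 1} (DZ.∣-*ʳ {+ p} {coef ℤR A 0} (coef ℤR G 1) A₀) (DZ.∣-*ˡ {+ p} {coef ℤR G 0} (coef ℤR (tail ℤR A) 0) G₀)))))
        where
        A₀ = p∣coef {A} hA
        G₀ = p∣coef {G} hG

      -- The root y is simple modulo p, so a power of p divides only one of two factors there.
      simple : ∀ {A G H} → Fₚ B.≈ (A B.* G) B.* H → ((+ p) ^ℤ N) ∣ℤ (value y A ℤ.* value y G) → ((+ p) ^ℤ N) ∣ℤ value y A ⊎ ((+ p) ^ℤ N) ∣ℤ value y G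
      simple {A} {G} {H} e d = go (p ℕ∣.∣? ℤ.∣ value y A ∣) (p ℕ∣.∣? ℤ.∣ value y G ∣)
        where
        go : Dec (p ℕ∣.∣ ℤ.∣ value y A ∣) → Dec (p ℕ∣.∣ ℤ.∣ value y G ∣) → ((+ p) ^ℤ N) ∣ℤ value y A ⊎ ((+ p) ^ℤ N) ∣ℤ value y G
        go (no nA) _ = inj₂ (coprime-power {p} {value y A} prime (λ h → nA (∣⇒∣ᵤ {+ p} {value y A} h)) N (value y G) d)
        go (yes _) (no nG) = inj₁ (coprime-power {p} {value y G} prime (λ h → nG (∣⇒∣ᵤ {+ p} {value y G} h)) N (value y A)
          (DZ.∣-respʳ {(+ p) ^ℤ N} (ℤP.*-comm (value y A) (value y G)) d))
        go (yes hA) (yes hG) = ⊥-elim (not-both {A} {G} {H} e (∣ᵤ⇒∣ {+ p} {value y A} hA) (∣ᵤ⇒∣ {+ p} {value y G} hG))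

      -- By `simple` the power pᴺ dividing the value at y is never shared, so it falls entirely to
      -- the unit A or to one prime factor. The recursion merges the primes into A one by one and
      -- then undoes the products.
      locate : ∀ ps A → Fₚ B.≈ A B.* DB.prod ps → All DB.Prime ps → ((+ p) ^ℤ N) ∣ℤ value y A ⊎
        (∃ λ π → ∃ λ G → DB.Prime π × Fₚ B.≈ π B.* G × ((+ p) ^ℤ N) ∣ℤ value y π)
      locate [] A e [] = inj₁ (DZ.∣-respʳ {(+ p) ^ℤ N} (Hom.cong (eval idℤ y) (B.trans e (B.*-identityʳ A))) root)
      locate (π ∷ ps) A e (pπ ∷ pps) = first (locate ps (A B.* π) (B.trans e (B.sym (B.*-assoc A π (DB.prod ps)))) pps)
        where
        Located : Set
        Located = ((+ p) ^ℤ N) ∣ℤ value y A ⊎ (∃ λ π → ∃ λ G → DB.Prime π × Fₚ B.≈ π B.* G × ((+ p) ^ℤ N) ∣ℤ value y π)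
        second : ((+ p) ^ℤ N) ∣ℤ value y A ⊎ ((+ p) ^ℤ N) ∣ℤ value y π → Located
        second (inj₁ dA) = inj₁ dA
        second (inj₂ dπ) = inj₂ (π , A B.* DB.prod ps , pπ , B.trans e (B.trans (B.sym (B.*-assoc A π (DB.prod ps))) (B.trans (B.*-congʳ (B.*-comm A π)) (B.*-assoc π A (DB.prod ps)))) , dπ)
        first : ((+ p) ^ℤ N) ∣ℤ value y (A B.* π) ⊎ (∃ λ π → ∃ λ G → DB.Prime π × Fₚ B.≈ π B.* G × ((+ p) ^ℤ N) ∣ℤ value y π) → Located
        first (inj₂ r) = inj₂ r
        first (inj₁ d) = second (simple {A} {π} {DB.prod ps} (B.trans e (B.sym (B.*-assoc A π (DB.prod ps)))) (DZ.∣-respʳ {(+ p) ^ℤ N} (*-homo (eval idℤ y) A π) d))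

      value-Fₚ : ∀ j → value (+ suc j) Fₚ ≡ value (+ p) (fibre j)
      value-Fₚ j = Zm-hom-ext ℤR 2 (eval idℤ (+ suc j) ∘ₕ mapₚ atp) (atp ∘ₕ eval (idₕ {𝔹}) (const ℤR (+ suc j))) (λ
        { zero → ≡.trans (Hom.cong (eval idℤ (+ suc j)) (mapₚ-X atp)) (≡.trans (eval-X idℤ _) (≡.sym (≡.trans (Hom.cong atp (eval-X (idₕ {𝔹}) _)) (eval-const idℤ (+ p) _))))
        ; (suc zero) → ≡.trans (Hom.cong (eval idℤ (+ suc j)) (mapₚ-const atp _)) (≡.trans (eval-const idℤ _ _) (≡.sym (Hom.cong atp (eval-const (idₕ {𝔹}) _ _)))) }) F

      1≤p : 1 ℕ.≤ p
      1≤p = ℕ.>-nonZero⁻¹ p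

      -- The values of π at the interpolation points divide those of F(p, ·), which are bounded by a
      -- constant times pᵂ. Hence the coefficients of π stay below pᵂ⁺¹, and π is a digit polynomial
      -- that vanishes on the branch; `small-vanishing` makes it 0.
      no-small-factor : ∀ {π G} → Fₚ B.≈ π B.* G → deg< ℤR n π → ((+ p) ^ℤ N) ∣ℤ value y π → ⊥
      no-small-factor {π} {G} e d vanish = Top⇒≉0 ℤ-domain f[V]≢0 Fₚ-top (B.trans e (B.trans (B.*-congʳ π≈0) (B.zeroˡ G)))
        where
        values : ∀ j → j ℕ.< N₀ → ℤ.∣ value (+ suc j) π ∣ ℕ.≤ sumBelow N₀ fibre-norm ℕ.* p ℕ.^ W
        values j j<N₀ = ℕP.≤-trans (ℕP.m≤m*n ℤ.∣ value (+ suc j) π ∣ ℤ.∣ value (+ suc j) G ∣ ⦃ ℕ.≢-nonZero (λ z → nonzero (≡.trans product (≡.trans (≡.cong (λ z → value (+ suc j) π ℤ.* z) (ℤP.∣i∣≡0⇒i≡0 z)) (ℤP.*-zeroʳ (value (+ suc j) π))))) ⦄)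
          (ℕP.≤-trans (ℕP.≤-reflexive (≡.trans (≡.sym (ℤP.abs-* (value (+ suc j) π) (value (+ suc j) G))) (≡.cong ℤ.∣_∣ (≡.trans (≡.sym product) (value-Fₚ j)))))
          (ℕP.≤-trans (value-bound W (fibre j) p 1≤p (width-fibre j)) (ℕP.*-monoˡ-≤ (p ℕ.^ W) (≤sumBelow N₀ fibre-norm j j<N₀))))
          where
          product : value (+ suc j) Fₚ ≡ value (+ suc j) π ℤ.* value (+ suc j) G
          product = ≡.trans (Hom.cong (eval idℤ (+ suc j)) e) (*-homo (eval idℤ (+ suc j)) π G)
          nonzero : value (+ suc j) Fₚ ≢ + 0
          nonzero z = proj₂ (nonzero-large (fibre j) (fibre≉0 j)) p (ℕP.≤-<-trans (≤sumBelow N₀ fibre-threshold j j<N₀) t₂<p) (≡.trans (≡.sym (value-Fₚ j)) z)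
        coefficients-small : ∀ j → ℤ.∣ coef ℤR π (Fin.toℕ {n} j) ∣ ℕ.< p ℕ.^ suc W
        coefficients-small j = ℕP.≤-<-trans (interpolation-bound (sumBelow N₀ fibre-norm ℕ.* p ℕ.^ W) d values j) (ℕP.≤-<-trans (ℕP.≤-reflexive (≡.sym (ℕP.*-assoc (sumℕ (λ j → norm (Dual.l (proj₁ dual₀) j))) (sumBelow N₀ fibre-norm) (p ℕ.^ W))))
          (ℕP.*-monoˡ-< (p ℕ.^ W) ⦃ ℕP.m^n≢0 p W ⦄ t₃<p))
        dg = digit-polynomial p n (suc W) π d coefficients-small
        g = proj₁ dg
        π≈0 : π B.≈ B.0#
        π≈0 = B.trans (B.sym (proj₂ (proj₂ dg))) (small-vanishing prime t₁<p (proj₁ (νs N)) (proj₂ (νs N)) g (proj₁ (proj₂ dg))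
          (DZ.∣-respʳ {(+ p) ^ℤ N} (solveᶻ 2 (λ a b → (a ⊕ ⊝ b) ⊕ b ⊜ a) ≡.refl _ (value y (fn (mapₚ atp) (polynomial ℤR n (suc W) g))))
            (DZ.∣-+ {(+ p) ^ℤ N} (Θ-Ev (polynomial ℤR n (suc W) g)) (DZ.∣-respʳ {(+ p) ^ℤ N} (Hom.cong (eval idℤ y) (B.sym (proj₂ (proj₂ dg)))) vanish))))

    -- The prime factor π that takes over the root has degree at least n. It divides A·G but neither
    -- factor, as both are nonzero of smaller degree. The unit cannot take over the root, since its
    -- value at y divides 1.
    Fₚ-irreducible : NoFactor ℤ-domain n Fₚ
    Fₚ-irreducible H A G e dA dG A≉0 G≉0 = Pol-factorisations ℤ-domain ℤ-factorisations Fₚ (Top⇒≉0 ℤ-domain f[V]≢0 Fₚ-top) λ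
      { (u , ps , (v , uv) , pps , e′) → conclude (locate ps u e′ pps) v uv }
      where
      conclude : ∀ {u} → ((+ p) ^ℤ N) ∣ℤ value y u ⊎ (∃ λ π → ∃ λ G → DB.Prime π × Fₚ B.≈ π B.* G × ((+ p) ^ℤ N) ∣ℤ value y π) → ∀ v → u B.* v B.≈ B.1# → ⊥
      conclude {u} (inj₁ d) v uv = Divisibility.nonunit (ℤ-prime prime) (DZ.∣-respʳ {+ p} (≡.trans (≡.sym (*-homo h u v)) (≡.trans (Hom.cong h uv) (1-homo h))) (DZ.∣-*ʳ {+ p} (value y v) (p^N⇒p d)))
        where h = eval idℤ y
      conclude (inj₂ (π , G′ , pπ , eπ , d)) v uv = degree (Top-factor ℤ-domain f[V]≢0 (Top-cong ℤR ≡.refl eπ Fₚ-top))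
        where
        degree : (∃ λ k₁ → ∃ λ l₁ → k₁ ℕ.+ l₁ ≡ n × (coef ℤR π k₁ ≢ + 0 × Top ℤR k₁ (coef ℤR π k₁) π) × (coef ℤR G′ l₁ ≢ + 0 × Top ℤR l₁ (coef ℤR G′ l₁) G′)) → ⊥
        degree (k₁ , l₁ , k+l , (nπ , tπ) , _) with k₁ ℕP.<? n
        ... | yes k<n = no-small-factor {π} {G′} eπ (Top-deg< ℤR tπ k<n) d
        ... | no k≮n = DB.split pπ {A} {G} (G′ B.* H , B.trans (B.sym (B.*-assoc π G′ H)) (B.trans (B.*-congʳ (B.sym eπ)) e)) (small-not-multiple ℤ-domain nπ tπ (ℕP.≮⇒≥ k≮n) dA A≉0) (small-not-multiple ℤ-domain nπ tπ (ℕP.≮⇒≥ k≮n) dG G≉0)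

-- The number field ℚ[s]/(F)

ℚ-clear : ∀ q → ∃ λ N → ∃ λ c → N ≢ + 0 × fn (ι ℚR) N ℚ.* q ≡ fn (ι ℚR) c
ℚ-clear q = ℚ.↧ q , ℚ.↥ q , (λ ()) , ≡.trans (≡.cong (λ z → z ℚ.* q) (ι-ℚ (ℚ.↧ q))) (≡.trans (ℚP.toℚᵘ-injective (ℚᵘP.≃-trans (ℚP.toℚᵘ-homo-* (ℚ.↧ q ℚ./ 1) q)
  (ℚᵘP.≃-trans (ℚᵘP.*-congʳ {ℚ.toℚᵘ q} (ℚP.toℚᵘ-fromℚᵘ (mkℚᵘ (ℚ.↧ q) 0))) (ℚᵘP.≃-trans (cross q) (ℚᵘP.≃-sym (ℚP.toℚᵘ-fromℚᵘ (mkℚᵘ (ℚ.↥ q) 0))))))) (≡.sym (ι-ℚ (ℚ.↥ q))))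
  where
  cross : ∀ q → mkℚᵘ (ℚ.↧ q) 0 ℚᵘ.* ℚ.toℚᵘ q ℚᵘ.≃ mkℚᵘ (ℚ.↥ q) 0
  cross (ℚ.mkℚ num den-1 _) = ℚᵘ.*≡* (≡.trans (ℤP.*-identityʳ _) (≡.trans (ℤP.*-comm (+ suc den-1) num) (≡.cong (λ z → num ℤ.* z) (≡.cong +_ (≡.sym (≡.cong suc (ℕP.+-identityʳ den-1)))))))

private
  ιℚ : Hom ℤR ℚR
  ιℚ = ι ℚR
  module ℚᴿ = CRing ℚR
  module PQ = CRing (Pol ℚR)
  module PZ = CRing (Pol ℤR)

j-nonzero : ∀ {N} → N ≢ + 0 → fn ιℚ N ≢ ℚ.0ℚ
j-nonzero nz e = nz (ι-ℚ-injective e)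

j-injective : ∀ {N M} → fn ιℚ N ≡ fn ιℚ M → N ≡ M
j-injective {N} {M} e = x-y≈0⇒x≈y ℤR N M (ι-ℚ-injective (≡.trans (+-homo ιℚ N (ℤ.- M)) (≡.trans (≡.cong₂ ℚ._+_ e (-‿homo ιℚ M)) (ℚᴿ.-‿inverseʳ (fn ιℚ M)))))

Polℚ-clear : ∀ a → ∃ λ N → ∃ λ A → N ≢ + 0 × const ℚR (fn ιℚ N) PQ.* a PQ.≈ fn (mapₚ ιℚ) A
Polℚ-clear = Pol-ind ℚR _
  (λ e (N , A , nz , p) → N , A , nz , PQ.trans (PQ.*-congˡ (PQ.sym e)) p)
  (+ 1 , PZ.0# , (λ ()) , PQ.trans (PQ.zeroʳ _) (PQ.sym (0-homo (mapₚ ιℚ))))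
  λ r a (N , A , nz , p) → clear r a N A nz p (ℚ-clear r)
  where
  clear : ∀ r a N A → N ≢ + 0 → const ℚR (fn ιℚ N) PQ.* a PQ.≈ fn (mapₚ ιℚ) A → (∃ λ M → ∃ λ c → M ≢ + 0 × fn ιℚ M ℚ.* r ≡ fn ιℚ c) →
    ∃ λ N → ∃ λ A → N ≢ + 0 × const ℚR (fn ιℚ N) PQ.* (const ℚR r PQ.+ X ℚR PQ.* a) PQ.≈ fn (mapₚ ιℚ) A
  clear r a N A nz p (M , c , nzM , q) = M ℤ.* N , const ℤR (N ℤ.* c) PZ.+ X ℤR PZ.* (const ℤR M PZ.* A) , Domain.*-nonzero ℤ-domain {M} {N} nzM nz , (begin
    const ℚR (fn ιℚ (M ℤ.* N)) PQ.* (const ℚR r PQ.+ X ℚR PQ.* a)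
      ≈⟨ PQ.*-congʳ (PQ.trans (Hom.cong (constₕ ℚR) (*-homo ιℚ M N)) (*-homo (constₕ ℚR) _ _)) ⟩
    (const ℚR (fn ιℚ M) PQ.* const ℚR (fn ιℚ N)) PQ.* (const ℚR r PQ.+ X ℚR PQ.* a)
      ≈⟨ solve 5 (λ M N r x a → (M :* N) :* (r :+ x :* a) := N :* (M :* r) :+ x :* (M :* (N :* a))) PQ.refl (const ℚR (fn ιℚ M)) (const ℚR (fn ιℚ N)) (const ℚR r) (X ℚR) a ⟩
    const ℚR (fn ιℚ N) PQ.* (const ℚR (fn ιℚ M) PQ.* const ℚR r) PQ.+ X ℚR PQ.* (const ℚR (fn ιℚ M) PQ.* (const ℚR (fn ιℚ N) PQ.* a))
      ≈⟨ PQ.+-cong (PQ.trans (PQ.*-congˡ (PQ.trans (PQ.sym (*-homo (constₕ ℚR) _ _)) (Hom.cong (constₕ ℚR) q))) (PQ.trans (PQ.sym (*-homo (constₕ ℚR) _ _)) (PQ.trans (Hom.cong (constₕ ℚR) (≡.sym (*-homo ιℚ N c))) (PQ.sym (mapₚ-const ιℚ _)))))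
           (PQ.*-cong (PQ.sym (mapₚ-X ιℚ)) (PQ.trans (PQ.*-cong (PQ.sym (mapₚ-const ιℚ M)) p) (PQ.sym (*-homo (mapₚ ιℚ) _ _)))) ⟩
    fn (mapₚ ιℚ) (const ℤR (N ℤ.* c)) PQ.+ fn (mapₚ ιℚ) (X ℤR) PQ.* fn (mapₚ ιℚ) (const ℤR M PZ.* A)
      ≈⟨ PQ.trans (+-homo (mapₚ ιℚ) _ _) (PQ.+-congˡ (*-homo (mapₚ ιℚ) _ _)) ⟨
    fn (mapₚ ιℚ) (const ℤR (N ℤ.* c) PZ.+ X ℤR PZ.* (const ℤR M PZ.* A)) ∎)
    where
    open SetoidReasoning PQ.setoid
    open Solver (Pol ℚR) using (solve; _:+_; _:*_; _:=_)

module Field {n : ℕ} (1≤n : 1 ℕ.≤ n) {c : ℤ} (c≢0 : c ≢ + 0) {F : ∣ Pol ℤR ∣} (top : Top ℤR n c F) (irreducible : NoFactor ℤ-domain n F) where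
  open Divisibility (Pol ℚR) using (_∣_; ∣-respʳ; ∣-+; ∣-neg; ∣-*ʳ; ∣-*ˡ)
  private
    module D = Domain (Pol-domain ℚ-domain)
    open Solver (Pol ℚR) using (solve; _:+_; _:*_; :-_; _:=_)

  Fq : ∣ Pol ℚR ∣
  Fq = fn (mapₚ ιℚ) F

  Fq-top : Top ℚR n (fn ιℚ c) Fq
  Fq-top = Top-mapₚ ιℚ top

  L : Ring
  L = Quotient (Pol ℚR) (principal (Pol ℚR) Fq)

  reduction : Hom (Pol ℚR) L
  reduction = toQuotient (Pol ℚR) (principal (Pol ℚR) Fq)

  private
    module L = CRing L

  small-multiple : ∀ {a} → deg< ℚR n a → Fq ∣ a → a PQ.≈ PQ.0#
  small-multiple {a} d Fq∣a with Domain.zero? (Pol-domain ℚ-domain) a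
  ... | yes z = z
  ... | no nz = ⊥-elim (small-not-multiple ℚ-domain (j-nonzero c≢0) Fq-top ℕP.≤-refl d nz Fq∣a)

  reduce : ∀ u → ∃ λ r → deg< ℚR n r × Fq ∣ (u PQ.- r)
  reduce u with pseudoDivide ℚR Fq-top (bound ℚR u) u (deg<-bound ℚR u)
  ... | N , q , r , e , d with ℚ-inverse _ (Domain.^-nonzero ℚ-domain N (j-nonzero c≢0))
  ... | v , cv = const ℚR v PQ.* r , deg<-const* ℚR v d , const ℚR v PQ.* q , (begin
    Fq PQ.* (const ℚR v PQ.* q) ≈⟨ solve 4 (λ F v q r → F :* (v :* q) := v :* (q :* F :+ r) :+ :- (v :* r)) PQ.refl Fq (const ℚR v) q r ⟩
    const ℚR v PQ.* (q PQ.* Fq PQ.+ r) PQ.- const ℚR v PQ.* r ≈⟨ PQ.+-congʳ (PQ.*-congˡ e) ⟨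
    const ℚR v PQ.* (const ℚR cN PQ.* u) PQ.- const ℚR v PQ.* r
      ≈⟨ PQ.+-congʳ (PQ.trans (PQ.sym (PQ.*-assoc _ _ _)) (PQ.trans (PQ.*-congʳ (PQ.trans (PQ.sym (*-homo (constₕ ℚR) v cN)) (PQ.trans (Hom.cong (constₕ ℚR) (≡.trans (ℚP.*-comm v cN) cv)) (1-homo (constₕ ℚR))))) (PQ.*-identityˡ u))) ⟩
    u PQ.- const ℚR v PQ.* r ∎)
    where
    open SetoidReasoning PQ.setoid
    cN = SemiringExp._^_ ℚᴿ.semiring (fn ιℚ c) N

  1≉0 : ¬ L.1# L.≈ L.0#
  1≉0 d = D.1≉0 (small-multiple (deg<-cong ℚR (1-homo (constₕ ℚR)) (deg<-const ℚR ℚ.1ℚ 1≤n)) (∣-respʳ (PQ.trans (PQ.+-congˡ (RingProps.-0#≈0# PQ.ring)) (PQ.+-identityʳ _)) d))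

  ≉0-small : ∀ {r} → deg< ℚR n r → ¬ r PQ.≈ PQ.0# → ¬ r L.≈ L.0#
  ≉0-small d nz e = nz (small-multiple d (∣-respʳ (PQ.trans (PQ.+-congˡ (RingProps.-0#≈0# PQ.ring)) (PQ.+-identityʳ _)) e))

  private
    -- Denominators are cleared, `bezout` over ℤ expresses a nonzero integer r₀ through F and the
    -- given residue, and r₀ is inverted in ℚ.
    inverse-small : ∀ r → deg< ℚR n r → ¬ r PQ.≈ PQ.0# → ∃ λ v → r L.* v L.≈ L.1#
    inverse-small r d r≉0 with Polℚ-clear r
    ... | N , A , nz , e with bezout ℤ-domain c≢0 top irreducible A A-deg A≉0
      where
      A-coef : ∀ i → fn ιℚ N ℚ.* coef ℚR r i ≡ fn ιℚ (coef ℤR A i)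
      A-coef i = ≡.trans (≡.sym (coef-const* ℚR (fn ιℚ N) r i)) (≡.trans (coef-cong ℚR e i) (coef-mapₚ ιℚ A i))
      A-deg : deg< ℤR n A
      A-deg i n≤i = ι-ℚ-injective (≡.trans (≡.sym (A-coef i)) (≡.trans (≡.cong (λ z → fn ιℚ N ℚ.* z) (d i n≤i)) (ℚP.*-zeroʳ (fn ιℚ N))))
      A≉0 : ¬ A PZ.≈ PZ.0#
      A≉0 z = D.*-nonzero {const ℚR (fn ιℚ N)} {r} (const≉0 ℚ-domain (j-nonzero nz)) r≉0 (PQ.trans e (PQ.trans (Hom.cong (mapₚ ιℚ) z) (0-homo (mapₚ ιℚ))))
    ... | a , b , r₀ , r₀≢0 , be with ℚ-inverse (fn ιℚ r₀) (j-nonzero r₀≢0)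
    ... | v , r₀v = const ℚR v PQ.* (const ℚR (fn ιℚ N) PQ.* fn (mapₚ ιℚ) b) , PQ.- (const ℚR v PQ.* fn (mapₚ ιℚ) a) , (begin
      Fq PQ.* PQ.- (const ℚR v PQ.* a′) ≈⟨ solve 6 (λ F v a b N r → F :* :- (v :* a) := r :* (v :* (N :* b)) :+ :- (v :* (a :* F :+ b :* (N :* r)))) PQ.refl Fq (const ℚR v) a′ b′ (const ℚR (fn ιℚ N)) r ⟩
      r PQ.* (const ℚR v PQ.* (const ℚR (fn ιℚ N) PQ.* b′)) PQ.- const ℚR v PQ.* (a′ PQ.* Fq PQ.+ b′ PQ.* (const ℚR (fn ιℚ N) PQ.* r))
        ≈⟨ PQ.+-congˡ (PQ.-‿cong (PQ.trans (PQ.*-congˡ be′) (PQ.trans (PQ.sym (*-homo (constₕ ℚR) v _)) (PQ.trans (Hom.cong (constₕ ℚR) (≡.trans (ℚP.*-comm v _) r₀v)) (1-homo (constₕ ℚR)))))) ⟩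
      r PQ.* (const ℚR v PQ.* (const ℚR (fn ιℚ N) PQ.* b′)) PQ.- PQ.1# ∎)
      where
      open SetoidReasoning PQ.setoid
      a′ = fn (mapₚ ιℚ) a
      b′ = fn (mapₚ ιℚ) b
      be′ : a′ PQ.* Fq PQ.+ b′ PQ.* (const ℚR (fn ιℚ N) PQ.* r) PQ.≈ const ℚR (fn ιℚ r₀)
      be′ = PQ.trans (PQ.+-congˡ (PQ.*-congˡ e)) (PQ.trans (PQ.sym (PQ.trans (+-homo (mapₚ ιℚ) _ _) (PQ.+-cong (*-homo (mapₚ ιℚ) _ _) (*-homo (mapₚ ιℚ) _ _))))
        (PQ.trans (Hom.cong (mapₚ ιℚ) (PZ.sym be)) (mapₚ-const ιℚ r₀)))

  zero-or-invertible : ∀ u → u L.≈ L.0# ⊎ (∃ λ v → u L.* v L.≈ L.1#)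
  zero-or-invertible u = by-remainder (reduce u)
    where
    by-remainder : (∃ λ r → deg< ℚR n r × Fq ∣ (u PQ.- r)) → u L.≈ L.0# ⊎ (∃ λ v → u L.* v L.≈ L.1#)
    by-remainder (r , d , u~r) = by-zero (Domain.zero? (Pol-domain ℚ-domain) r)
      where
      invert : (∃ λ v → r L.* v L.≈ L.1#) → ∃ λ v → u L.* v L.≈ L.1#
      invert (v , rv) = v , L.trans {u L.* v} {r L.* v} {L.1#} (L.*-congʳ {v} {u} {r} u~r) rv
      by-zero : Dec (r PQ.≈ PQ.0#) → u L.≈ L.0# ⊎ (∃ λ v → u L.* v L.≈ L.1#)
      by-zero (yes z) = inj₁ (L.trans {u} {r} {L.0#} u~r (Hom.cong reduction z))
      by-zero (no nz) = inj₂ (invert (inverse-small r d nz))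

  private
    contra : ∀ {u v} → u L.≈ L.0# → u L.* v L.≈ L.1# → ⊥
    contra {u} {v} z e = 1≉0 (L.trans {L.1#} {u L.* v} {L.0#} (L.sym {u L.* v} {L.1#} e) (L.trans {u L.* v} {L.0# L.* v} {L.0#} (L.*-congʳ {v} {u} {L.0#} z) (L.zeroˡ v)))

  L-domain : Domain L
  L-domain = record
    { 1≉0 = 1≉0
    ; nzd = λ {a} {b} e → nzd a b e (zero-or-invertible a)
    ; zero? = λ u → dec u (zero-or-invertible u) }
    where
    dec : ∀ u → u L.≈ L.0# ⊎ (∃ λ v → u L.* v L.≈ L.1#) → Dec (u L.≈ L.0#)
    dec u (inj₁ z) = yes z
    dec u (inj₂ (v , e)) = no λ z → contra {u} {v} z e
    nzd : ∀ a b → a L.* b L.≈ L.0# → a L.≈ L.0# ⊎ (∃ λ v → a L.* v L.≈ L.1#) → a L.≈ L.0# ⊎ b L.≈ L.0#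
    nzd a b e (inj₁ z) = inj₁ z
    nzd a b e (inj₂ (v , av)) = inj₂ (begin
      b ≈⟨ L.*-identityˡ b ⟨
      L.1# L.* b ≈⟨ L.*-congʳ {b} {a L.* v} {L.1#} av ⟨
      (a L.* v) L.* b ≈⟨ Hom.cong reduction (solve 3 (λ a v b → (a :* v) :* b := v :* (a :* b)) PQ.refl a v b) ⟩
      v L.* (a L.* b) ≈⟨ L.*-congˡ {v} {a L.* b} {L.0#} e ⟩
      v L.* L.0# ≈⟨ L.zeroʳ v ⟩
      L.0# ∎)
      where open SetoidReasoning L.setoid

  ≈-dec : ∀ x y → Dec (x L.≈ y)
  ≈-dec x y = by-difference (Domain.zero? L-domain (x L.- y))
    where
    by-difference : Dec (x L.- y L.≈ L.0#) → Dec (x L.≈ y)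
    by-difference (yes z) = yes (x-y≈0⇒x≈y L x y z)
    by-difference (no nz) = no λ e → nz (L.trans {x L.- y} {y L.- y} {L.0#} (L.+-congʳ {L.- y} {x} {y} e) (L.-‿inverseʳ y))

  heytingField : HeytingField 0ℓ 0ℓ 0ℓ
  heytingField = record
    { Carrier = ∣ L ∣ ; _≈_ = L._≈_ ; _#_ = λ x y → ¬ x L.≈ y ; _+_ = L._+_ ; _*_ = L._*_ ; -_ = L.-_ ; 0# = L.0# ; 1# = L.1#
    ; isHeytingField = record
      { isHeytingCommutativeRing = record
        { isCommutativeRing = L.isCommutativeRing
        ; isApartnessRelation = record
          { irrefl = λ {x} {y} e ne → ne e
          ; sym = λ {x} {y} ne e → ne (L.sym {y} {x} e)
          ; cotrans = λ {x} {y} ne z → cotrans x y z ne (≈-dec x z) }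
        ; #⇒invertible = λ {x} {y} ne → invertible x y ne (zero-or-invertible (x L.- y))
        ; invertible⇒# = λ {x} {y} (v , _ , e) x≈y → contra {x L.- y} {v} (L.trans {x L.- y} {y L.- y} {L.0#} (L.+-congʳ {L.- y} {x} {y} x≈y) (L.-‿inverseʳ y)) e }
      ; tight = λ x y → (λ nne → stable x y nne (≈-dec x y)) , (λ e ne → ne e) } }
    where
    cotrans : ∀ x y z → ¬ x L.≈ y → Dec (x L.≈ z) → ¬ x L.≈ z ⊎ ¬ z L.≈ y
    cotrans x y z ne (yes e) = inj₂ λ e′ → ne (L.trans {x} {z} {y} e e′)
    cotrans x y z ne (no ne′) = inj₁ ne′
    invertible : ∀ x y → ¬ x L.≈ y → x L.- y L.≈ L.0# ⊎ (∃ λ v → (x L.- y) L.* v L.≈ L.1#) → ∃ λ v → v L.* (x L.- y) L.≈ L.1# × (x L.- y) L.* v L.≈ L.1#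
    invertible x y ne (inj₁ z) = ⊥-elim (ne (x-y≈0⇒x≈y L x y z))
    invertible x y ne (inj₂ (v , e)) = v , L.trans {v L.* (x L.- y)} {(x L.- y) L.* v} {L.1#} (L.*-comm v (x L.- y)) e , e
    stable : ∀ x y → ¬ ¬ x L.≈ y → Dec (x L.≈ y) → x L.≈ y
    stable x y nne (yes e) = e
    stable x y nne (no ne) = ⊥-elim (nne ne)

  open Sums (Pol ℚR) using (sum)
  open SemiringExp PQ.semiring using (_^_)

  powers : Fin n → ∣ L ∣
  powers i = X ℚR ^ Fin.toℕ i

  sum-powers : ∀ {n} (b : Fin n → ℚ) → sum (λ i → const ℚR (b i) PQ.* X ℚR ^ Fin.toℕ i) PQ.≈ build ℚR b
  sum-powers {zero} b = PQ.refl
  sum-powers {suc n} b = PQ.+-cong (PQ.*-identityʳ _) (PQ.trans (Sums.sum-cong (Pol ℚR) (λ i → const ℚR (b (suc i)) PQ.* (X ℚR PQ.* X ℚR ^ Fin.toℕ i)) (λ i → X ℚR PQ.* (const ℚR (b (suc i)) PQ.* X ℚR ^ Fin.toℕ i))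
      (λ i → solve 3 (λ b x p → b :* (x :* p) := x :* (b :* p)) PQ.refl (const ℚR (b (suc i))) (X ℚR) (X ℚR ^ Fin.toℕ i)))
    (PQ.trans (PQ.sym (Sums.sum-*ˡ (Pol ℚR) (X ℚR) (λ i → const ℚR (b (suc i)) PQ.* X ℚR ^ Fin.toℕ i))) (PQ.*-congˡ (sum-powers (b ∘ suc)))))

  numberField : NumberField
  numberField = record
    { heytingField = heytingField
    ; ι = const ℚR
    ; ι-isRingHomomorphism = record
      { isSemiringHomomorphism = record
        { isNearSemiringHomomorphism = record
          { +-isMonoidHomomorphism = record
            { isMagmaHomomorphism = record
              { isRelHomomorphism = record { cong = λ { {x} ≡.refl → L.refl {const ℚR x} } }
              ; homo = λ x y → q (+-homo (constₕ ℚR) x y) }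
            ; ε-homo = q (0-homo (constₕ ℚR)) }
          ; *-homo = λ x y → q (*-homo (constₕ ℚR) x y) }
        ; 1#-homo = q (1-homo (constₕ ℚR)) }
      ; -‿homo = λ x → q (-‿homo (constₕ ℚR) x) }
    ; degree = n
    ; basis = powers
    ; isBasis = λ x → let (r , d , e) = reduce x in (λ i → coef ℚR r (Fin.toℕ i)) ,
        L.trans {x} {r} {sum (λ i → const ℚR (coef ℚR r (Fin.toℕ i)) PQ.* powers i)} e (q (PQ.sym (PQ.trans (sum-powers (λ i → coef ℚR r (Fin.toℕ {n} i))) (build-coef ℚR n d)))) ,
        λ {b} e′ i → unique r d b (L.trans {r} {x} {build ℚR b} (L.sym {x} {r} e) (L.trans {x} {sum (λ i → const ℚR (b i) PQ.* powers i)} {build ℚR b} e′ (q (sum-powers b)))) i }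
    where
    q : ∀ {a b} → a PQ.≈ b → a L.≈ b
    q = Hom.cong reduction
    unique : ∀ r → deg< ℚR n r → (b : Fin n → ℚ) → r L.≈ build ℚR b → ∀ i → coef ℚR r (Fin.toℕ i) ≡ b i
    unique r d b e i = ≡.trans (coef-cong ℚR (x-y≈0⇒x≈y (Pol ℚR) _ _ (small-multiple (deg<-+ ℚR d (deg<-neg ℚR (build-deg ℚR b))) e)) (Fin.toℕ i)) (coef-build ℚR b i)

  θ : ∣ L ∣
  θ = X ℚR

  toL : Hom (Pol ℤR) L
  toL = reduction ∘ₕ mapₚ ιℚ

  toL-F : fn toL F L.≈ L.0#
  toL-F = PQ.1# , PQ.trans (PQ.*-identityʳ Fq) (PQ.sym (PQ.trans (PQ.+-congˡ (RingProps.-0#≈0# PQ.ring)) (PQ.+-identityʳ Fq)))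

  toL-nonzero : ∀ {A} → deg< ℤR n A → ¬ A PZ.≈ PZ.0# → ¬ fn toL A L.≈ L.0#
  toL-nonzero {A} d nz = ≉0-small (deg<-mapₚ ιℚ d) λ z → nz (ext ℤR λ i → ≡.trans (ι-ℚ-injective (≡.trans (≡.sym (coef-mapₚ ιℚ A i)) (≡.trans (coef-cong ℚR z i) (coef-0 ℚR i)))) (≡.sym (coef-0 ℤR i)))

  eval-L : ∀ {m} (g : Poly m) x → NumberField.eval numberField g x L.≈ evalP L g x
  eval-L [] x = L.refl {L.0#}
  eval-L ((b , α) ∷ g) x = L.+-cong {const ℚR (b ℚ./ 1) L.* M} {fn (ι L) b L.* M} {NumberField.eval numberField g x} {evalP L g x}
    (L.*-congʳ {M} {const ℚR (b ℚ./ 1)} {fn (ι L) b} (L.trans {const ℚR (b ℚ./ 1)} {fn reduction (const ℚR (fn ιℚ b))}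
      (Hom.cong reduction (Hom.cong (constₕ ℚR) (≡.sym (ι-ℚ b)))) (ι-homo (reduction ∘ₕ constₕ ℚR) b)))
    (eval-L g x)
    where M = monomial L α x

-- New points

suc≢0 : ∀ {k} → + suc k ≢ + 0
suc≢0 ()

module Fibration {m d : ℕ} (f : Poly m) (hom : Homogeneous d f) (P V : Fin m → ℤ) (f[P]≡0 : evalP ℤR f P ≡ + 0)
  (Q ω : ℤ) (a k n : ℕ) (2≤k : 2 ℕ.≤ k) (degrees : d ℕ.* (a ℕ.+ k) ≡ a ℕ.+ n) (ξ : Fin m → ℤ) where

  open Curves f hom P V f[P]≡0 Q ω a k n 2≤k degrees
  open Shape ℤR ξ
  private
    𝔹 = Pol ℤR
    module B = CRing 𝔹
    module PB = CRing (Pol 𝔹)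
  open SemiringExp B.semiring using (_^_)

  ηᵖ : ℤ → ∣ 𝔹 ∣
  ηᵖ p = fn (ι 𝔹) Q B.* (const ℤR p B.+ X ℤR) B.+ X ℤR ^ k

  pointᵖ : ℤ → ∣ 𝔹 ∣ → Fin m → ∣ 𝔹 ∣
  pointᵖ p φ i = fn (ι 𝔹) (Q ℤ.* ω) B.* y₁ φ i B.+ (X ℤR ^ a B.* ηᵖ p) B.* fn (ι 𝔹) (V i)

  record Fibre (p : ℤ) : Set where
    field
      φ h₁ F : ∣ 𝔹 ∣
      φ-0 : coef ℤR φ 0 ≡ + 0
      y₁-eq : evalP 𝔹 f (y₁ φ) B.≈ X ℤR ^ (2 ℕ.+ a) B.* h₁
      F-eq : X ℤR ^ a B.* F B.≈ evalP 𝔹 f (pointᵖ p φ)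
      F-top : Top ℤR n (evalP ℤR f V) F

  fibre : Curve ℤR ξ → ∀ p → Fibre p
  fibre C p = record
    { φ = φ ; h₁ = h₁ ; F = fn h F ; φ-0 = φ-0 ; y₁-eq = y₁-eq
    ; F-eq = B.trans (B.sym (B.trans (*-homo h _ F) (B.*-congʳ (h-s^ a)))) (B.trans (Hom.cong h F-eq) (B.trans (evalP-homo h f (point φ)) (evalP-cong 𝔹 f h-point)))
    ; F-top = Top-cong ℤR (≡.trans (ι-homo atp _) (ι-ℤ _)) B.refl (Top-mapₚ atp F-top) }
    where
    open Curve C
    atp : Hom 𝔹 ℤR
    atp = eval idℤ p
    h : Hom (Pol 𝔹) 𝔹
    h = mapₚ atp
    h-s^ : ∀ j → fn h (SemiringExp._^_ PB.semiring s j) B.≈ X ℤR ^ j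
    h-s^ j = B.trans (^-homo h s j) (SemiringExp.^-congˡ B.semiring j (mapₚ-X atp))
    h-lift : ∀ b → fn h (fn lift b) B.≈ b
    h-lift = Pol-hom-ext (h ∘ₕ lift) (idₕ {𝔹})
      (λ r → B.trans (Hom.cong h (mapₚ-const (constₕ ℤR) r)) (B.trans (mapₚ-const atp _) (Hom.cong (constₕ ℤR) (eval-const idℤ p r))))
      (B.trans (Hom.cong h (mapₚ-X (constₕ ℤR))) (mapₚ-X atp))
    h-T : fn h T B.≈ const ℤR p
    h-T = B.trans (mapₚ-const atp (X ℤR)) (Hom.cong (constₕ ℤR) (eval-X idℤ p))
    h-η : fn h η B.≈ ηᵖ p
    h-η = B.trans (+-homo h _ _) (B.+-cong (B.trans (*-homo h _ _) (B.*-cong (ι-homo h Q) (B.trans (+-homo h T s) (B.+-cong h-T (mapₚ-X atp))))) (h-s^ k))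
    h-point : ∀ i → fn h (point φ i) B.≈ pointᵖ p φ i
    h-point i = B.trans (+-homo h _ _) (B.+-cong (B.trans (*-homo h _ _) (B.*-cong (ι-homo h _) (h-lift (y₁ φ i))))
      (B.trans (*-homo h _ _) (B.*-cong (B.trans (*-homo h _ _) (B.*-cong (h-s^ a) h-η)) (ι-homo h (V i)))))

  module Points {p : ℤ} (fib : Fibre p) (2≤n : 2 ℕ.≤ n) (f[V]≢0 : evalP ℤR f V ≢ + 0) (l≢0 : l ≢ + 0) (Qω≢0 : Q ℤ.* ω ≢ + 0)
    (dualV : Dual ℤR (vectorsℤ P V ξ)) (dualV≢0 : Dual.Δ dualV ≢ + 0)
    (L : Ring) (dom : Domain L) (toL : Hom 𝔹 L) (toL-F : CRing._≈_ L (fn toL (Fibre.F fib)) (CRing.0# L))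
    (toL-nonzero : ∀ {A} → deg< ℤR n A → ¬ A B.≈ B.0# → ¬ CRing._≈_ L (fn toL A) (CRing.0# L)) where

    open Fibre fib
    private
      module L = CRing L
      module D = Domain dom
      module E = CRing (Pol L)
      iL : ℤ → ∣ L ∣
      iL = fn (ι L)

    θ : ∣ L ∣
    θ = fn toL (X ℤR)

    x : Fin m → ∣ L ∣
    x i = fn toL (pointᵖ p φ i)

    on-hypersurface : evalP L f x L.≈ L.0#
    on-hypersurface = L.trans (L.sym (evalP-homo toL f (pointᵖ p φ))) (L.trans (Hom.cong toL (B.sym F-eq)) (L.trans (*-homo toL _ F) (L.trans (L.*-congˡ toL-F) (L.zeroʳ _))))

    private
      ιL≉0 : ∀ {c} → c ≢ + 0 → ¬ iL c L.≈ L.0#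
      ιL≉0 {c} nz e = toL-nonzero (deg<-const ℤR c (ℕP.≤-trans (s≤s z≤n) 2≤n)) (const≉0 ℤ-domain nz)
        (L.trans (Hom.cong toL (B.sym (B.trans (ι-const ℤR c) (Hom.cong (constₕ ℤR) (ι-ℤ c))))) (L.trans (ι-homo toL c) e))

      θ≉0 : ¬ θ L.≈ L.0#
      θ≉0 = toL-nonzero (deg<-mono ℤR 2≤n (deg<-X ℤR)) λ z → suc≢0 (≡.trans (≡.sym (≡.trans (coef-cong ℤR (B.sym (B.*-identityʳ _)) 1) (≡.trans (coef-X*-suc ℤR B.1# 0)
        (≡.trans (coef-cong ℤR (B.sym (1-homo (constₕ ℤR))) 0) (coef-const-0 ℤR (+ 1)))))) (≡.trans (coef-cong ℤR z 1) (coef-0 ℤR 1)))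

    -- The tangent vector of the curve would lie in the kernel of df, making θ a double root of sᵃF.
    not-singular : ¬ (∀ i → evalP L (∂ i f) x L.≈ L.0#)
    not-singular singular = D.*-nonzero θᵃ≉0 F′[θ]≉0 (L.trans (L.sym (ε₀-line (X ℤR ^ a) F′)) (L.trans (Hom.cong (at0 L) reduced) ε₀-right))
      where
      open Sums (Pol L) using (sum-0)
      h : Hom ℤR (Pol L)
      h = ι (Pol L)
      c : ∣ L ∣ → ∣ Pol L ∣
      c = const L
      ε = X L
      -- Substitution of s = θ + ε. In `F-eq` the left side becomes θᵃF′(θ)ε modulo ε², and the
      -- right side 0 if all partial derivatives vanish at x.
      e : Hom 𝔹 (Pol L)
      e = eval h (c θ E.+ ε)
      e₀-toL : ∀ b → fn (eval h (c θ)) b E.≈ c (fn toL b)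
      e₀-toL = Pol-hom-ext (eval h (c θ)) (constₕ L ∘ₕ toL)
        (λ r → E.trans (eval-const h (c θ) r) (E.sym (E.trans (Hom.cong (constₕ L) (Hom.cong toL (B.sym (Hom.cong (constₕ ℤR) (ι-ℤ r)))))
          (ι-unique (constₕ L ∘ₕ (toL ∘ₕ (constₕ ℤR ∘ₕ ι ℤR))) r))))
        (eval-X h (c θ))
      F′ = proj₁ (derivative h F)
      F′-coef = proj₁ (proj₂ (derivative h F))
      expand : ∀ b → ∃ λ w → fn e b E.≈ c (fn toL b) E.+ ε E.* w
      expand b with derivative h b
      ... | b′ , _ , t = _ , E.trans (proj₂ (t (c θ) ε)) (E.+-congʳ (e₀-toL b))
      w : Fin m → ∣ Pol L ∣
      w i = proj₁ (expand (pointᵖ p φ i))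
      tay = taylor (Pol L) f ε (c ∘ x) w
      rhs : evalP (Pol L) f (λ i → fn e (pointᵖ p φ i)) E.≈ ε E.* (ε E.* proj₁ tay)
      rhs = E.trans (evalP-cong (Pol L) f (λ i → proj₂ (expand (pointᵖ p φ i)))) (E.trans (proj₂ tay) (E.trans (E.+-congʳ
          (E.trans (E.sym (evalP-homo (constₕ L) f x)) (E.trans (Hom.cong (constₕ L) on-hypersurface) (0-homo (constₕ L)))))
        (E.trans (E.+-identityˡ _) (E.*-congˡ (E.trans (E.+-congʳ (sum-0 (λ j → evalP (Pol L) (∂ j f) (c ∘ x) E.* w j)
          λ j → E.trans (E.*-congʳ (E.trans (E.sym (evalP-homo (constₕ L) (∂ j f) x)) (E.trans (Hom.cong (constₕ L) (singular j)) (0-homo (constₕ L))))) (E.zeroˡ _))) (E.+-identityˡ _))))))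
      derF = proj₂ (proj₂ (proj₂ (derivative h F)) (c θ) ε)
      r = proj₁ (proj₂ (proj₂ (derivative h F)) (c θ) ε)
      lhs : fn e (X ℤR ^ a B.* F) E.≈ ε E.* (fn e (X ℤR ^ a) E.* (fn (eval h (c θ)) F′ E.+ ε E.* r))
      lhs = E.trans (*-homo e _ F) (E.trans (E.*-congˡ (E.trans derF (E.trans (E.+-congʳ (E.trans (e₀-toL F) (E.trans (Hom.cong (constₕ L) toL-F) (0-homo (constₕ L))))) (E.+-identityˡ _))))
        (solve 3 (λ u e v → u :* (e :* v) := e :* (u :* v)) E.refl (fn e (X ℤR ^ a)) ε _))
        where open Solver (Pol L) using (solve; _:*_; _:=_)
      reduced : fn e (X ℤR ^ a) E.* (fn (eval h (c θ)) F′ E.+ ε E.* r) E.≈ ε E.* proj₁ tay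
      reduced = X*-cancel L (E.trans (E.sym lhs) (E.trans (Hom.cong e F-eq) (E.trans (evalP-homo e f (pointᵖ p φ)) rhs)))
      at0-ε* : ∀ q → fn (at0 L) (ε E.* q) L.≈ L.0#
      at0-ε* q = L.trans (at0-coef L _) (coef-X*-0 L q)
      ε₀-right : fn (at0 L) (ε E.* proj₁ tay) L.≈ L.0#
      ε₀-right = at0-ε* _
      at0-e : ∀ b → fn (at0 L) (fn e b) L.≈ fn toL b
      at0-e b = L.trans (Hom.cong (at0 L) (proj₂ (expand b))) (L.trans (+-homo (at0 L) _ _) (L.trans (L.+-cong (eval-const (idₕ {L}) L.0# _) (at0-ε* _)) (L.+-identityʳ _)))
      ε₀-line : ∀ b g → fn (at0 L) (fn e b E.* (fn (eval h (c θ)) g E.+ ε E.* r)) L.≈ fn toL b L.* fn toL g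
      ε₀-line b g = L.trans (*-homo (at0 L) _ _) (L.*-cong (at0-e b) (L.trans (+-homo (at0 L) _ _)
        (L.trans (L.+-cong (L.trans (Hom.cong (at0 L) (e₀-toL g)) (eval-const (idₕ {L}) L.0# _)) (at0-ε* r)) (L.+-identityʳ _))))
      θᵃ≉0 : ¬ fn toL (X ℤR ^ a) L.≈ L.0#
      θᵃ≉0 z = D.^-nonzero a θ≉0 (L.trans (L.sym (^-homo toL (X ℤR) a)) z)
      1≤n : 1 ℕ.≤ n
      1≤n = ℕP.≤-trans (s≤s z≤n) 2≤n
      n≡ : suc (ℕ.pred n) ≡ n
      n≡ = ℕP.suc-pred n ⦃ ℕ.>-nonZero 1≤n ⦄
      F′-deg : deg< ℤR n F′
      F′-deg i n≤i = ≡.trans (F′-coef i) (≡.trans (≡.cong (λ z → fn (ι ℤR) (+ suc i) ℤ.* z) (degᵗ F-top (suc i) (s≤s n≤i))) (ℤP.*-zeroʳ (fn (ι ℤR) (+ suc i))))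
      -- Its coefficient of index n - 1 is n·f(V). Being nonzero of degree below n, F′ does not
      -- vanish at θ.
      F′≉0 : ¬ F′ B.≈ B.0#
      F′≉0 z = Domain.*-nonzero ℤ-domain {fn (ι ℤR) (+ suc (ℕ.pred n))} {coef ℤR F (suc (ℕ.pred n))}
        (λ e → suc≢0 (≡.trans (≡.sym (ι-ℤ _)) e))
        (λ e → f[V]≢0 (≡.trans (≡.sym (lead F-top)) (≡.trans (≡.cong (coef ℤR F) (≡.sym n≡)) e)))
        (≡.trans (≡.sym (F′-coef (ℕ.pred n))) (≡.trans (coef-cong ℤR z (ℕ.pred n)) (coef-0 ℤR (ℕ.pred n))))
      F′[θ]≉0 : ¬ fn toL F′ L.≈ L.0#
      F′[θ]≉0 = toL-nonzero F′-deg F′≉0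

    private
      open Sums L using (sum)
      module Rec = Dual dualV

      -- The coordinates of x(θ) with respect to P, V and ξ; the third is l²θ times the first.
      c : Fin 3 → ∣ L ∣
      c zero = iL (Q ℤ.* ω)
      c (suc zero) = fn toL (fn (ι 𝔹) (Q ℤ.* ω) B.* φ B.+ X ℤR ^ a B.* ηᵖ p)
      c (suc (suc zero)) = iL ((Q ℤ.* ω) ℤ.* (l ℤ.* l)) L.* θ

      dualL : Dual L (λ i k → iL (vectorsℤ P V ξ i k))
      dualL = Dual-map (ι L) dualV

      split : ∀ j → x j L.≈ iL (P j) L.* c zero L.+ (iL (V j) L.* c (suc zero) L.+ iL (ξ j) L.* c (suc (suc zero)))
      split j = L.trans (Hom.cong toL (solve 8 (λ N P φ V l s ξ u → N :* ((P :+ φ :* V) :+ (l :* s) :* ξ) :+ u :* V := P :* N :+ (V :* (N :* φ :+ u) :+ ξ :* ((N :* l) :* s))) B.refl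
          (fn (ι 𝔹) (Q ℤ.* ω)) (fn (ι 𝔹) (P j)) φ (fn (ι 𝔹) (V j)) (fn (ι 𝔹) (l ℤ.* l)) (X ℤR) (const ℤR (ξ j)) (X ℤR ^ a B.* ηᵖ p)))
        (hom+ (L.trans (*-homo toL _ _) (L.*-cong (ι-homo toL (P j)) (ι-homo toL _)))
          (hom+ (L.trans (*-homo toL _ _) (L.*-congʳ (ι-homo toL (V j))))
            (L.trans (*-homo toL _ _) (L.*-cong (L.trans (Hom.cong toL (Hom.cong (constₕ ℤR) (≡.sym (ι-ℤ (ξ j))))) (ι-homo (toL ∘ₕ constₕ ℤR) (ξ j)))
              (L.trans (*-homo toL _ _) (L.*-congʳ (L.trans (Hom.cong toL (B.sym (*-homo (ι 𝔹) _ _))) (ι-homo toL _))))))))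
        where
        open Solver 𝔹 using (solve; _:+_; _:*_; _:=_)
        hom+ : ∀ {u v u′ v′} → fn toL u L.≈ u′ → fn toL v L.≈ v′ → fn toL (u B.+ v) L.≈ u′ L.+ v′
        hom+ e e′ = L.trans (+-homo toL _ _) (L.+-cong e e′)

      coordinates : ∀ j → pad L.0# x j L.≈ sum (λ i → c i L.* iL (vectorsℤ P V ξ i j))
      coordinates j with j ℕP.<? m
      ... | yes j<m = L.trans (split (Fin.fromℕ< j<m)) (L.+-cong (L.*-comm _ _) (L.+-cong (L.*-comm _ _) (L.trans (L.*-comm _ _) (L.sym (L.+-identityʳ _)))))
      ... | no _ = L.sym (sum-0 (λ i → c i L.* iL (+ 0)) λ i → L.trans (L.*-congˡ (0-homo (ι L))) (L.zeroʳ _))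
        where open Sums L using (sum-0)

      extract : ∀ i → dot L (Dual.l dualL i) (pad L.0# x) L.≈ Dual.Δ dualL L.* c i
      extract i = L.trans (dot-cong L (Dual.l dualL i) coordinates) (dual-sum L dualL c i)

    -- The functional dual to P reads ΔQω ≠ 0 from the coordinates.
    not-all-zero : ¬ (∀ i → x i L.≈ L.0#)
    not-all-zero z = D.*-nonzero (ιL≉0 dualV≢0) (ιL≉0 Qω≢0) (L.trans (L.sym (extract zero)) (L.trans (dot-cong L (Dual.l dualL zero) zeros) (dot-0 L (Dual.l dualL zero))))
      where
      zeros : ∀ j → pad L.0# x j L.≈ L.0#
      zeros j with j ℕP.<? m
      ... | yes j<m = z _
      ... | no _ = L.refl

    -- Ratios of ℤ-linear combinations of the coordinates recover θ.
    θ-rational : (K : ∣ L ∣ → Set) → (∀ {x y} → x L.≈ y → K x → K y) → K L.0# → (∀ n → K (iL n)) →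
      (∀ {x y} → K x → K y → K (x L.+ y)) → (∀ {x y} → K x → K y → K (x L.* y)) → (∀ {x y} → K x → x L.* y L.≈ L.1# → K y) →
      (∀ x → ¬ x L.≈ L.0# → ∃ λ y → x L.* y L.≈ L.1#) → ∀ t → ¬ t L.≈ L.0# → (∀ i → K (t L.* x i)) → K θ
    θ-rational K resp 0∈ ι∈ +∈ *∈ ⁻¹∈ inverse t t≉0 tx∈ = resp ratio (*∈ (⁻¹∈ (*∈ (ι∈ (l ℤ.* l)) (member zero)) (proj₂ inv)) (member (suc (suc zero))))
      where
      padded : ∀ j → K (t L.* pad L.0# x j)
      padded j with j ℕP.<? m
      ... | yes j<m = tx∈ _
      ... | no _ = resp (L.sym (L.zeroʳ t)) 0∈
      dot∈ : ∀ cs v → (∀ j → K (t L.* v j)) → K (t L.* dot L (List.map iL cs) v)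
      dot∈ [] v h = resp (L.sym (L.zeroʳ t)) 0∈
      dot∈ (b ∷ cs) v h = resp (solve 4 (λ b t v d → b :* (t :* v) :+ t :* d := t :* (b :* v :+ d)) L.refl (iL b) t (v 0) _) (+∈ (*∈ (ι∈ b) (h 0)) (dot∈ cs (v ∘ suc) (h ∘ suc)))
        where open Solver L using (solve; _:+_; _:*_; _:=_)
      member : ∀ i → K (t L.* (iL Rec.Δ L.* c i))
      member i = resp (L.*-congˡ (extract i)) (dot∈ (Rec.l i) (pad L.0# x) padded)
      pivot : ∣ L ∣
      pivot = iL (l ℤ.* l) L.* (t L.* (iL Rec.Δ L.* c zero))
      inv = inverse pivot (D.*-nonzero (ιL≉0 (Domain.*-nonzero ℤ-domain {l} {l} l≢0 l≢0)) (D.*-nonzero t≉0 (D.*-nonzero (ιL≉0 dualV≢0) (ιL≉0 Qω≢0))))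
      ratio : proj₁ inv L.* (t L.* (iL Rec.Δ L.* c (suc (suc zero)))) L.≈ θ
      ratio = begin
        proj₁ inv L.* (t L.* (iL Rec.Δ L.* (iL ((Q ℤ.* ω) ℤ.* (l ℤ.* l)) L.* θ)))
          ≈⟨ L.*-congˡ (L.*-congˡ (L.*-congˡ (L.*-congʳ (*-homo (ι L) (Q ℤ.* ω) (l ℤ.* l))))) ⟩
        proj₁ inv L.* (t L.* (iL Rec.Δ L.* ((iL (Q ℤ.* ω) L.* iL (l ℤ.* l)) L.* θ)))
          ≈⟨ solve 6 (λ w t Δ N l θ → w :* (t :* (Δ :* ((N :* l) :* θ))) := ((l :* (t :* (Δ :* N))) :* w) :* θ) L.refl (proj₁ inv) t (iL Rec.Δ) (iL (Q ℤ.* ω)) (iL (l ℤ.* l)) θ ⟩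
        (pivot L.* proj₁ inv) L.* θ ≈⟨ L.trans (L.*-congʳ (proj₂ inv)) (L.*-identityˡ θ) ⟩
        θ ∎
        where
        open SetoidReasoning L.setoid
        open Solver L using (solve; _:*_; _:=_)

-- The closure properties of `IsSubfield` over a bare ring, so that one argument serves both ℚ and
-- ℚ(θ).
record Subfield (L : Ring) (K : ∣ L ∣ → Set) : Set where
  open CRing L
  field
    resp : ∀ {x y} → x ≈ y → K x → K y
    0∈ : K 0#
    1∈ : K 1#
    +∈ : ∀ {x y} → K x → K y → K (x + y)
    *∈ : ∀ {x y} → K x → K y → K (x * y)
    -∈ : ∀ {x} → K x → K (- x)
    ⁻¹∈ : ∀ {x y} → K x → x * y ≈ 1# → K y

  private
    naturals∈ : ∀ n → K (fn (ι L) (+ n))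
    naturals∈ zero = resp (sym (0-homo (ι L))) 0∈
    naturals∈ (suc n) = resp (sym (+-homo (ι L) (+ 1) (+ n))) (+∈ (resp (sym (1-homo (ι L))) 1∈) (naturals∈ n))

  integers∈ : ∀ n → K (fn (ι L) n)
  integers∈ (+ n) = naturals∈ n
  integers∈ -[1+ n ] = resp (sym (-‿homo (ι L) (+ suc n))) (-∈ (naturals∈ (suc n)))

  rationals∈ : (h : Hom ℚR L) → ∀ r → K (fn h r)
  rationals∈ h r with ℚ-clear r
  ... | N , c , N≢0 , e with ℚ-inverse (fn (ι ℚR) N) (j-nonzero N≢0)
  ... | w , Nw = resp quotient (*∈ (⁻¹∈ (integers∈ N) inverse) (integers∈ c))
    where
    inverse : fn (ι L) N * fn h w ≈ 1#
    inverse = trans (*-congʳ (sym (ι-homo h N))) (trans (sym (*-homo h _ w)) (trans (Hom.cong h Nw) (1-homo h)))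
    quotient : fn h w * fn (ι L) c ≈ fn h r
    quotient = begin
      fn h w * fn (ι L) c ≈⟨ *-congˡ (ι-homo h c) ⟨
      fn h w * fn h (fn (ι ℚR) c) ≈⟨ *-congˡ (trans (Hom.cong h (≡.sym e)) (trans (*-homo h _ r) (*-congʳ (ι-homo h N)))) ⟩
      fn h w * (fn (ι L) N * fn h r) ≈⟨ trans (sym (*-assoc _ _ _)) (*-congʳ (trans (*-comm _ _) inverse)) ⟩
      1# * fn h r ≈⟨ *-identityˡ _ ⟩
      fn h r ∎
      where open SetoidReasoning setoid

  polynomials∈ : (h : Hom (Pol ℚR) L) → K (fn h (X ℚR)) → ∀ a → K (fn h a)
  polynomials∈ h θ∈ = Pol-ind ℚR (λ a → K (fn h a)) (λ e → resp (Hom.cong h e)) (resp (sym (0-homo h)) 0∈)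
    λ r a a∈ → resp (sym (trans (+-homo h _ _) (+-congˡ (*-homo h _ _)))) (+∈ (rationals∈ (h ∘ₕ constₕ ℚR) r) (*∈ θ∈ a∈))

module NewField {m d : ℕ} (f : Poly m) (hom : Homogeneous d f) (P V : Fin m → ℤ) (f[P]≡0 : evalP ℤR f P ≡ + 0)
  (Q ω : ℤ) (a k n : ℕ) (2≤k : 2 ℕ.≤ k) (degrees : d ℕ.* (a ℕ.+ k) ≡ a ℕ.+ n) (ξ : Fin m → ℤ)
  {p : ℤ} (fib : Fibration.Fibre f hom P V f[P]≡0 Q ω a k n 2≤k degrees ξ p) (irreducible : NoFactor ℤ-domain n (Fibration.Fibre.F fib))
  (2≤n : 2 ℕ.≤ n) (f[V]≢0 : evalP ℤR f V ≢ + 0) (l≢0 : directional ℤR f P V ≢ + 0) (Qω≢0 : Q ℤ.* ω ≢ + 0)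
  (dualV : Dual ℤR (vectorsℤ P V ξ)) (dualV≢0 : Dual.Δ dualV ≢ + 0) where

  open Fibration f hom P V f[P]≡0 Q ω a k n 2≤k degrees ξ using (module Points; module Fibre)
  open Field (ℕP.≤-trans (s≤s z≤n) 2≤n) f[V]≢0 (Fibre.F-top fib) irreducible public
  open Points fib 2≤n f[V]≢0 l≢0 Qω≢0 dualV dualV≢0 L L-domain toL toL-F toL-nonzero using (x; on-hypersurface; not-singular; not-all-zero; θ-rational)
  private
    module L = CRing L

    some-nonzero : ∀ {k} (g : Fin k → ∣ L ∣) → ¬ (∀ i → g i L.≈ L.0#) → ∃ λ i → ¬ g i L.≈ L.0#
    some-nonzero {k} g = FinP.¬∀⟶∃¬ k (λ i → g i L.≈ L.0#) (λ i → ≈-dec (g i) L.0#)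

    inverse : ∀ x → ¬ x L.≈ L.0# → ∃ λ y → x L.* y L.≈ L.1#
    inverse x nz = invert (zero-or-invertible x)
      where
      invert : x L.≈ L.0# ⊎ (∃ λ y → x L.* y L.≈ L.1#) → ∃ λ y → x L.* y L.≈ L.1#
      invert (inj₁ z) = ⊥-elim (nz z)
      invert (inj₂ v) = v

    singular : (∀ i → NumberField.eval numberField (∂ i f) x L.≈ L.0#) → ∀ i → evalP L (∂ i f) x L.≈ L.0#
    singular z i = L.trans {evalP L (∂ i f) x} {NumberField.eval numberField (∂ i f) x} {L.0#} (L.sym {NumberField.eval numberField (∂ i f) x} {evalP L (∂ i f) x} (eval-L (∂ i f) x)) (z i)

  point : Point numberField m
  point = record { coord = x ; nonzero = some-nonzero x not-all-zero }

  isNewPoint : IsNewPoint f point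
  isNewPoint = record
    { onHypersurface = L.trans {NumberField.eval numberField f x} {evalP L f x} {L.0#} (eval-L f x) on-hypersurface
    ; nonSingular = some-nonzero (λ i → NumberField.eval numberField (∂ i f) x) λ z → not-singular (singular z)
    ; new = new }
    where
    new : ∀ K → IsProperSubfield numberField K → ¬ DefinedOver K point
    -- A field of definition contains θ, hence every polynomial in θ with rational coefficients, and
    -- these are all of L.
    new K (sub , proper) (t , t≉0 , tx∈) = proper (polynomials∈ reduction (resp {fn toL (X ℤR)} {X ℚR} mapₚ-X-in-L θ∈))
      where
      module K = IsSubfield sub
      subfield : Subfield L K
      subfield = record { resp = λ {x} {y} → K.resp {x} {y} ; 0∈ = K.0∈ ; 1∈ = K.1∈ ; +∈ = λ {x} {y} → K.+-closed {x} {y} ; *∈ = λ {x} {y} → K.*-closed {x} {y}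
        ; -∈ = λ {x} → K.-‿closed {x} ; ⁻¹∈ = λ {x} {y} → K.⁻¹-closed {x} {y} }
      open Subfield subfield
      θ∈ : K (fn toL (X ℤR))
      θ∈ = θ-rational K (λ {x} {y} → resp {x} {y}) 0∈ integers∈ (λ {x} {y} → +∈ {x} {y}) (λ {x} {y} → *∈ {x} {y}) (λ {x} {y} → ⁻¹∈ {x} {y}) inverse t t≉0 tx∈
      mapₚ-X-in-L : fn toL (X ℤR) L.≈ X ℚR
      mapₚ-X-in-L = Hom.cong reduction (mapₚ-X (ι ℚR))

  new-field : 𝓕 f numberField
  new-field = point , isNewPoint

-- Absence of q-adic roots

-- The form bⁿF(u/b), which tests a fraction as a root of F without dividing, in any ring.
homog : ∀ (S : Ring) → ℕ → ∣ Pol ℤR ∣ → ∣ S ∣ → ∣ S ∣ → ∣ S ∣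
homog S zero F u b = fn (ι S) (coef ℤR F 0)
homog S (suc n) F u b = fn (ι S) (coef ℤR F 0) * b ^ suc n + u * homog S n (tail ℤR F) u b
  where
  open CRing S
  open SemiringExp semiring using (_^_)

homog-homo : ∀ {S T} (h : Hom S T) n F u b → CRing._≈_ T (fn h (homog S n F u b)) (homog T n F (fn h u) (fn h b))
homog-homo h zero F u b = ι-homo h _
homog-homo {S} {T} h (suc n) F u b = T.trans (+-homo h _ _) (T.+-cong (T.trans (*-homo h _ _) (T.*-cong (ι-homo h _) (^-homo h b (suc n))))
  (T.trans (*-homo h _ _) (T.*-congˡ (homog-homo h n (tail ℤR F) u b))))
  where module T = CRing T

module _ (S : Ring) where
  open CRing S
  open SemiringExp semiring using (_^_)
  open Solver S using (solve; _:+_; _:*_; _:=_)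

  homog-cong : ∀ n F {u u′ b b′} → u ≈ u′ → b ≈ b′ → homog S n F u b ≈ homog S n F u′ b′
  homog-cong zero F e e′ = refl
  homog-cong (suc n) F e e′ = +-cong (*-congˡ (SemiringExp.^-congˡ semiring (suc n) e′)) (*-cong e (homog-cong n (tail ℤR F) e e′))

  homog-ratio : ∀ n F {u b w} → deg< ℤR (suc n) F → b * w ≈ u → homog S n F u b ≈ b ^ n * fn (eval (ι S) w) F
  homog-ratio zero F {u} {b} {w} d e = sym (trans (*-identityˡ _) (trans (Hom.cong (eval (ι S) w) constant) (eval-const (ι S) w _)))
    where
    constant : CRing._≈_ (Pol ℤR) F (const ℤR (coef ℤR F 0))
    constant = ext ℤR λ { zero → ≡.sym (coef-const-0 ℤR _) ; (suc i) → ≡.trans (d (suc i) (s≤s z≤n)) (≡.sym (coef-const-suc ℤR _ i)) }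
  homog-ratio (suc n) F {u} {b} {w} d e = begin
    f₀ * (b * b ^ n) + u * homog S n (tail ℤR F) u b ≈⟨ +-congˡ (*-cong (sym e) (homog-ratio n (tail ℤR F) (deg<-tail ℤR d) e)) ⟩
    f₀ * (b * b ^ n) + (b * w) * (b ^ n * g)
      ≈⟨ solve 5 (λ f b B w g → f :* (b :* B) :+ (b :* w) :* (B :* g) := (b :* B) :* (f :+ w :* g)) refl f₀ b (b ^ n) w g ⟩
    (b * b ^ n) * (f₀ + w * g) ≈⟨ *-congˡ (trans (Hom.cong h (Pol-decompose ℤR F)) (trans (+-homo h _ _) (+-cong (eval-const (ι S) w _) (trans (*-homo h _ _) (*-congʳ (eval-X (ι S) w)))))) ⟨
    (b * b ^ n) * fn h F ∎
    where
    open SetoidReasoning setoid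
    h = eval (ι S) w
    f₀ = fn (ι S) (coef ℤR F 0)
    g = fn h (tail ℤR F)

  homog-scale : ∀ n F q u b → homog S n F (q * u) (q * b) ≈ q ^ n * homog S n F u b
  homog-scale zero F q u b = sym (*-identityˡ _)
  homog-scale (suc n) F q u b = begin
    f₀ * (q * b) ^ suc n + (q * u) * homog S n (tail ℤR F) (q * u) (q * b) ≈⟨ +-cong (*-congˡ (power (suc n))) (*-congˡ (homog-scale n (tail ℤR F) q u b)) ⟩
    f₀ * (q ^ suc n * b ^ suc n) + (q * u) * (q ^ n * g)
      ≈⟨ solve 6 (λ f q Q B u g → f :* ((q :* Q) :* B) :+ (q :* u) :* (Q :* g) := (q :* Q) :* (f :* B :+ u :* g)) refl f₀ q (q ^ n) (b ^ suc n) u g ⟩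
    q ^ suc n * (f₀ * b ^ suc n + u * g) ∎
    where
    open SetoidReasoning setoid
    f₀ = fn (ι S) (coef ℤR F 0)
    g = homog S n (tail ℤR F) u b
    power : ∀ k → (q * b) ^ k ≈ q ^ k * b ^ k
    power zero = sym (*-identityˡ _)
    power (suc k) = trans (*-congˡ (power k)) (solve 4 (λ q b x y → (q :* b) :* (x :* y) := (q :* x) :* (b :* y)) refl q b (q ^ k) (b ^ k))

  homog-lead : ∀ n F u b → (∀ i → i ℕ.< n → fn (ι S) (coef ℤR F i) ≈ 0#) → homog S n F u b ≈ fn (ι S) (coef ℤR F n) * u ^ n
  homog-lead zero F u b z = sym (*-identityʳ _)
  homog-lead (suc n) F u b z = begin
    fn (ι S) (coef ℤR F 0) * b ^ suc n + u * homog S n (tail ℤR F) u b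
      ≈⟨ +-cong (trans (*-congʳ (z 0 (s≤s z≤n))) (zeroˡ _)) (*-congˡ (homog-lead n (tail ℤR F) u b λ i i<n → trans (Hom.cong (ι S) (coef-tail ℤR F i)) (z (suc i) (s≤s i<n)))) ⟩
    0# + u * (fn (ι S) (coef ℤR (tail ℤR F) n) * u ^ n) ≈⟨ +-identityˡ _ ⟩
    u * (fn (ι S) (coef ℤR (tail ℤR F) n) * u ^ n) ≈⟨ *-congˡ (*-congʳ (Hom.cong (ι S) (coef-tail ℤR F n))) ⟩
    u * (fn (ι S) (coef ℤR F (suc n)) * u ^ n) ≈⟨ solve 3 (λ u c U → u :* (c :* U) := c :* (u :* U)) refl u _ (u ^ n) ⟩
    fn (ι S) (coef ℤR F (suc n)) * (u * u ^ n) ∎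
    where open SetoidReasoning setoid

evalP-mod : ∀ (S : Ring) (let open CRing S) (let open Divisibility S) {m} (f : Poly m) z {x y : Fin m → Carrier} →
  (∀ j → z ∣ x j - y j) → z ∣ evalP S f x - evalP S f y
evalP-mod S f z {x} {y} e = Q.trans (evalP-homo h f x) (Q.trans (evalP-cong (Quotient S (principal S z)) f {x} {y} e) (Q.sym (evalP-homo h f y)))
  where
  h = toQuotient S (principal S z)
  module Q = CRing (Quotient S (principal S z))

-- Values of f on the curve at arguments divisible by q

module _ {m d : ℕ} (f : Poly m) (hom : Homogeneous d f) (P V : Fin m → ℤ) {R S : Ring} (π : Hom R S) where
  private
    module R = CRing R
    module S = CRing S
    iR = fn (ι R)
    iS = fn (ι S)
    πf = fn π
  open SemiringExp R.semiring using (_^_; ^-congˡ)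
  open Solver R using (solve; _:+_; _:*_; _:=_)

  module _ {q : R.Carrier} (πq : πf q S.≈ S.0#) {s s′ : R.Carrier} (s≈ : s R.≈ q R.* s′) (Q′ p : R.Carrier) (k : ℕ) where

    π-multiple : ∀ {x y} → x R.≈ q R.* y → πf x S.≈ S.0#
    π-multiple e = S.trans (Hom.cong π e) (S.trans (*-homo π _ _) (S.trans (S.*-congʳ πq) (S.zeroˡ _)))

    π-congruent : ∀ {y t} c → y R.≈ iR c R.+ q R.* t → πf y S.≈ iS c
    π-congruent c e = S.trans (Hom.cong π e) (S.trans (+-homo π _ _) (S.trans (S.+-cong (ι-homo π c) (π-multiple R.refl)) (S.+-identityʳ _)))

    -- η = qη′ for s = qs′ and Q = qQ′; the exponent k here is the previous one minus 2. Since the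
    -- last term of η contains s at least twice, η′ is Q′p modulo q.
    η′ : R.Carrier
    η′ = Q′ R.* (p R.+ s) R.+ s′ R.* (s R.* s ^ k)

    η-split : (q R.* Q′) R.* (p R.+ s) R.+ s ^ (2 ℕ.+ k) R.≈ q R.* η′
    η-split = R.trans (R.+-congˡ (R.*-congʳ s≈)) (solve 7 (λ q Q p s t s′ u → (q :* Q) :* (p :+ s) :+ (q :* s′) :* (s :* t) := q :* (Q :* (p :+ s) :+ s′ :* (s :* t))) R.refl
      q Q′ p s (s ^ k) s′ R.1#)

    π-η′ : πf η′ S.≈ πf (Q′ R.* p)
    π-η′ = S.trans (Hom.cong π (R.trans (R.+-congˡ (R.*-congˡ (R.*-congʳ s≈))) (R.trans (R.+-congʳ (R.*-congˡ (R.+-congˡ s≈)))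
        (solve 5 (λ Q p q s′ t → Q :* (p :+ q :* s′) :+ s′ :* ((q :* s′) :* t) := Q :* p :+ q :* (Q :* s′ :+ s′ :* (s′ :* t))) R.refl Q′ p q s′ (s ^ k)))))
      (S.trans (+-homo π _ _) (S.trans (S.+-congˡ (π-multiple R.refl)) (S.+-identityʳ _)))

    -- The case a = 0. Because ω = Q, the coefficient of y contains q², so after division by q the
    -- point is Q′p·V modulo q, and f takes the value (Q′p)ᵈf(V) there.
    unit-transverse : (y x : Fin m → R.Carrier) → (∀ i → x i R.≈ ((q R.* Q′) R.* (q R.* Q′)) R.* y i R.+ ((q R.* Q′) R.* (p R.+ s) R.+ s ^ (2 ℕ.+ k)) R.* iR (V i)) →
      ∃ λ g → evalP R f x R.≈ q ^ d R.* g × πf g S.≈ SemiringExp._^_ S.semiring (πf (Q′ R.* p)) d S.* iS (evalP ℤR f V)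
    unit-transverse y x e = evalP R f x″ , R.trans (evalP-cong R f λ i → R.trans (e i) (factor i)) (evalP-scale R {f} hom q x″) ,
      S.trans (evalP-homo π f x″) (S.trans (evalP-cong S f π-x″) (S.trans (evalP-scale S {f} hom _ (iS ∘ V)) (S.*-congˡ (S.sym (evalP-homo (ι S) f V)))))
      where
      x″ : Fin m → R.Carrier
      x″ i = (Q′ R.* (q R.* Q′)) R.* y i R.+ η′ R.* iR (V i)
      factor : ∀ i → ((q R.* Q′) R.* (q R.* Q′)) R.* y i R.+ ((q R.* Q′) R.* (p R.+ s) R.+ s ^ (2 ℕ.+ k)) R.* iR (V i) R.≈ q R.* x″ i
      factor i = R.trans (R.+-congˡ (R.*-congʳ η-split)) (solve 5 (λ q Q y η v → ((q :* Q) :* (q :* Q)) :* y :+ (q :* η) :* v := q :* ((Q :* (q :* Q)) :* y :+ η :* v)) R.refl q Q′ (y i) η′ (iR (V i)))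
      π-x″ : ∀ i → πf (x″ i) S.≈ πf (Q′ R.* p) S.* iS (V i)
      π-x″ i = S.trans (+-homo π _ _) (S.trans (S.+-cong (π-multiple (solve 3 (λ q Q y → (Q :* (q :* Q)) :* y := q :* ((Q :* Q) :* y)) R.refl q Q′ (y i)))
        (S.trans (*-homo π _ _) (S.*-cong π-η′ (ι-homo π (V i))))) (S.+-identityˡ _))

    -- The case of a positive exponent, here written `suc a`. After division by q the point is Q′P
    -- modulo q, where f vanishes, so the leading part comes from Taylor along V: sᵃ⁺¹ times the
    -- slope. The factor Q′ on both sides of the residue stands for the exponent d - 1 of
    -- homogeneity.
    unit-tangent : (a : ℕ) (y x : Fin m → R.Carrier) (h : R.Carrier) → (∀ i → πf (y i) S.≈ iS (P i)) → evalP R f y R.≈ s ^ (3 ℕ.+ a) R.* h →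
      (∀ i → x i R.≈ (q R.* Q′) R.* y i R.+ (s ^ suc a R.* ((q R.* Q′) R.* (p R.+ s) R.+ s ^ (2 ℕ.+ k))) R.* iR (V i)) →
      ∃ λ g → evalP R f x R.≈ q ^ d R.* (s ^ suc a R.* g) × πf (Q′ R.* g) S.≈ πf (Q′ R.* p) S.* (πf (Q′ ^ d) S.* iS (directional ℤR f P V))
    unit-tangent a y x h y~P f[y] e = g , evaluation , residue
      where
      z = s ^ suc a R.* η′
      x″ : Fin m → R.Carrier
      x″ i = Q′ R.* y i R.+ z R.* iR (V i)
      tay = taylor R f z (λ i → Q′ R.* y i) (iR ∘ V)
      Dir = directional R f (λ i → Q′ R.* y i) (iR ∘ V)
      r = proj₁ tay
      g = Q′ ^ d R.* (s R.* s R.* h) R.+ η′ R.* (Dir R.+ z R.* r)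
      factor : ∀ i → x i R.≈ q R.* x″ i
      factor i = R.trans (e i) (R.trans (R.+-congˡ (R.*-congʳ (R.*-congˡ η-split)))
        (solve 6 (λ q Q y t η v → (q :* Q) :* y :+ (t :* (q :* η)) :* v := q :* (Q :* y :+ (t :* η) :* v)) R.refl q Q′ (y i) (s ^ suc a) η′ (iR (V i))))
      f[x″] : evalP R f x″ R.≈ s ^ suc a R.* g
      f[x″] = R.trans (proj₂ tay) (R.trans (R.+-congʳ (R.trans (evalP-scale R {f} hom Q′ y) (R.*-congˡ f[y])))
        (solve 7 (λ Qd s t h η D w → Qd :* ((s :* (s :* t)) :* h) :+ (t :* η) :* (D :+ w) := t :* (Qd :* (s :* s :* h) :+ η :* (D :+ w))) R.refl (Q′ ^ d) s (s ^ suc a) h η′ Dir (z R.* r)))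
      evaluation : evalP R f x R.≈ q ^ d R.* (s ^ suc a R.* g)
      evaluation = R.trans (evalP-cong R f factor) (R.trans (evalP-scale R {f} hom q x″) (R.*-congˡ f[x″]))
      residue : πf (Q′ R.* g) S.≈ πf (Q′ R.* p) S.* (πf (Q′ ^ d) S.* iS (directional ℤR f P V))
      residue = begin
        πf (Q′ R.* g) ≈⟨ Hom.cong π (R.trans (solve 6 (λ Q X η D z r → Q :* (X :+ η :* (D :+ z :* r)) := η :* (Q :* D) :+ (Q :* X :+ Q :* η :* (z :* r))) R.refl Q′ (Q′ ^ d R.* (s R.* s R.* h)) η′ Dir z r)
             (R.+-cong (R.*-congˡ (directional-scale R {f = f} hom Q′ y (iR ∘ V))) (R.trans
               (R.+-cong (R.*-congˡ (R.*-congˡ (R.*-congʳ (R.*-congʳ s≈)))) (R.*-congˡ (R.*-congʳ (R.*-congʳ (R.*-congʳ s≈)))))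
               (solve 9 (λ Q Qd q s′ s h η t r → Q :* (Qd :* ((q :* s′) :* s :* h)) :+ Q :* η :* (((q :* s′) :* t) :* η :* r) := q :* (Q :* (Qd :* (s′ :* s :* h)) :+ Q :* η :* ((s′ :* t) :* η :* r))) R.refl
                 Q′ (Q′ ^ d) q s′ s h η′ (s ^ a) r)))) ⟩
        πf (η′ R.* (Q′ ^ d R.* directional R f y (iR ∘ V)) R.+ q R.* rest) ≈⟨ S.trans (+-homo π _ _) (S.trans (S.+-congˡ (π-multiple R.refl)) (S.+-identityʳ _)) ⟩
        πf (η′ R.* (Q′ ^ d R.* directional R f y (iR ∘ V))) ≈⟨ S.trans (*-homo π _ _) (S.*-cong π-η′ (S.trans (*-homo π _ _) (S.*-congˡ slope))) ⟩
        πf (Q′ R.* p) S.* (πf (Q′ ^ d) S.* iS (directional ℤR f P V)) ∎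
        where
        open SetoidReasoning S.setoid
        rest = Q′ R.* (Q′ ^ d R.* (s′ R.* s R.* h)) R.+ Q′ R.* η′ R.* ((s′ R.* s ^ a) R.* η′ R.* r)
        slope : πf (directional R f y (iR ∘ V)) S.≈ iS (directional ℤR f P V)
        slope = S.trans (directional-homo π f y (iR ∘ V)) (S.trans (directional-cong S f y~P (λ i → ι-homo π (V i))) (S.sym (directional-homo (ι S) f P V)))

∣ℤ-trans : ∀ {a b c} → a ∣ℤ b → b ∣ℤ c → a ∣ℤ c
∣ℤ-trans {a} {b} {c} (r , e) (t , e′) = r ℤ.* t , ≡.trans (≡.sym (ℤP.*-assoc a r t)) (≡.trans (≡.cong (λ z → z ℤ.* t) e) e′)

-- In effect induction on the q-adic valuation of b, run on its absolute value.
prime-induction : ∀ {q} → ℕPrime.Prime q → (A : ℤ → Set) → (∀ b → ¬ (+ q) ∣ℤ b → A b) → (∀ b → b ≢ + 0 → A b → A (+ q ℤ.* b)) → ∀ b → b ≢ + 0 → A b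
prime-induction {q} prime-q A base step b b≢0 = <-rec (λ N → ∀ b → ℤ.∣ b ∣ ≡ N → b ≢ + 0 → A b) go ℤ.∣ b ∣ b ≡.refl b≢0
  where
  go : ∀ N → (∀ {M} → M ℕ.< N → ∀ b → ℤ.∣ b ∣ ≡ M → b ≢ + 0 → A b) → ∀ b → ℤ.∣ b ∣ ≡ N → b ≢ + 0 → A b
  go N rec b ≡.refl b≢0 with q ℕ∣.∣? ℤ.∣ b ∣
  ... | no ¬d = base b λ d → ¬d (∣⇒∣ᵤ {+ q} {b} d)
  ... | yes d = descend (∣ᵤ⇒∣ {+ q} {b} d)
    where
    descend : (+ q) ∣ℤ b → A b
    descend (c , e) = ≡.subst A e (step c c≢0 (rec smaller c ≡.refl c≢0))
      where
      c≢0 : c ≢ + 0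
      c≢0 z = b≢0 (≡.trans (≡.sym e) (≡.trans (≡.cong (λ z → + q ℤ.* z) z) (ℤP.*-zeroʳ (+ q))))
      smaller : ℤ.∣ c ∣ ℕ.< ℤ.∣ b ∣
      smaller = ≡.subst (ℤ.∣ c ∣ ℕ.<_) (≡.trans (ℕP.*-comm ℤ.∣ c ∣ q) (≡.trans (≡.sym (ℤP.abs-* (+ q) c)) (≡.cong ℤ.∣_∣ e)))
        (ℕP.m<m*n ℤ.∣ c ∣ q ⦃ ℕ.≢-nonZero (λ z → c≢0 (ℤP.∣i∣≡0⇒i≡0 z)) ⦄ (ℕ.nonTrivial⇒n>1 q ⦃ ℕPrime.prime⇒nonTrivial prime-q ⦄))

module ModPrime {q : ℕ} (prime : ℕPrime.Prime q) where
  open Divisibility (ℤR) using (∣-respʳ; ∣-*ʳ)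

  infix 4 q∣_
  q∣_ : ℤ → Set
  q∣ x = (+ q) ∣ℤ x

  q≢0 : + q ≢ + 0
  q≢0 = Divisibility.nonzero (ℤ-prime prime)

  split : ∀ x y → q∣ x ℤ.* y → ¬ q∣ x → ¬ q∣ y → ⊥
  split x y = Divisibility.split (ℤ-prime prime) {x} {y}

  ¬q∣^ : ∀ {x} k → ¬ q∣ x → ¬ q∣ x ^ℤ k
  ¬q∣^ {x} zero nx = Divisibility.nonunit (ℤ-prime prime)
  ¬q∣^ {x} (suc k) nx d = split x (x ^ℤ k) d nx (¬q∣^ {x} k nx)

  ∣-cong : ∀ {x y} K → ((+ q) ^ℤ K) ∣ℤ (x ℤ.- y) → ((+ q) ^ℤ K) ∣ℤ x → ((+ q) ^ℤ K) ∣ℤ y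
  ∣-cong {x} {y} K d e = Divisibility.∣-respʳ ℤR {(+ q) ^ℤ K} (solve 2 (λ x y → x :+ :- (x :+ :- y) := y) ≡.refl x y)
    (Divisibility.∣-+ ℤR {(+ q) ^ℤ K} {x} e (Divisibility.∣-neg ℤR {(+ q) ^ℤ K} {x ℤ.- y} d))
    where open Solver ℤR using (solve; _:+_; :-_; _:=_)

  ℤ/_ : ℕ → Ring
  ℤ/ K = Quotient ℤR (principal ℤR ((+ q) ^ℤ K))

  to : ∀ K → Hom ℤR (ℤ/ K)
  to K = toQuotient ℤR (principal ℤR ((+ q) ^ℤ K))

  zero⇒∣ : ∀ K {x} → CRing._≈_ (ℤ/ K) x (+ 0) → ((+ q) ^ℤ K) ∣ℤ x
  zero⇒∣ K {x} = ∣-respʳ {(+ q) ^ℤ K} (ℤP.+-identityʳ x)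

  ∣⇒zero : ∀ K {x} → ((+ q) ^ℤ K) ∣ℤ x → CRing._≈_ (ℤ/ K) x (+ 0)
  ∣⇒zero K {x} = ∣-respʳ {(+ q) ^ℤ K} (≡.sym (ℤP.+-identityʳ x))

  q^1∣ : ∀ {x} → q∣ x → ((+ q) ^ℤ 1) ∣ℤ x
  q^1∣ (r , e) = r , ≡.trans (≡.cong (λ z → z ℤ.* r) (ℤP.*-identityʳ (+ q))) e

  ∣q^1 : ∀ {x} K → ((+ q) ^ℤ suc K) ∣ℤ x → q∣ x
  ∣q^1 K (r , e) = (+ q) ^ℤ K ℤ.* r , ≡.trans (≡.sym (ℤP.*-assoc (+ q) ((+ q) ^ℤ K) r)) e

  ^ℤ-cancel : ∀ j K x → ((+ q) ^ℤ (j ℕ.+ K)) ∣ℤ ((+ q) ^ℤ j ℤ.* x) → ((+ q) ^ℤ K) ∣ℤ x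
  ^ℤ-cancel zero K x = ∣-respʳ {(+ q) ^ℤ K} (ℤP.*-identityˡ x)
  ^ℤ-cancel (suc j) K x d = ^ℤ-cancel j K x (∣ℤ-cancel {+ q} {(+ q) ^ℤ (j ℕ.+ K)} {(+ q) ^ℤ j ℤ.* x} q≢0
    (∣-respʳ {(+ q) ^ℤ (suc j ℕ.+ K)} (ℤP.*-assoc (+ q) ((+ q) ^ℤ j) x) d))

  -- J is the q-adic valuation of N.
  cofactor-bound : ∀ N → N ≢ + 0 → ∃ λ J → ∀ K x → ((+ q) ^ℤ (J ℕ.+ K)) ∣ℤ (N ℤ.* x) → ((+ q) ^ℤ K) ∣ℤ x
  cofactor-bound = prime-induction prime (λ N → ∃ λ J → ∀ K x → ((+ q) ^ℤ (J ℕ.+ K)) ∣ℤ (N ℤ.* x) → ((+ q) ^ℤ K) ∣ℤ x)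
    (λ N ¬d → 0 , λ K x d → coprime-power {q} {N} prime ¬d K x d)
    λ N _ (J , h) → suc J , λ K x d → h K x (∣ℤ-cancel {+ q} {(+ q) ^ℤ (J ℕ.+ K)} {N ℤ.* x} q≢0 (∣-respʳ {(+ q) ^ℤ (suc J ℕ.+ K)} (ℤP.*-assoc (+ q) N x) d))

  -- s is u/b modulo qᴷ⁺¹. Should the representative be 0 it is moved to qᴷ⁺¹, since the bounds on F
  -- apply to nonzero arguments only.
  quotient-root : ∀ {b u} K → ¬ q∣ b → q∣ u → ∃ λ s → s ≢ + 0 × (q∣ s) × ((+ q) ^ℤ suc K) ∣ℤ (b ℤ.* s ℤ.- u)
  quotient-root {b} {u} K ¬d u₀ = adjust (s₀ ℤP.≟ + 0)
    where
    open Solver ℤR using (solve; _:+_; _:*_; :-_; _:=_)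
    ν₁ = inverse-mod-prime {q} {b} prime ¬d
    ν = inverse-mod {+ q} {b} {proj₁ ν₁} (proj₂ ν₁) (suc K)
    s₀ = u ℤ.* proj₁ ν
    q∣s₀ : q∣ s₀
    q∣s₀ = ∣-*ʳ {+ q} {u} (proj₁ ν) u₀
    s₀-root : ((+ q) ^ℤ suc K) ∣ℤ (b ℤ.* s₀ ℤ.- u)
    s₀-root = ∣-respʳ {(+ q) ^ℤ suc K} (≡.trans (solve 4 (λ b u n o → (b :* n :+ :- o) :* u := b :* (u :* n) :+ :- (o :* u)) ≡.refl b u (proj₁ ν) (+ 1)) (≡.cong (λ z → b ℤ.* s₀ ℤ.- z) (ℤP.*-identityˡ u)))
      (∣-*ʳ {(+ q) ^ℤ suc K} {b ℤ.* proj₁ ν ℤ.- + 1} u (proj₂ ν))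
    adjust : Dec (s₀ ≡ + 0) → ∃ λ s → s ≢ + 0 × (q∣ s) × ((+ q) ^ℤ suc K) ∣ℤ (b ℤ.* s ℤ.- u)
    adjust (no s₀≢0) = s₀ , s₀≢0 , q∣s₀ , s₀-root
    adjust (yes z) = s₁ , Domain.^-nonzero ℤ-domain {+ q} (suc K) q≢0 , ((+ q) ^ℤ K , ≡.refl) ,
      ∣-respʳ {s₁} (≡.trans (solve 4 (λ b s t u → (b :* s :+ :- u) :+ t :* b := b :* (s :+ t) :+ :- u) ≡.refl b s₀ s₁ u) (≡.cong (λ z → b ℤ.* z ℤ.- u) (≡.trans (≡.cong (λ z → z ℤ.+ s₁) z) (ℤP.+-identityˡ s₁))))
        (Divisibility.∣-+ ℤR {s₁} {b ℤ.* s₀ ℤ.- u} s₀-root (b , ≡.refl))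
      where s₁ = (+ q) ^ℤ suc K

  -- Hypotheses on F: F ≡ c sⁿ modulo q, and bounded divisibility at arguments divisible by q.
  module _ {n e : ℕ} {F : ∣ Pol ℤR ∣} (F-deg : deg< ℤR (suc n) F) (F-low : ∀ i → i ℕ.< n → q∣ coef ℤR F i) (F-lead : ¬ q∣ coef ℤR F n)
    (bounded : ∀ s → s ≢ + 0 → q∣ s → ¬ ((+ q) ^ℤ suc e) ∣ℤ value s F) where

    private
      -- Modulo q only the top term, a unit times uⁿ, survives.
      coprime-argument : ∀ u b → ¬ q∣ u → ¬ q∣ homog ℤR n F u b
      coprime-argument u b ¬d d = split (coef ℤR F n) (u ^ℤ n) (∣q^1 0 (zero⇒∣ 1 {coef ℤR F n ℤ.* u ^ℤ n} residue)) F-lead (¬q∣^ {u} n ¬d)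
        where
        module M = CRing (ℤ/ 1)
        ι-to : ∀ c → fn (ι (ℤ/ 1)) c M.≈ c
        ι-to c = M.sym {c} {fn (ι (ℤ/ 1)) c} (ι-unique (to 1) c)
        H = homog ℤR n F u b
        residue : coef ℤR F n ℤ.* u ^ℤ n M.≈ + 0
        residue = M.trans {coef ℤR F n ℤ.* u ^ℤ n} {fn (ι (ℤ/ 1)) (coef ℤR F n) M.* u′} {+ 0}
          (M.*-cong {coef ℤR F n} {fn (ι (ℤ/ 1)) (coef ℤR F n)} {u ^ℤ n} {u′} (M.sym {fn (ι (ℤ/ 1)) (coef ℤR F n)} {coef ℤR F n} (ι-to (coef ℤR F n))) (^-homo (to 1) u n))
          (M.trans {fn (ι (ℤ/ 1)) (coef ℤR F n) M.* u′} {homog (ℤ/ 1) n F u b} {+ 0}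
            (M.sym {homog (ℤ/ 1) n F u b} {fn (ι (ℤ/ 1)) (coef ℤR F n) M.* u′} (homog-lead (ℤ/ 1) n F u b λ i i<n → M.trans {fn (ι (ℤ/ 1)) (coef ℤR F i)} {coef ℤR F i} {+ 0} (ι-to (coef ℤR F i)) (∣⇒zero 1 {coef ℤR F i} (q^1∣ (F-low i i<n)))))
            (M.trans {homog (ℤ/ 1) n F u b} {H} {+ 0} (M.sym {H} {homog (ℤ/ 1) n F u b} (homog-homo (to 1) n F u b)) (∣⇒zero 1 {H} (q^1∣ d))))
          where u′ = SemiringExp._^_ M.semiring u n

      -- If q divides u, the form is bⁿF(s) modulo a power of q, where s ≡ u/b is divisible by q;
      -- there `bounded` applies.
      coprime-denominator : ∀ b → ¬ q∣ b → ∀ u → ¬ ((+ q) ^ℤ suc e) ∣ℤ homog ℤR n F u b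
      coprime-denominator b ¬b u d with q ℕ∣.∣? ℤ.∣ u ∣
      ... | no ¬u = coprime-argument u b (λ h → ¬u (∣⇒∣ᵤ {+ q} {u} h)) (∣q^1 e d)
      ... | yes h = evaluate (quotient-root {b} {u} e ¬b (∣ᵤ⇒∣ {+ q} {u} h))
        where
        module M = CRing (ℤ/ suc e)
        evaluate : (∃ λ s → s ≢ + 0 × (q∣ s) × ((+ q) ^ℤ suc e) ∣ℤ (b ℤ.* s ℤ.- u)) → ⊥
        evaluate (s , s≢0 , q∣s , root) = bounded s s≢0 q∣s (coprime-power {q} {b ^ℤ n} prime (¬q∣^ {b} n ¬b) (suc e) (value s F) (∣-cong {homog ℤR n F u b} (suc e) congruent d))
          where
          w = fn (eval (ι (ℤ/ suc e)) s) F
          b′ = SemiringExp._^_ M.semiring b n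
          value-mod : w M.≈ value s F
          value-mod = M.sym {value s F} {w} (Pol-hom-ext (to (suc e) ∘ₕ eval idℤ s) (eval (ι (ℤ/ suc e)) s)
            (λ r → M.trans {value s (const ℤR r)} {r} {fn (eval (ι (ℤ/ suc e)) s) (const ℤR r)} (Hom.cong (to (suc e)) (eval-const idℤ s r))
              (M.trans {r} {fn (ι (ℤ/ suc e)) r} {fn (eval (ι (ℤ/ suc e)) s) (const ℤR r)} (ι-unique (to (suc e)) r) (M.sym {fn (eval (ι (ℤ/ suc e)) s) (const ℤR r)} {fn (ι (ℤ/ suc e)) r} (eval-const (ι (ℤ/ suc e)) s r))))
            (M.trans {value s (X ℤR)} {s} {fn (eval (ι (ℤ/ suc e)) s) (X ℤR)} (Hom.cong (to (suc e)) (eval-X idℤ s)) (M.sym {fn (eval (ι (ℤ/ suc e)) s) (X ℤR)} {s} (eval-X (ι (ℤ/ suc e)) s))) F)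
          congruent : homog ℤR n F u b M.≈ b ^ℤ n ℤ.* value s F
          congruent = M.trans {homog ℤR n F u b} {homog (ℤ/ suc e) n F u b} {b ^ℤ n ℤ.* value s F} (homog-homo (to (suc e)) n F u b)
            (M.trans {homog (ℤ/ suc e) n F u b} {b′ M.* w} {b ^ℤ n ℤ.* value s F} (homog-ratio (ℤ/ suc e) n F {u} {b} {s} F-deg root)
              (M.*-cong {b′} {b ^ℤ n} {w} {value s F} (M.sym {b ^ℤ n} {b′} (^-homo (to (suc e)) b n)) value-mod))

    -- A factor q common to u and b contributes qⁿ by homogeneity, and b ≠ 0 limits how often this
    -- occurs. The exponent depends on b and not on u.
    homog-bound : ∀ b → b ≢ + 0 → ∃ λ E → ∀ u → ¬ ((+ q) ^ℤ E) ∣ℤ homog ℤR n F u b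
    homog-bound = prime-induction prime (λ b → ∃ λ E → ∀ u → ¬ ((+ q) ^ℤ E) ∣ℤ homog ℤR n F u b)
      (λ b ¬d → suc e , coprime-denominator b ¬d)
      λ b _ (E , h) → n ℕ.+ suc E , step b E h
      where
      step : ∀ b E → (∀ u → ¬ ((+ q) ^ℤ E) ∣ℤ homog ℤR n F u b) → ∀ u → ¬ ((+ q) ^ℤ (n ℕ.+ suc E)) ∣ℤ homog ℤR n F u (+ q ℤ.* b)
      step b E h u d with q ℕ∣.∣? ℤ.∣ u ∣
      ... | no ¬u = coprime-argument u (+ q ℤ.* b) (λ h → ¬u (∣⇒∣ᵤ {+ q} {u} h)) (∣q^1 (n ℕ.+ E) (≡.subst (λ j → ((+ q) ^ℤ j) ∣ℤ homog ℤR n F u (+ q ℤ.* b)) (ℕP.+-suc n E) d))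
      ... | yes q∣u = descend (∣ᵤ⇒∣ {+ q} {u} q∣u)
        where
        descend : q∣ u → ⊥
        descend (u′ , e′) = h u′ (∣ℤ-trans {(+ q) ^ℤ E} {(+ q) ^ℤ suc E} {homog ℤR n F u′ b} (^ℤ-mono (+ q) (ℕP.n≤1+n E)) (^ℤ-cancel n (suc E) (homog ℤR n F u′ b)
          (∣-respʳ {(+ q) ^ℤ (n ℕ.+ suc E)} (≡.trans (homog-cong ℤR n F {u} {+ q ℤ.* u′} {+ q ℤ.* b} (≡.sym e′) ≡.refl) (homog-scale ℤR n F (+ q) u′ b)) d)))

    module _ {N : ℕ} (1≤N : 1 ℕ.≤ N) {c : ℤ} (c≢0 : c ≢ + 0) {G : ∣ Pol ℤR ∣} (top : Top ℤR N c G) (irreducible : NoFactor ℤ-domain N G)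
      (roots : ∀ K → ∃ λ y → ((+ q) ^ℤ K) ∣ℤ value y G) where
      open Field 1≤N c≢0 top irreducible using (L; Fq; reduction; toL)
      private
        module L = CRing L

      -- A root w = A/M in ℚ[s]/(G) gives GH = N·R over ℤ, where R = MⁿF(A/M). At y with G(y)
      -- divisible by a high power of q, R(y) is divisible by almost the same power, against
      -- `homog-bound` for b = M, which is uniform in u = A(y).
      no-root : ∀ w → ¬ fn (eval (ι L) w) F L.≈ L.0#
      no-root w F[w] = clear-denominator (Polℚ-clear w)
        where
        clear-denominator : (∃ λ M → ∃ λ A → M ≢ + 0 × const ℚR (fn ιℚ M) PQ.* w PQ.≈ fn (mapₚ ιℚ) A) → ⊥
        clear-denominator (M , A , M≢0 , e) = clear-cofactor (Polℚ-clear (proj₁ multiple))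
          where
          R = homog (Pol ℤR) n F A (fn (ι (Pol ℤR)) M)
          ιM : fn toL (fn (ι (Pol ℤR)) M) L.≈ fn (ι L) M
          ιM = ι-homo toL M
          ratio : fn (ι L) M L.* w L.≈ fn toL A
          ratio = L.trans {fn (ι L) M L.* w} {const ℚR (fn ιℚ M) L.* w} {fn toL A}
            (L.*-congʳ {w} {fn (ι L) M} {const ℚR (fn ιℚ M)} (L.sym {const ℚR (fn ιℚ M)} {fn (ι L) M} (ι-homo (reduction ∘ₕ constₕ ℚR) M)))
            (Hom.cong reduction e)
          R≈0 : fn toL R L.≈ L.0#
          R≈0 = L.trans {fn toL R} {homog L n F (fn toL A) (fn toL (fn (ι (Pol ℤR)) M))} {L.0#} (homog-homo toL n F A (fn (ι (Pol ℤR)) M))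
            (L.trans {homog L n F (fn toL A) (fn toL (fn (ι (Pol ℤR)) M))} {homog L n F (fn toL A) (fn (ι L) M)} {L.0#} (homog-cong L n F {fn toL A} {fn toL A} {fn toL (fn (ι (Pol ℤR)) M)} {fn (ι L) M} (L.refl {fn toL A}) ιM)
            (L.trans {homog L n F (fn toL A) (fn (ι L) M)} {M^n L.* fn (eval (ι L) w) F} {L.0#} (homog-ratio L n F {fn toL A} {fn (ι L) M} {w} F-deg ratio)
            (L.trans {M^n L.* fn (eval (ι L) w) F} {M^n L.* L.0#} {L.0#} (L.*-congˡ {M^n} {fn (eval (ι L) w) F} {L.0#} F[w]) (L.zeroʳ M^n))))
            where M^n = SemiringExp._^_ L.semiring (fn (ι L) M) n
          multiple : Divisibility._∣_ (Pol ℚR) Fq (fn (mapₚ ιℚ) R)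
          multiple = Divisibility.∣-respʳ (Pol ℚR) (PQ.trans (PQ.+-congˡ (RingProps.-0#≈0# PQ.ring)) (PQ.+-identityʳ _)) R≈0
          clear-cofactor : (∃ λ N → ∃ λ H → N ≢ + 0 × const ℚR (fn ιℚ N) PQ.* proj₁ multiple PQ.≈ fn (mapₚ ιℚ) H) → ⊥
          clear-cofactor (N , H , N≢0 , e′) = contradict (roots (J ℕ.+ E))
            where
            E = proj₁ (homog-bound M M≢0)
            J = proj₁ (cofactor-bound N N≢0)
            integral : G PZ.* H PZ.≈ const ℤR N PZ.* R
            integral = ext ℤR λ i → j-injective (≡.trans (≡.sym (coef-mapₚ ιℚ (G PZ.* H) i)) (≡.trans (coef-cong ℚR rational i) (coef-mapₚ ιℚ (const ℤR N PZ.* R) i)))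
              where
              rational : fn (mapₚ ιℚ) (G PZ.* H) PQ.≈ fn (mapₚ ιℚ) (const ℤR N PZ.* R)
              rational = begin
                fn (mapₚ ιℚ) (G PZ.* H) ≈⟨ *-homo (mapₚ ιℚ) G H ⟩
                Fq PQ.* fn (mapₚ ιℚ) H ≈⟨ PQ.*-congˡ e′ ⟨
                Fq PQ.* (const ℚR (fn ιℚ N) PQ.* proj₁ multiple) ≈⟨ solve 3 (λ F c m → F :* (c :* m) := c :* (F :* m)) PQ.refl Fq (const ℚR (fn ιℚ N)) (proj₁ multiple) ⟩
                const ℚR (fn ιℚ N) PQ.* (Fq PQ.* proj₁ multiple) ≈⟨ PQ.*-cong (PQ.sym (mapₚ-const ιℚ N)) (proj₂ multiple) ⟩
                fn (mapₚ ιℚ) (const ℤR N) PQ.* fn (mapₚ ιℚ) R ≈⟨ *-homo (mapₚ ιℚ) _ _ ⟨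
                fn (mapₚ ιℚ) (const ℤR N PZ.* R) ∎
                where
                open SetoidReasoning PQ.setoid
                open Solver (Pol ℚR) using (solve; _:*_; _:=_)
            contradict : (∃ λ y → ((+ q) ^ℤ (J ℕ.+ E)) ∣ℤ value y G) → ⊥
            contradict (y , d) = proj₂ (homog-bound M M≢0) (value y A) (∣-respʳ {(+ q) ^ℤ E} R[y] (proj₂ (cofactor-bound N N≢0) E (value y R)
              (∣-respʳ {(+ q) ^ℤ (J ℕ.+ E)} G[y]H[y] (∣-*ʳ {(+ q) ^ℤ (J ℕ.+ E)} {value y G} (value y H) d))))
              where
              h = eval idℤ y
              R[y] : value y R ≡ homog ℤR n F (value y A) M
              R[y] = ≡.trans (homog-homo h n F A (fn (ι (Pol ℤR)) M)) (homog-cong ℤR n F {value y A} {value y A} ≡.refl (≡.trans (ι-homo h M) (ι-ℤ M)))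
              G[y]H[y] : value y G ℤ.* value y H ≡ N ℤ.* value y R
              G[y]H[y] = ≡.trans (≡.sym (*-homo h G H)) (≡.trans (Hom.cong h integral) (≡.trans (*-homo h (const ℤR N) R) (≡.cong (λ z → z ℤ.* value y R) (eval-const idℤ y N))))

-- The curve at a prime q that divides Q exactly once

module Ramified {m d : ℕ} (f : Poly m) (hom : Homogeneous d f) (P V : Fin m → ℤ) (f[P]≡0 : evalP ℤR f P ≡ + 0)
  (Q ω : ℤ) (a k n : ℕ) (2≤k : 2 ℕ.≤ k) (degrees : d ℕ.* (a ℕ.+ k) ≡ a ℕ.+ n) (ξ : Fin m → ℤ)
  {p : ℤ} (fib : Fibration.Fibre f hom P V f[P]≡0 Q ω a k n 2≤k degrees ξ p)
  {q : ℕ} (prime : ℕPrime.Prime q) (Q′ : ℤ) (Q≡ : Q ≡ + q ℤ.* Q′) (¬q∣Q′ : ¬ (+ q) ∣ℤ Q′) (¬q∣p : ¬ (+ q) ∣ℤ p)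
  (¬q∣c : ¬ (+ q) ∣ℤ evalP ℤR f V) (¬q∣l : ¬ (+ q) ∣ℤ directional ℤR f P V)
  (shape : (a ≡ 0 × ω ≡ Q) ⊎ (∃ λ a′ → a ≡ suc a′ × ω ≡ + 1)) where

  open Curves f hom P V f[P]≡0 Q ω a k n 2≤k degrees using (l; module Shape)
  open Shape ℤR ξ using (y₁)
  open Fibration f hom P V f[P]≡0 Q ω a k n 2≤k degrees ξ using (pointᵖ; ηᵖ; module Fibre)
  open Fibre fib
  open ModPrime prime
  private
    𝔹 = Pol ℤR
    module B = CRing 𝔹
    module Z = CRing ℤR
    open SemiringExp B.semiring using (_^_; ^-homo-*)
    module DB = Divisibility 𝔹

  F-deg : deg< ℤR (suc n) F
  F-deg = degᵗ F-top

  F-lead : ¬ q∣ coef ℤR F n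
  F-lead d = ¬q∣c (≡.subst (λ z → q∣ z) (lead F-top) d)

  -- Q ≡ 0 modulo q, so x(s) ≡ sᵃ⁺ᵏV there.
  F-low : ∀ i → i ℕ.< n → q∣ coef ℤR F i
  F-low i i<n = proj₁ small , (begin
    + q ℤ.* proj₁ small ≡⟨ proj₂ small ⟩
    coef ℤR (X ℤR ^ a B.* F B.- X ℤR ^ a B.* (X ℤR ^ n B.* constant)) (a ℕ.+ i) ≡⟨ coef-+ ℤR (X ℤR ^ a B.* F) _ (a ℕ.+ i) ⟩
    coef ℤR (X ℤR ^ a B.* F) (a ℕ.+ i) ℤ.+ coef ℤR (B.- (X ℤR ^ a B.* (X ℤR ^ n B.* constant))) (a ℕ.+ i)
      ≡⟨ ≡.cong₂ ℤ._+_ (coef-X^* ℤR a F i) (≡.trans (coef-neg ℤR (X ℤR ^ a B.* (X ℤR ^ n B.* constant)) (a ℕ.+ i)) (≡.cong ℤ.-_ (≡.trans (coef-X^* ℤR a (X ℤR ^ n B.* constant) i) (X^-low n i i<n)))) ⟩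
    coef ℤR F i ℤ.+ + 0 ≡⟨ ℤP.+-identityʳ (coef ℤR F i) ⟩
    coef ℤR F i ∎)
    where
    open ≡.≡-Reasoning
    open Solver 𝔹 using (solve; _:+_; _:*_; :-_; _:=_)
    ιB = fn (ι 𝔹)
    constant = evalP 𝔹 f (ιB ∘ V)
    X^-low : ∀ n i → i ℕ.< n → coef ℤR (X ℤR ^ n B.* constant) i ≡ + 0
    X^-low (suc n) zero _ = ≡.trans (coef-cong ℤR (B.*-assoc (X ℤR) (X ℤR ^ n) constant) 0) (coef-X*-0 ℤR (X ℤR ^ n B.* constant))
    X^-low (suc n) (suc i) (s≤s i<n) = ≡.trans (coef-cong ℤR (B.*-assoc (X ℤR) (X ℤR ^ n) constant) (suc i)) (≡.trans (coef-X*-suc ℤR (X ℤR ^ n B.* constant) i) (X^-low n i i<n))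
    qᴮ = ιB (+ q)
    leading : Fin m → ∣ 𝔹 ∣
    leading j = X ℤR ^ (a ℕ.+ k) B.* ιB (V j)
    ιQ : ιB Q B.≈ qᴮ B.* ιB Q′
    ιQ = B.trans (Hom.cong (ι 𝔹) Q≡) (*-homo (ι 𝔹) (+ q) Q′)
    near : ∀ j → qᴮ DB.∣ (pointᵖ p φ j B.- leading j)
    near j = ιB Q′ B.* (ιB ω B.* y₁ φ j B.+ (X ℤR ^ a B.* (const ℤR p B.+ X ℤR)) B.* ιB (V j)) , B.sym (B.trans
      (B.+-cong (B.+-cong (B.*-congʳ (B.trans (*-homo (ι 𝔹) Q ω) (B.*-congʳ ιQ))) (B.*-congʳ (B.*-congˡ (B.+-congʳ (B.*-congʳ ιQ)))))
        (B.-‿cong (B.*-congʳ (^-homo-* (X ℤR) a k))))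
      (solve 8 (λ q Q w y A t K v → (((q :* Q) :* w) :* y :+ (A :* ((q :* Q) :* t :+ K)) :* v) :+ :- ((A :* K) :* v) := q :* (Q :* (w :* y :+ (A :* t) :* v))) B.refl
        qᴮ (ιB Q′) (ιB ω) (y₁ φ j) (X ℤR ^ a) (const ℤR p B.+ X ℤR) (X ℤR ^ k) (ιB (V j))))
    values : qᴮ DB.∣ (evalP 𝔹 f (pointᵖ p φ) B.- evalP 𝔹 f leading)
    values = evalP-mod 𝔹 f qᴮ near
    powers : evalP 𝔹 f leading B.≈ X ℤR ^ a B.* (X ℤR ^ n B.* constant)
    powers = B.trans (evalP-scale 𝔹 {f} hom (X ℤR ^ (a ℕ.+ k)) (ιB ∘ V)) (B.trans (B.*-congʳ (B.trans (SemiringExp.^-assocʳ B.semiring (X ℤR) (a ℕ.+ k) d)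
        (B.trans (B.reflexive (≡.cong (X ℤR ^_) (≡.trans (ℕP.*-comm (a ℕ.+ k) d) degrees))) (^-homo-* (X ℤR) a n)))) (B.*-assoc _ _ _))
    difference : qᴮ DB.∣ (X ℤR ^ a B.* F B.- X ℤR ^ a B.* (X ℤR ^ n B.* constant))
    difference = DB.∣-respʳ (B.+-cong (B.sym F-eq) (B.-‿cong powers)) values
    small : q∣ coef ℤR (X ℤR ^ a B.* F B.- X ℤR ^ a B.* (X ℤR ^ n B.* constant)) (a ℕ.+ i)
    small = coef ℤR (proj₁ difference) (a ℕ.+ i) , ≡.trans (≡.trans (≡.cong (λ z → z ℤ.* coef ℤR (proj₁ difference) (a ℕ.+ i)) (≡.sym (ι-ℤ (+ q)))) (≡.sym (coef-const* ℤR (fn (ι ℤR) (+ q)) (proj₁ difference) (a ℕ.+ i))))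
      (coef-cong ℤR (B.trans (B.*-congʳ (B.sym (ι-const ℤR (+ q)))) (proj₂ difference)) (a ℕ.+ i))

  private
    k″ = k ℕ.∸ 2
    k≡ : k ≡ 2 ℕ.+ k″
    k≡ = ≡.sym (ℕP.m+[n∸m]≡n 2≤k)
    c = evalP ℤR f V

    point-value : ∀ s {N A} → Q ℤ.* ω ≡ N → s ^ℤ a ≡ A → ∀ i →
      value s (pointᵖ p φ i) ≡ N ℤ.* value s (y₁ φ i) ℤ.+ (A ℤ.* ((+ q ℤ.* Q′) ℤ.* (p ℤ.+ s) ℤ.+ s ^ℤ (2 ℕ.+ k″))) ℤ.* fn (ι ℤR) (V i)
    point-value s {N} {A} N≡ A≡ i = ≡.trans (+-homo e (fn (ι 𝔹) (Q ℤ.* ω) B.* y₁ φ i) ((X ℤR ^ a B.* ηᵖ p) B.* fn (ι 𝔹) (V i)))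
      (≡.cong₂ ℤ._+_ (≡.trans (*-homo e _ (y₁ φ i)) (≡.cong (λ z → z ℤ.* value s (y₁ φ i)) (≡.trans (ι-homo e _) (≡.trans (ι-ℤ _) N≡))))
        (≡.trans (*-homo e (X ℤR ^ a B.* ηᵖ p) (fn (ι 𝔹) (V i))) (≡.cong₂ ℤ._*_ (≡.trans (*-homo e (X ℤR ^ a) (ηᵖ p)) (≡.cong₂ ℤ._*_ (≡.trans (e-X^ a) A≡) e-η)) (ι-homo e (V i)))))
      where
      e = eval idℤ s
      e-X^ : ∀ j → fn e (X ℤR ^ j) ≡ s ^ℤ j
      e-X^ j = ≡.trans (^-homo e (X ℤR) j) (≡.cong (_^ℤ j) (eval-X idℤ s))
      e-η : fn e (ηᵖ p) ≡ (+ q ℤ.* Q′) ℤ.* (p ℤ.+ s) ℤ.+ s ^ℤ (2 ℕ.+ k″)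
      e-η = ≡.trans (+-homo e (fn (ι 𝔹) Q B.* (const ℤR p B.+ X ℤR)) (X ℤR ^ k)) (≡.cong₂ ℤ._+_
        (≡.trans (*-homo e (fn (ι 𝔹) Q) (const ℤR p B.+ X ℤR)) (≡.cong₂ ℤ._*_ (≡.trans (ι-homo e Q) (≡.trans (ι-ℤ Q) Q≡))
          (≡.trans (+-homo e (const ℤR p) (X ℤR)) (≡.cong₂ ℤ._+_ (eval-const idℤ s p) (eval-X idℤ s)))))
        (≡.trans (e-X^ k) (≡.cong (s ^ℤ_) k≡)))

    F-value : ∀ s → s ^ℤ a ℤ.* value s F ≡ evalP ℤR f (λ i → value s (pointᵖ p φ i))
    F-value s = ≡.trans (≡.sym (≡.trans (*-homo e (X ℤR ^ a) F) (≡.cong (λ z → z ℤ.* value s F) (≡.trans (^-homo e (X ℤR) a) (≡.cong (_^ℤ a) (eval-X idℤ s))))))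
      (≡.trans (Hom.cong e F-eq) (evalP-homo e f (pointᵖ p φ)))
      where e = eval idℤ s

    ¬q∣Q′p : ¬ q∣ Q′ ℤ.* p
    ¬q∣Q′p d = split Q′ p d ¬q∣Q′ ¬q∣p

    module M = CRing (ℤ/ 1)

    π : Hom ℤR (ℤ/ 1)
    π = to 1

    π-q : fn π (+ q) M.≈ + 0
    π-q = ∣⇒zero 1 {+ q} (q^1∣ {+ q} (+ 1 , ℤP.*-identityʳ (+ q)))

    residue≢0 : ∀ {x} → ¬ q∣ x → ¬ x M.≈ + 0
    residue≢0 {x} nd e = nd (∣q^1 {x} 0 (zero⇒∣ 1 {x} e))

    unit-bound : ∀ {g} → (q∣ g → ⊥) → ∀ {z} → z ≡ (+ q) ^ℤ d ℤ.* g → ¬ ((+ q) ^ℤ suc d) ∣ℤ z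
    unit-bound {g} ng ≡.refl h = ng (∣q^1 {g} 0 (^ℤ-cancel d 1 g (≡.subst (λ j → ((+ q) ^ℤ j) ∣ℤ ((+ q) ^ℤ d ℤ.* g)) (ℕP.+-comm 1 d) h)))

    transverse : a ≡ 0 → ω ≡ Q → ∀ s s′ → s ≡ + q ℤ.* s′ → ¬ ((+ q) ^ℤ suc d) ∣ℤ value s F
    transverse a≡0 ω≡Q s s′ s≡ = conclude (unit-transverse f hom P V π {+ q} π-q {s} {s′} s≡ Q′ p k″ (λ i → value s (y₁ φ i)) (λ i → value s (pointᵖ p φ i)) shape′)
      where
      Q²≡ : Q ℤ.* ω ≡ (+ q ℤ.* Q′) ℤ.* (+ q ℤ.* Q′)
      Q²≡ = ≡.cong₂ ℤ._*_ Q≡ (≡.trans ω≡Q Q≡)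
      shape′ : ∀ i → value s (pointᵖ p φ i) ≡ ((+ q ℤ.* Q′) ℤ.* (+ q ℤ.* Q′)) ℤ.* value s (y₁ φ i) ℤ.+ ((+ q ℤ.* Q′) ℤ.* (p ℤ.+ s) ℤ.+ s ^ℤ (2 ℕ.+ k″)) ℤ.* fn (ι ℤR) (V i)
      shape′ i = ≡.trans (point-value s {A = + 1} Q²≡ (≡.cong (s ^ℤ_) a≡0) i)
        (≡.cong (λ z → ((+ q ℤ.* Q′) ℤ.* (+ q ℤ.* Q′)) ℤ.* value s (y₁ φ i) ℤ.+ z ℤ.* fn (ι ℤR) (V i)) (ℤP.*-identityˡ ((+ q ℤ.* Q′) ℤ.* (p ℤ.+ s) ℤ.+ s ^ℤ (2 ℕ.+ k″))))
      conclude : (∃ λ g → evalP ℤR f (λ i → value s (pointᵖ p φ i)) ≡ (+ q) ^ℤ d ℤ.* g × g M.≈ SemiringExp._^_ M.semiring (Q′ ℤ.* p) d M.* fn (ι (ℤ/ 1)) c) →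
        ¬ ((+ q) ^ℤ suc d) ∣ℤ value s F
      conclude (g , e , r) = unit-bound {g} ng {value s F} (≡.trans (≡.trans (≡.sym (ℤP.*-identityˡ (value s F))) (≡.cong (λ z → z ℤ.* value s F) (≡.sym (≡.cong (s ^ℤ_) a≡0)))) (≡.trans (F-value s) e))
        where
        Qp^ = SemiringExp._^_ M.semiring (Q′ ℤ.* p) d
        ng : ¬ q∣ g
        ng h = residue≢0 {(Q′ ℤ.* p) ^ℤ d ℤ.* c} (λ h′ → split ((Q′ ℤ.* p) ^ℤ d) c h′ (¬q∣^ {Q′ ℤ.* p} d ¬q∣Q′p) ¬q∣c)
          (M.trans {(Q′ ℤ.* p) ^ℤ d ℤ.* c} {Qp^ M.* fn (ι (ℤ/ 1)) c} {+ 0} (M.*-cong {(Q′ ℤ.* p) ^ℤ d} {Qp^} {c} {fn (ι (ℤ/ 1)) c} (^-homo π (Q′ ℤ.* p) d) (ι-unique π c))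
            (M.trans {Qp^ M.* fn (ι (ℤ/ 1)) c} {g} {+ 0} (M.sym {g} {Qp^ M.* fn (ι (ℤ/ 1)) c} r) (∣⇒zero 1 {g} (q^1∣ {g} h))))

    tangent : ∀ a′ → a ≡ suc a′ → ω ≡ + 1 → ∀ s s′ → s ≢ + 0 → s ≡ + q ℤ.* s′ → ¬ ((+ q) ^ℤ suc d) ∣ℤ value s F
    tangent a′ a≡ ω≡1 s s′ s≢0 s≡ = conclude (unit-tangent f hom P V π {+ q} π-q {s} {s′} s≡ Q′ p k″ a′ y (λ i → value s (pointᵖ p φ i)) (value s h₁) y~P f[y]
        (point-value s (≡.trans (≡.cong₂ ℤ._*_ Q≡ ω≡1) (ℤP.*-identityʳ (+ q ℤ.* Q′))) (≡.cong (s ^ℤ_) a≡)))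
      where
      e = eval idℤ s
      y : Fin m → ℤ
      y i = value s (y₁ φ i)
      iZ = fn (ι ℤR)
      φ′ = s′ ℤ.* value s (tail ℤR φ)
      φ≡ : value s φ ≡ + q ℤ.* φ′
      φ≡ = ≡.trans (value-decompose s φ) (≡.trans (≡.cong₂ (λ x z → x ℤ.+ z ℤ.* value s (tail ℤR φ)) φ-0 s≡)
        (≡.trans (ℤP.+-identityˡ ((+ q ℤ.* s′) ℤ.* value s (tail ℤR φ))) (ℤP.*-assoc (+ q) s′ (value s (tail ℤR φ)))))
      y≡ : ∀ i → y i ≡ iZ (P i) ℤ.+ + q ℤ.* (φ′ ℤ.* iZ (V i) ℤ.+ (iZ (l ℤ.* l) ℤ.* s′) ℤ.* ξ i)
      y≡ i = ≡.trans (+-homo e (fn (ι 𝔹) (P i) B.+ φ B.* fn (ι 𝔹) (V i)) ((fn (ι 𝔹) (l ℤ.* l) B.* X ℤR) B.* const ℤR (ξ i)))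
        (≡.trans (≡.cong₂ ℤ._+_
          (≡.trans (+-homo e (fn (ι 𝔹) (P i)) (φ B.* fn (ι 𝔹) (V i))) (≡.cong₂ ℤ._+_ (ι-homo e (P i)) (≡.trans (*-homo e φ (fn (ι 𝔹) (V i))) (≡.cong₂ ℤ._*_ φ≡ (ι-homo e (V i))))))
          (≡.trans (*-homo e (fn (ι 𝔹) (l ℤ.* l) B.* X ℤR) (const ℤR (ξ i))) (≡.cong₂ ℤ._*_ (≡.trans (*-homo e (fn (ι 𝔹) (l ℤ.* l)) (X ℤR)) (≡.cong₂ ℤ._*_ (ι-homo e (l ℤ.* l)) (≡.trans (eval-X idℤ s) s≡))) (eval-const idℤ s (ξ i)))))
        (solve 7 (λ P q φ v L s x → (P :+ (q :* φ) :* v) :+ (L :* (q :* s)) :* x := P :+ q :* (φ :* v :+ (L :* s) :* x)) ≡.refl (iZ (P i)) (+ q) φ′ (iZ (V i)) (iZ (l ℤ.* l)) s′ (ξ i)))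
        where open Solver ℤR using (solve; _:+_; _:*_; _:=_)
      y~P : ∀ i → y i M.≈ fn (ι (ℤ/ 1)) (P i)
      y~P i = π-congruent f hom P V π {+ q} π-q {s} {s′} s≡ Q′ p k″ (P i) (y≡ i)
      f[y] : evalP ℤR f y ≡ s ^ℤ (3 ℕ.+ a′) ℤ.* value s h₁
      f[y] = ≡.trans (≡.sym (evalP-homo e f (y₁ φ))) (≡.trans (Hom.cong e y₁-eq) (≡.trans (*-homo e (X ℤR ^ (2 ℕ.+ a)) h₁)
        (≡.cong (λ z → z ℤ.* value s h₁) (≡.trans (^-homo e (X ℤR) (2 ℕ.+ a)) (≡.cong₂ _^ℤ_ (eval-X idℤ s) (≡.cong (2 ℕ.+_) a≡))))))
      conclude : (∃ λ g → evalP ℤR f (λ i → value s (pointᵖ p φ i)) ≡ (+ q) ^ℤ d ℤ.* (s ^ℤ suc a′ ℤ.* g) ×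
          (Q′ ℤ.* g) M.≈ (Q′ ℤ.* p) M.* ((Q′ ^ℤ d) M.* fn (ι (ℤ/ 1)) (directional ℤR f P V))) → ¬ ((+ q) ^ℤ suc d) ∣ℤ value s F
      conclude (g , e′ , r) = unit-bound {g} ng {value s F} (Domain.*-cancel ℤ-domain {s ^ℤ suc a′} (Domain.^-nonzero ℤ-domain {s} (suc a′) s≢0)
          (≡.trans (≡.cong (λ z → z ℤ.* value s F) (≡.cong (s ^ℤ_) (≡.sym a≡))) (≡.trans (F-value s) (≡.trans e′
            (solve 3 (λ q s g → q :* (s :* g) := s :* (q :* g)) ≡.refl ((+ q) ^ℤ d) (s ^ℤ suc a′) g)))))
        where
        open Solver ℤR using (solve; _:*_; _:=_)
        unit = (Q′ ℤ.* p) ℤ.* (Q′ ^ℤ d ℤ.* l)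
        unit′ = (Q′ ℤ.* p) M.* ((Q′ ^ℤ d) M.* fn (ι (ℤ/ 1)) l)
        ng : ¬ q∣ g
        ng h = residue≢0 {unit} (λ h′ → split (Q′ ℤ.* p) (Q′ ^ℤ d ℤ.* l) h′ ¬q∣Q′p λ h″ → split (Q′ ^ℤ d) l h″ (¬q∣^ {Q′} d ¬q∣Q′) ¬q∣l)
          (M.trans {unit} {unit′} {+ 0} (M.*-congˡ {Q′ ℤ.* p} {Q′ ^ℤ d ℤ.* l} {(Q′ ^ℤ d) M.* fn (ι (ℤ/ 1)) l} (M.*-congˡ {Q′ ^ℤ d} {l} {fn (ι (ℤ/ 1)) l} (ι-unique π l)))
            (M.trans {unit′} {Q′ ℤ.* g} {+ 0} (M.sym {Q′ ℤ.* g} {unit′} r) (∣⇒zero 1 {Q′ ℤ.* g} (q^1∣ {Q′ ℤ.* g} (Divisibility.∣-*ˡ ℤR {+ q} {g} Q′ h)))))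

  bounded : ∀ s → s ≢ + 0 → q∣ s → ¬ ((+ q) ^ℤ suc d) ∣ℤ value s F
  bounded s s≢0 (s′ , e) = by-shape shape
    where
    by-shape : (a ≡ 0 × ω ≡ Q) ⊎ (∃ λ a′ → a ≡ suc a′ × ω ≡ + 1) → ¬ ((+ q) ^ℤ suc d) ∣ℤ value s F
    by-shape (inj₁ (a≡0 , ω≡Q)) = transverse a≡0 ω≡Q s s′ (≡.sym e)
    by-shape (inj₂ (a′ , a≡ , ω≡1)) = tangent a′ a≡ ω≡1 s s′ s≢0 (≡.sym e)

open import Algebra.Morphism.Structures using (IsRingIsomorphism)
-- The sequence of number fields

opaque
  -- Euclid's argument: a prime factor of N! + 1.
  prime-above : ∀ N → ∃ λ p → ℕPrime.Prime p × N ℕ.< p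
  prime-above N = first (Factorisation.factorise (suc (N ℕ.!)))
    where
    first : Factorisation.PrimeFactorisation (suc (N ℕ.!)) → ∃ λ p → ℕPrime.Prime p × N ℕ.< p
    first record { factors = [] ; isFactorisation = e } = ⊥-elim (ℕP.<⇒≢ (ℕP.1≤n! N) (≡.sym (ℕP.suc-injective e)))
    first record { factors = p ∷ ps ; isFactorisation = e ; factorsPrime = prime-p ∷ _ } = p , prime-p , ℕP.≰⇒> λ p≤N →
      ℕ.nonTrivial⇒≢1 ⦃ ℕPrime.prime⇒nonTrivial prime-p ⦄ (ℕ∣.∣1⇒≡1 (ℕ∣.∣m+n∣m⇒∣n
        (≡.subst (p ℕ∣.∣_) (≡.sym (≡.trans (ℕP.+-comm (N ℕ.!) 1) e)) (ℕ∣.m∣m*n (ℕList.product ps))) (p∣N! prime-p p≤N)))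
      where
      p∣N! : ∀ {p} → ℕPrime.Prime p → p ℕ.≤ N → p ℕ∣.∣ N ℕ.!
      p∣N! {zero} prime-0 _ = ⊥-elim (ℕPrime.¬prime[0] prime-0)
      p∣N! {suc p} _ p≤N = ℕ∣.∣-trans (ℕ∣.m∣m*n (p ℕ.!)) (ℕ∣.m≤n⇒m!∣n! p≤N)

-- The multiplier ω. At a prime dividing Q, the point divided by that prime has to reduce to a
-- multiple of V if a = 0, which requires another factor Q on y₁; for a > 0 it has to reduce to a
-- multiple of P.
choose : ℕ → ℤ → ℤ
choose zero Q = Q
choose (suc _) Q = + 1

choose-shape : ∀ a Q → (a ≡ 0 × choose a Q ≡ Q) ⊎ (∃ λ a′ → a ≡ suc a′ × choose a Q ≡ + 1)
choose-shape zero Q = inj₁ (≡.refl , ≡.refl)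
choose-shape (suc a) Q = inj₂ (a , ≡.refl , ≡.refl)

choose≢0 : ∀ a {Q} → Q ≢ + 0 → choose a Q ≢ + 0
choose≢0 zero Q≢0 = Q≢0
choose≢0 (suc a) Q≢0 = suc≢0

module _ {R S : Ring} (g : Hom R S) where
  private
    module R = CRing R
    module S = CRing S

  eval-homo : ∀ w F → fn g (fn (eval (ι R) w) F) S.≈ fn (eval (ι S) (fn g w)) F
  eval-homo w = Pol-hom-ext (g ∘ₕ eval (ι R) w) (eval (ι S) (fn g w))
    (λ r → S.trans (Hom.cong g (eval-const (ι R) w r)) (S.trans (ι-homo g r) (S.sym (eval-const (ι S) _ r))))
    (S.trans (Hom.cong g (eval-X (ι R) w)) (S.sym (eval-X (ι S) _)))

  root-forward : ∀ w F → fn (eval (ι R) w) F R.≈ R.0# → fn (eval (ι S) (fn g w)) F S.≈ S.0#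
  root-forward w F e = S.trans (S.sym (eval-homo w F)) (S.trans (Hom.cong g e) (0-homo g))

  root-backward : (∀ {x y} → fn g x S.≈ fn g y → x R.≈ y) → ∀ w w′ F → fn g w S.≈ w′ → fn (eval (ι S) w′) F S.≈ S.0# → fn (eval (ι R) w) F R.≈ R.0#
  root-backward injective w w′ F e z = injective (S.trans (eval-homo w F) (S.trans (at-cong F) (S.trans z (S.sym (0-homo g)))))
    where
    at-cong : ∀ F → fn (eval (ι S) (fn g w)) F S.≈ fn (eval (ι S) w′) F
    at-cong = Pol-hom-ext (eval (ι S) (fn g w)) (eval (ι S) w′) (λ r → S.trans (eval-const (ι S) _ r) (S.sym (eval-const (ι S) _ r)))
      (S.trans (eval-X (ι S) _) (S.trans e (S.sym (eval-X (ι S) _))))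

root-of-image : ∀ {S : Ring} (h : Hom (Pol ℤR) S) (let open CRing S) F → fn h F ≈ 0# → fn (eval (ι S) (fn h (X ℤR))) F ≈ 0#
root-of-image {S} h F e = trans (sym (Pol-hom-ext h (eval (ι S) (fn h (X ℤR)))
  (λ r → trans (Hom.cong h (Hom.cong (constₕ ℤR) (≡.sym (ι-ℤ r)))) (trans (ι-homo (h ∘ₕ constₕ ℤR) r) (sym (eval-const (ι S) _ r)))) (sym (eval-X (ι S) _)) F)) e
  where open CRing S

module Family {m d : ℕ} (f : Poly m) (hom : Homogeneous d f) (2≤d : 2 ℕ.≤ d) (primef : Divisibility.Prime (Zm m) (hat f))
  (P V : Fin m → ℤ) (f[P]≡0 : evalP ℤR f P ≡ + 0) (P≢0 : ∃ λ j → P j ≢ + 0) (f[V]≢0 : evalP ℤR f V ≢ + 0) (l≢0 : directional ℤR f P V ≢ + 0)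
  (a k n : ℕ) (2≤k : 2 ℕ.≤ k) (2≤n : 2 ℕ.≤ n) (degrees : d ℕ.* (a ℕ.+ k) ≡ a ℕ.+ n) where

  private
    c l : ℤ
    c = evalP ℤR f V
    l = directional ℤR f P V

  record Stage (Q : ℤ) : Set where
    field
      p : ℕ
      prime : ℕPrime.Prime p
      -- Keeps p prime to every nonzero one of Q, f(V) and l. In the chain below it also exceeds all
      -- earlier primes, since these divide Q.
      large : ℤ.∣ Q ∣ ℕ.+ (ℤ.∣ c ∣ ℕ.+ ℤ.∣ l ∣) ℕ.< p
      ξ : Fin m → ℤ
      fib : Fibration.Fibre f hom P V f[P]≡0 Q (choose a Q) a k n 2≤k degrees ξ (+ p)
      irreducible : NoFactor ℤ-domain n (Fibration.Fibre.F fib)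
      roots : ∀ K → ∃ λ y → ((+ p) ^ℤ K) ∣ℤ value y (Fibration.Fibre.F fib)
      dualV : Dual ℤR (vectorsℤ P V ξ)
      dualV≢0 : Dual.Δ dualV ≢ + 0

  module Construction (Q : ℤ) (Q≢0 : Q ≢ + 0)
    (sp : Specialise.Specialised {f = f} hom 2≤d primef P V f[P]≡0 P≢0 f[V]≢0 l≢0 Q (choose a Q) Q≢0 (choose≢0 a Q≢0) a k n 2≤k degrees) where
    open Specialise.Specialised sp
    μ≢0 : Curves.μ f hom P V f[P]≡0 Q (choose a Q) a k n 2≤k degrees ≢ + 0
    μ≢0 = GenericIrreducible.μ≢0 {f = f} hom (ℕP.≤-trans (s≤s z≤n) 2≤d) primef P V f[P]≡0 f[V]≢0 l≢0 Q (choose a Q) Q≢0 (choose≢0 a Q≢0) a k n 2≤k degrees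
    open Fibres {f = f} hom P V f[P]≡0 f[V]≢0 Q (choose a Q) Q≢0 a k n 2≤k degrees μ≢0 ξ C W F-width dual₁ dual₁≢0 dual₂ dual₂≢0
    build-stage : (∃ λ p → ℕPrime.Prime p × threshold ℕ.+ (ℤ.∣ Q ∣ ℕ.+ (ℤ.∣ c ∣ ℕ.+ ℤ.∣ l ∣)) ℕ.< p) → Stage Q
    build-stage (p , prime-p , large) = record
      { p = p ; prime = prime-p ; large = ℕP.≤-<-trans (ℕP.m≤n+m _ threshold) large ; ξ = ξ
      ; fib = Fibration.fibre f hom P V f[P]≡0 Q (choose a Q) a k n 2≤k degrees ξ C (+ p)
      ; irreducible = Fₚ-irreducible ; roots = roots ; dualV = dualV ; dualV≢0 = dualV≢0 }
      where open AtPrime {p} prime-p (ℕP.≤-<-trans (ℕP.m≤m+n threshold _) large) using (Fₚ-irreducible; roots)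

  opaque
    stage : ∀ Q → Q ≢ + 0 → Stage Q
    stage Q Q≢0 = build-stage (prime-above _)
      where open Construction Q Q≢0 (Specialise.specialised {f = f} hom 2≤d primef P V f[P]≡0 P≢0 f[V]≢0 l≢0 Q (choose a Q) Q≢0 (choose≢0 a Q≢0) a k n 2≤k degrees)

  -- Q is the product of the primes chosen so far, so that each later curve degenerates at each
  -- earlier prime.
  chain : ℕ → ∃ λ Q → Q ≢ + 0
  chain zero = + 1 , suc≢0
  chain (suc i) = let (Q , Q≢0) = chain i ; p = Stage.p (stage Q Q≢0) in
    + p ℤ.* Q , Domain.*-nonzero ℤ-domain {+ p} {Q} (Divisibility.nonzero (ℤ-prime (Stage.prime (stage Q Q≢0)))) Q≢0

  q : ℕ → ℤ
  q i = proj₁ (chain i)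

  stages : ∀ i → Stage (q i)
  stages i = stage (proj₁ (chain i)) (proj₂ (chain i))

  p : ℕ → ℕ
  p i = Stage.p (stages i)

  module St i = Stage (stages i)
  module Fib i = Fibration.Fibre (St.fib i)

  module N i = NewField f hom P V f[P]≡0 (q i) (choose a (q i)) a k n 2≤k degrees (St.ξ i) (St.fib i) (St.irreducible i) 2≤n f[V]≢0 l≢0
    (Domain.*-nonzero ℤ-domain {q i} {choose a (q i)} (proj₂ (chain i)) (choose≢0 a (proj₂ (chain i)))) (St.dualV i) (St.dualV≢0 i)

  private
    q<p : ∀ i → ℤ.∣ q i ∣ ℕ.< p i
    q<p i = ℕP.≤-<-trans (ℕP.m≤m+n _ _) (St.large i)

    ¬∣small : ∀ i {x} → x ≢ + 0 → ℤ.∣ x ∣ ℕ.< p i → ¬ (+ p i) ∣ℤ x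
    ¬∣small i {x} x≢0 small d = x≢0 (∣∧<⇒≡0 {p i} {x} d small)

    ¬p∣later : ∀ i t → p i ℕ.≤ ℤ.∣ q (suc i ℕ.+ t) ∣ → ¬ (+ p i) ∣ℤ (+ p (suc i ℕ.+ t))
    ¬p∣later i t p≤q d with ℕPrime.prime⇒irreducible (St.prime (suc i ℕ.+ t)) (∣⇒∣ᵤ {+ p i} {+ p (suc i ℕ.+ t)} d)
    ... | inj₁ e = ℕ.nonTrivial⇒≢1 ⦃ ℕPrime.prime⇒nonTrivial (St.prime i) ⦄ e
    ... | inj₂ e = ℕP.<⇒≱ (q<p (suc i ℕ.+ t)) (≡.subst (ℕ._≤ ℤ.∣ q (suc i ℕ.+ t) ∣) e p≤q)

    multiple-large : ∀ i {x} t → x ≡ + p i ℤ.* t → x ≢ + 0 → p i ℕ.≤ ℤ.∣ x ∣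
    multiple-large i {x} t e x≢0 = ≡.subst (p i ℕ.≤_) (≡.trans (≡.sym (ℤP.abs-* (+ p i) t)) (≡.cong ℤ.∣_∣ (≡.sym e)))
      (ℕP.m≤m*n (p i) ℤ.∣ t ∣ ⦃ ℕ.≢-nonZero (λ z → x≢0 (≡.trans e (≡.trans (≡.cong (λ z → + p i ℤ.* z) (ℤP.∣i∣≡0⇒i≡0 z)) (ℤP.*-zeroʳ (+ p i))))) ⦄)

    -- The further factors of Q are the earlier Q, smaller than pᵢ, and primes larger than pᵢ.
    cofactor : ∀ i t → ∃ λ Q′ → q (suc i ℕ.+ t) ≡ + p i ℤ.* Q′ × ¬ (+ p i) ∣ℤ Q′
    cofactor i zero = q i , ≡.cong q (≡.cong suc (ℕP.+-identityʳ i)) , ¬∣small i (proj₂ (chain i)) (q<p i)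
    cofactor i (suc t) = step (cofactor i t)
      where
      j = suc i ℕ.+ t
      open Solver ℤR using (solve; _:*_; _:=_)
      step : (∃ λ Q′ → q j ≡ + p i ℤ.* Q′ × ¬ (+ p i) ∣ℤ Q′) → ∃ λ Q′ → q (suc i ℕ.+ suc t) ≡ + p i ℤ.* Q′ × ¬ (+ p i) ∣ℤ Q′
      step (Q′ , e , nd) = + p j ℤ.* Q′ ,
        ≡.trans (≡.cong q (ℕP.+-suc (suc i) t)) (≡.trans (≡.cong (λ z → + p j ℤ.* z) e) (solve 3 (λ r s t → r :* (s :* t) := s :* (r :* t)) ≡.refl (+ p j) (+ p i) Q′)) ,
        λ d → Divisibility.split (ℤ-prime (St.prime i)) {+ p j} {Q′} d (¬p∣later i t (multiple-large i Q′ e (proj₂ (chain j)))) nd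

  later-no-root : ∀ i t w → ¬ CRing._≈_ (N.L i) (fn (eval (ι (N.L i)) w) (Fib.F (suc i ℕ.+ t))) (CRing.0# (N.L i))
  later-no-root i t = with-cofactor (cofactor i t)
    where
    j = suc i ℕ.+ t
    with-cofactor : (∃ λ Q′ → q j ≡ + p i ℤ.* Q′ × ¬ (+ p i) ∣ℤ Q′) →
      ∀ w → ¬ CRing._≈_ (N.L i) (fn (eval (ι (N.L i)) w) (Fib.F j)) (CRing.0# (N.L i))
    with-cofactor (Q′ , e , nd) = ModPrime.no-root (St.prime i) {n} {d} {Fib.F j} F-deg F-low F-lead bounded
      (ℕP.≤-trans (s≤s z≤n) 2≤n) f[V]≢0 (Fib.F-top i) (St.irreducible i) (St.roots i)
      where
      large = St.large i
      open Ramified f hom P V f[P]≡0 (q j) (choose a (q j)) a k n 2≤k degrees (St.ξ j) (St.fib j) (St.prime i) Q′ e nd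
        (¬p∣later i t (multiple-large i Q′ e (proj₂ (chain j))))
        (¬∣small i f[V]≢0 (ℕP.≤-<-trans (ℕP.≤-trans (ℕP.m≤m+n ℤ.∣ c ∣ ℤ.∣ l ∣) (ℕP.m≤n+m _ ℤ.∣ q i ∣)) large))
        (¬∣small i l≢0 (ℕP.≤-<-trans (ℕP.≤-trans (ℕP.m≤n+m ℤ.∣ l ∣ ℤ.∣ c ∣) (ℕP.m≤n+m _ ℤ.∣ q i ∣)) large))
        (choose-shape a (q j))

  own-root : ∀ i → CRing._≈_ (N.L i) (fn (eval (ι (N.L i)) (fn (N.toL i) (X ℤR))) (Fib.F i)) (CRing.0# (N.L i))
  own-root i = root-of-image (N.toL i) (Fib.F i) (N.toL-F i)

  module Iso (i j : ℕ) (iso : N.numberField i ≅ N.numberField j) where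
    module I = IsRingIsomorphism (proj₂ iso)
    g : Hom (N.L i) (N.L j)
    g = record { fn = proj₁ iso ; cong = I.⟦⟧-cong ; +-homo = I.+-homo ; *-homo = I.*-homo ; 1-homo = I.1#-homo }

    transported : CRing._≈_ (N.L j) (fn (eval (ι (N.L j)) (fn g (fn (N.toL i) (X ℤR)))) (Fib.F i)) (CRing.0# (N.L j))
    transported = root-forward g (fn (N.toL i) (X ℤR)) (Fib.F i) (own-root i)

    reflected : ∃ λ w → CRing._≈_ (N.L i) (fn (eval (ι (N.L i)) w) (Fib.F j)) (CRing.0# (N.L i))
    reflected = let (w , e) = I.surjective (fn (N.toL j) (X ℤR)) in
      w , root-backward g (λ {x} {y} → I.injective {x} {y}) w (fn (N.toL j) (X ℤR)) (Fib.F j) (e {w} (CRing.refl (N.L i) {w})) (own-root j)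

  private
    Root : ℕ → ℕ → Set
    Root i j = ∃ λ w → CRing._≈_ (N.L i) (fn (eval (ι (N.L i)) w) (Fib.F j)) (CRing.0# (N.L i))

    earlier : ∀ i j → i ℕ.< j → ¬ Root i j
    earlier i j i<j = by-difference (ℕP.m≤n⇒∃[o]m+o≡n i<j)
      where
      by-difference : (∃ λ t → suc i ℕ.+ t ≡ j) → ¬ Root i j
      by-difference (t , e) (w , z) = later-no-root i t w (≡.subst (λ j → CRing._≈_ (N.L i) (fn (eval (ι (N.L i)) w) (Fib.F j)) (CRing.0# (N.L i))) (≡.sym e) z)

  -- An isomorphism moves the root of Fᵢ to the other field and, by surjectivity, the root of Fⱼ
  -- back. In either order the field of smaller index receives a root of the later polynomial, which
  -- it does not have.
  distinct : ∀ i j → N.numberField i ≅ N.numberField j → i ≡ j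
  distinct i j iso = compare (ℕP.<-cmp i j)
    where
    compare : Tri (i ℕ.< j) (i ≡ j) (j ℕ.< i) → i ≡ j
    compare (tri≈ _ e _) = e
    compare (tri< i<j _ _) = ⊥-elim (earlier i j i<j (Iso.reflected i j iso))
    compare (tri> _ _ j<i) = ⊥-elim (earlier j i j<i (fn (Iso.g i j iso) (fn (N.toL i) (X ℤR)) , Iso.transported i j iso))

  infinitely-many : Dinf f n
  infinitely-many = N.numberField , (λ i → N.new-field i , ≡.refl) , distinct

-- From the rational point to the family

eval-ℚ : ∀ {m} (f : Poly m) x → NumberField.eval rationals f x ≡ evalP ℚR f x
eval-ℚ [] x = ≡.refl
eval-ℚ ((b , α) ∷ f) x = ≡.cong₂ (λ u v → u ℚ.* monomial ℚR α x ℚ.+ v) (≡.sym (ι-ℚ b)) (eval-ℚ f x)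

ℚ-clear-vector : ∀ {m} (x : Fin m → ℚ) → ∃ λ N → ∃ λ (P : Fin m → ℤ) → N ≢ + 0 × (∀ i → fn (ι ℚR) N ℚ.* x i ≡ fn (ι ℚR) (P i))
ℚ-clear-vector {zero} x = + 1 , (λ ()) , suc≢0 , λ ()
ℚ-clear-vector {suc m} x with ℚ-clear (x zero) | ℚ-clear-vector (x ∘ suc)
... | N₀ , c , N₀≢0 , e₀ | N , P , N≢0 , e = N₀ ℤ.* N , P′ , Domain.*-nonzero ℤ-domain {N₀} {N} N₀≢0 N≢0 , cleared
  where
  j = fn (ι ℚR)
  open Solver ℚR using (solve; _:*_; _:=_)
  P′ : Fin (suc m) → ℤ
  P′ zero = N ℤ.* c
  P′ (suc i) = N₀ ℤ.* P i
  cleared : ∀ i → j (N₀ ℤ.* N) ℚ.* x i ≡ j (P′ i)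
  cleared zero = ≡.trans (≡.cong (ℚ._* x zero) (*-homo (ι ℚR) N₀ N)) (≡.trans (solve 3 (λ a b x → (a :* b) :* x := b :* (a :* x)) ≡.refl (j N₀) (j N) (x zero))
    (≡.trans (≡.cong (j N ℚ.*_) e₀) (≡.sym (*-homo (ι ℚR) N c))))
  cleared (suc i) = ≡.trans (≡.cong (ℚ._* x (suc i)) (*-homo (ι ℚR) N₀ N)) (≡.trans (solve 3 (λ a b x → (a :* b) :* x := a :* (b :* x)) ≡.refl (j N₀) (j N) (x (suc i)))
    (≡.trans (≡.cong (j N₀ ℚ.*_) (e i)) (≡.sym (*-homo (ι ℚR) N₀ (P i)))))

module IntegralPoint {m d : ℕ} {f : Poly m} (hom : Homogeneous d f) (pt : Point rationals m) (on : OnHypersurface f pt) (ns : NonSingular f pt) where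
  private
    x = Point.coord pt
    cl = ℚ-clear-vector x
    N = proj₁ cl
    ιN = fn (ι ℚR) N
    ιN≢0 : ιN ≢ ℚ.0ℚ
    ιN≢0 = j-nonzero (proj₁ (proj₂ (proj₂ cl)))
    cleared : ∀ i → ιN ℚ.* x i ≡ fn (ι ℚR) (proj₁ (proj₂ cl) i)
    cleared = proj₂ (proj₂ (proj₂ cl))
    open Domain ℚ-domain using (*-nonzero; ^-nonzero)
    open Sums ℚR using (sum-single)

  P : Fin m → ℤ
  P = proj₁ (proj₂ cl)

  f[P]≡0 : evalP ℤR f P ≡ + 0
  f[P]≡0 = ι-ℚ-injective (begin
    fn (ι ℚR) (evalP ℤR f P) ≡⟨ evalP-homo (ι ℚR) f P ⟩
    evalP ℚR f (fn (ι ℚR) ∘ P) ≡⟨ evalP-cong ℚR f cleared ⟨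
    evalP ℚR f (λ i → ιN ℚ.* x i) ≡⟨ evalP-scale ℚR {f} hom ιN x ⟩
    ιN^d ℚ.* evalP ℚR f x ≡⟨ ≡.cong (ιN^d ℚ.*_) (≡.trans (≡.sym (eval-ℚ f x)) on) ⟩
    ιN^d ℚ.* ℚ.0ℚ ≡⟨ ℚP.*-zeroʳ ιN^d ⟩
    ℚ.0ℚ ∎)
    where
    open ≡.≡-Reasoning
    ιN^d = SemiringExp._^_ (CRing.semiring ℚR) ιN d

  P≢0 : ∃ λ j → P j ≢ + 0
  P≢0 = proj₁ (Point.nonzero pt) , λ e → *-nonzero ιN≢0 (proj₂ (Point.nonzero pt)) (≡.trans (cleared (proj₁ (Point.nonzero pt))) (≡.trans (≡.cong (fn (ι ℚR)) e) (0-homo (ι ℚR))))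

  e : Fin m → ℤ
  e = δ ℤR (proj₁ ns)

  private
    δ-same : ∀ {k} (j : Fin k) → δ ℤR j j ≡ + 1
    δ-same zero = ≡.refl
    δ-same (suc j) = δ-same j
    δ-other : ∀ {k} (i j : Fin k) → i ≢ j → δ ℤR i j ≡ + 0
    δ-other zero zero ne = ⊥-elim (ne ≡.refl)
    δ-other zero (suc j) ne = ≡.refl
    δ-other (suc i) zero ne = ≡.refl
    δ-other (suc i) (suc j) ne = δ-other i j λ { ≡.refl → ne ≡.refl }

    partial : directional ℚR f x (fn (ι ℚR) ∘ e) ≡ evalP ℚR (∂ (proj₁ ns) f) x
    partial = ≡.trans (sum-single (λ j → evalP ℚR (∂ j f) x ℚ.* fn (ι ℚR) (e j)) (proj₁ ns)
        (λ j ne → ≡.trans (≡.cong (evalP ℚR (∂ j f) x ℚ.*_) (≡.trans (≡.cong (fn (ι ℚR)) (δ-other (proj₁ ns) j ne)) (0-homo (ι ℚR)))) (ℚP.*-zeroʳ (evalP ℚR (∂ j f) x))))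
      (≡.trans (≡.cong (evalP ℚR (∂ (proj₁ ns) f) x ℚ.*_) (≡.trans (≡.cong (fn (ι ℚR)) (δ-same (proj₁ ns))) (1-homo (ι ℚR)))) (ℚP.*-identityʳ (evalP ℚR (∂ (proj₁ ns) f) x)))

  slope≢0 : directional ℤR f P e ≢ + 0
  slope≢0 z = *-nonzero (^-nonzero d ιN≢0) (λ z′ → proj₂ ns (≡.trans (eval-ℚ (∂ (proj₁ ns) f) x) (≡.trans (≡.sym partial) z′))) (begin
    ιN^d ℚ.* directional ℚR f x v ≡⟨ directional-scale ℚR {f = f} hom ιN x v ⟨
    ιN ℚ.* directional ℚR f (λ i → ιN ℚ.* x i) v ≡⟨ ≡.cong (ιN ℚ.*_) (≡.trans (directional-cong ℚR f {λ i → ιN ℚ.* x i} {fn (ι ℚR) ∘ P} {v} {v} cleared (λ _ → ≡.refl)) (≡.trans (≡.sym (directional-homo (ι ℚR) f P e)) (≡.trans (≡.cong (fn (ι ℚR)) z) (0-homo (ι ℚR))))) ⟩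
    ιN ℚ.* ℚ.0ℚ ≡⟨ ℚP.*-zeroʳ ιN ⟩
    ℚ.0ℚ ∎)
    where
    open ≡.≡-Reasoning
    v = fn (ι ℚR) ∘ e
    ιN^d = SemiringExp._^_ (CRing.semiring ℚR) ιN d

  -- f and V ↦ D_V f(P) are both nonzero polynomials in V, the second because P is non-singular, and
  -- a point where their product is nonzero serves.
  direction : ¬ CRing._≈_ (Zm m) (hat f) (CRing.0# (Zm m)) → ∃ λ V → evalP ℤR f V ≢ + 0 × directional ℤR f P V ≢ + 0
  direction f≉0 = split (nonzero-point m (hat f A.* slope) (Domain.*-nonzero (Zm-domain m) f≉0 slope≉0))
    where
    module A = CRing (Zm m)
    slope : A.Carrier
    slope = directional (Zm m) f (fn (ι (Zm m)) ∘ P) (var m)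
    value-slope : ∀ ξ → fn (evZ {m} ℤR ξ) slope ≡ directional ℤR f P ξ
    value-slope ξ = ≡.trans (directional-homo (evZ {m} ℤR ξ) f (fn (ι (Zm m)) ∘ P) (var m))
      (directional-cong ℤR f (λ i → ≡.trans (ι-homo (evZ {m} ℤR ξ) (P i)) (ι-ℤ (P i))) (evZ-var ℤR ξ))
    slope≉0 : ¬ slope A.≈ A.0#
    slope≉0 z = slope≢0 (≡.trans (≡.sym (value-slope e)) (≡.trans (Hom.cong (evZ {m} ℤR e) z) (0-homo (evZ {m} ℤR e))))
    split : (∃ λ ξ → fn (evZ {m} ℤR ξ) (hat f A.* slope) ≢ + 0) → ∃ λ V → evalP ℤR f V ≢ + 0 × directional ℤR f P V ≢ + 0
    split (ξ , nz) = ξ , (λ z → Domain.factorˡ-nonzero ℤ-domain {b = directional ℤR f P ξ} product nz z) , λ z → Domain.factorʳ-nonzero ℤ-domain {a = evalP ℤR f ξ} product nz z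
      where
      product : evalP ℤR f ξ ℤ.* directional ℤR f P ξ ≡ fn (evZ {m} ℤR ξ) (hat f A.* slope)
      product = ≡.sym (≡.trans (*-homo (evZ {m} ℤR ξ) (hat f) slope) (≡.cong₂ ℤ._*_ (evZ-hat ℤR f ξ) (value-slope ξ)))

irreducible⇒prime : ∀ {m} {f : Poly m} → Irreducible f → Divisibility.Prime (Zm m) (hat f)
irreducible⇒prime {m} {f} irr = record
  { nonzero = λ z → prime λ pf → Prime.nonzero pf z
  ; nonunit = λ u → prime λ pf → Prime.nonunit pf u
  ; split = λ d nd nd′ → prime λ pf → Prime.split pf d nd nd′ }
  where
  open Divisibility (Zm m) using (module Prime)
  prime = hat-prime {m} {f} irr

-- n = d(a + k) - a with k ≥ 2, from division with remainder.
exponents : ∀ {d n} → 2 ℕ.≤ d → d ℕ.* d ℕ.≤ n → ∃ λ a → ∃ λ k → 2 ℕ.≤ k × d ℕ.* (a ℕ.+ k) ≡ a ℕ.+ n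
exponents {d} {n} 2≤d d²≤n = by-remainder (n ℕ.% d) (n ℕ./ d) (ℕDivMod.m≡m%n+[m/n]*n n d) (ℕDivMod.m%n<n n d)
    (≡.subst (ℕ._≤ n ℕ./ d) (ℕDivMod.m*n/n≡m d d) (ℕDivMod./-monoˡ-≤ d d²≤n))
  where
  instance
    d≢0 : ℕ.NonZero d
    d≢0 = ℕ.>-nonZero (ℕP.≤-trans (s≤s z≤n) 2≤d)
  by-remainder : ∀ r t → n ≡ r ℕ.+ t ℕ.* d → r ℕ.< d → d ℕ.≤ t → ∃ λ a → ∃ λ k → 2 ℕ.≤ k × d ℕ.* (a ℕ.+ k) ≡ a ℕ.+ n
  by-remainder zero t e _ d≤t = 0 , t , ℕP.≤-trans 2≤d d≤t , ≡.trans (ℕP.*-comm d t) (≡.sym e)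
  by-remainder (suc r) t e r<d d≤t = a , suc t ℕ.∸ a , 2≤k , total
    where
    -- With this a, d(t + 1) = a + n. The bound n ≥ d² gives t ≥ d > a, whence k = t + 1 - a ≥ 2;
    -- this is where d² comes from.
    a = d ℕ.∸ suc r
    a<d : suc a ℕ.≤ d
    a<d = ℕP.≤-trans (ℕP.+-monoˡ-≤ a (s≤s z≤n)) (ℕP.≤-reflexive (ℕP.m+[n∸m]≡n (ℕP.<⇒≤ r<d)))
    2≤k : 2 ℕ.≤ suc t ℕ.∸ a
    2≤k = ℕP.m+n≤o⇒m≤o∸n 2 (s≤s (ℕP.≤-trans a<d d≤t))
    total : d ℕ.* (a ℕ.+ (suc t ℕ.∸ a)) ≡ a ℕ.+ n
    total = begin
      d ℕ.* (a ℕ.+ (suc t ℕ.∸ a)) ≡⟨ ≡.cong (d ℕ.*_) (ℕP.m+[n∸m]≡n (ℕP.≤-trans (ℕP.<⇒≤ a<d) (ℕP.≤-trans d≤t (ℕP.n≤1+n t)))) ⟩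
      d ℕ.* suc t ≡⟨ ≡.trans (ℕP.*-suc d t) (≡.cong (d ℕ.+_) (ℕP.*-comm d t)) ⟩
      d ℕ.+ t ℕ.* d ≡⟨ ≡.cong (ℕ._+ t ℕ.* d) (≡.sym (≡.trans (ℕP.+-comm a (suc r)) (ℕP.m+[n∸m]≡n (ℕP.<⇒≤ r<d)))) ⟩
      a ℕ.+ suc r ℕ.+ t ℕ.* d ≡⟨ ≡.trans (ℕP.+-assoc a (suc r) (t ℕ.* d)) (≡.cong (a ℕ.+_) (≡.sym e)) ⟩
      a ℕ.+ n ∎
      where open ≡.≡-Reasoning

large-degrees : ∀ {m d n} (f : Poly m) → Irreducible f → Homogeneous d f → HasNonSingularRationalPoint f → 2 ℕ.≤ d → d ℕ.^ 2 ℕ.≤ n → Dinf f n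
large-degrees {m} {d} {n} f irr hom (pt , on , ns) 2≤d d²≤n = with-direction (direction (Divisibility.nonzero prime-f))
  where
  prime-f = irreducible⇒prime {m} {f} irr
  open IntegralPoint {f = f} hom pt on ns
  d*d≤n : d ℕ.* d ℕ.≤ n
  d*d≤n = ≡.subst (ℕ._≤ n) (≡.cong (d ℕ.*_) (ℕP.*-identityʳ d)) d²≤n
  with-direction : (∃ λ V → evalP ℤR f V ≢ + 0 × directional ℤR f P V ≢ + 0) → Dinf f n
  with-direction (V , f[V]≢0 , l≢0) with exponents 2≤d d*d≤n
  ... | a , k , 2≤k , degrees = Family.infinitely-many f hom 2≤d prime-f P V f[P]≡0 P≢0 f[V]≢0 l≢0 a k n 2≤k
    (ℕP.≤-trans 2≤d (ℕP.≤-trans (ℕP.m≤m*n d d ⦃ ℕ.>-nonZero (ℕP.≤-trans (s≤s z≤n) 2≤d) ⦄) d*d≤n)) degrees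

-- ℚ has no proper subfield, so the given point is new over ℚ. This puts 1 into D and forces the gcd
-- to be 1.
rationals-new : ∀ {m} (f : Poly m) → HasNonSingularRationalPoint f → 𝓕 f rationals
rationals-new f (pt , on , ns) = pt , record { onHypersurface = on ; nonSingular = ns ; new = λ K (sub , proper) _ → proper (rational K sub) }
  where
  rational : ∀ K → IsSubfield rationals K → ∀ x → K x
  rational K sub = Subfield.rationals∈ subfield (idₕ {ℚR})
    where
    module K = IsSubfield sub
    subfield : Subfield ℚR K
    subfield = record { resp = K.resp ; 0∈ = K.0∈ ; 1∈ = K.1∈ ; +∈ = K.+-closed ; *∈ = K.*-closed ; -∈ = K.-‿closed ; ⁻¹∈ = K.⁻¹-closed }

-- 2d² - 3d + 2 exceeds d² by (d - 1)(d - 2), which is e² + e for d = e + 2.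
square-bound : ∀ {d} → 2 ℕ.≤ d → d ℕ.^ 2 ℕ.≤ suc ((2 ℕ.* d ℕ.^ 2 ℕ.∸ 3 ℕ.* d) ℕ.+ 1)
square-bound {suc (suc e)} (s≤s (s≤s z≤n)) = begin
  d ℕ.^ 2 ≡⟨ solve 1 (λ e → (con 2 :+ e) :* ((con 2 :+ e) :* con 1) := (e :* e :+ con 4 :* e :+ con 2) :+ con 2) ≡.refl e ⟩
  y ℕ.+ 2 ≤⟨ ℕP.+-monoˡ-≤ 2 (ℕP.m+n≤o⇒m≤o∸n y (ℕP.≤-trans (ℕP.m≤m+n (y ℕ.+ 3 ℕ.* d) (e ℕ.* e ℕ.+ e)) (ℕP.≤-reflexive expand))) ⟩
  (2 ℕ.* d ℕ.^ 2 ℕ.∸ 3 ℕ.* d) ℕ.+ 2 ≡⟨ ℕP.+-suc (2 ℕ.* d ℕ.^ 2 ℕ.∸ 3 ℕ.* d) 1 ⟩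
  suc ((2 ℕ.* d ℕ.^ 2 ℕ.∸ 3 ℕ.* d) ℕ.+ 1) ∎
  where
  open ℕP.≤-Reasoning
  open ℕSolver.+-*-Solver
  d = suc (suc e)
  y = e ℕ.* e ℕ.+ 4 ℕ.* e ℕ.+ 2
  expand : y ℕ.+ 3 ℕ.* d ℕ.+ (e ℕ.* e ℕ.+ e) ≡ 2 ℕ.* d ℕ.^ 2
  expand = solve 1 (λ e → ((e :* e :+ con 4 :* e :+ con 2) :+ con 3 :* (con 2 :+ e)) :+ (e :* e :+ e) := con 2 :* ((con 2 :+ e) :* ((con 2 :+ e) :* con 1))) ≡.refl e

open import Data.Nat.Base using (_+_; _∸_; _*_; _^_; _≤_)
open import Relation.Unary using (_⊆_)

theorem1p3 : ∀ {m d : ℕ} (f : Poly m) →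
    Irreducible f → Homogeneous d f → HasNonSingularRationalPoint f →
    G≡ f 1 ×
    (2 ≤ d →
    (d ^ 2) +ˢ Frob ((d ∸ 1) ∷ d ∷ []) ⊆ Dinf f ×
    𝓔 f ⊆ (λ n → 1 ≤ n × n ≤ (2 * d ^ 2 ∸ 3 * d) + 1))
theorem1p3 {m} {d} f irr hom pt =
  ((λ {n} _ → ℕ∣.1∣ n) , λ k∣ → k∣ (rationals , rationals-new f pt , ≡.refl)) ,
  λ 2≤d →
    (λ { (s , _ , ≡.refl) → large-degrees f irr hom pt 2≤d (ℕP.m≤m+n (d ^ 2) s) }) ,
    λ (1≤n , _ , n∉Dinf) → 1≤n , ℕP.≮⇒≥ λ n> → n∉Dinf (large-degrees f irr hom pt 2≤d (ℕP.≤-trans (square-bound 2≤d) n>))
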